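{- Let $\mathcal{M}$ be the family of $3$-graphs defined in the context. There exists $\epsilon_0>0$ such that for every $0<\epsilon<\epsilon_0$ there exists $n_0$ such that the following holds for all $n\ge n_0$: every $\mathcal{M}$-free $3$-graph $\mathcal{H}$ with $n$ vertices and at least $2n^3/27-\epsilon n^3$ edges contains a set $W\subset V(\mathcal{H})$ with $|W|>n-3\epsilon^{1/2}n$ such that $\delta(\mathcal{H}[W])\ge \frac{2n^2}{9}-20\epsilon^{1/2}n^2$ and $\mathcal{H}[W]$ is either semibipartite or $\mathcal{G}^2_6$-colorable.
   Context: A $3$-graph is a set of $3$-element subsets of a finite vertex set. $\mathcal{H}[W]$ is the induced subgraph on $W$; $\delta(\cdot)$ is the minimum degree, where the degree of $v$ is the number of edges containing $v$. $F\subset\mathcal{H}$ means $\mathcal{H}$ has a subgraph isomorphic to $F$; $\mathcal{H}$ is $\mathcal{M}$-free if it contains no member of $\mathcal{M}$. $\tau(\mathcal{H})$ is the minimum size of a vertex set meeting every edge ($0$ if no edges). $K_5^{3- }$: $5$ vertices, all but one of the $10$ triples. For $\ell\ge2$, $\mathcal{K}^3_{\ell+1}$ is the set of $3$-graphs $F$ on at most $(\ell+1)+\binom{\ell+1}{2}$ vertices with an $(\ell+1)$-set $S$ (a core) every pair of which lies in an edge of $F$. $\mathcal{G}^1_n$: vertex set $A\cup B$ disjoint, $|A|=\lfloor n/3\rfloor$, $|B|=\lceil 2n/3\rceil$, edges all triples with exactly one vertex in $A$. $\mathcal{G}^2_6$: vertex set $[6]$, all triples except $\{1,2,3\},\{1,2,6\},\{3,4,5\},\{4,5,6\}$.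 A blowup of a $3$-graph on $[s]$ replaces vertex $i$ by a nonempty set $V_i$ (pairwise disjoint) and each edge $\{i,j,k\}$ by all triples meeting each of $V_i,V_j,V_k$ once. For $n>6$, $\mathcal{G}^2_n$ is a blowup of $\mathcal{G}^2_6$ on $n$ vertices with the maximum number of edges. $\mathcal{M}=M_1\cup M_2\cup M_3$: $M_1=\{K_5^{3- }\}$; $M_2$ = all $F\in\mathcal{K}^3_7$ having a core $S$ with $\tau(F[S])\ge2$; $M_3$ = all $F\in\mathcal{K}^3_6$ with $F\not\subset\mathcal{G}^1_n$ and $F\not\subset\mathcal{G}^2_n$ for all $n$. A $3$-graph is semibipartite if its vertex set has a partition $A\cup B$ with every edge having exactly one vertex in $A$ and two in $B$; it is $\mathcal{G}^2_6$-colorable if it is a subgraph of a blowup of $\mathcal{G}^2_6$.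
   Formalization: The formal theorem takes ε (and ε₀) to be rational rather than real; the bounds with ε^{1/2} are expressed exactly by squaring both sides. -}

module Defs where

open import Data.Nat as ℕ using (ℕ; zero; suc; _≤_; _∸_; _+_)
open import Data.Bool using (Bool; true; false; _∧_; _∨_; not; if_then_else_)
open import Data.Fin as Fin using (Fin; toℕ)
open import Data.Fin.Subset using (Subset; _∈_; _⊆_; _∩_; _─_; _∪_; ⁅_⁆; ∣_∣)
open import Data.Vec using (Vec; []; _∷_; lookup; tabulate)
open import Data.List using (List; []; _∷_; _++_; map; foldr; allFin)
open import Data.Bool.ListAction using (any)
open import Data.Product using (Σ; ∃; _×_; _,_)
open import Data.Sum using (_⊎_)
open import Data.Integer using (+_)
open import Data.Rational as ℚ using (ℚ; _/_)
open import Relation.Binary.PropositionalEquality using (_≡_; _≢_)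
open import Relation.Nullary using (¬_; does)
open import Function.Definitions using (Injective)
open import Data.Nat.Combinatorics using (_C_)

_≡ᵇᶠ_ : ∀ {n} → Fin n → Fin n → Bool
x ≡ᵇᶠ y = does (x Fin.≟ y)

_⊆ᵇ_ : ∀ {n} → Subset n → Subset n → Bool
[] ⊆ᵇ [] = true
(a ∷ p) ⊆ᵇ (b ∷ q) = ((not a) ∨ b) ∧ (p ⊆ᵇ q)

_≡ᵇˢ_ : ∀ {n} → Subset n → Subset n → Bool
[] ≡ᵇˢ [] = true
(a ∷ p) ≡ᵇˢ (b ∷ q) = ((a ∧ b) ∨ (not a ∧ not b)) ∧ (p ≡ᵇˢ q)

allSubsets : ∀ n → List (Subset n)
allSubsets zero = [] ∷ []
allSubsets (suc n) = map (true ∷_) (allSubsets n) ++ map (false ∷_) (allSubsets n)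

countᵇ : ∀ {A : Set} → (A → Bool) → List A → ℕ
countᵇ P = foldr (λ x r → if P x then suc r else r) 0

img : ∀ {m n} → (Fin m → Fin n) → Subset m → Subset n
img {m} p S = tabulate (λ y → any (λ x → lookup S x ∧ (p x ≡ᵇᶠ y)) (allFin m))

triple : ∀ {n} → Fin n → Fin n → Fin n → Subset n
triple a b c = ⁅ a ⁆ ∪ ⁅ b ⁆ ∪ ⁅ c ⁆

record 3Graph (n : ℕ) : Set where
  field
    isEdge  : Subset n → Bool
    edge3   : ∀ S → isEdge S ≡ true → ∣ S ∣ ≡ 3
open 3Graph public

IsEdgeT : ∀ {n} → 3Graph n → Fin n → Fin n → Fin n → Set
IsEdgeT H a b c = isEdge H (triple a b c) ≡ true

numEdges : ∀ {n} → 3Graph n → ℕ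
numEdges {n} H = countᵇ (isEdge H) (allSubsets n)

-- induced subgraph H[W] (kept on the vertex set Fin n; vertices outside W
-- are isolated and are not counted for the minimum degree below)
induced : ∀ {n} → 3Graph n → Subset n → 3Graph n
induced H W = record
  { isEdge = λ S → isEdge H S ∧ (S ⊆ᵇ W)
  ; edge3  = λ S e → edge3 H S (∧-true₁ e) }
  where
  ∧-true₁ : ∀ {x y} → (x ∧ y) ≡ true → x ≡ true
  ∧-true₁ {true} _ = _≡_.refl

degree : ∀ {n} → 3Graph n → Fin n → ℕ
degree {n} H v = countᵇ (λ S → isEdge H S ∧ lookup S v) (allSubsets n)

MinDegInducedGe : ∀ {n} → 3Graph n → Subset n → (ℚ → Set) → Set
MinDegInducedGe H W P = ∀ v → v ∈ W → P (+ degree (induced H W) v / 1)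

_⊑_ : ∀ {m n} → 3Graph m → 3Graph n → Set
_⊑_ {m} {n} F H = Σ (Fin m → Fin n) λ φ → Injective _≡_ _≡_ φ ×
  (∀ a b c → IsEdgeT F a b c → IsEdgeT H (φ a) (φ b) (φ c))

mk3 : ∀ {n} → (Subset n → Bool) → 3Graph n
mk3 P = record { isEdge = λ S → (∣ S ∣ ℕ.≡ᵇ 3) ∧ P S ; edge3 = λ S e → lem S e }
  where
  lem : ∀ S → ((∣ S ∣ ℕ.≡ᵇ 3) ∧ P S) ≡ true → ∣ S ∣ ≡ 3
  lem S e with ∣ S ∣ | e
  ... | 3 | _ = _≡_.refl
  ... | 0 | ()
  ... | 1 | ()
  ... | 2 | ()
  ... | suc (suc (suc (suc k))) | ()

K5minus : 3Graph 5
K5minus = mk3 (λ S → not (S ≡ᵇˢ (true ∷ true ∷ true ∷ false ∷ false ∷ [])))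

-- G^2_6 on Fin 6 (vertex i+1 of the paper is i here):
-- all triples except {1,2,3},{1,2,6},{3,4,5},{4,5,6}
G26 : 3Graph 6
G26 = mk3 (λ S → not ( (S ≡ᵇˢ (true ∷ true ∷ true ∷ false ∷ false ∷ false ∷ []))
                     ∨ (S ≡ᵇˢ (true ∷ true ∷ false ∷ false ∷ false ∷ true ∷ []))
                     ∨ (S ≡ᵇˢ (false ∷ false ∷ true ∷ true ∷ true ∷ false ∷ []))
                     ∨ (S ≡ᵇˢ (false ∷ false ∷ false ∷ true ∷ true ∷ true ∷ []))))

G1A : ∀ n → Subset n
G1A n = tabulate (λ i → toℕ i ℕ.<ᵇ (n ℕ./ 3))

G1 : ∀ n → 3Graph n
G1 n = mk3 (λ S → ∣ S ∩ G1A n ∣ ℕ.≡ᵇ 1)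

Surj : ∀ {m s} → (Fin m → Fin s) → Set
Surj {m} {s} p = ∀ y → ∃ λ x → p x ≡ y

-- blowup of G (on Fin s) along p : Fin m → Fin s; for p surjective the
-- parts V_i = p⁻¹(i) are nonempty and pairwise disjoint
blowup : ∀ {s m} → 3Graph s → (Fin m → Fin s) → 3Graph m
blowup G p = mk3 (λ S → isEdge G (img p S))

InG2 : ∀ {m} → 3Graph m → ℕ → Set
InG2 F n = Σ (Fin n → Fin 6) λ p → Surj p ×
  (∀ (q : Fin n → Fin 6) → Surj q → numEdges (blowup G26 q) ≤ numEdges (blowup G26 p)) ×
  (F ⊑ blowup G26 p)

IsCore : ∀ {m} → 3Graph m → ℕ → Subset m → Set
IsCore F k S = ∣ S ∣ ≡ k ×
  (∀ x y → x ∈ S → y ∈ S → x ≢ y → ∃ λ z → IsEdgeT F x y z)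

TauInducedGe2 : ∀ {m} → 3Graph m → Subset m → Set
TauInducedGe2 {m} F S = ∀ (T : Subset m) → T ⊆ S →
  (∀ e → isEdge (induced F S) e ≡ true → ∃ λ v → v ∈ e × v ∈ T) → 2 ≤ ∣ T ∣

InKWithCore : ∀ {m} → 3Graph m → ℕ → Subset m → Set
InKWithCore {m} F k S = m ≤ k + (k C 2) × IsCore F k S

InM2 : ∀ {m} → 3Graph m → Set
InM2 F = ∃ λ S → InKWithCore F 7 S × TauInducedGe2 F S

InM3 : ∀ {m} → 3Graph m → Set
InM3 F = (∃ λ S → InKWithCore F 6 S) ×
  (∀ n → ¬ (F ⊑ G1 n)) × (∀ n → ¬ InG2 F n)

MFree : ∀ {n} → 3Graph n → Set
MFree H = ¬ (K5minus ⊑ H) ×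
  (∀ m (F : 3Graph m) → InM2 F → ¬ (F ⊑ H)) ×
  (∀ m (F : 3Graph m) → InM3 F → ¬ (F ⊑ H))

SemibipartiteInduced : ∀ {n} → 3Graph n → Subset n → Set
SemibipartiteInduced {n} H W = Σ (Subset n) λ A → A ⊆ W ×
  (∀ S → isEdge (induced H W) S ≡ true → ∣ S ∩ A ∣ ≡ 1 × ∣ S ∩ (W ─ A) ∣ ≡ 2)

G26Colorable : ∀ {n} → 3Graph n → Set
G26Colorable H = ∃ λ m → Σ (Fin m → Fin 6) λ p → Surj p × (H ⊑ blowup G26 p)

ℚℕ : ℕ → ℚ
ℚℕ k = + k / 1

-- "x < c·√ε·y"  (for c, y ≥ 0 and ε > 0), stated without square roots
LtMulSqrt : ℚ → ℚ → ℚ → ℚ → Set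
LtMulSqrt x c ε y = x ℚ.< ℚ.0ℚ ⊎ x ℚ.* x ℚ.< c ℚ.* c ℚ.* ε ℚ.* y ℚ.* y

-- "x ≤ c·√ε·y"  (for c, y ≥ 0 and ε > 0), stated without square roots
LeMulSqrt : ℚ → ℚ → ℚ → ℚ → Set
LeMulSqrt x c ε y = x ℚ.≤ ℚ.0ℚ ⊎ x ℚ.* x ℚ.≤ c ℚ.* c ℚ.* ε ℚ.* y ℚ.* y

{-# OPTIONS --safe #-}
module Submission where

-- Give the vertices integer weights w of total mass m, and let L(w) be the sum of w(x) w(y) w(z) over ordered edges.
--
-- Pairwise covered sets of vertices are coloured: by M₂ the edges inside seven such vertices share a vertex, by M₃
-- those inside six do or embed in G²₆, and for at most five vertices K₅³⁻-freeness suffices. A colouring bounds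
-- 9 L(w) by 4 m³ through the arithmetic-geometric mean inequality.
--
-- Vertex extension: if U carries a colouring and U and a further vertex v have almost maximal degrees, the link of every
-- vertex of U nearly fills what its class allows (else raising its weight would break the bound on L). Vertices chosen
-- at random in suitable classes then complete v, and up to two vertices from a pair that would spoil a colour for v, to
-- a member of M₂ or M₃; so v can be coloured.
--
-- Symmetrisation: as long as some vertex has low degree, move a unit of its weight to a vertex of maximum degree; else,
-- as long as two vertices of the support are uncovered, move a unit from one to the other. Undoing the moves, each moved
-- vertex is put back by vertex extension, so that L(w) close to its maximum yields a coloured set of almost full weight,
-- and a graph with almost maximal minimum degree is coloured entirely. Removing the vertices of low degree from H leaves
-- such a graph; fewer than 2 √ε n are removed, because otherwise the rest would violate 9 L ≤ 4 m³.

-- There are two extremal constructions and they differ globally, so the end of the symmetrisation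
-- does not tell which of them the graph resembles: the colouring has to be carried back through all
-- the moves, and the losses must not add up over a number of moves that depends on the weights.
-- `Result` prevents this by a rate of exchange. A unit of weight left uncoloured is charged m²
-- against 9 `K` times the volume; a move away from a vertex of low degree raises that multiple of
-- the volume by at least m², and a move between uncovered vertices costs nothing, since its vertex
-- is put back at once. Hence the total loss is bounded by the initial distance from the maximum,
-- however long the process lasts, and the same inequality contains the bound 9 `vol` ≤ 4 m³ for all
-- M-free relations of large mass.
--
-- Weights are natural numbers and every estimate is cross-multiplied. No limit or compactness
-- argument occurs, the process ends because a bounded integer grows, and all constants are
-- explicit.

-- Weighted sums over finite sets, written as integrals.

module Integration where

  open import Data.Nat
  open import Data.Nat.Properties
  open import Data.Bool using (Bool; true; false; not)
  open import Data.Fin using (Fin; zero; suc)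
  import Data.Fin as Fin
  open import Data.Product using (∃; _×_; _,_)
  open import Function using (_∘_)
  open import Relation.Nullary using (yes; no; does; contradiction)
  open import Relation.Binary.PropositionalEquality
  open import Data.Nat.Tactic.RingSolver using (solve-∀)

  private variable
    n s : ℕ

  -- Here `l ≤ r` is a nonnegative combination of hypotheses, `k` is the slack, and the equation is
  -- a polynomial identity for the ring solver. Negative terms are moved to the other side, so
  -- truncated subtraction never enters.
  certify : ∀ {a b l r} k → l ≤ r → a + r + k ≡ b + l → a ≤ b
  certify {a} {b} {l} {r} k l≤r eq = +-cancelʳ-≤ r a b (begin
    a + r      ≤⟨ m≤m+n (a + r) k ⟩
    a + r + k  ≡⟨ eq ⟩
    b + l      ≤⟨ +-monoʳ-≤ b l≤r ⟩
    b + r      ∎)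
    where open ≤-Reasoning

  ⟦_⟧ : Bool → ℕ
  ⟦ true ⟧ = 1
  ⟦ false ⟧ = 0

  ⟦⟧≤1 : ∀ b → ⟦ b ⟧ ≤ 1
  ⟦⟧≤1 true = ≤-refl
  ⟦⟧≤1 false = z≤n

  ⟦⟧-split : ∀ b → ⟦ b ⟧ + ⟦ not b ⟧ ≡ 1
  ⟦⟧-split true = refl
  ⟦⟧-split false = refl

  opaque
    -- Opaque, so that type checking does not expand sums; they are unfolded on purpose where a
    -- concrete number of terms has to be evaluated.
    sum : (Fin n → ℕ) → ℕ
    sum {zero} f = 0
    sum {suc n} f = f zero + sum (f ∘ suc)

  opaque
    unfolding sum

    sum-cong-≗ : {f g : Fin n → ℕ} → (∀ x → f x ≡ g x) → sum f ≡ sum g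
    sum-cong-≗ {zero} h = refl
    sum-cong-≗ {suc n} h = cong₂ _+_ (h zero) (sum-cong-≗ (h ∘ suc))

  +-interchange : ∀ a b c d → a + b + (c + d) ≡ a + c + (b + d)
  +-interchange = solve-∀

  opaque
    unfolding sum

    ∑-distrib-+ : (f g : Fin n → ℕ) → sum (λ x → f x + g x) ≡ sum f + sum g
    ∑-distrib-+ {zero} f g = refl
    ∑-distrib-+ {suc n} f g = trans (cong (f zero + g zero +_) (∑-distrib-+ (f ∘ suc) (g ∘ suc))) (+-interchange (f zero) (g zero) _ _)

    *-distribˡ-sum : ∀ k (f : Fin n → ℕ) → k * sum f ≡ sum (λ x → k * f x)
    *-distribˡ-sum {zero} k f = *-zeroʳ k
    *-distribˡ-sum {suc n} k f = trans (*-distribˡ-+ k (f zero) _) (cong (k * f zero +_) (*-distribˡ-sum k (f ∘ suc)))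

  *-distribʳ-sum : ∀ k (f : Fin n → ℕ) → sum f * k ≡ sum (λ x → f x * k)
  *-distribʳ-sum k f = trans (*-comm (sum f) k) (trans (*-distribˡ-sum k f) (sum-cong-≗ λ x → *-comm k (f x)))

  opaque
    unfolding sum

    sum-mono : {f g : Fin n → ℕ} → (∀ x → f x ≤ g x) → sum f ≤ sum g
    sum-mono {zero} h = z≤n
    sum-mono {suc n} h = +-mono-≤ (h zero) (sum-mono (h ∘ suc))

    sum-zero : {f : Fin n → ℕ} → (∀ x → f x ≡ 0) → sum f ≡ 0
    sum-zero {zero} h = refl
    sum-zero {suc n} h = cong₂ _+_ (h zero) (sum-zero (h ∘ suc))

    ∑-comm : (f : Fin n → Fin s → ℕ) → sum (λ x → sum (f x)) ≡ sum (λ y → sum λ x → f x y)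
    ∑-comm {zero} {s} f = sym (sum-zero {s} {λ _ → 0} λ _ → refl)
    ∑-comm {suc n} f = trans (cong (sum (f zero) +_) (∑-comm (f ∘ suc))) (sym (∑-distrib-+ (f zero) _))

    term≤sum : (f : Fin n → ℕ) → ∀ x → f x ≤ sum f
    term≤sum f zero = m≤m+n _ _
    term≤sum f (suc x) = ≤-trans (term≤sum (f ∘ suc) x) (m≤n+m _ _)

    sum-single : (f : Fin n → ℕ) (v : Fin n) → (∀ x → x ≢ v → f x ≡ 0) → sum f ≡ f v
    sum-single f zero h = trans (cong (f zero +_) (sum-zero (λ x → h (suc x) λ ()))) (+-identityʳ _)
    sum-single f (suc v) h rewrite h zero (λ ()) = sum-single (f ∘ suc) v λ x x≢v → h (suc x) λ { refl → x≢v refl }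

    sum-<⇒∃< : {f g : Fin n → ℕ} → sum f < sum g → ∃ λ x → f x < g x
    sum-<⇒∃< {suc n} {f} {g} lt with f zero <? g zero
    ... | yes p = zero , p
    ... | no ¬p with sum-<⇒∃< {f = f ∘ suc} {g ∘ suc} (≰⇒> λ q → <⇒≱ lt (+-mono-≤ (≮⇒≥ ¬p) q))
    ... | x , p = suc x , p

  opaque
    -- The weight `μ` acts as a measure: degrees and edge counts of weighted graphs become iterated
    -- integrals, and averaging becomes monotonicity.
    ∫ : (Fin n → ℕ) → (Fin n → ℕ) → ℕ
    ∫ μ f = sum λ x → μ x * f x

  opaque
    unfolding ∫

    ∫-cong : (μ : Fin n → ℕ) {f g : Fin n → ℕ} → (∀ x → f x ≡ g x) → ∫ μ f ≡ ∫ μ g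
    ∫-cong μ h = sum-cong-≗ λ x → cong (μ x *_) (h x)

    -- Asking for the inequality on the support only is what makes membership in a class, encoded by
    -- a restricted weight, available under the integral.
    ∫-mono : (μ : Fin n → ℕ) {f g : Fin n → ℕ} → (∀ x → 0 < μ x → f x ≤ g x) → ∫ μ f ≤ ∫ μ g
    ∫-mono μ h = sum-mono λ x → go (μ x) (h x)
      where
      go : ∀ k {a b} → (0 < k → a ≤ b) → k * a ≤ k * b
      go zero h = z≤n
      go (suc k) h = *-monoʳ-≤ (suc k) (h z<s)

    ∫-monoˡ : {μ ν : Fin n → ℕ} (f : Fin n → ℕ) → (∀ x → μ x ≤ ν x) → ∫ μ f ≤ ∫ ν f
    ∫-monoˡ f h = sum-mono λ x → *-monoˡ-≤ (f x) (h x)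

    ∫-congˡ : {μ ν : Fin n → ℕ} (f : Fin n → ℕ) → (∀ x → μ x ≡ ν x) → ∫ μ f ≡ ∫ ν f
    ∫-congˡ f h = sum-cong-≗ λ x → cong (_* f x) (h x)

    ∫-+ : (μ f g : Fin n → ℕ) → ∫ μ (λ x → f x + g x) ≡ ∫ μ f + ∫ μ g
    ∫-+ μ f g = trans (sum-cong-≗ λ x → *-distribˡ-+ (μ x) (f x) (g x)) (∑-distrib-+ _ _)

    ∫-+ˡ : (μ ν f : Fin n → ℕ) → ∫ (λ x → μ x + ν x) f ≡ ∫ μ f + ∫ ν f
    ∫-+ˡ μ ν f = trans (sum-cong-≗ λ x → *-distribʳ-+ (f x) (μ x) (ν x)) (∑-distrib-+ _ _)

    ∫-* : (μ : Fin n → ℕ) (k : ℕ) (f : Fin n → ℕ) → ∫ μ (λ x → k * f x) ≡ k * ∫ μ f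
    ∫-* μ k f = trans (sum-cong-≗ λ x → trans (sym (*-assoc (μ x) k (f x))) (trans (cong (_* f x) (*-comm (μ x) k)) (*-assoc k (μ x) (f x))))
      (sym (*-distribˡ-sum k _))

    ∫-*ˡ : (k : ℕ) (μ f : Fin n → ℕ) → ∫ (λ x → k * μ x) f ≡ k * ∫ μ f
    ∫-*ˡ k μ f = trans (sum-cong-≗ λ x → *-assoc k (μ x) (f x)) (sym (*-distribˡ-sum k _))

    ∫-const : (μ : Fin n → ℕ) (k : ℕ) → ∫ μ (λ _ → k) ≡ sum μ * k
    ∫-const μ k = sym (*-distribʳ-sum k μ)

  ∫-1 : (μ : Fin n → ℕ) → ∫ μ (λ _ → 1) ≡ sum μ
  ∫-1 μ = trans (∫-const μ 1) (*-identityʳ _)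

  ∫≤ : (μ : Fin n → ℕ) {f : Fin n → ℕ} (k : ℕ) → (∀ x → 0 < μ x → f x ≤ k) → ∫ μ f ≤ sum μ * k
  ∫≤ μ k h = ≤-trans (∫-mono μ h) (≤-reflexive (∫-const μ k))

  ∫-zero : (μ : Fin n → ℕ) {f : Fin n → ℕ} → (∀ x → 0 < μ x → f x ≡ 0) → ∫ μ f ≡ 0
  ∫-zero μ h = n≤0⇒n≡0 (≤-trans (∫≤ μ 0 λ x p → ≤-reflexive (h x p)) (≤-reflexive (*-zeroʳ (sum μ))))

  opaque
    unfolding ∫

    ∫-swap : (μ : Fin n → ℕ) (ν : Fin s → ℕ) (f : Fin n → Fin s → ℕ) → ∫ μ (λ x → ∫ ν (f x)) ≡ ∫ ν (λ y → ∫ μ (λ x → f x y))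
    ∫-swap μ ν f = begin
      sum (λ x → μ x * ∫ ν (f x))                       ≡⟨ sum-cong-≗ (λ x → sym (∫-* ν (μ x) (f x))) ⟩
      sum (λ x → sum λ y → ν y * (μ x * f x y))         ≡⟨ ∑-comm _ ⟩
      sum (λ y → sum λ x → ν y * (μ x * f x y))         ≡⟨ sum-cong-≗ (λ y → sym (*-distribˡ-sum (ν y) _)) ⟩
      ∫ ν (λ y → ∫ μ (λ x → f x y))                     ∎
      where open ≡-Reasoning

    ∫-<⇒∃< : (μ : Fin n → ℕ) {f g : Fin n → ℕ} → ∫ μ f < ∫ μ g → ∃ λ x → 0 < μ x × f x < g x
    ∫-<⇒∃< μ {f} {g} lt with sum-<⇒∃< lt
    ... | x , p = x , pos (μ x) p , *-cancelˡ-< (μ x) _ _ p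
      where
      pos : ∀ k {a b} → k * a < k * b → 0 < k
      pos (suc k) _ = z<s

  -- Averaging. Replacing `g` by `g` + 1 makes the comparison strict, because the mass is positive,
  -- and contraposition then applies.
  ∫-≤⇒∃≤ : (μ : Fin n → ℕ) {f g : Fin n → ℕ} → 0 < sum μ → ∫ μ f ≤ ∫ μ g → ∃ λ x → 0 < μ x × f x ≤ g x
  ∫-≤⇒∃≤ μ {f} {g} pos le with ∫-<⇒∃< μ {f} {λ x → g x + 1} (≤-trans (+-mono-≤ pos le)
      (≤-reflexive (trans (+-comm (sum μ) _) (sym (trans (∫-+ μ g _) (cong (∫ μ g +_) (∫-1 μ)))))))
  ... | x , x∈ , p = x , x∈ , s≤s⁻¹ (subst (f x <_) (+-comm (g x) 1) p)

  opaque
    unfolding ∫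

    ∫-comm : (μ f : Fin n → ℕ) → ∫ μ f ≡ ∫ f μ
    ∫-comm μ f = sum-cong-≗ λ x → *-comm (μ x) (f x)

  -- Used in two ways: as the point mass at `v`, and in the form `δ (c x) i` as the indicator of the
  -- colour class `i`.
  δ : Fin n → Fin n → ℕ
  δ v x = ⟦ does (v Fin.≟ x) ⟧

  δ-self : (v : Fin n) → δ v v ≡ 1
  δ-self v with v Fin.≟ v
  ... | yes _ = refl
  ... | no v≢v = contradiction refl v≢v

  δ-other : {v x : Fin n} → x ≢ v → δ v x ≡ 0
  δ-other {v = v} {x} x≢v with v Fin.≟ x
  ... | yes refl = contradiction refl x≢v
  ... | no _ = refl

  δ-support : (v x : Fin n) → 0 < δ v x → v ≡ x
  δ-support v x p with v Fin.≟ x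
  ... | yes v≡x = v≡x

  opaque
    unfolding ∫

    ∫-δ : (v : Fin n) (f : Fin n → ℕ) → ∫ (δ v) f ≡ f v
    ∫-δ v f = trans (sum-single _ v λ x x≢v → cong (_* f x) (δ-other x≢v)) (trans (cong (_* f v) (δ-self v)) (+-identityʳ _))

  mass-δ : (v : Fin n) → sum (δ v) ≡ 1
  mass-δ v = trans (sum-single _ v λ x → δ-other) (δ-self v)

  infixl 8 _↾_
  _↾_ : (Fin n → ℕ) → (Fin n → Bool) → Fin n → ℕ
  (μ ↾ b) x = ⟦ b x ⟧ * μ x

  ↾≤ : (μ : Fin n → ℕ) (b : Fin n → Bool) → ∀ x → (μ ↾ b) x ≤ μ x
  ↾≤ μ b x with b x
  ... | true = ≤-reflexive (+-identityʳ _)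
  ... | false = z≤n

  ↾-support : (μ : Fin n → ℕ) (b : Fin n → Bool) (x : Fin n) → 0 < (μ ↾ b) x → b x ≡ true × 0 < μ x
  ↾-support μ b x p with b x
  ... | true = refl , subst (0 <_) (+-identityʳ (μ x)) p

  opaque
    unfolding ∫

    ∫-↾ : (μ : Fin n → ℕ) (b : Fin n → Bool) (f : Fin n → ℕ) → ∫ (μ ↾ b) f ≡ ∫ μ (λ x → ⟦ b x ⟧ * f x)
    ∫-↾ μ b f = sum-cong-≗ λ x → trans (cong (_* f x) (*-comm ⟦ b x ⟧ (μ x))) (*-assoc (μ x) ⟦ b x ⟧ (f x))

    mass-↾ : (μ : Fin n → ℕ) (b : Fin n → Bool) → sum (μ ↾ b) ≡ ∫ μ (λ x → ⟦ b x ⟧)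
    mass-↾ μ b = sum-cong-≗ λ x → *-comm ⟦ b x ⟧ (μ x)

  ∫-split : (μ : Fin n → ℕ) (b : Fin n → Bool) (f : Fin n → ℕ) → ∫ μ f ≡ ∫ (μ ↾ b) f + ∫ (μ ↾ (not ∘ b)) f
  ∫-split μ b f = trans (∫-congˡ f λ x → sym (trans (sym (*-distribʳ-+ (μ x) ⟦ b x ⟧ ⟦ not (b x) ⟧)) (trans (cong (_* μ x) (⟦⟧-split (b x))) (+-identityʳ _)))) (∫-+ˡ _ _ f)

  mass-split : (μ : Fin n → ℕ) (b : Fin n → Bool) → sum μ ≡ sum (μ ↾ b) + sum (μ ↾ (not ∘ b))
  mass-split μ b = trans (sym (∫-1 μ)) (trans (∫-split μ b _) (cong₂ _+_ (∫-1 _) (∫-1 _)))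

  fibre : (Fin n → ℕ) → (Fin n → Fin s) → Fin s → Fin n → ℕ
  fibre w c i = w ↾ λ x → does (c x Fin.≟ i)

  fibre≤ : (w : Fin n → ℕ) (c : Fin n → Fin s) (i : Fin s) → ∀ x → fibre w c i x ≤ w x
  fibre≤ w c i = ↾≤ w (λ x → does (c x Fin.≟ i))

  mass-fibre≤ : (w : Fin n → ℕ) (c : Fin n → Fin s) (i : Fin s) → sum (fibre w c i) ≤ sum w
  mass-fibre≤ w c i = sum-mono (fibre≤ w c i)

  fibre-support : (w : Fin n → ℕ) (c : Fin n → Fin s) (i : Fin s) (x : Fin n) → 0 < fibre w c i x → c x ≡ i × 0 < w x
  fibre-support w c i x p with c x Fin.≟ i
  ... | yes q = q , subst (0 <_) (+-identityʳ _) p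

  opaque
    unfolding ∫

    -- Change of variables along `c`: the push-forward of `w` gives each colour the mass of its
    -- fibre. Through it the volume of a blown-up pattern depends on the class masses alone.
    ∫-fibres : (w : Fin n → ℕ) (c : Fin n → Fin s) (f : Fin s → ℕ) → ∫ w (f ∘ c) ≡ ∫ (λ i → sum (fibre w c i)) f
    ∫-fibres w c f = begin
      sum (λ x → w x * f (c x))
        ≡⟨ sum-cong-≗ (λ x → trans (sym (*-identityˡ _)) (trans (cong (_* (w x * f (c x))) (sym (δ-self (c x)))) (sym (sum-single _ (c x) λ i i≢ → cong (_* (w x * f i)) (δ-other i≢))))) ⟩
      sum (λ x → sum λ i → δ (c x) i * (w x * f i))
        ≡⟨ ∑-comm _ ⟩
      sum (λ i → sum λ x → δ (c x) i * (w x * f i))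
        ≡⟨ sum-cong-≗ (λ i → trans (sum-cong-≗ λ x → sym (*-assoc (δ (c x) i) (w x) (f i))) (sym (*-distribʳ-sum (f i) _))) ⟩
      ∫ (λ i → sum (fibre w c i)) f ∎
      where open ≡-Reasoning

  ∫∫-fibre : (w : Fin n → ℕ) (c : Fin n → Fin s) (i j : Fin s) (f : Fin n → Fin n → ℕ) →
    ∫ (fibre w c i) (λ y → ∫ (fibre w c j) (f y)) ≡ ∫ w (λ y → ∫ w λ z → δ (c y) i * (δ (c z) j * f y z))
  ∫∫-fibre w c i j f = trans (∫-↾ w (λ y → does (c y Fin.≟ i)) _) (∫-cong w λ y →
    trans (cong (δ (c y) i *_) (∫-↾ w (λ z → does (c z Fin.≟ j)) (f y))) (sym (∫-* w (δ (c y) i) _)))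

  opaque
    unfolding ∫

    ∫-sum : (w : Fin n → ℕ) (g : Fin n → Fin s → ℕ) → ∫ w (λ x → sum (g x)) ≡ sum (λ i → ∫ w (λ x → g x i))
    ∫-sum w g = trans (sum-cong-≗ λ x → *-distribˡ-sum (w x) (g x)) (∑-comm _)

  ∫-classes : (w : Fin n → ℕ) (c : Fin n → Fin s) (f : Fin n → ℕ) → ∫ w f ≡ sum (λ i → ∫ (fibre w c i) f)
  ∫-classes w c f = begin
    ∫ w f                                     ≡⟨ ∫-cong w (λ x → sym (trans (sum-single _ (c x) λ i i≢ → cong (_* f x) (δ-other i≢)) (trans (cong (_* f x) (δ-self (c x))) (+-identityʳ _)))) ⟩
    ∫ w (λ x → sum λ i → δ (c x) i * f x)     ≡⟨ ∫-sum w (λ x i → δ (c x) i * f x) ⟩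
    sum (λ i → ∫ w (λ x → δ (c x) i * f x))   ≡⟨ sum-cong-≗ (λ i → sym (∫-↾ w (λ x → does (c x Fin.≟ i)) f)) ⟩
    sum (λ i → ∫ (fibre w c i) f)             ∎
    where
    open ≡-Reasoning

  opaque
    unfolding sum

    sum≤ : (f : Fin n → ℕ) (k : ℕ) → (∀ x → f x ≤ k) → sum f ≤ n * k
    sum≤ {zero} f k h = z≤n
    sum≤ {suc n} f k h = +-mono-≤ (h zero) (sum≤ (f ∘ suc) k (h ∘ suc))

-- Triples, colour patterns and finite checks on small configurations.

module Configurations where

  open import Data.Nat using (ℕ; zero; suc; _+_; _≡ᵇ_)
  open import Data.Nat.Properties using (+-comm)
  open import Data.Nat.Tactic.RingSolver using (solve-∀)
  open import Data.Bool using (Bool; true; false; _∧_; _∨_; not)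
  open import Data.Bool.ListAction using (any; all)
  open import Data.Fin using (Fin; zero; suc; toℕ)
  import Data.Fin as Fin
  open import Data.Fin.Properties using (all?)
  open import Data.Vec using (Vec; []; _∷_; lookup; allFin; tabulate)
  open import Data.Vec.Properties using (lookup∘tabulate)
  open import Data.List using (List; []; _∷_; map; _++_)
  import Data.List as List
  open import Data.List.Relation.Unary.Any using (Any; here; there; any?)
  open import Data.List.Relation.Unary.All using (All; []; _∷_)
  import Data.List.Relation.Unary.All as All
  open import Data.Product using (∃; _×_; _,_; proj₁; proj₂)
  open import Data.Sum using (_⊎_; inj₁; inj₂; [_,_]′)
  open import Data.Empty using (⊥)
  open import Function using (_∘_)
  open import Function.Definitions using (Injective)
  open import Relation.Nullary using (¬_; Dec; yes; no; does; contradiction; ¬?; _×-dec_; _⊎-dec_)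
  open import Relation.Binary.PropositionalEquality

  private variable
    n s k : ℕ
    A B : Set

  -- Pairs and triples are increasing and given by their first entry and the rest. Checks on six or
  -- seven points thus run over 20 or 35 triples, and a particular triple is a constructor term:
  -- `first (first zero)` is that of the points 0, 1, 2.
  data Pair : ℕ → Set where
    first : Fin k → Pair (suc k)
    later : Pair k → Pair (suc k)

  data Triple : ℕ → Set where
    first : Pair k → Triple (suc k)
    later : Triple k → Triple (suc k)

  pairOn : (A → A → B) → Pair k → Vec A k → B
  pairOn f (first r) (x ∷ xs) = f x (lookup xs r)
  pairOn f (later p) (x ∷ xs) = pairOn f p xs

  tripleOn : (A → A → A → B) → Triple k → Vec A k → B
  tripleOn f (first p) (x ∷ xs) = pairOn (f x) p xs
  tripleOn f (later t) (x ∷ xs) = tripleOn f t xs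

  pairs : ∀ k → List (Pair k)
  pairs zero = []
  pairs (suc k) = map first (List.allFin k) ++ map later (pairs k)

  triples : ∀ k → List (Triple k)
  triples zero = []
  triples (suc k) = map first (pairs k) ++ map later (triples k)

  fst² snd² : Pair k → Fin k
  fst² (first r) = zero
  fst² (later p) = suc (fst² p)
  snd² (first r) = suc r
  snd² (later p) = suc (snd² p)

  fst³ snd³ thd³ : Triple k → Fin k
  fst³ (first p) = zero
  fst³ (later t) = suc (fst³ t)
  snd³ (first p) = suc (fst² p)
  snd³ (later t) = suc (snd³ t)
  thd³ (first p) = suc (snd² p)
  thd³ (later t) = suc (thd³ t)

  pairOn-lookup : (f : A → A → B) (p : Pair k) (xs : Vec A k) → pairOn f p xs ≡ f (lookup xs (fst² p)) (lookup xs (snd² p))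
  pairOn-lookup f (first r) (x ∷ xs) = refl
  pairOn-lookup f (later p) (x ∷ xs) = pairOn-lookup f p xs

  tripleOn-lookup : (f : A → A → A → B) (t : Triple k) (xs : Vec A k) → tripleOn f t xs ≡ f (lookup xs (fst³ t)) (lookup xs (snd³ t)) (lookup xs (thd³ t))
  tripleOn-lookup f (first p) (x ∷ xs) = pairOn-lookup (f x) p xs
  tripleOn-lookup f (later t) (x ∷ xs) = tripleOn-lookup f t xs

  record Pattern (s : ℕ) : Set where
    field
      rel : Fin s → Fin s → Fin s → Bool
      sym₁₂ : ∀ i j k → rel i j k ≡ rel j i k
      sym₂₃ : ∀ i j k → rel i j k ≡ rel i k j

  -- Class 0 is the part that every edge meets exactly once.
  semi : Fin 2 → Fin 2 → Fin 2 → Bool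
  semi i j k = (toℕ i + toℕ j + toℕ k) ≡ᵇ 2

  -- The non-edges of G²₆ are the unions of {1,2} or {4,5} with a point of {3,6}; among triples
  -- of distinct classes they are the ones whose codes add up to 2 and to 6.
  code : Fin 6 → ℕ
  code i = lookup (1 ∷ 1 ∷ 0 ∷ 3 ∷ 3 ∷ 0 ∷ []) i

  six : Fin 6 → Fin 6 → Fin 6 → Bool
  six i j k = not (does (i Fin.≟ j)) ∧ not (does (j Fin.≟ k)) ∧ not (does (i Fin.≟ k)) ∧
    not ((code i + code j + code k) ≡ᵇ 2) ∧ not ((code i + code j + code k) ≡ᵇ 6)

  Semi : Pattern 2
  Semi = record
    { rel = semi
    ; sym₁₂ = λ i j k → cong (_≡ᵇ 2) (cong (_+ toℕ k) (+-comm (toℕ i) (toℕ j)))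
    ; sym₂₃ = λ i j k → cong (_≡ᵇ 2) (+-swap (toℕ i) (toℕ j) (toℕ k)) }
    where
    +-swap : ∀ a b c → a + b + c ≡ a + c + b
    +-swap = solve-∀

  private
    ≟-sym : (i j : Fin n) → does (i Fin.≟ j) ≡ does (j Fin.≟ i)
    ≟-sym i j with i Fin.≟ j | j Fin.≟ i
    ... | yes _ | yes _ = refl
    ... | no _ | no _ = refl
    ... | yes p | no q = contradiction (sym p) q
    ... | no p | yes q = contradiction (sym q) p

    -- The shape of `six` with its three equality tests and the sum of codes as variables. Its
    -- symmetry is then Boolean algebra instead of a check of 216 cases.
    clauses : Bool → Bool → Bool → ℕ → Bool
    clauses a b c m = not a ∧ not b ∧ not c ∧ not (m ≡ᵇ 2) ∧ not (m ≡ᵇ 6)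

    clauses-cong : ∀ {a b c m a′ b′ c′ m′} → a ≡ a′ → b ≡ b′ → c ≡ c′ → m ≡ m′ → clauses a b c m ≡ clauses a′ b′ c′ m′
    clauses-cong refl refl refl refl = refl

    clauses-swap₁₂ : ∀ a b c m → clauses a b c m ≡ clauses b a c m
    clauses-swap₁₂ true true c m = refl
    clauses-swap₁₂ true false c m = refl
    clauses-swap₁₂ false true c m = refl
    clauses-swap₁₂ false false c m = refl

    clauses-swap₂₃ : ∀ a b c m → clauses a b c m ≡ clauses a c b m
    clauses-swap₂₃ true b c m = refl
    clauses-swap₂₃ false b c m = clauses-swap₁₂ b c false m

  Six : Pattern 6
  Six = record
    { rel = six
    ; sym₁₂ = λ i j k → trans (clauses-swap₂₃ (does (i Fin.≟ j)) (does (j Fin.≟ k)) (does (i Fin.≟ k)) (code i + code j + code k))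
        (clauses-cong {a = does (i Fin.≟ j)} {b = does (i Fin.≟ k)} {c = does (j Fin.≟ k)} {a′ = does (j Fin.≟ i)} (≟-sym i j) refl refl (cong (_+ code k) (+-comm (code i) (code j))))
    ; sym₂₃ = λ i j k → trans (trans (clauses-swap₂₃ (does (i Fin.≟ j)) (does (j Fin.≟ k)) (does (i Fin.≟ k)) (code i + code j + code k))
        (trans (clauses-swap₁₂ (does (i Fin.≟ j)) (does (i Fin.≟ k)) (does (j Fin.≟ k)) (code i + code j + code k))
        (clauses-swap₂₃ (does (i Fin.≟ k)) (does (i Fin.≟ j)) (does (j Fin.≟ k)) (code i + code j + code k))))
        (clauses-cong {a = does (i Fin.≟ k)} {b = does (j Fin.≟ k)} {c = does (i Fin.≟ j)} {b′ = does (k Fin.≟ j)} refl (≟-sym j k) refl (+-swap (code i) (code j) (code k))) }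
    where
    +-swap : ∀ a b c → a + b + c ≡ a + c + b
    +-swap = solve-∀

  six-distinct : ∀ {i j k} → six i j k ≡ true → i ≢ j
  six-distinct {i} {j} p with i Fin.≟ j
  ... | no i≢j = i≢j

  -- The three fields express M-freeness through the edges inside the core: those among 7 (resp. 6)
  -- pairwise covered vertices share a vertex (resp. share a vertex or embed in G²₆).
  record MFreeRelation (n : ℕ) : Set where
    field
      e : Fin n → Fin n → Fin n → Bool
      swap₁₂ : ∀ x y z → e x y z ≡ e y x z
      swap₂₃ : ∀ x y z → e x y z ≡ e x z y
      irrefl : ∀ x z → e x x z ≡ false

    Covered : Fin n → Fin n → Set
    Covered x y = ∃ λ z → e x y z ≡ true

    PairwiseCovered : (Fin k → Fin n) → Set
    PairwiseCovered S = ∀ i j → i ≢ j → Covered (S i) (S j)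

    Centre : (Fin k → Fin n) → Fin k → Set
    Centre S i = ∀ a b c → e (S a) (S b) (S c) ≡ true → a ≡ i ⊎ b ≡ i ⊎ c ≡ i

    field
      seven : (S : Fin 7 → Fin n) → PairwiseCovered S → ∃ (Centre S)
      sixth : (S : Fin 6 → Fin n) → PairwiseCovered S → ∃ (Centre S) ⊎
        ∃ λ (σ : Fin 6 → Fin 6) → Injective _≡_ _≡_ σ × (∀ a b c → e (S a) (S b) (S c) ≡ true → six (σ a) (σ b) (σ c) ≡ true)
      -- The excepted triple is the one that `K5minus` omits.
      five : (S : Fin 5 → Fin n) → Injective _≡_ _≡_ S →
        ¬ (∀ t → t ≢ first (first zero) → e (S (fst³ t)) (S (snd³ t)) (S (thd³ t)) ≡ true)

    covered-sym : ∀ {x y} → Covered x y → Covered y x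
    covered-sym {x} {y} (z , p) = z , trans (swap₁₂ y x z) p

  Touches : Fin k → Fin k → Triple k → Set
  Touches i j t = (i ≡ fst³ t × j ≡ snd³ t) ⊎ (i ≡ fst³ t × j ≡ thd³ t) ⊎ (i ≡ snd³ t × j ≡ thd³ t)

  touches? : (i j : Fin k) (t : Triple k) → Dec (Touches i j t)
  touches? i j t = (i Fin.≟ fst³ t ×-dec j Fin.≟ snd³ t) ⊎-dec (i Fin.≟ fst³ t ×-dec j Fin.≟ thd³ t) ⊎-dec (i Fin.≟ snd³ t ×-dec j Fin.≟ thd³ t)

  -- A pair may be covered for two reasons: by an edge of `E` inside the configuration, or because
  -- it is in `P`, where the covering edge leaves the configuration and is only known to exist.
  Joined : List (Triple k) → List (Fin k × Fin k) → Fin k → Fin k → Set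
  Joined E P i j = Any (Touches i j) E ⊎ Any ((i , j) ≡_) P

  AllJoined : List (Triple k) → List (Fin k × Fin k) → Set
  AllJoined {k} E P = ∀ i j → i ≡ j ⊎ Joined E P i j ⊎ Joined E P j i

  -- Transversal number at least 2. This contradicts the centre granted by `seven` and the first
  -- alternative of `sixth`.
  Spread : List (Triple k) → Set
  Spread {k} E = ∀ i → Any (λ t → fst³ t ≢ i × snd³ t ≢ i × thd³ t ≢ i) E

  private
    joined? : (E : List (Triple k)) (P : List (Fin k × Fin k)) → ∀ i j → Dec (Joined E P i j)
    joined? E P i j = any? (touches? i j) E ⊎-dec any? (λ q → pair? q) P
      where
      pair? : ∀ q → Dec ((i , j) ≡ q)
      pair? (a , b) with i Fin.≟ a | j Fin.≟ b
      ... | yes refl | yes refl = yes refl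
      ... | no p | _ = no λ { refl → p refl }
      ... | _ | no p = no λ { refl → p refl }

  allJoined? : (E : List (Triple k)) (P : List (Fin k × Fin k)) → Dec (AllJoined E P)
  allJoined? E P = all? λ i → all? λ j → (i Fin.≟ j) ⊎-dec joined? E P i j ⊎-dec joined? E P j i

  spread? : (E : List (Triple k)) → Dec (Spread E)
  spread? E = all? λ i → any? (λ t → ¬? (fst³ t Fin.≟ i) ×-dec ¬? (snd³ t Fin.≟ i) ×-dec ¬? (thd³ t Fin.≟ i)) E

  heads : List (Triple (suc k)) → List (Pair k)
  heads [] = []
  heads (first p ∷ E) = p ∷ heads E
  heads (later t ∷ E) = heads E

  tails : List (Triple (suc k)) → List (Triple k)
  tails [] = []
  tails (first p ∷ E) = tails E
  tails (later t ∷ E) = t ∷ tails E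

  clash : Fin 6 → Vec (Fin 6) k → List (Pair k) → Bool
  clash {k} i v h = any (λ q → does (i Fin.≟ lookup v q)) (List.allFin k) ∨ any (λ p → not (pairOn (six i) p v)) h

  -- Backtracking search over the embeddings of `E` in G²₆, in continuation style: the last point is
  -- coloured first, and each new colour is tested at once against the triples that it completes.
  -- With a constantly false `f` the outcome `true` says that there is no embedding, far more
  -- cheaply than by listing all maps.
  every : List (Triple k) → (Vec (Fin 6) k → Bool) → Bool
  every {zero} E f = f []
  every {suc k} E f = every (tails E) λ v → all (λ i → clash i v (heads E) ∨ f (i ∷ v)) (List.allFin 6)

  private
    all-elim : (f : A → Bool) (xs : List A) → all f xs ≡ true → All (λ x → f x ≡ true) xs
    all-elim f [] p = []
    all-elim f (x ∷ xs) p with f x in eq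
    ... | true = eq ∷ all-elim f xs p

    any-none : (f : A → Bool) (xs : List A) → All (λ x → f x ≡ false) xs → any f xs ≡ false
    any-none f [] [] = refl
    any-none f (x ∷ xs) (p ∷ ps) rewrite p = any-none f xs ps

    all-heads : {P : Triple (suc k) → Set} (E : List (Triple (suc k))) → All P E → All (P ∘ first) (heads E)
    all-heads [] [] = []
    all-heads (first p ∷ E) (q ∷ qs) = q ∷ all-heads E qs
    all-heads (later t ∷ E) (q ∷ qs) = all-heads E qs

    all-tails : {P : Triple (suc k) → Set} (E : List (Triple (suc k))) → All P E → All (P ∘ later) (tails E)
    all-tails [] [] = []
    all-tails (first p ∷ E) (q ∷ qs) = all-tails E qs
    all-tails (later t ∷ E) (q ∷ qs) = q ∷ all-tails E qs

    all-allFin : {P : Fin k → Set} → (∀ i → P i) → All P (List.allFin k)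
    all-allFin {k} h = All.universal h (List.allFin k)

    all-allFin⁻¹ : {P : Fin 6 → Set} → All P (List.allFin 6) → ∀ i → P i
    all-allFin⁻¹ {P} ps = All.lookup ps ∘ ∈-allFin
      where open import Data.List.Membership.Propositional.Properties using (∈-allFin)

  every-sound : (E : List (Triple k)) (f : Vec (Fin 6) k → Bool) → every E f ≡ true →
    (v : Vec (Fin 6) k) → Injective _≡_ _≡_ (lookup v) → All (λ t → tripleOn six t v ≡ true) E → f v ≡ true
  every-sound {zero} E f p [] inj good = p
  every-sound {suc k} E f p (i ∷ v) inj good =
    trans (cong (_∨ f (i ∷ v)) (sym noClash)) (all-allFin⁻¹ (all-elim (step v) (List.allFin 6) rest) i)
    where
    step : Vec (Fin 6) k → Fin 6 → Bool
    step v i = clash i v (heads E) ∨ f (i ∷ v)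
    suc-inj : ∀ {a b : Fin k} → Fin.suc a ≡ suc b → a ≡ b
    suc-inj refl = refl
    rest : all (step v) (List.allFin 6) ≡ true
    rest = every-sound (tails E) (λ v → all (step v) (List.allFin 6)) p v (λ eq → suc-inj (inj eq)) (all-tails E good)
    fresh : ∀ q → does (i Fin.≟ lookup v q) ≡ false
    fresh q with i Fin.≟ lookup v q
    ... | yes eq = contradiction (inj {zero} {suc q} eq) λ ()
    ... | no _ = refl
    noClash : clash i v (heads E) ≡ false
    noClash = cong₂ _∨_ (any-none (λ q → does (i Fin.≟ lookup v q)) (List.allFin k) (all-allFin fresh))
      (any-none (λ p → not (pairOn (six i) p v)) (heads E) (All.map (cong not) (all-heads E good)))

  module Forbidden {n : ℕ} (G : MFreeRelation n) where
    open MFreeRelation G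

    EdgesOn : Vec (Fin n) k → List (Triple k) → Set
    EdgesOn xs E = All (λ t → tripleOn e t xs ≡ true) E

    CoveredOn : Vec (Fin n) k → List (Fin k × Fin k) → Set
    CoveredOn xs P = All (λ q → Covered (lookup xs (proj₁ q)) (lookup xs (proj₂ q))) P

    private
      edge-at : (xs : Vec (Fin n) k) (t : Triple k) → tripleOn e t xs ≡ true → e (lookup xs (fst³ t)) (lookup xs (snd³ t)) (lookup xs (thd³ t)) ≡ true
      edge-at xs t p = trans (sym (tripleOn-lookup e t xs)) p

      joined-covered : (xs : Vec (Fin n) k) {E : List (Triple k)} {P : List (Fin k × Fin k)} → EdgesOn xs E → CoveredOn xs P →
        ∀ {i j} → Joined E P i j → Covered (lookup xs i) (lookup xs j)
      joined-covered xs (p ∷ ps) qs {i} {j} (inj₁ (here {t} touch)) = go touch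
        where
        go : Touches i j t → _
        go (inj₁ (refl , refl)) = _ , edge-at xs t p
        go (inj₂ (inj₁ (refl , refl))) = _ , trans (swap₂₃ _ _ _) (edge-at xs t p)
        go (inj₂ (inj₂ (refl , refl))) = _ , trans (trans (swap₂₃ _ _ _) (swap₁₂ _ _ _)) (edge-at xs t p)
      joined-covered xs (p ∷ ps) qs (inj₁ (there a)) = joined-covered xs ps qs (inj₁ a)
      joined-covered xs ps (q ∷ qs) (inj₂ (here refl)) = q
      joined-covered xs ps (q ∷ qs) (inj₂ (there a)) = joined-covered xs ps qs (inj₂ a)

      pairwise : (xs : Vec (Fin n) k) {E : List (Triple k)} {P : List (Fin k × Fin k)} → EdgesOn xs E → CoveredOn xs P →
        AllJoined E P → PairwiseCovered (lookup xs)
      pairwise xs ps qs J i j i≢j with J i j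
      ... | inj₁ i≡j = contradiction i≡j i≢j
      ... | inj₂ (inj₁ a) = joined-covered xs ps qs a
      ... | inj₂ (inj₂ a) = covered-sym (joined-covered xs ps qs a)

      spread-no-centre : (xs : Vec (Fin n) k) {E : List (Triple k)} → EdgesOn xs E → Spread E → ¬ ∃ (Centre (lookup xs))
      spread-no-centre xs {E} ps S (i , c) = go E ps (S i)
        where
        go : ∀ E → EdgesOn xs E → Any (λ t → fst³ t ≢ i × snd³ t ≢ i × thd³ t ≢ i) E → ⊥
        go (t ∷ E) (p ∷ ps) (here (a , b , d)) = [ a , [ b , d ]′ ]′ (c _ _ _ (edge-at xs t p))
        go (t ∷ E) (p ∷ ps) (there q) = go E ps q

    no-seven : (xs : Vec (Fin n) 7) {E : List (Triple 7)} {P : List (Fin 7 × Fin 7)} → EdgesOn xs E → CoveredOn xs P →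
      AllJoined E P → Spread E → ⊥
    no-seven xs ps qs J S = spread-no-centre xs ps S (seven (lookup xs) (pairwise xs ps qs J))

    -- Of the two outcomes of `sixth`, `Spread` excludes the centre and the exhausted search
    -- excludes the embedding.
    no-six : (xs : Vec (Fin n) 6) {E : List (Triple 6)} {P : List (Fin 6 × Fin 6)} → EdgesOn xs E → CoveredOn xs P →
      AllJoined E P → Spread E → every E (λ _ → false) ≡ true → ⊥
    no-six xs {E} ps qs J S ev = [ spread-no-centre xs ps S , embedded ]′ (sixth (lookup xs) (pairwise xs ps qs J))
      where
      embedded : (∃ λ (σ : Fin 6 → Fin 6) → Injective _≡_ _≡_ σ ×
        (∀ a b c → e (lookup xs a) (lookup xs b) (lookup xs c) ≡ true → six (σ a) (σ b) (σ c) ≡ true)) → ⊥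
      embedded (σ , inj , col) = contradiction (every-sound E (λ _ → false) ev (tabulate σ) inj′ (All.map (λ {t} → good t) ps)) λ ()
        where
        at : ∀ i → lookup (tabulate σ) i ≡ σ i
        at = lookup∘tabulate σ
        inj′ : Injective _≡_ _≡_ (lookup (tabulate σ))
        inj′ {a} {b} eq = inj (trans (sym (at a)) (trans eq (at b)))
        six-cong : ∀ {a b c a′ b′ c′} → a ≡ a′ → b ≡ b′ → c ≡ c′ → six a b c ≡ six a′ b′ c′
        six-cong refl refl refl = refl
        good : ∀ t → tripleOn e t xs ≡ true → tripleOn six t (tabulate σ) ≡ true
        good t p = trans (tripleOn-lookup six t (tabulate σ))
          (trans (six-cong (at (fst³ t)) (at (snd³ t)) (at (thd³ t))) (col _ _ _ (edge-at xs t p)))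

-- Random placement of configurations in weighted sets.

module Selection where

  open Integration
  open Configurations
  open import Data.Nat
  open import Data.Nat.Properties
  open import Data.Bool using (Bool; true; false; _∧_; _∨_; not)
  open import Data.Fin using (Fin; zero; suc)
  open import Data.Vec using (Vec; []; _∷_; lookup)
  open import Data.List using (List; []; _∷_; length; filterᵇ)
  open import Data.List.Relation.Unary.All using (All; []; _∷_)
  open import Data.Product using (∃; _×_; _,_; proj₁; proj₂)
  open import Function using (_∘_)
  open import Relation.Binary.PropositionalEquality

  private variable
    n s k : ℕ

  -- An expectation that is not normalised: the vertices are drawn independently with weights `μs`,
  -- and the mean is this value divided by `total μs`.
  expect : Vec (Fin n → ℕ) k → (Vec (Fin n) k → ℕ) → ℕ
  expect [] f = f []
  expect (μ ∷ μs) f = ∫ μ λ x → expect μs λ xs → f (x ∷ xs)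

  total : Vec (Fin n → ℕ) k → ℕ
  total [] = 1
  total (μ ∷ μs) = sum μ * total μs

  expect-+ : (μs : Vec (Fin n → ℕ) k) (f g : Vec (Fin n) k → ℕ) → expect μs (λ xs → f xs + g xs) ≡ expect μs f + expect μs g
  expect-+ [] f g = refl
  expect-+ (μ ∷ μs) f g = trans (∫-cong μ λ x → expect-+ μs _ _) (∫-+ μ _ _)

  expect-const : (μs : Vec (Fin n → ℕ) k) (c : ℕ) → expect μs (λ _ → c) ≡ total μs * c
  expect-const [] c = sym (+-identityʳ c)
  expect-const (μ ∷ μs) c = trans (∫-cong μ λ x → expect-const μs c) (trans (∫-const μ _) (sym (*-assoc (sum μ) (total μs) c)))

  private
    pull : ∀ a b c → a * (b * c) ≡ b * (a * c)
    pull a b c = trans (sym (*-assoc a b c)) (trans (cong (_* c) (*-comm a b)) (*-assoc b a c))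

  -- All coordinates but one are integrated out. The factor on the left takes the place of a
  -- division by the mass of that coordinate.
  expect-single : (μs : Vec (Fin n → ℕ) k) (r : Fin k) (h : Fin n → ℕ) →
    sum (lookup μs r) * expect μs (λ xs → h (lookup xs r)) ≡ total μs * ∫ (lookup μs r) h
  expect-single (μ ∷ μs) zero h = begin
    sum μ * ∫ μ (λ x → expect μs (λ _ → h x))  ≡⟨ cong (sum μ *_) (∫-cong μ λ x → expect-const μs (h x)) ⟩
    sum μ * ∫ μ (λ x → total μs * h x)         ≡⟨ cong (sum μ *_) (∫-* μ (total μs) h) ⟩
    sum μ * (total μs * ∫ μ h)                 ≡⟨ sym (*-assoc (sum μ) _ _) ⟩
    sum μ * total μs * ∫ μ h                   ∎
    where open ≡-Reasoning
  expect-single (μ ∷ μs) (suc r) h = begin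
    ν * ∫ μ (λ _ → expect μs (λ xs → h (lookup xs r)))  ≡⟨ cong (ν *_) (∫-const μ _) ⟩
    ν * (sum μ * expect μs (λ xs → h (lookup xs r)))    ≡⟨ pull ν (sum μ) _ ⟩
    sum μ * (ν * expect μs (λ xs → h (lookup xs r)))    ≡⟨ cong (sum μ *_) (expect-single μs r h) ⟩
    sum μ * (total μs * ∫ (lookup μs r) h)              ≡⟨ sym (*-assoc (sum μ) _ _) ⟩
    sum μ * total μs * ∫ (lookup μs r) h                ∎
    where
    open ≡-Reasoning
    ν = sum (lookup μs r)

  expect-pair : (μs : Vec (Fin n → ℕ) k) (p : Pair k) (g : Fin n → Fin n → ℕ) →
    sum (lookup μs (fst² p)) * sum (lookup μs (snd² p)) * expect μs (λ xs → g (lookup xs (fst² p)) (lookup xs (snd² p)))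
      ≡ total μs * ∫ (lookup μs (fst² p)) (λ x → ∫ (lookup μs (snd² p)) (g x))
  expect-pair (μ ∷ μs) (first r) g = begin
    sum μ * ν * ∫ μ (λ x → expect μs (λ xs → g x (lookup xs r)))    ≡⟨ *-assoc (sum μ) ν _ ⟩
    sum μ * (ν * ∫ μ (λ x → expect μs (λ xs → g x (lookup xs r))))  ≡⟨ cong (sum μ *_) (sym (∫-* μ ν _)) ⟩
    sum μ * ∫ μ (λ x → ν * expect μs (λ xs → g x (lookup xs r)))    ≡⟨ cong (sum μ *_) (∫-cong μ λ x → expect-single μs r (g x)) ⟩
    sum μ * ∫ μ (λ x → total μs * ∫ (lookup μs r) (g x))            ≡⟨ cong (sum μ *_) (∫-* μ (total μs) _) ⟩
    sum μ * (total μs * ∫ μ (λ x → ∫ (lookup μs r) (g x)))          ≡⟨ sym (*-assoc (sum μ) _ _) ⟩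
    sum μ * total μs * ∫ μ (λ x → ∫ (lookup μs r) (g x))            ∎
    where
    open ≡-Reasoning
    ν = sum (lookup μs r)
  expect-pair (μ ∷ μs) (later p) g = begin
    ν * ∫ μ (λ _ → X)                                 ≡⟨ cong (ν *_) (∫-const μ _) ⟩
    ν * (sum μ * X)                                   ≡⟨ pull ν (sum μ) _ ⟩
    sum μ * (ν * X)                                   ≡⟨ cong (sum μ *_) (expect-pair μs p g) ⟩
    sum μ * (total μs * I)                            ≡⟨ sym (*-assoc (sum μ) _ _) ⟩
    sum μ * total μs * I                              ∎
    where
    open ≡-Reasoning
    ν = sum (lookup μs (fst² p)) * sum (lookup μs (snd² p))
    X = expect μs (λ xs → g (lookup xs (fst² p)) (lookup xs (snd² p)))
    I = ∫ (lookup μs (fst² p)) (λ x → ∫ (lookup μs (snd² p)) (g x))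

  Positive : Vec (Fin n → ℕ) k → Set
  Positive μs = ∀ i → 0 < sum (lookup μs i)

  -- The density 1/`D` is demanded for each `x` separately, so the condition serves for random and
  -- for fixed first vertices alike.
  Sparse : ℕ → (Fin n → Fin n → Fin n → ℕ) → (α β γ : Fin n → ℕ) → Set
  Sparse D g α β γ = ∀ x → 0 < α x → D * ∫ β (λ y → ∫ γ (g x y)) ≤ sum β * sum γ

  expect-pair≤ : (D : ℕ) (μs : Vec (Fin n → ℕ) k) → Positive μs → (p : Pair k) (g : Fin n → Fin n → ℕ) →
    D * ∫ (lookup μs (fst² p)) (λ x → ∫ (lookup μs (snd² p)) (g x)) ≤ sum (lookup μs (fst² p)) * sum (lookup μs (snd² p)) →
    D * expect μs (λ xs → g (lookup xs (fst² p)) (lookup xs (snd² p))) ≤ total μs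
  expect-pair≤ D μs pos p g h = *-cancelˡ-≤ (α * β) {{>-nonZero (*-mono-≤ (pos (fst² p)) (pos (snd² p)))}} (begin
    α * β * (D * X)    ≡⟨ pull (α * β) D X ⟩
    D * (α * β * X)    ≡⟨ cong (D *_) (expect-pair μs p g) ⟩
    D * (total μs * I) ≡⟨ pull D (total μs) I ⟩
    total μs * (D * I) ≤⟨ *-monoʳ-≤ (total μs) h ⟩
    total μs * (α * β) ≡⟨ *-comm (total μs) (α * β) ⟩
    α * β * total μs   ∎)
    where
    open ≤-Reasoning
    α = sum (lookup μs (fst² p))
    β = sum (lookup μs (snd² p))
    X = expect μs (λ xs → g (lookup xs (fst² p)) (lookup xs (snd² p)))
    I = ∫ (lookup μs (fst² p)) (λ x → ∫ (lookup μs (snd² p)) (g x))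

  expect-triple≤ : (D : ℕ) (μs : Vec (Fin n → ℕ) k) → Positive μs → (t : Triple k) (g : Fin n → Fin n → Fin n → ℕ) →
    Sparse D g (lookup μs (fst³ t)) (lookup μs (snd³ t)) (lookup μs (thd³ t)) →
    D * expect μs (λ xs → g (lookup xs (fst³ t)) (lookup xs (snd³ t)) (lookup xs (thd³ t))) ≤ total μs
  expect-triple≤ D (μ ∷ μs) pos (first p) g h = begin
    D * ∫ μ (λ x → X x)   ≡⟨ sym (∫-* μ D X) ⟩
    ∫ μ (λ x → D * X x)   ≤⟨ ∫≤ μ (total μs) (λ x x∈ → expect-pair≤ D μs (pos ∘ suc) p (g x) (h x x∈)) ⟩
    sum μ * total μs      ∎
    where
    open ≤-Reasoning
    X : Fin _ → ℕ
    X x = expect μs λ xs → g x (lookup xs (fst² p)) (lookup xs (snd² p))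
  expect-triple≤ D (μ ∷ μs) pos (later t) g h = begin
    D * ∫ μ (λ _ → X)     ≡⟨ cong (D *_) (∫-const μ X) ⟩
    D * (sum μ * X)       ≡⟨ pull D (sum μ) X ⟩
    sum μ * (D * X)       ≤⟨ *-monoʳ-≤ (sum μ) (expect-triple≤ D μs (pos ∘ suc) t g h) ⟩
    sum μ * total μs      ∎
    where
    open ≤-Reasoning
    X = expect μs λ xs → g (lookup xs (fst³ t)) (lookup xs (snd³ t)) (lookup xs (thd³ t))

  total-positive : (μs : Vec (Fin n → ℕ) k) → Positive μs → 0 < total μs
  total-positive [] pos = z<s
  total-positive (μ ∷ μs) pos = *-mono-≤ (pos zero) (total-positive μs (pos ∘ suc))

  -- First moment method, one coordinate at a time: some choice of the first vertex keeps the
  -- conditional mean below 1, and at the end a natural number below 1 is 0.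
  expect-<⇒∃0 : (μs : Vec (Fin n → ℕ) k) (f : Vec (Fin n) k → ℕ) → expect μs f < total μs →
    ∃ λ xs → (∀ i → 0 < lookup μs i (lookup xs i)) × f xs ≡ 0
  expect-<⇒∃0 [] f lt = [] , (λ ()) , n≤0⇒n≡0 (s≤s⁻¹ lt)
  expect-<⇒∃0 (μ ∷ μs) f lt with ∫-<⇒∃< μ {g = λ _ → total μs} (subst (∫ μ _ <_) (sym (∫-const μ (total μs))) lt)
  ... | x , x∈ , lt′ with expect-<⇒∃0 μs (λ xs → f (x ∷ xs)) lt′
  ... | xs , xs∈ , p = x ∷ xs , (λ { zero → x∈ ; (suc i) → xs∈ i }) , p

  missing : (Fin n → Fin n → Fin n → Bool) → List (Triple k) → Vec (Fin n) k → ℕ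
  missing e [] xs = 0
  missing e (t ∷ E) xs = ⟦ not (e (lookup xs (fst³ t)) (lookup xs (snd³ t)) (lookup xs (thd³ t))) ⟧ + missing e E xs

  none-missing : (e : Fin n → Fin n → Fin n → Bool) (E : List (Triple k)) (xs : Vec (Fin n) k) → missing e E xs ≡ 0 →
    All (λ t → tripleOn e t xs ≡ true) E
  none-missing e [] xs p = []
  none-missing e (t ∷ E) xs p = trans (tripleOn-lookup e t xs) (not-bad _ (m+n≡0⇒m≡0 _ p)) ∷ none-missing e E xs (m+n≡0⇒n≡0 ⟦ not (e (lookup xs (fst³ t)) (lookup xs (snd³ t)) (lookup xs (thd³ t))) ⟧ p)
    where
    not-bad : ∀ b → ⟦ not b ⟧ ≡ 0 → b ≡ true
    not-bad true _ = refl

  SparseAt : ℕ → (Fin n → Fin n → Fin n → Bool) → Vec (Fin n → ℕ) k → Triple k → Set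
  SparseAt D e μs t = Sparse D (λ x y z → ⟦ not (e x y z) ⟧) (lookup μs (fst³ t)) (lookup μs (snd³ t)) (lookup μs (thd³ t))

  expect-missing≤ : (D : ℕ) (e : Fin n → Fin n → Fin n → Bool) (μs : Vec (Fin n → ℕ) k) → Positive μs →
    (E : List (Triple k)) → All (SparseAt D e μs) E → D * expect μs (missing e E) ≤ length E * total μs
  expect-missing≤ D e μs pos [] [] = ≤-reflexive (trans (cong (D *_) (trans (expect-const μs 0) (*-zeroʳ (total μs)))) (*-zeroʳ D))
  expect-missing≤ D e μs pos (t ∷ E) (p ∷ ps) = begin
    D * expect μs (λ xs → bad xs + missing e E xs)            ≡⟨ cong (D *_) (expect-+ μs bad (missing e E)) ⟩
    D * (expect μs bad + expect μs (missing e E))             ≡⟨ *-distribˡ-+ D _ _ ⟩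
    D * expect μs bad + D * expect μs (missing e E)           ≤⟨ +-mono-≤ (expect-triple≤ D μs pos t _ p) (expect-missing≤ D e μs pos E ps) ⟩
    total μs + length E * total μs                            ∎
    where
    open ≤-Reasoning
    bad : Vec (Fin _) _ → ℕ
    bad xs = ⟦ not (e (lookup xs (fst³ t)) (lookup xs (snd³ t)) (lookup xs (thd³ t))) ⟧

  -- Union bound: each triple of `E` fails with probability at most 1/`D`, and there are fewer than
  -- `D` of them.
  select : (D : ℕ) (e : Fin n → Fin n → Fin n → Bool) (μs : Vec (Fin n → ℕ) k) → Positive μs → (E : List (Triple k)) → length E < D →
    All (SparseAt D e μs) E → ∃ λ xs → (∀ i → 0 < lookup μs i (lookup xs i)) × All (λ t → tripleOn e t xs ≡ true) E
  select D e μs pos E |E|<D sparse with expect-<⇒∃0 μs (missing e E) (*-cancelˡ-< D _ _ (<-≤-trans (s≤s (expect-missing≤ D e μs pos E sparse))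
      (*-monoˡ-< (total μs) {{>-nonZero (total-positive μs pos)}} |E|<D)))
  ... | xs , xs∈ , none = xs , xs∈ , none-missing e E xs none

  -- The vertices of a configuration are either fixed (ℓ says which pairs of classes the link of the vertex nearly fills)
  -- or drawn at random from a large subset of a class. Fixed vertices come first, so that in an increasing triple with
  -- at most one of them the last two entries are random.
  data Role (s : ℕ) : Set where
    point : (Fin s → Fin s → Bool) → Role s
    rich : Fin s → Role s

  module Roles (P : Pattern s) where
    open Pattern P

    link : Role s → Fin s → Fin s → Bool
    link (point ℓ) = ℓ
    link (rich i) = rel i

    row : Role s → Role s → Role s → Bool
    row ρ (rich j) (rich k) = link ρ j k
    row ρ _ _ = false

    rowAt : Vec (Role s) k → Triple k → Bool
    rowAt ρs t = row (lookup ρs (fst³ t)) (lookup ρs (snd³ t)) (lookup ρs (thd³ t))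

    -- `κ` adds the triples that are certain to be edges because of the way the supports were
    -- chosen.
    known : Vec (Role s) k → (Triple k → Bool) → List (Triple k)
    known {k} ρs κ = filterᵇ (λ t → rowAt ρs t ∨ κ t) (triples k)

  module Placement {n : ℕ} (G : MFreeRelation n) {s : ℕ} (P : Pattern s) (c : Fin n → Fin s) (w : Fin n → ℕ) (N : ℕ) {{N≢0 : NonZero N}} where
    open MFreeRelation G
    open Pattern P
    open Roles P public

    m : ℕ
    m = sum w

    gap : Fin n → (Fin s → Fin s → Bool) → ℕ
    gap x ℓ = ∫ w λ y → ∫ w λ z → ⟦ ℓ (c y) (c z) ∧ not (e x y z) ⟧

    -- A random vertex comes from a set of mass at least m/`N`, so in a product of two such sets the
    -- missing pairs have density at most `N`² gap / m², hence at most 1/36. The number 36 is one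
    -- more than the number of triples of seven points.
    Near : Fin n → (Fin s → Fin s → Bool) → Set
    Near x ℓ = 36 * (N * N) * gap x ℓ ≤ m * m

    Fits : Role s → (Fin n → ℕ) → Set
    Fits (point ℓ) μ = 0 < sum μ × (∀ x → 0 < μ x → Near x ℓ)
    Fits (rich i) μ = (0 < sum μ × (∀ x → 0 < μ x → Near x (rel i))) × (∀ x → μ x ≤ w x) × (∀ x → 0 < μ x → c x ≡ i) × m ≤ N * sum μ

    private
      fits-link : ∀ ρ {μ} → Fits ρ μ → 0 < sum μ × (∀ x → 0 < μ x → Near x (link ρ))
      fits-link (point ℓ) p = p
      fits-link (rich i) p = proj₁ p

      row-sparse : ∀ {α β γ} ρ j k → Fits ρ α → Fits (rich j) β → Fits (rich k) γ → link ρ j k ≡ true →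
        Sparse 36 (λ x y z → ⟦ not (e x y z) ⟧) α β γ
      row-sparse {α} {β} {γ} ρ j k fα (_ , β≤w , β∈ , m≤β) (_ , γ≤w , γ∈ , m≤γ) jk x x∈ =
        *-cancelˡ-≤ (N * N) {{m*n≢0 N N}} (begin
          N * N * (36 * B)        ≡⟨ pull (N * N) 36 B ⟩
          36 * (N * N * B)        ≡⟨ sym (*-assoc 36 (N * N) B) ⟩
          36 * (N * N) * B        ≤⟨ *-monoʳ-≤ (36 * (N * N)) B≤gap ⟩
          36 * (N * N) * gap x (link ρ) ≤⟨ proj₂ (fits-link ρ fα) x x∈ ⟩
          m * m                   ≤⟨ *-mono-≤ m≤β m≤γ ⟩
          N * sum β * (N * sum γ) ≡⟨ [m*n]*[o*p]≡[m*o]*[n*p] N (sum β) N (sum γ) ⟩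
          N * N * (sum β * sum γ) ∎)
        where
        open ≤-Reasoning
        B = ∫ β λ y → ∫ γ λ z → ⟦ not (e x y z) ⟧
        f : Fin n → Fin n → ℕ
        f y z = ⟦ link ρ (c y) (c z) ∧ not (e x y z) ⟧
        B≤gap : B ≤ gap x (link ρ)
        B≤gap = begin
          B                       ≤⟨ ∫-mono β (λ y y∈ → ∫-mono γ λ z z∈ → ≤-reflexive (sym (cong (λ b → ⟦ b ∧ not (e x y z) ⟧)
                                       (trans (cong₂ (link ρ) (β∈ y y∈) (γ∈ z z∈)) jk)))) ⟩
          ∫ β (λ y → ∫ γ (f y))   ≤⟨ ∫-mono β (λ y _ → ∫-monoˡ (f y) γ≤w) ⟩
          ∫ β (λ y → ∫ w (f y))   ≤⟨ ∫-monoˡ _ β≤w ⟩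
          ∫ w (λ y → ∫ w (f y))   ∎

      row-sparse′ : ∀ {α β γ} ρ ρ′ ρ″ → Fits ρ α → Fits ρ′ β → Fits ρ″ γ → row ρ ρ′ ρ″ ≡ true →
        Sparse 36 (λ x y z → ⟦ not (e x y z) ⟧) α β γ
      row-sparse′ ρ (rich j) (rich k) = row-sparse ρ j k

    Sure : (α β γ : Fin n → ℕ) → Set
    Sure α β γ = ∀ x y z → 0 < α x → 0 < β y → 0 < γ z → e x y z ≡ true

    SureAt : Vec (Fin n → ℕ) k → Triple k → Set
    SureAt μs t = Sure (lookup μs (fst³ t)) (lookup μs (snd³ t)) (lookup μs (thd³ t))

    private
      sure-sparse : ∀ {α β γ} → Sure α β γ → Sparse 36 (λ x y z → ⟦ not (e x y z) ⟧) α β γ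
      sure-sparse {α} {β} {γ} sure x x∈ = subst (_≤ sum β * sum γ) (sym (trans (cong (36 *_) zero-integral) (*-zeroʳ 36))) z≤n
        where
        zero-integral = ∫-zero β λ y y∈ → ∫-zero γ λ z z∈ → cong (λ b → ⟦ not b ⟧) (sure x y z x∈ y∈ z∈)

      all-filterᵇ : ∀ {A : Set} {Q : A → Set} (p : A → Bool) (xs : List A) → (∀ x → p x ≡ true → Q x) → All Q (filterᵇ p xs)
      all-filterᵇ p [] h = []
      all-filterᵇ p (x ∷ xs) h with p x in eq
      ... | true = h x eq ∷ all-filterᵇ p xs h
      ... | false = all-filterᵇ p xs h

      length-filterᵇ : ∀ {A : Set} (p : A → Bool) (xs : List A) → length (filterᵇ p xs) ≤ length xs
      length-filterᵇ p [] = z≤n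
      length-filterᵇ p (x ∷ xs) with p x
      ... | true = s≤s (length-filterᵇ p xs)
      ... | false = m≤n⇒m≤1+n (length-filterᵇ p xs)

    -- Estimated triples fail with probability at most 1/36 each and those in `κ` never, so all of
    -- them can be edges at the same time.
    place : (ρs : Vec (Role s) k) (μs : Vec (Fin n → ℕ) k) → (∀ i → Fits (lookup ρs i) (lookup μs i)) → (κ : Triple k → Bool) →
      (∀ t → κ t ≡ true → SureAt μs t) → length (triples k) < 36 →
      ∃ λ xs → (∀ i → 0 < lookup μs i (lookup xs i)) × All (λ t → tripleOn e t xs ≡ true) (known ρs κ)
    place {k} ρs μs fits κ sure small = select 36 e μs (λ i → proj₁ (fits-link (lookup ρs i) (fits i))) (known ρs κ)
      (≤-<-trans (length-filterᵇ _ (triples k)) small) (all-filterᵇ _ (triples k) sparse)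
      where
      sparse : ∀ t → (rowAt ρs t ∨ κ t) ≡ true → SparseAt 36 e μs t
      sparse t p with rowAt ρs t in eq
      ... | true = row-sparse′ (lookup ρs (fst³ t)) (lookup ρs (snd³ t)) (lookup ρs (thd³ t)) (fits (fst³ t)) (fits (snd³ t)) (fits (thd³ t)) eq
      ... | false = sure-sparse {lookup μs (fst³ t)} {lookup μs (snd³ t)} {lookup μs (thd³ t)} (sure t p)

-- Degrees, volumes and the setting of vertex extension.

module Extension where

  open Integration
  open Configurations
  open Selection
  open import Data.Nat
  open import Data.Nat.Properties
  open import Data.Nat.Tactic.RingSolver using (solve-∀)
  open import Data.Bool.Properties using (∨-identityʳ)
  open import Data.Bool using (Bool; true; false; _∧_; _∨_; not)
  open import Data.Fin using (Fin; zero; suc)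
  import Data.Fin as Fin
  open import Data.Nat.Solver using (module +-*-Solver)
  open import Data.Empty using (⊥)
  open import Data.Sum using (inj₁; inj₂)
  open import Data.Vec using (Vec; lookup; replicate)
  open import Data.Vec.Properties using (lookup-replicate)
  open import Data.List using (List)
  open import Data.Product using (∃; _×_; _,_; proj₁)
  open import Function using (_∘_)
  open import Relation.Nullary using (yes; no; does; contradiction)
  open import Relation.Binary.PropositionalEquality hiding (J)

  private variable
    n s : ℕ

  -- Ordered pairs and triples are counted: for unit weights this is twice the degree, and `vol` is
  -- six times the number of edges. The extremal degree 2n²/9 and edge number 2n³/27 thus both turn
  -- into the coefficient 4/9.
  deg : (Fin n → Fin n → Fin n → Bool) → (Fin n → ℕ) → Fin n → ℕ
  deg R w x = ∫ w λ y → ∫ w λ z → ⟦ R x y z ⟧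

  vol : (Fin n → Fin n → Fin n → Bool) → (Fin n → ℕ) → ℕ
  vol R w = ∫ w (deg R w)

  blow : Pattern s → (Fin n → Fin s) → Fin n → Fin n → Fin n → Bool
  blow P c x y z = Pattern.rel P (c x) (c y) (c z)

  VolumeBound : Pattern s → Set
  VolumeBound {s} P = ∀ {n} (c : Fin n → Fin s) (w : Fin n → ℕ) → 9 * vol (blow P c) w ≤ 4 * (sum w * sum w * sum w)

  vol-fibres : (P : Pattern s) (c : Fin n → Fin s) (w : Fin n → ℕ) →
    vol (blow P c) w ≡ vol (Pattern.rel P) (λ i → sum (fibre w c i))
  vol-fibres {s} P c w = begin
    ∫ w (λ x → ∫ w λ y → ∫ w λ z → ⟦ rel (c x) (c y) (c z) ⟧)  ≡⟨ ∫-cong w (λ x → ∫-cong w λ y → ∫-fibres w c _) ⟩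
    ∫ w (λ x → ∫ w λ y → ∫ ω λ k → ⟦ rel (c x) (c y) k ⟧)      ≡⟨ ∫-cong w (λ x → ∫-fibres w c (λ j → ∫ ω λ k → ⟦ rel (c x) j k ⟧)) ⟩
    ∫ w (λ x → ∫ ω λ j → ∫ ω λ k → ⟦ rel (c x) j k ⟧)          ≡⟨ ∫-fibres w c (λ i → ∫ ω λ j → ∫ ω λ k → ⟦ rel i j k ⟧) ⟩
    ∫ ω (λ i → ∫ ω λ j → ∫ ω λ k → ⟦ rel i j k ⟧)              ∎
    where
    open ≡-Reasoning
    open Pattern P
    ω : Fin s → ℕ
    ω i = sum (fibre w c i)

  mass-fibres : (c : Fin n → Fin s) (w : Fin n → ℕ) → sum w ≡ sum (λ i → sum (fibre w c i))
  mass-fibres c w = trans (sym (∫-1 w)) (trans (∫-fibres w c (λ _ → 1)) (∫-1 _))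

  -- Adding to J·w a mass m at x raises the volume by at least 3 J² m times the degree of x,
  -- so a volume bound that w nearly attains bounds the degree of x.
  module _ (R : Fin n → Fin n → Fin n → Bool) (s₁₂ : ∀ x y z → R x y z ≡ R y x z) (s₂₃ : ∀ x y z → R x y z ≡ R x z y)
    (w : Fin n → ℕ) (J m : ℕ) (x : Fin n) where

    private
      u : Fin n → ℕ
      u y = J * w y + m * δ x y

      ∫u : (f : Fin n → ℕ) → ∫ u f ≡ J * ∫ w f + m * f x
      ∫u f = trans (∫-+ˡ _ _ f) (cong₂ _+_ (∫-*ˡ J w f) (trans (∫-*ˡ m (δ x) f) (cong (m *_) (∫-δ x f))))

      ∫u≥ : (f : Fin n → ℕ) → J * ∫ w f ≤ ∫ u f
      ∫u≥ f = ≤-trans (m≤m+n _ _) (≤-reflexive (sym (∫u f)))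

      D = deg R w x

      -- Only the part linear in `m` is kept; it is the first-order response of a degree to the mass
      -- added at `x`.
      deg-u : ∀ a → J * (J * deg R w a) + (J * (m * ∫ w (λ b → ⟦ R a b x ⟧)) + m * (J * ∫ w (λ z → ⟦ R a x z ⟧))) ≤ deg R u a
      deg-u a = begin
        J * (J * deg R w a) + (J * (m * ∫ w (λ b → ⟦ R a b x ⟧)) + m * (J * ∫ w (λ z → ⟦ R a x z ⟧)))
          ≡⟨ sym (+-assoc (J * (J * deg R w a)) _ _) ⟩
        J * (J * deg R w a) + J * (m * ∫ w (λ b → ⟦ R a b x ⟧)) + m * (J * ∫ w (λ z → ⟦ R a x z ⟧))
          ≡⟨ cong (_+ m * (J * ∫ w (λ z → ⟦ R a x z ⟧))) (trans (sym (*-distribˡ-+ J _ _)) (cong (J *_)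
               (trans (cong₂ _+_ (sym (∫-* w J _)) (sym (∫-* w m _))) (trans (sym (∫-+ w _ _)) (∫-cong w λ b → sym (∫u _)))))) ⟩
        J * ∫ w (λ b → ∫ u λ z → ⟦ R a b z ⟧) + m * (J * ∫ w (λ z → ⟦ R a x z ⟧))
          ≤⟨ +-monoʳ-≤ (J * ∫ w (λ b → ∫ u λ z → ⟦ R a b z ⟧)) (*-monoʳ-≤ m (∫u≥ _)) ⟩
        J * ∫ w (λ b → ∫ u λ z → ⟦ R a b z ⟧) + m * ∫ u (λ z → ⟦ R a x z ⟧)
          ≡⟨ sym (∫u _) ⟩
        deg R u a ∎
        where open ≤-Reasoning

      rot₁ : ∫ w (λ a → ∫ w λ b → ⟦ R a b x ⟧) ≡ D
      rot₁ = ∫-cong w λ a → ∫-cong w λ b → cong ⟦_⟧ (trans (s₂₃ a b x) (s₁₂ a x b))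

      rot₂ : ∫ w (λ a → ∫ w λ b → ⟦ R a x b ⟧) ≡ D
      rot₂ = ∫-cong w λ a → ∫-cong w λ b → cong ⟦_⟧ (s₁₂ a x b)

      collect : ∀ J m V D → J * J * J * V + 3 * (J * J * m * D) ≡
        J * (J * (J * V) + (J * (m * D) + m * (J * D))) + m * (J * (J * D))
      collect = solve-∀

    vol-add-point : J * J * J * vol R w + 3 * (J * J * m * D) ≤ vol R u
    vol-add-point = begin
      J * J * J * vol R w + 3 * (J * J * m * D) ≡⟨ collect J m (vol R w) D ⟩
      J * (J * (J * vol R w) + (J * (m * D) + m * (J * D))) + m * (J * (J * D))
        ≡⟨ cong (λ t → J * t + m * (J * (J * D))) (sym (trans (∫-+ w _ _) (cong₂ _+_
             (trans (∫-* w J _) (cong (J *_) (∫-* w J _)))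
             (trans (∫-+ w _ _) (cong₂ _+_ (trans (∫-* w J _) (cong (J *_) (trans (∫-* w m _) (cong (m *_) rot₁))))
                                           (trans (∫-* w m _) (cong (m *_) (trans (∫-* w J _) (cong (J *_) rot₂))))))))) ⟩
      J * ∫ w (λ a → J * (J * deg R w a) + (J * (m * ∫ w (λ b → ⟦ R a b x ⟧)) + m * (J * ∫ w (λ z → ⟦ R a x z ⟧)))) + m * (J * (J * D))
        ≤⟨ +-mono-≤ (*-monoʳ-≤ J (∫-mono w λ a _ → deg-u a)) (*-monoʳ-≤ m two) ⟩
      J * ∫ w (deg R u) + m * deg R u x ≡⟨ sym (∫u _) ⟩
      vol R u ∎
      where
      open ≤-Reasoning
      two : J * (J * D) ≤ deg R u x
      two = ≤-trans (*-monoʳ-≤ J (≤-trans (≤-reflexive (sym (∫-* w J _))) (∫-mono w λ b _ → ∫u≥ _))) (∫u≥ _)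

    mass-add-point : sum u ≡ J * sum w + m
    mass-add-point = trans (sym (∫-1 u)) (trans (∫u _) (cong₂ _+_ (cong (J *_) (∫-1 w)) (*-identityʳ m)))

  Colours : (Fin n → Fin n → Fin n → Bool) → Pattern s → (Fin n → Fin s) → (Fin n → Bool) → Set
  Colours e P c U = ∀ x y z → U x ≡ true → U y ≡ true → U z ≡ true → e x y z ≡ true → Pattern.rel P (c x) (c y) (c z) ≡ true

  _∪̂_ : (Fin n → Bool) → Fin n → Fin n → Bool
  (U ∪̂ v) x = U x ∨ does (x Fin.≟ v)

  -- The degrees of `v` and of all of `U` fall short of 4m²/9 by at most m²/(9 `J`²). The accuracy
  -- is quadratic in 1/`J` because passing from volumes to links loses a square root.
  record Situation {n : ℕ} (G : MFreeRelation n) {s : ℕ} (P : Pattern s) : Set where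
    open MFreeRelation G
    field
      bound : VolumeBound P
      J : ℕ
      J>0 : 0 < J
      U : Fin n → Bool
      w : Fin n → ℕ
      w⊆U : ∀ x → 0 < w x → U x ≡ true
      m>0 : 0 < sum w
      c : Fin n → Fin s
      coloured : Colours e P c U
      high : ∀ x → U x ≡ true → 4 * (J * J) * (sum w * sum w) ≤ 9 * (J * J) * deg e w x + sum w * sum w
      v : Fin n
      high-v : 4 * (J * J) * (sum w * sum w) ≤ 9 * (J * J) * deg e w v + sum w * sum w

  module InSituation {n : ℕ} {G : MFreeRelation n} {s : ℕ} {P : Pattern s} (S : Situation G P) where
    open MFreeRelation G public
    open Pattern P public
    open Situation S public

    m : ℕ
    m = sum w

    instance
      m≢0 : NonZero m
      m≢0 = >-nonZero m>0
      J≢0 : NonZero J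
      J≢0 = >-nonZero J>0

    class : ∀ i x → 0 < fibre w c i x → c x ≡ i
    class i x x∈ = proj₁ (fibre-support w c i x x∈)

    R : Fin n → Fin n → Fin n → Bool
    R = blow P c

    gap : Fin n → (Fin s → Fin s → Bool) → ℕ
    gap x ℓ = ∫ w λ y → ∫ w λ z → ⟦ ℓ (c y) (c z) ∧ not (e x y z) ⟧

    stray : Fin n → (Fin s → Fin s → Bool) → ℕ
    stray x ℓ = ∫ w λ y → ∫ w λ z → ⟦ not (ℓ (c y) (c z)) ∧ e x y z ⟧

    linkSize : (Fin s → Fin s → Bool) → ℕ
    linkSize ℓ = ∫ w λ y → ∫ w λ z → ⟦ ℓ (c y) (c z) ⟧

    -- Both sides count the pairs that lie in the link of `x` or are allowed by `ℓ`.
    gap-deg : ∀ x ℓ → gap x ℓ + deg e w x ≡ linkSize ℓ + stray x ℓ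
    gap-deg x ℓ = trans (sym (double+ _ _)) (trans (∫-cong w λ y → ∫-cong w λ z → swap (ℓ (c y) (c z)) (e x y z)) (double+ _ _))
      where
      double+ : ∀ (f g : Fin n → Fin n → ℕ) → ∫ w (λ y → ∫ w λ z → f y z + g y z) ≡ ∫ w (λ y → ∫ w (f y)) + ∫ w (λ y → ∫ w (g y))
      double+ f g = trans (∫-cong w λ y → ∫-+ w (f y) (g y)) (∫-+ w _ _)
      swap : ∀ a b → ⟦ a ∧ not b ⟧ + ⟦ b ⟧ ≡ ⟦ a ⟧ + ⟦ not a ∧ b ⟧
      swap true true = refl
      swap true false = refl
      swap false true = refl
      swap false false = refl

    -- The degree bound is averaged over `w`; on the support the colouring embeds every link of `e`
    -- in the corresponding link of `R`.
    vol-high : 4 * (J * J) * (m * m * m) ≤ 9 * (J * J) * vol R w + m * m * m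
    vol-high = begin
      4 * (J * J) * (m * m * m)                     ≡⟨ assoc (4 * (J * J)) m ⟩
      m * (4 * (J * J) * (m * m))                   ≡⟨ sym (∫-const w _) ⟩
      ∫ w (λ _ → 4 * (J * J) * (m * m))             ≤⟨ ∫-mono w (λ x x∈ → ≤-trans (high x (w⊆U x x∈))
                                                         (+-monoˡ-≤ (m * m) (*-monoʳ-≤ (9 * (J * J)) (deg≤ x x∈)))) ⟩
      ∫ w (λ x → 9 * (J * J) * deg R w x + m * m)   ≡⟨ trans (∫-+ w _ _) (cong₂ _+_ (∫-* w (9 * (J * J)) (deg R w)) (∫-const w (m * m))) ⟩
      9 * (J * J) * vol R w + m * (m * m)           ≡⟨ cong (9 * (J * J) * vol R w +_) (sym (*-assoc m m m)) ⟩
      9 * (J * J) * vol R w + m * m * m             ∎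
      where
      open ≤-Reasoning
      assoc : ∀ a m → a * (m * m * m) ≡ m * (a * (m * m))
      assoc = solve-∀
      mono : ∀ {a b} → (a ≡ true → b ≡ true) → ⟦ a ⟧ ≤ ⟦ b ⟧
      mono {false} h = z≤n
      mono {true} h rewrite h refl = ≤-refl
      deg≤ : ∀ x → 0 < w x → deg e w x ≤ deg R w x
      deg≤ x x∈ = ∫-mono w λ y y∈ → ∫-mono w λ z z∈ → mono (coloured x y z (w⊆U x x∈) (w⊆U y y∈) (w⊆U z z∈))

    -- The weight `J` w plus mass m at `x` still obeys the volume bound, which w misses by at most
    -- m³/(9 `J`²). So the linear gain, 3 `J`² m times the link size, can exceed its extremal value
    -- only by terms of lower order in `J`: an error of 1/`J`² in the volume becomes one of order
    -- 1/`J` in the link.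
    link-bound : ∀ x → 27 * (J * J) * linkSize (rel (c x)) ≤ m * m * (12 * (J * J) + 13 * J + 4)
    link-bound x = *-cancelˡ-≤ m (certify 0 (+-mono-≤ (*-monoʳ-≤ 9 step) (+-mono-≤ bd (*-monoʳ-≤ J vol-high)))
      (id₁ J m (vol R w) (linkSize (rel (c x))) (vol R (λ y → J * w y + m * δ x y))))
      where
      step = vol-add-point R (λ a b d → sym₁₂ _ _ _) (λ a b d → sym₂₃ _ _ _) w J m x
      bd : 9 * vol R (λ y → J * w y + m * δ x y) ≤ 4 * ((J * m + m) * (J * m + m) * (J * m + m))
      bd = subst (λ t → 9 * vol R (λ y → J * w y + m * δ x y) ≤ 4 * (t * t * t))
        (mass-add-point R (λ a b d → sym₁₂ _ _ _) (λ a b d → sym₂₃ _ _ _) w J m x) (bound c _)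
      id₁ : ∀ J m V D Vu → m * (27 * (J * J) * D) + (9 * Vu + (4 * ((J * m + m) * (J * m + m) * (J * m + m)) + J * (9 * (J * J) * V + m * m * m))) + 0 ≡
        m * (m * m * (12 * (J * J) + 13 * J + 4)) + (9 * (J * J * J * V + 3 * (J * J * m * D)) + (9 * Vu + J * (4 * (J * J) * (m * m * m))))
      id₁ = solve-∀

    gap-bound : ∀ x i → 4 * (J * J) * (m * m) ≤ 9 * (J * J) * deg e w x + m * m → (∃ λ y → c y ≡ i) →
      J * gap x (rel i) ≤ m * m + J * stray x (rel i)
    -- In units of m² the error is 13 `J` + 7, at most 20 `J`; with 27 `J` available this leaves the
    -- slack 7 `J`.
    gap-bound x i hi (y , refl) = *-cancelˡ-≤ (27 * J) {{m*n≢0 27 J}} (certify (7 * (J * (m * m)))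
      (+-mono-≤ (≤-reflexive (cong (27 * (J * J) *_) (gap-deg x (rel i)))) (+-mono-≤ (link-bound y) (+-mono-≤ (*-monoʳ-≤ 3 hi) (*-monoʳ-≤ (7 * (m * m)) J>0))))
      (id₂ J m (gap x (rel i)) (deg e w x) (linkSize (rel i)) (stray x (rel i))))
      where
      id₂ : ∀ J m g d l t → 27 * J * (J * g) + (27 * (J * J) * (l + t) + (m * m * (12 * (J * J) + 13 * J + 4) + (3 * (9 * (J * J) * d + m * m) + 7 * (m * m) * J))) + 7 * (J * (m * m)) ≡
        27 * J * (m * m + J * t) + (27 * (J * J) * (g + d) + (27 * (J * J) * l + (3 * (4 * (J * J) * (m * m)) + 7 * (m * m) * 1)))
      id₂ = solve-∀

    stray-zero : ∀ x ℓ → (∀ y z → U y ≡ true → U z ≡ true → e x y z ≡ true → ℓ (c y) (c z) ≡ true) → stray x ℓ ≡ 0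
    stray-zero x ℓ h = ∫-zero w λ y y∈ → ∫-zero w λ z z∈ → none (h y z (w⊆U y y∈) (w⊆U z z∈))
      where
      none : ∀ {a b} → (b ≡ true → a ≡ true) → ⟦ not a ∧ b ⟧ ≡ 0
      none {true} h = refl
      none {false} {false} h = refl
      none {false} {true} h with h refl
      ... | ()

    gap-U : ∀ x → U x ≡ true → J * gap x (rel (c x)) ≤ m * m
    gap-U x x∈ = subst (J * gap x (rel (c x)) ≤_) (trans (cong (λ t → m * m + J * t) (stray-zero x (rel (c x)) λ y z → coloured x y z x∈))
      (trans (cong (m * m +_) (*-zeroʳ J)) (+-identityʳ _))) (gap-bound x (c x) (high x x∈) (x , refl))

    Extends : Set
    Extends = ∃ λ c′ → Colours e P c′ (U ∪̂ v)

    -- Edges with `v` in the first place are enough: the other places follow by symmetry, and `v`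
    -- cannot occur twice in an edge.
    extend : (i : Fin s) → (∀ y z → U y ≡ true → U z ≡ true → e v y z ≡ true → rel i (c y) (c z) ≡ true) → Extends
    extend i ok = c′ , good
      where
      c′ : Fin n → Fin s
      c′ x with x Fin.≟ v
      ... | yes _ = i
      ... | no _ = c x
      data At (x : Fin n) : Set where
        new : x ≡ v → c′ x ≡ i → At x
        old : U x ≡ true → c′ x ≡ c x → At x
      at : ∀ x → (U ∪̂ v) x ≡ true → At x
      at x p with x Fin.≟ v in eq
      ... | yes q = new q lem
        where
        lem : c′ x ≡ i
        lem rewrite eq = refl
      ... | no q = old (trans (sym (∨-identityʳ (U x))) p) lem
        where
        lem : c′ x ≡ c x
        lem rewrite eq = refl
      loop : ∀ {y z} → e y y z ≡ true → ∀ {A : Set} → A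
      loop {y} {z} p = contradiction (trans (sym p) (irrefl y z)) λ ()
      rel-cong : ∀ {a b d a′ b′ d′} → a ≡ a′ → b ≡ b′ → d ≡ d′ → rel a′ b′ d′ ≡ true → rel a b d ≡ true
      rel-cong refl refl refl p = p
      good : Colours e P c′ (U ∪̂ v)
      good x y z x∈ y∈ z∈ p with at x x∈ | at y y∈ | at z z∈
      ... | old xU xc | old yU yc | old zU zc = rel-cong xc yc zc (coloured x y z xU yU zU p)
      ... | new refl xc | old yU yc | old zU zc = rel-cong xc yc zc (ok y z yU zU p)
      ... | old xU xc | new refl yc | old zU zc = rel-cong xc yc zc (trans (sym₁₂ _ _ _) (ok x z xU zU (trans (swap₁₂ y x z) p)))
      ... | old xU xc | old yU yc | new refl zc = rel-cong xc yc zc (trans (sym₂₃ _ _ _) (trans (sym₁₂ _ _ _) (ok x y xU yU (trans (swap₁₂ z x y) (trans (swap₂₃ x z y) p)))))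
      ... | new refl _ | new refl _ | _ = loop p
      ... | new refl _ | _ | new refl _ = loop (trans (swap₂₃ x z y) p)
      ... | _ | new refl _ | new refl _ = loop (trans (trans (swap₂₃ y z x) (swap₁₂ y x z)) p)

  -- Once 36 `N`² ≤ `J`, every vertex of `U` is near the link of its class. Two values of `N` occur:
  -- `N₀` when whole classes are sampled, `N₁` when the sampled sets were found inside a dense link.
  module Slots {n : ℕ} {G : MFreeRelation n} {s : ℕ} {P : Pattern s} (S : Situation G P) (N : ℕ) {{N≢0 : NonZero N}}
    (N-small : 36 * (N * N) ≤ Situation.J S) where
    open InSituation S
    open Placement G P c w N public hiding (gap; m)
    open Forbidden G

    near-U : ∀ {x i} → U x ≡ true → c x ≡ i → Near x (rel i)
    near-U {x} x∈ refl = ≤-trans (*-monoˡ-≤ (gap x (rel (c x))) N-small) (gap-U x x∈)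

    fits-rich : ∀ {μ} i → (∀ x → μ x ≤ w x) → (∀ x → 0 < μ x → c x ≡ i) → m ≤ N * sum μ → Fits (rich i) μ
    fits-rich {μ} i μ≤w μ∈ m≤ = (pos (sum μ) m≤ , λ x x∈ → near-U (w⊆U x (<-≤-trans x∈ (μ≤w x))) (μ∈ x x∈)) , μ≤w , μ∈ , m≤
      where
      pos : ∀ k → m ≤ N * k → 0 < k
      pos zero p = contradiction (≤-trans m>0 (≤-trans p (≤-reflexive (*-zeroʳ N)))) λ ()
      pos (suc k) p = z<s

    fits-near : ∀ {x ℓ} → Near x ℓ → Fits (point ℓ) (δ x)
    fits-near {x} {ℓ} p = ≤-reflexive (sym (mass-δ x)) , λ y y∈ → subst (λ z → Near z ℓ) (δ-support x y y∈) p

    fits-point : ∀ {x i} → U x ≡ true → c x ≡ i → Fits (point (rel i)) (δ x)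
    fits-point {x} {i} x∈ p = fits-near {x} {rel i} (near-U x∈ p)

    -- The link promised for a vertex of which nothing is known in advance; its edges come from `κ`
    -- and its covered pairs from `Q`.
    none : Fin s → Fin s → Bool
    none _ _ = false

    fits-bare : ∀ x → Fits (point none) (δ x)
    fits-bare x = fits-near {x} {none} (subst (λ t → 36 * (N * N) * t ≤ m * m) (sym (∫-zero w λ y _ → ∫-zero w λ z _ → refl))
      (subst (_≤ m * m) (sym (*-zeroʳ (36 * (N * N)))) z≤n))

    fits-replicate : ∀ {k ρ μ} → Fits ρ μ → (r : Fin k) → Fits (lookup (replicate k ρ) r) (lookup (replicate k μ) r)
    fits-replicate {k} {ρ} {μ} f r rewrite lookup-replicate r ρ | lookup-replicate r μ = f

    -- Seven points have 35 triples, the most that `place` admits. `Q` lists the pairs covered by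
    -- edges that leave the seven points.
    refute₇ : (ρs : Vec (Role s) 7) (μs : Vec (Fin n → ℕ) 7) → (∀ i → Fits (lookup ρs i) (lookup μs i)) →
      (κ : Triple 7 → Bool) → (∀ t → κ t ≡ true → SureAt μs t) → (Q : List (Fin 7 × Fin 7)) →
      (∀ xs → (∀ i → 0 < lookup μs i (lookup xs i)) → CoveredOn xs Q) →
      AllJoined (known ρs κ) Q → Spread (known ρs κ) → ⊥
    refute₇ ρs μs fits κ sure Q cov joined spread = conclude (place ρs μs fits κ sure (≤-refl {36}))
      where
      conclude : (∃ λ xs → (∀ i → 0 < lookup μs i (lookup xs i)) × EdgesOn xs (known ρs κ)) → ⊥
      conclude (xs , xs∈ , edges) = no-seven xs edges (cov xs xs∈) joined spread

    refute₆ : (ρs : Vec (Role s) 6) (μs : Vec (Fin n → ℕ) 6) → (∀ i → Fits (lookup ρs i) (lookup μs i)) →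
      (κ : Triple 6 → Bool) → (∀ t → κ t ≡ true → SureAt μs t) → (Q : List (Fin 6 × Fin 6)) →
      (∀ xs → (∀ i → 0 < lookup μs i (lookup xs i)) → CoveredOn xs Q) →
      AllJoined (known ρs κ) Q → Spread (known ρs κ) → every (known ρs κ) (λ _ → false) ≡ true → ⊥
    refute₆ ρs μs fits κ sure Q cov joined spread ev = conclude (place ρs μs fits κ sure (m≤m+n 21 15))
      where
      conclude : (∃ λ xs → (∀ i → 0 < lookup μs i (lookup xs i)) × EdgesOn xs (known ρs κ)) → ⊥
      conclude (xs , xs∈ , edges) = no-six xs edges (cov xs xs∈) joined spread ev

  -- N₀ measures the classes of a near-extremal colouring, 1/q separates dense links from sparse ones,
  -- N₁ measures the sets found inside dense links, and 1/J bounds the proportion of missing edges.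
  record Scale (J : ℕ) : Set where
    field
      N₀ q N₁ : ℕ
      N₀≥12 : 12 ≤ N₀
      q-large : 128 * (36 * (N₀ * N₀)) ≤ q
      N₁-large : 2 * q ≤ N₁
      J-large : 36 * (N₁ * N₁) ≤ J

    instance
      N₀≢0 : NonZero N₀
      N₀≢0 = >-nonZero (≤-trans (s≤s z≤n) N₀≥12)

    q>0 : 0 < q
    q>0 = ≤-trans (≤-trans (s≤s z≤n) (*-mono-≤ {1} {128} (s≤s z≤n) (*-mono-≤ {1} {36} (s≤s z≤n) (*-mono-≤ (>-nonZero⁻¹ N₀) (>-nonZero⁻¹ N₀))))) q-large

    instance
      q≢0 : NonZero q
      q≢0 = >-nonZero q>0
      N₁≢0 : NonZero N₁
      N₁≢0 = >-nonZero (≤-trans q>0 (≤-trans (m≤n*m q 2) N₁-large))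

    N₁≤J : N₁ ≤ J
    N₁≤J = ≤-trans (≤-trans (m≤m*n N₁ N₁) (m≤n*m (N₁ * N₁) 36)) J-large

    2q≤J : 2 * q ≤ J
    2q≤J = ≤-trans N₁-large N₁≤J

    q≤J : q ≤ J
    q≤J = ≤-trans (m≤n*m q 2) 2q≤J

    N₀-small : 36 * (N₀ * N₀) ≤ J
    N₀-small = ≤-trans (m≤n*m (36 * (N₀ * N₀)) 128) (≤-trans q-large q≤J)

  -- The errors 1/`J` from the degree and 1/`q` from stray edges are each at most half of 1/`h`.
  gap-split : ∀ {J q h M g t} .{{_ : NonZero J}} → 2 * h ≤ J → 2 * h ≤ q → J * g ≤ M + J * t → q * t ≤ M → h * g ≤ M
  gap-split {J} {q} {h} {M} {g} {t} hJ hq p r = *-cancelˡ-≤ (2 * J) {{m*n≢0 2 J}} (begin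
    2 * J * (h * g)           ≡⟨ id₁ J h g ⟩
    2 * h * (J * g)           ≤⟨ *-monoʳ-≤ (2 * h) p ⟩
    2 * h * (M + J * t)       ≡⟨ id₂ h M J t ⟩
    2 * h * M + J * (2 * h * t) ≤⟨ +-mono-≤ (*-monoˡ-≤ M hJ) (*-monoʳ-≤ J (≤-trans (*-monoˡ-≤ t hq) r)) ⟩
    J * M + J * M             ≡⟨ id₃ J M ⟩
    2 * J * M                 ∎)
    where
    open ≤-Reasoning
    id₁ : ∀ J h g → 2 * J * (h * g) ≡ 2 * h * (J * g)
    id₁ = solve-∀
    id₂ : ∀ h M J t → 2 * h * (M + J * t) ≡ 2 * h * M + J * (2 * h * t)
    id₂ = solve-∀
    id₃ : ∀ J M → J * M + J * M ≡ 2 * J * M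
    id₃ = solve-∀

  opaque
    -- The absolute difference, specified without subtraction: its square is (a - b)², and the two
    -- inequalities later turn a bound on it into lower bounds for `a` and `b`.
    ∣-∣-square : ∀ a b → ∃ λ t → t * t + 2 * (a * b) ≡ a * a + b * b × a ≤ b + t × b ≤ a + t
    ∣-∣-square a b with ≤-total a b
    ... | inj₁ a≤b = b ∸ a , trans (cong (λ z → (b ∸ a) * (b ∸ a) + 2 * (a * z)) (sym (m+[n∸m]≡n a≤b)))
        (trans (id₁ a (b ∸ a)) (cong (λ z → a * a + z * z) (m+[n∸m]≡n a≤b))) , ≤-trans a≤b (m≤m+n _ _) , ≤-reflexive (sym (m+[n∸m]≡n a≤b))
      where
      id₁ : ∀ a d → d * d + 2 * (a * (a + d)) ≡ a * a + (a + d) * (a + d)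
      id₁ = solve-∀
    ... | inj₂ b≤a = a ∸ b , trans (cong (λ z → (a ∸ b) * (a ∸ b) + 2 * (z * b)) (sym (m+[n∸m]≡n b≤a)))
        (trans (id₁ b (a ∸ b)) (cong (λ z → z * z + b * b) (m+[n∸m]≡n b≤a))) , ≤-reflexive (sym (m+[n∸m]≡n b≤a)) , ≤-trans b≤a (m≤m+n _ _)
      where
      id₁ : ∀ b d → d * d + 2 * ((b + d) * b) ≡ (b + d) * (b + d) + b * b
      id₁ = solve-∀

  open +-*-Solver using (Polynomial; con; _:+_; _:*_)

  ∑ᵖ : ∀ {v s} → (Fin s → Polynomial v) → Polynomial v
  ∑ᵖ {s = zero} f = con 0
  ∑ᵖ {s = suc s} f = f zero :+ ∑ᵖ (f ∘ suc)

  -- Solver syntax that repeats the recursion of `vol` term by term. Its evaluation is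
  -- definitionally the unfolded volume, so the closed form is found by normalisation.
  volᵖ : ∀ {v s} → (Fin s → Fin s → Fin s → Bool) → (Fin s → Polynomial v) → Polynomial v
  volᵖ R x = ∑ᵖ λ i → x i :* ∑ᵖ λ j → x j :* ∑ᵖ λ k → x k :* con ⟦ R i j k ⟧

-- Vertex extension for semibipartite colourings.

module SemiExtension where

  open Integration
  open Configurations
  open Selection
  open Extension
  open import Data.Nat
  open import Data.Nat.Properties
  open import Data.Nat.Tactic.RingSolver using (solve-∀)
  open import Data.Nat.Solver using (module +-*-Solver)
  open import Data.Bool using (Bool; true; false; _∧_; not)
  open import Data.Fin using (Fin; zero; suc)
  open import Data.Fin.Patterns using (0F; 1F; 2F; 3F)
  open import Data.Vec using (Vec; []; _∷_; lookup; replicate)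
  open import Data.Vec.Properties using (lookup-replicate)
  open import Data.List using (List; []; _∷_)
  open import Data.List.Relation.Unary.All using ([]; _∷_)
  open import Data.Product using (∃; _×_; _,_; proj₁; proj₂)
  open import Data.Empty using (⊥; ⊥-elim)
  open import Relation.Nullary using (yes; no)
  open import Relation.Nullary.Decidable using (toWitness)
  open import Relation.Binary.PropositionalEquality hiding (J)

  open +-*-Solver using (con; _:*_; _:=_; solve)

  private
    vec₂ : ∀ {A : Set} → A → A → Fin 2 → A
    vec₂ a b 0F = a
    vec₂ a b 1F = b

  opaque
    unfolding ∫ sum

    vol-semi : ∀ (x : Fin 2 → ℕ) → vol semi x ≡ 3 * (x 0F * (x 1F * x 1F))
    vol-semi x = solve 2 (λ a b → volᵖ semi (vec₂ a b) := con 3 :* (a :* (b :* b))) refl (x 0F) (x 1F)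

    sum₂ : ∀ (x : Fin 2 → ℕ) → sum x ≡ x 0F + x 1F
    sum₂ x = cong (x 0F +_) (+-identityʳ (x 1F))

  -- The identity is 4 (a + b)³ - 27 a b² = (2 a - b)² (a + 4 b), with `t` for the absolute value of
  -- 2 a - b.
  semi-bound : VolumeBound Semi
  semi-bound c w rewrite vol-fibres Semi c w | mass-fibres c w | vol-semi (λ i → sum (fibre w c i)) | sum₂ (λ i → sum (fibre w c i)) =
    bound (sum (fibre w c 0F)) (sum (fibre w c 1F))
    where
    id₁ : ∀ a b T → 9 * (3 * (a * (b * b))) + (2 * a * (2 * a) + b * b) * (a + 4 * b) + T * (a + 4 * b) ≡
      4 * ((a + b) * (a + b) * (a + b)) + (T + 2 * (2 * a * b)) * (a + 4 * b)
    id₁ = solve-∀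
    bound : ∀ a b → 9 * (3 * (a * (b * b))) ≤ 4 * ((a + b) * (a + b) * (a + b))
    bound a b with ∣-∣-square (2 * a) b
    ... | t , eq , _ = certify (t * t * (a + 4 * b)) (≤-reflexive (cong (_* (a + 4 * b)) eq)) (id₁ a b (t * t))

  module SemiExtension {n : ℕ} {G : MFreeRelation n} (S : Situation G Semi) (scale : Scale (Situation.J S)) where
    open InSituation S
    open Scale scale

    A B : Fin n → ℕ
    A = fibre w c 0F
    B = fibre w c 1F

    private
      a = sum A
      b = sum B

      high′ : 4 * (J * J) * (m * m * m) ≤ 9 * (J * J) * (3 * (a * (b * b))) + m * m * m
      high′ = subst (λ t → 4 * (J * J) * (m * m * m) ≤ 9 * (J * J) * t + m * m * m) (trans (vol-fibres Semi c w) (vol-semi _)) vol-high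

      -- From 27 a b² ≥ (4 - 1/`J`²) m³ ≥ 3 m³ it follows that x ≥ m/9, so `N₀` ≥ 12 is enough.
      large : ∀ x → a * (b * b) ≤ x * (m * m) → m ≤ N₀ * x
      large x p = ≤-trans (*-cancelˡ-≤ (3 * (J * J) * (m * m)) {{m*n≢0 (3 * (J * J)) (m * m) {{m*n≢0 3 (J * J) {{_}} {{m*n≢0 J J}}}} {{m*n≢0 m m}}}}
        (certify (9 * (J * J) * (x * (m * m))) (+-mono-≤ high′ (+-mono-≤ (*-monoʳ-≤ (27 * (J * J)) p) (*-monoʳ-≤ (m * m * m) (*-mono-≤ J>0 J>0))))
          (id₁ (J * J) m (a * (b * b)) x))) (*-monoˡ-≤ x N₀≥12)
        where
        id₁ : ∀ K m y x → 3 * K * (m * m) * m + (9 * K * (3 * y) + m * m * m + (27 * K * (x * (m * m)) + m * m * m * K)) + 9 * K * (x * (m * m)) ≡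
          3 * K * (m * m) * (12 * x) + (4 * K * (m * m * m) + (27 * K * y + m * m * m * (1 * 1)))
        id₁ = solve-∀

      m≤A : m ≤ N₀ * a
      m≤A = large a (*-monoʳ-≤ a (*-mono-≤ (mass-fibre≤ w c 1F) (mass-fibre≤ w c 1F)))

      m≤B : m ≤ N₀ * b
      m≤B = large b (≤-trans (≤-reflexive (id₂ a b)) (*-monoʳ-≤ b (*-mono-≤ (mass-fibre≤ w c 0F) (mass-fibre≤ w c 1F))))
        where
        id₂ : ∀ a b → a * (b * b) ≡ b * (a * b)
        id₂ = solve-∀

      nowhere : ∀ {k} → Triple k → Bool
      nowhere _ = false

    module S₀ = Slots S N₀ N₀-small
    module S₁ = Slots S N₁ J-large

    private
      richA : S₀.Fits (rich 0F) A
      richA = S₀.fits-rich 0F (fibre≤ w c 0F) (class 0F) m≤A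

      richB : S₀.Fits (rich 1F) B
      richB = S₀.fits-rich 1F (fibre≤ w c 1F) (class 1F) m≤B

    module _ {x y : Fin n} (x∈ : U x ≡ true) (cx : c x ≡ 0F) (y∈ : U y ≡ true) (cy : c y ≡ 0F) (cov : Covered x y) where
      private
        ρs : Vec (Role 2) 7
        ρs = point (semi 0F) ∷ point (semi 0F) ∷ replicate 5 (rich 1F)

        μs : Vec (Fin n → ℕ) 7
        μs = δ x ∷ δ y ∷ replicate 5 B

        fits : ∀ i → S₀.Fits (lookup ρs i) (lookup μs i)
        fits 0F = S₀.fits-point {x} x∈ cx
        fits 1F = S₀.fits-point {y} y∈ cy
        fits (suc (suc r)) = S₀.fits-replicate {5} {rich 1F} {B} richB r

      -- With five random vertices b of B, the likely edges x b b′ and y b b′ cover all pairs except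
      -- that of x and y, which is covered by assumption. Since x b₁ b₂ and y b₃ b₄ are disjoint,
      -- there is no common vertex.
      no-cover-AA : ⊥
      no-cover-AA = S₀.refute₇ ρs μs fits nowhere (λ _ ()) ((0F , 1F) ∷ [])
        (λ { (x₀ ∷ x₁ ∷ _) xs∈ → subst₂ Covered (δ-support x x₀ (xs∈ 0F)) (δ-support y x₁ (xs∈ 1F)) cov ∷ [] })
        (toWitness {a? = allJoined? (S₀.known ρs nowhere) ((0F , 1F) ∷ [])} _) (toWitness {a? = spread? (S₀.known ρs nowhere)} _)

    -- Many pairs of B in the link of `v` mean that `v` behaves like a vertex of A, few that it
    -- behaves like one of B; the threshold is m²/`q`.
    β : ℕ
    β = ∫ B λ y → ∫ B λ z → ⟦ e v y z ⟧

    module _ (dense : m * m ≤ q * β) {x : Fin n} (x∈ : U x ≡ true) (cx : c x ≡ 0F) (cov : Covered v x) where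
      private
        common : Fin n → Fin n → Bool
        common y z = e v y z ∧ e x y z

        X = ∫ B λ y → ∫ B λ z → ⟦ common y z ⟧

        Y = ∫ B λ y → ∫ B λ z → ⟦ not (e x y z) ⟧

        β≤ : β ≤ X + Y
        β≤ = ≤-trans (∫-mono B λ y _ → ≤-trans (∫-mono B λ z _ → split (e v y z) (e x y z)) (≤-reflexive (∫-+ B _ _))) (≤-reflexive (∫-+ B _ _))
          where
          split : ∀ p r → ⟦ p ⟧ ≤ ⟦ p ∧ r ⟧ + ⟦ not r ⟧
          split true true = ≤-refl
          split true false = ≤-refl
          split false r = z≤n

        Y≤ : Y ≤ gap x (semi 0F)
        Y≤ = begin
          Y ≤⟨ ∫-mono B (λ y y∈ → ∫-mono B λ z z∈ → ≤-reflexive (sym (cong (λ t → ⟦ t ∧ not (e x y z) ⟧)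
                 (cong₂ (semi 0F) (class 1F y y∈) (class 1F z z∈))))) ⟩
          ∫ B (λ y → ∫ B (f y)) ≤⟨ ∫-mono B (λ y _ → ∫-monoˡ (f y) (fibre≤ w c 1F)) ⟩
          ∫ B (λ y → ∫ w (f y)) ≤⟨ ∫-monoˡ _ (fibre≤ w c 1F) ⟩
          gap x (semi 0F) ∎
          where
          open ≤-Reasoning
          f : Fin n → Fin n → ℕ
          f y z = ⟦ semi 0F (c y) (c z) ∧ not (e x y z) ⟧

        JY : 2 * q * Y ≤ m * m
        JY = ≤-trans (*-mono-≤ 2q≤J Y≤) (subst (λ i → J * gap x (semi i) ≤ m * m) cx (gap-U x x∈))

        X≥ : m * m ≤ 2 * q * X
        X≥ = certify 0 (+-mono-≤ (*-monoʳ-≤ 2 (≤-trans dense (*-monoʳ-≤ q β≤))) JY) (id₁ (m * m) q X Y)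
          where
          id₁ : ∀ M q X Y → M + (2 * (q * (X + Y)) + M) + 0 ≡ 2 * q * X + (2 * M + 2 * q * Y)
          id₁ = solve-∀

        f : Fin n → ℕ
        f y = ∫ B λ z → ⟦ common y z ⟧

        -- The link of `x` misses at most m²/(2 `q`) pairs of B, so `v` and `x` have at least m²/(2
        -- `q`) pairs in common. On average, hence for some y, these give at least m/(2 `q`)
        -- vertices z with both v y z and x y z edges.
        pivot : ∃ λ y → 0 < B y × m ≤ 2 * q * f y
        pivot = ∫-≤⇒∃≤ B {λ _ → m} {λ y → 2 * q * f y} (proj₁ (proj₁ richB)) (begin
          ∫ B (λ _ → m)            ≡⟨ ∫-const B m ⟩
          b * m                    ≤⟨ *-monoˡ-≤ m (mass-fibre≤ w c 1F) ⟩
          m * m                    ≤⟨ X≥ ⟩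
          2 * q * X                ≡⟨ sym (∫-* B (2 * q) f) ⟩
          ∫ B (λ y → 2 * q * f y)  ∎)
          where open ≤-Reasoning

      module _ (y : Fin n) (large-y : m ≤ 2 * q * f y) where
        private
          μ : Fin n → ℕ
          μ = B ↾ common y

          ρs : Vec (Role 2) 7
          ρs = point S₁.none ∷ point (semi 0F) ∷ point S₁.none ∷ replicate 4 (rich 1F)

          μs : Vec (Fin n → ℕ) 7
          μs = δ v ∷ δ x ∷ δ y ∷ replicate 4 μ

          fits : ∀ i → S₁.Fits (lookup ρs i) (lookup μs i)
          fits 0F = S₁.fits-bare v
          fits 1F = S₁.fits-point {x} x∈ cx
          fits 2F = S₁.fits-bare y
          fits (suc (suc (suc r))) = S₁.fits-replicate {4} {rich 1F} {μ}
            (S₁.fits-rich 1F (λ z → ≤-trans (↾≤ B (common y) z) (fibre≤ w c 1F z))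
              (λ z z∈ → class 1F z (proj₂ (↾-support B (common y) z z∈)))
              (≤-trans large-y (≤-trans (*-monoʳ-≤ (2 * q) (≤-reflexive (sym (mass-↾ B (common y))))) (*-monoˡ-≤ (sum μ) N₁-large)))) r

          κ : Triple 7 → Bool
          κ (first (later (first r))) = true
          κ (later (first (first r))) = true
          κ _ = false

          ∧-fst : ∀ p {r} → p ∧ r ≡ true → p ≡ true
          ∧-fst true _ = refl

          ∧-snd : ∀ p {r} → p ∧ r ≡ true → r ≡ true
          ∧-snd true r = r

          in-μ : ∀ (r : Fin 4) {z} → 0 < lookup (replicate 4 μ) r z → common y z ≡ true
          in-μ r {z} p = proj₁ (↾-support B (common y) z (subst (λ ν → 0 < ν z) (lookup-replicate r μ) p))

          sure : ∀ t → κ t ≡ true → S₁.SureAt μs t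
          sure (first (later (first r))) _ x′ y′ z′ px py pz =
            subst₂ (λ a b → e a b z′ ≡ true) (δ-support v x′ px) (δ-support y y′ py) (∧-fst (e v y z′) (in-μ r pz))
          sure (later (first (first r))) _ x′ y′ z′ px py pz =
            subst₂ (λ a b → e a b z′ ≡ true) (δ-support x x′ px) (δ-support y y′ py) (∧-snd (e v y z′) (in-μ r pz))

        -- Four vertices z are drawn from the common neighbourhood: v y z and x y z are certain, x z
        -- z′ is likely, and the pair of `v` and `x` is covered by assumption. The edges v y z₁ and
        -- x z₂ z₃ are disjoint.
        no-pivot : ⊥
        no-pivot = S₁.refute₇ ρs μs fits κ sure ((0F , 1F) ∷ [])
          (λ { (x₀ ∷ x₁ ∷ _) xs∈ → subst₂ Covered (δ-support v x₀ (xs∈ 0F)) (δ-support x x₁ (xs∈ 1F)) cov ∷ [] })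
          (toWitness {a? = allJoined? (S₁.known ρs κ) ((0F , 1F) ∷ [])} _) (toWitness {a? = spread? (S₁.known ρs κ)} _)

      no-cover-A : ⊥
      no-cover-A = let (y , _ , large-y) = pivot in no-pivot y large-y

    module _ (sparse : q * β ≤ m * m) {x y : Fin n} (x∈ : U x ≡ true) (cx : c x ≡ 1F) (y∈ : U y ≡ true) (cy : c y ≡ 1F) (vxy : e v x y ≡ true) where
      private
        -- Pairs that are wrong for colour 1 lie inside A or inside B; `no-cover-AA` excludes the
        -- former and `β` counts the latter.
        stray≤ : stray v (semi 1F) ≤ β
        stray≤ = begin
          stray v (semi 1F) ≤⟨ ∫-mono w (λ y y∈ → ∫-mono w λ z z∈ → pointwise y z (w⊆U y y∈) (w⊆U z z∈)) ⟩
          ∫ w (λ y → ∫ w λ z → δ (c y) 1F * (δ (c z) 1F * ⟦ e v y z ⟧)) ≡⟨ sym (∫∫-fibre w c 1F 1F _) ⟩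
          β ∎
          where
          open ≤-Reasoning
          pointwise : ∀ y z → U y ≡ true → U z ≡ true → ⟦ not (semi 1F (c y) (c z)) ∧ e v y z ⟧ ≤
            δ (c y) 1F * (δ (c z) 1F * ⟦ e v y z ⟧)
          pointwise y z y∈ z∈ with c y in cy | c z in cz
          ... | 0F | 1F = z≤n
          ... | 1F | 0F = z≤n
          ... | 1F | 1F = ≤-reflexive (sym (trans (+-identityʳ _) (+-identityʳ _)))
          ... | 0F | 0F with e v y z in vyz
          ... | false = z≤n
          ... | true = ⊥-elim (no-cover-AA y∈ cy z∈ cz (v , trans (trans (swap₂₃ y z v) (swap₁₂ y v z)) vyz))

        near-v : S₀.Near v (semi 1F)
        near-v = gap-split {J} {q} {36 * (N₀ * N₀)} {m * m} {gap v (semi 1F)} {stray v (semi 1F)}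
          (≤-trans (≤-trans (*-monoˡ-≤ (36 * (N₀ * N₀)) {2} {128} (s≤s (s≤s z≤n))) q-large) q≤J)
          (≤-trans (*-monoˡ-≤ (36 * (N₀ * N₀)) {2} {128} (s≤s (s≤s z≤n))) q-large)
          (gap-bound v 1F high-v (x , cx)) (≤-trans (*-monoʳ-≤ q stray≤) sparse)

        ρs : Vec (Role 2) 7
        ρs = point (semi 1F) ∷ point (semi 1F) ∷ point (semi 1F) ∷ rich 0F ∷ replicate 3 (rich 1F)

        μs : Vec (Fin n → ℕ) 7
        μs = δ v ∷ δ x ∷ δ y ∷ A ∷ replicate 3 B

        fits : ∀ i → S₀.Fits (lookup ρs i) (lookup μs i)
        fits 0F = S₀.fits-near {v} {semi 1F} near-v
        fits 1F = S₀.fits-point {x} x∈ cx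
        fits 2F = S₀.fits-point {y} y∈ cy
        fits 3F = richA
        fits (suc (suc (suc (suc r)))) = S₀.fits-replicate {3} {rich 1F} {B} richB r

        κ : Triple 7 → Bool
        κ (first (first zero)) = true
        κ _ = false

        sure : ∀ t → κ t ≡ true → S₀.SureAt μs t
        sure (first (first zero)) _ x′ y′ z′ px py pz =
          trans (cong₂ (λ a b → e a b z′) (sym (δ-support v x′ px)) (sym (δ-support x y′ py))) (trans (cong (e v x) (sym (δ-support y z′ pz))) vxy)

      -- One random vertex a of A and three vertices b of B are added to the edge v x y. The edges v
      -- a b, x a b, y a b and a b b′ cover the remaining pairs; they all contain a, which v x y
      -- avoids.
      no-edge-BB : ⊥
      no-edge-BB = S₀.refute₇ ρs μs fits κ sure [] (λ _ _ → [])
        (toWitness {a? = allJoined? (S₀.known ρs κ) []} _) (toWitness {a? = spread? (S₀.known ρs κ)} _)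

    extend-semi : Extends
    extend-semi with m * m ≤? q * β
    ... | yes dense = extend 0F ok
      where
      ok : ∀ y z → U y ≡ true → U z ≡ true → e v y z ≡ true → semi 0F (c y) (c z) ≡ true
      ok y z y∈ z∈ vyz with c y in cy | c z in cz
      ... | 0F | _ = ⊥-elim (no-cover-A dense y∈ cy (z , vyz))
      ... | 1F | 0F = ⊥-elim (no-cover-A dense z∈ cz (y , trans (swap₂₃ v z y) vyz))
      ... | 1F | 1F = refl
    ... | no ¬dense = extend 1F ok
      where
      ok : ∀ y z → U y ≡ true → U z ≡ true → e v y z ≡ true → semi 1F (c y) (c z) ≡ true
      ok y z y∈ z∈ vyz with c y in cy | c z in cz
      ... | 0F | 0F = ⊥-elim (no-cover-AA y∈ cy z∈ cz (v , trans (trans (swap₂₃ y z v) (swap₁₂ y v z)) vyz))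
      ... | 0F | 1F = refl
      ... | 1F | 0F = refl
      ... | 1F | 1F = ⊥-elim (no-edge-BB (<⇒≤ (≰⇒> ¬dense)) y∈ cy z∈ cz vyz)

-- The volume of blowups of G²₆ and its stability.

module SixVolume where

  open Integration
  open Configurations
  open Selection
  open Extension
  open import Data.Nat
  open import Data.Nat.Properties
  open import Data.Nat.Tactic.RingSolver using (solve-∀)
  open import Data.Nat.Solver using (module +-*-Solver)
  open import Data.Fin using (Fin)
  open import Data.Fin.Patterns using (0F; 1F; 2F; 3F; 4F; 5F)
  open import Data.Vec using ([]; _∷_; lookup)
  open import Data.Product using (_,_; proj₁; proj₂)
  open import Relation.Nullary using (yes; no; contradiction)
  open import Relation.Binary.PropositionalEquality hiding (J)

  open +-*-Solver using (con; _:+_; _:*_; _:=_; solve)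

  private
    vec₆ : ∀ {A : Set} → A → A → A → A → A → A → Fin 6 → A
    vec₆ a b c d e f i = lookup (a ∷ b ∷ c ∷ d ∷ e ∷ f ∷ []) i

    -- The 16 edges of G²₆, grouped by the pairs (a, b), (d, e), (c, f); the missing triples are a b
    -- or d e together with c or f.
    edges₆ : ℕ → ℕ → ℕ → ℕ → ℕ → ℕ → ℕ
    edges₆ a b c d e f = a * b * (d + e) + d * e * (a + b) + c * f * (a + b + (d + e)) + (a + b) * (d + e) * (c + f)

  opaque
    unfolding ∫ sum

    vol-six : ∀ (x : Fin 6 → ℕ) → vol six x ≡ 6 * edges₆ (x 0F) (x 1F) (x 2F) (x 3F) (x 4F) (x 5F)
    vol-six x = solve 6 (λ a b c d e f → volᵖ six (vec₆ a b c d e f) :=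
      con 6 :* (a :* b :* (d :+ e) :+ d :* e :* (a :+ b) :+ c :* f :* (a :+ b :+ (d :+ e)) :+ (a :+ b) :* (d :+ e) :* (c :+ f))) refl
      (x 0F) (x 1F) (x 2F) (x 3F) (x 4F) (x 5F)

    sum₆ : ∀ (x : Fin 6 → ℕ) → sum x ≡ x 0F + x 1F + (x 3F + x 4F) + (x 2F + x 5F)
    sum₆ x = solve 6 (λ a b c d e f → ∑ᵖ (vec₆ a b c d e f) := a :+ b :+ (d :+ e) :+ (c :+ f)) refl
      (x 0F) (x 1F) (x 2F) (x 3F) (x 4F) (x 5F)

  -- With p = a + b, q = d + e, r = c + f, the maximum of the volume is approached by equalising, in turn,
  -- the two classes of each pair, p and q, and finally p + q and 2 r; T₁, …, T₅ are the squares lost in these steps.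
  module Balance (a b c d e f : ℕ) where
    p q r m : ℕ
    p = a + b
    q = d + e
    r = c + f
    m = p + q + r

    module _ (T₁ T₂ T₃ T₄ T₅ : ℕ) (E₁ : T₁ + 2 * (a * b) ≡ a * a + b * b) (E₂ : T₂ + 2 * (d * e) ≡ d * d + e * e)
      (E₃ : T₃ + 2 * (c * f) ≡ c * c + f * f) (E₄ : T₄ + 2 * (p * q) ≡ p * p + q * q)
      (E₅ : T₅ + 2 * ((p + q) * (2 * r)) ≡ (p + q) * (p + q) + 2 * r * (2 * r)) where

      deficit : ℕ
      deficit = T₁ * (108 * q) + T₂ * (108 * p) + T₃ * (108 * (p + q)) + T₄ * (27 * (p + q + 4 * r)) + T₅ * (5 * (p + q) + 8 * r)

      private
        excess : ℕ
        excess = 2 * (a * b) * (108 * q) + 2 * (d * e) * (108 * p) + 2 * (c * f) * (108 * (p + q)) +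
          2 * (p * q) * (27 * (p + q + 4 * r)) + 2 * ((p + q) * (2 * r)) * (5 * (p + q) + 8 * r)

        regroup : ∀ V T₁ S₁ g₁ T₂ S₂ g₂ T₃ S₃ g₃ T₄ S₄ g₄ T₅ S₅ g₅ →
          V + (T₁ * g₁ + T₂ * g₂ + T₃ * g₃ + T₄ * g₄ + T₅ * g₅) + (S₁ * g₁ + S₂ * g₂ + S₃ * g₃ + S₄ * g₄ + S₅ * g₅) ≡
          V + ((T₁ + S₁) * g₁ + (T₂ + S₂) * g₂ + (T₃ + S₃) * g₃ + (T₄ + S₄) * g₄ + (T₅ + S₅) * g₅)
        regroup = solve-∀

        expand : ∀ a b c d e f → 432 * (a * b * (d + e) + d * e * (a + b) + c * f * (a + b + (d + e)) + (a + b) * (d + e) * (c + f)) +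
          ((a * a + b * b) * (108 * (d + e)) + (d * d + e * e) * (108 * (a + b)) + (c * c + f * f) * (108 * (a + b + (d + e))) +
            ((a + b) * (a + b) + (d + e) * (d + e)) * (27 * (a + b + (d + e) + 4 * (c + f))) +
            ((a + b + (d + e)) * (a + b + (d + e)) + 2 * (c + f) * (2 * (c + f))) * (5 * (a + b + (d + e)) + 8 * (c + f))) ≡
          32 * ((a + b + (d + e) + (c + f)) * (a + b + (d + e) + (c + f)) * (a + b + (d + e) + (c + f))) +
          (2 * (a * b) * (108 * (d + e)) + 2 * (d * e) * (108 * (a + b)) + 2 * (c * f) * (108 * (a + b + (d + e))) +
            2 * ((a + b) * (d + e)) * (27 * (a + b + (d + e) + 4 * (c + f))) +
            2 * ((a + b + (d + e)) * (2 * (c + f))) * (5 * (a + b + (d + e)) + 8 * (c + f)))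
        expand = solve-∀

      balance : 432 * edges₆ a b c d e f + deficit ≡ 32 * (m * m * m)
      -- Adding the double products to both sides turns each square into a sum of squares, by E₁ to
      -- E₅; what is left is an identity in the six masses.
      balance = +-cancelʳ-≡ excess _ _ (begin
        432 * edges₆ a b c d e f + deficit + excess
          ≡⟨ regroup (432 * edges₆ a b c d e f) T₁ _ (108 * q) T₂ _ (108 * p) T₃ _ (108 * (p + q)) T₄ _ (27 * (p + q + 4 * r)) T₅ _ (5 * (p + q) + 8 * r) ⟩
        432 * edges₆ a b c d e f + ((T₁ + 2 * (a * b)) * (108 * q) + (T₂ + 2 * (d * e)) * (108 * p) + (T₃ + 2 * (c * f)) * (108 * (p + q)) +
          (T₄ + 2 * (p * q)) * (27 * (p + q + 4 * r)) + (T₅ + 2 * ((p + q) * (2 * r))) * (5 * (p + q) + 8 * r))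
          ≡⟨ cong (432 * edges₆ a b c d e f +_) (cong₂ _+_ (cong₂ _+_ (cong₂ _+_ (cong₂ _+_ (cong (_* (108 * q)) E₁) (cong (_* (108 * p)) E₂))
               (cong (_* (108 * (p + q))) E₃)) (cong (_* (27 * (p + q + 4 * r))) E₄)) (cong (_* (5 * (p + q) + 8 * r)) E₅)) ⟩
        432 * edges₆ a b c d e f + ((a * a + b * b) * (108 * q) + (d * d + e * e) * (108 * p) + (c * c + f * f) * (108 * (p + q)) +
          (p * p + q * q) * (27 * (p + q + 4 * r)) + ((p + q) * (p + q) + 2 * r * (2 * r)) * (5 * (p + q) + 8 * r))
          ≡⟨ expand a b c d e f ⟩
        32 * (m * m * m) + excess ∎)
        where open ≡-Reasoning

  square-cancel-≤ : ∀ x y → x * x ≤ y * y → x ≤ y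
  square-cancel-≤ x y p with x ≤? y
  ... | yes q = q
  ... | no q = contradiction p (<⇒≱ (*-mono-< (≰⇒> q) (≰⇒> q)))

  six-bound : VolumeBound Six
  six-bound c w rewrite vol-fibres Six c w | mass-fibres c w | vol-six (λ i → sum (fibre w c i)) | sum₆ (λ i → sum (fibre w c i)) =
    bound (x 0F) (x 1F) (x 2F) (x 3F) (x 4F) (x 5F)
    where
    x : Fin 6 → ℕ
    x i = sum (fibre w c i)
    id₁ : ∀ V D M → 8 * (9 * (6 * V)) + 32 * M + D ≡ 8 * (4 * M) + (432 * V + D)
    id₁ = solve-∀
    bound : ∀ a b c d e f → 9 * (6 * edges₆ a b c d e f) ≤ 4 * ((a + b + (d + e) + (c + f)) * (a + b + (d + e) + (c + f)) * (a + b + (d + e) + (c + f)))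
    bound a b c d e f with ∣-∣-square a b | ∣-∣-square d e | ∣-∣-square c f | ∣-∣-square (a + b) (d + e) | ∣-∣-square (a + b + (d + e)) (2 * (c + f))
    ... | t₁ , E₁ , _ | t₂ , E₂ , _ | t₃ , E₃ , _ | t₄ , E₄ , _ | t₅ , E₅ , _ =
      *-cancelˡ-≤ 8 (certify def (≤-reflexive bal) (id₁ (edges₆ a b c d e f) def M))
      where
      M = (a + b + (d + e) + (c + f)) * (a + b + (d + e) + (c + f)) * (a + b + (d + e) + (c + f))
      def = Balance.deficit a b c d e f (t₁ * t₁) (t₂ * t₂) (t₃ * t₃) (t₄ * t₄) (t₅ * t₅) E₁ E₂ E₃ E₄ E₅
      bal : 432 * edges₆ a b c d e f + def ≡ 32 * M
      bal = Balance.balance a b c d e f (t₁ * t₁) (t₂ * t₂) (t₃ * t₃) (t₄ * t₄) (t₅ * t₅) E₁ E₂ E₃ E₄ E₅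

  private
    -- A loss t² g of at most 8 m³/`J`² with a factor g ≥ 2 m bounds the imbalance t itself by 2
    -- m/`J`.
    root : ∀ J t m g → 0 < m → 2 * m ≤ g → J * J * (t * t * g) ≤ 8 * (m * m * m) → J * t ≤ 2 * m
    root J t m g m>0 m≤g h = square-cancel-≤ (J * t) (2 * m) (*-cancelˡ-≤ (2 * m) {{m*n≢0 2 m {{_}} {{>-nonZero m>0}}}} (begin
      2 * m * (J * t * (J * t))   ≤⟨ *-monoˡ-≤ (J * t * (J * t)) m≤g ⟩
      g * (J * t * (J * t))       ≡⟨ id₁ J t g ⟩
      J * J * (t * t * g)         ≤⟨ h ⟩
      8 * (m * m * m)             ≡⟨ id₂ m ⟩
      2 * m * (2 * m * (2 * m))   ∎))
      where
      open ≤-Reasoning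
      id₁ : ∀ J t g → g * (J * t * (J * t)) ≡ J * J * (t * t * g)
      id₁ = solve-∀
      id₂ : ∀ m → 8 * (m * m * m) ≡ 2 * m * (2 * m * (2 * m))
      id₂ = solve-∀

  module NearSixth (J a b c d e f : ℕ) (J≥24 : 24 ≤ J) (m>0 : 0 < a + b + (d + e) + (c + f)) where
    open Balance a b c d e f using (p; q; r; m; deficit; balance)

    module _ (high : 4 * (J * J) * (m * m * m) ≤ 9 * (J * J) * (6 * edges₆ a b c d e f) + m * m * m) where
      private
        t₁ = ∣-∣-square a b
        t₂ = ∣-∣-square d e
        t₃ = ∣-∣-square c f
        t₄ = ∣-∣-square p q
        t₅ = ∣-∣-square (p + q) (2 * r)

        def : ℕ
        def = deficit (proj₁ t₁ * proj₁ t₁) (proj₁ t₂ * proj₁ t₂) (proj₁ t₃ * proj₁ t₃) (proj₁ t₄ * proj₁ t₄) (proj₁ t₅ * proj₁ t₅)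
            (proj₁ (proj₂ t₁)) (proj₁ (proj₂ t₂)) (proj₁ (proj₂ t₃)) (proj₁ (proj₂ t₄)) (proj₁ (proj₂ t₅))

        small : J * J * def ≤ 8 * (m * m * m)
        small = certify 0 (+-mono-≤ (*-monoʳ-≤ 8 high) (≤-reflexive (cong (J * J *_)
            (balance (proj₁ t₁ * proj₁ t₁) (proj₁ t₂ * proj₁ t₂) (proj₁ t₃ * proj₁ t₃) (proj₁ t₄ * proj₁ t₄) (proj₁ t₅ * proj₁ t₅)
            (proj₁ (proj₂ t₁)) (proj₁ (proj₂ t₂)) (proj₁ (proj₂ t₃)) (proj₁ (proj₂ t₄)) (proj₁ (proj₂ t₅))))))
          (id₁ (J * J) def (edges₆ a b c d e f) (m * m * m))
          where
          id₁ : ∀ K D V M → K * D + (8 * (9 * K * (6 * V) + M) + K * (32 * M)) + 0 ≡ 8 * M + (8 * (4 * K * M) + K * (432 * V + D))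
          id₁ = solve-∀

        parts : ∀ A B C D E → J * J * (A + B + C + D + E) ≤ 8 * (m * m * m) → ∀ i → J * J * lookup (A ∷ B ∷ C ∷ D ∷ E ∷ []) i ≤ 8 * (m * m * m)
        parts A B C D E h i = ≤-trans (*-monoʳ-≤ (J * J) (le i)) h
          where
          le : ∀ i → lookup (A ∷ B ∷ C ∷ D ∷ E ∷ []) i ≤ A + B + C + D + E
          le 0F = ≤-trans (m≤m+n A B) (≤-trans (m≤m+n (A + B) C) (≤-trans (m≤m+n (A + B + C) D) (m≤m+n (A + B + C + D) E)))
          le 1F = ≤-trans (m≤n+m B A) (≤-trans (m≤m+n (A + B) C) (≤-trans (m≤m+n (A + B + C) D) (m≤m+n (A + B + C + D) E)))
          le 2F = ≤-trans (m≤n+m C (A + B)) (≤-trans (m≤m+n (A + B + C) D) (m≤m+n (A + B + C + D) E))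
          le 3F = ≤-trans (m≤n+m D (A + B + C)) (m≤m+n (A + B + C + D) E)
          le 4F = m≤n+m E (A + B + C + D)

        T₁ = proj₁ t₁
        T₂ = proj₁ t₂
        T₃ = proj₁ t₃
        T₄ = proj₁ t₄
        T₅ = proj₁ t₅

        part = parts (T₁ * T₁ * (108 * q)) (T₂ * T₂ * (108 * p)) (T₃ * T₃ * (108 * (p + q))) (T₄ * T₄ * (27 * (p + q + 4 * r))) (T₅ * T₅ * (5 * (p + q) + 8 * r)) small

        -- The last two balancing steps are read off first: the factors of T₅ and T₄ are at least 2
        -- m outright, while those of T₁, T₂, T₃ are multiples of p and q, which are only now shown
        -- to be large.
        J₅ : J * T₅ ≤ 2 * m
        J₅ = root J T₅ m (5 * (p + q) + 8 * r) m>0 (certify 0 (+-mono-≤ (z≤n {3 * (p + q)}) (z≤n {6 * r})) (id₁ (p + q) r)) (part 4F)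
          where
          id₁ : ∀ s r → 2 * (s + r) + (3 * s + 6 * r) + 0 ≡ 5 * s + 8 * r + (0 + 0)
          id₁ = solve-∀

        J₄ : J * T₄ ≤ 2 * m
        J₄ = root J T₄ m (27 * (p + q + 4 * r)) m>0 (certify 0 (+-mono-≤ (z≤n {25 * (p + q)}) (z≤n {106 * r})) (id₁ (p + q) r))
          (part 3F)
          where
          id₁ : ∀ s r → 2 * (s + r) + (25 * s + 106 * r) + 0 ≡ 27 * (s + 4 * r) + (0 + 0)
          id₁ = solve-∀

        r-large : J * m ≤ 3 * (J * r) + 2 * m
        r-large = certify 0 (+-mono-≤ (*-monoʳ-≤ J (proj₁ (proj₂ (proj₂ t₅)))) J₅) (id₁ J (p + q) r T₅ (2 * m))
          where
          id₁ : ∀ J s r t z → J * (s + r) + (J * (2 * r + t) + z) + 0 ≡ 3 * (J * r) + z + (J * s + J * t)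
          id₁ = solve-∀

        s-large : 2 * (J * m) ≤ 3 * (J * (p + q)) + 2 * m
        s-large = certify 0 (+-mono-≤ (*-monoʳ-≤ J (proj₂ (proj₂ (proj₂ t₅)))) J₅) (id₁ J (p + q) r T₅ (2 * m))
          where
          id₁ : ∀ J s r t z → 2 * (J * (s + r)) + (J * (s + t) + z) + 0 ≡ 3 * (J * s) + z + (J * (2 * r) + J * t)
          id₁ = solve-∀

        half : ∀ {x y t u} → y ≤ x + t → J * t ≤ 2 * m → J * (x + y) ≤ 2 * (J * x) + (u + 2 * m)
        half {x} {y} {t} {u} h h′ = certify u (+-mono-≤ (*-monoʳ-≤ J h) h′) (id₁ J x y t (2 * m) u)
          where
          id₁ : ∀ J x y t z u → J * (x + y) + (J * (x + t) + z) + u ≡ 2 * (J * x) + (u + z) + (J * y + J * t)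
          id₁ = solve-∀

        p-large : J * m ≤ 3 * (J * p) + 4 * m
        p-large = *-cancelˡ-≤ 2 (certify 0 (+-mono-≤ s-large (*-monoʳ-≤ 3 (half {p} {q} {T₄} {0} (proj₂ (proj₂ (proj₂ t₄))) J₄))) (id₁ J p q m))
          where
          id₁ : ∀ J p q m → 2 * (J * m) + (3 * (J * (p + q)) + 2 * m + 3 * (2 * (J * p) + (0 + 2 * m))) + 0 ≡ 2 * (3 * (J * p) + 4 * m) + (2 * (J * m) + 3 * (J * (p + q)))
          id₁ = solve-∀

        q-large : J * m ≤ 3 * (J * q) + 4 * m
        q-large = *-cancelˡ-≤ 2 (certify 0 (+-mono-≤ s-large (*-monoʳ-≤ 3 (half {q} {p} {T₄} {0} (proj₁ (proj₂ (proj₂ t₄))) J₄))) (id₁ J p q m))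
          where
          id₁ : ∀ J p q m → 2 * (J * m) + (3 * (J * (p + q)) + 2 * m + 3 * (2 * (J * q) + (0 + 2 * m))) + 0 ≡ 2 * (3 * (J * q) + 4 * m) + (2 * (J * m) + 3 * (J * (q + p)))
          id₁ = solve-∀

        quarter : ∀ x → J * m ≤ 3 * (J * x) + 4 * m → 2 * m ≤ 108 * x
        quarter x h = ≤-trans (*-cancelˡ-≤ J {{>-nonZero (≤-trans (s≤s z≤n) J≥24)}} (certify (18 * (J * m)) (+-mono-≤ (*-monoʳ-≤ 24 h) (*-monoʳ-≤ (4 * m) J≥24)) (id₁ J m x)))
          (*-monoˡ-≤ x {72} {108} (m≤m+n 72 36))
          where
          id₁ : ∀ J m x → J * (2 * m) + (24 * (3 * (J * x) + 4 * m) + 4 * m * J) + 18 * (J * m) ≡ J * (72 * x) + (24 * (J * m) + 4 * m * 24)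
          id₁ = solve-∀

        J₁ : J * T₁ ≤ 2 * m
        J₁ = root J T₁ m (108 * q) m>0 (quarter q q-large) (part 0F)

        J₂ : J * T₂ ≤ 2 * m
        J₂ = root J T₂ m (108 * p) m>0 (quarter p p-large) (part 1F)

        J₃ : J * T₃ ≤ 2 * m
        J₃ = root J T₃ m (108 * (p + q)) m>0 (≤-trans (quarter p p-large) (*-monoʳ-≤ 108 (m≤m+n p q))) (part 2F)

        final : ∀ {x y g t} → J * m ≤ 3 * (J * g) + 4 * m → J * t ≤ 2 * m → y ≤ x + t → x + y ≡ g → J * m ≤ 6 * (J * x) + 12 * m
        final {x} {y} {g} {t} hg ht h refl = certify (2 * m) (+-mono-≤ hg (*-monoʳ-≤ 3 (half {x} {y} {t} {0} h ht))) (id₁ J x y m)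
          where
          id₁ : ∀ J x y m → J * m + (3 * (J * (x + y)) + 4 * m + 3 * (2 * (J * x) + (0 + 2 * m))) + 2 * m ≡ 6 * (J * x) + 12 * m + (J * m + 3 * (J * (x + y)))
          id₁ = solve-∀

        r-large′ : J * m ≤ 3 * (J * r) + 4 * m
        r-large′ = ≤-trans r-large (+-monoʳ-≤ (3 * (J * r)) (*-monoˡ-≤ m {2} {4} (m≤m+n 2 2)))

      -- Each of p, q, r is at least a third of m up to an error of order m/`J`, and each class at
      -- least half of its pair up to the same order; together the class falls short of m/6 by at
      -- most 2 m/`J`.
      near-sixth : ∀ i → J * m ≤ 6 * (J * lookup (a ∷ b ∷ c ∷ d ∷ e ∷ f ∷ []) i) + 12 * m
      near-sixth 0F = final p-large J₁ (proj₂ (proj₂ (proj₂ t₁))) refl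
      near-sixth 1F = final p-large J₁ (proj₁ (proj₂ (proj₂ t₁))) (+-comm b a)
      near-sixth 2F = final r-large′ J₃ (proj₂ (proj₂ (proj₂ t₃))) refl
      near-sixth 3F = final q-large J₂ (proj₂ (proj₂ (proj₂ t₂))) refl
      near-sixth 4F = final q-large J₂ (proj₁ (proj₂ (proj₂ t₂))) (+-comm e d)
      near-sixth 5F = final r-large′ J₃ (proj₁ (proj₂ (proj₂ t₃))) (+-comm f c)

-- The forbidden configurations that exclude wrong positions relative to G²₆.

module SixConfigurations where

  open Integration
  open Configurations
  open Selection
  open Extension
  open SixVolume
  open import Data.Nat
  open import Data.Nat.Properties
  open import Data.Bool using (Bool; true; false; _∧_; _∨_; not; if_then_else_)
  import Data.Bool.Properties as Bool
  open import Data.Fin using (Fin; zero; suc; punchIn)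
  open import Data.Fin.Patterns using (0F; 1F; 2F; 3F; 4F; 5F)
  open import Data.Fin.Properties using (all?)
  import Data.Fin as Fin
  open import Data.Vec using (Vec; []; _∷_; lookup; map; tabulate; allFin)
  open import Data.List using (List; []; _∷_)
  import Data.List as List
  open import Data.Product using (_×_; _,_)
  open import Relation.Nullary using (Dec; does; ¬?; _×-dec_; _→-dec_)
  open import Relation.Nullary.Decidable using (toWitness)
  open import Relation.Binary.PropositionalEquality hiding (J)

  open Roles Six using (known)

  module Patterns where
    none : Fin 6 → Fin 6 → Bool
    none _ _ = false

    nowhere : ∀ {k} → Triple k → Bool
    nowhere _ = false

    initial : ∀ {k} → Triple k → Bool
    initial (first (first zero)) = true
    initial _ = false

    others : Fin 6 → Vec (Fin 6) 5
    others i = tabulate (punchIn i)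

    outside : Fin 6 → Fin 6 → Fin 6 → Bool
    outside i j k = not (does (i Fin.≟ k)) ∧ not (does (j Fin.≟ k))

    outside² : Fin 6 → Fin 6 → Fin 6 → Fin 6 → Bool
    outside² i j k l = outside i j k ∧ outside i j l

    -- An edge of G²₆ avoiding `i` and `j`, taken twice. A vertex whose link has all pairs of
    -- classes outside `i` and `j`, also those within one class, covers the two copies of each
    -- class, and seven points become pairwise covered. For distinct `i` and `j` the fallback is not
    -- reached, since the four non-edges span all six classes and so are not the four triples of the
    -- remaining four.
    edge-outside : Fin 6 → Fin 6 → Vec (Fin 6) 6
    edge-outside i j = go (triples 6)
      where
      ok : Fin 6 → Fin 6 → Fin 6 → Bool
      ok a b c = outside i j a ∧ outside i j b ∧ outside i j c ∧ six a b c
      go : List (Triple 6) → Vec (Fin 6) 6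
      go [] = allFin 6
      go (t ∷ ts) = if ok (fst³ t) (snd³ t) (thd³ t) then fst³ t ∷ snd³ t ∷ thd³ t ∷ fst³ t ∷ snd³ t ∷ thd³ t ∷ [] else go ts

    bad : Fin 6 → Fin 6 → Fin 6 → Bool
    bad i j k = not (does (i Fin.≟ j)) ∧ not (does (j Fin.≟ k)) ∧ not (does (i Fin.≟ k)) ∧ not (six i j k)

    -- The complement of a non-edge of G²₆ is a non-edge.
    rest : Fin 6 → Fin 6 → Fin 6 → Vec (Fin 6) 3
    rest i j k = if (code i + code j + code k) ≡ᵇ 2 then 3F ∷ 4F ∷ single ∷ [] else 0F ∷ 1F ∷ single ∷ []
      where
      single : Fin 6
      single = if does (i Fin.≟ 2F) ∨ does (j Fin.≟ 2F) ∨ does (k Fin.≟ 2F) then 5F else 2F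

    -- A vertex v and one random vertex of every class, each covered together with v. The edges
    -- among the six already have no common vertex.
    ρ-all : Vec (Role 6) 7
    ρ-all = point none ∷ map rich (allFin 6)

    -- A fixed vertex replaces the random one of class `i`. In `ρ-cover` it and the other five are
    -- covered together with v; in `ρ-inside` two fixed vertices of the same class are covered
    -- together.
    ρ-cover ρ-inside : Fin 6 → Vec (Role 6) 7
    ρ-cover i = point none ∷ point (six i) ∷ map rich (others i)
    ρ-inside i = point (six i) ∷ point (six i) ∷ map rich (others i)

    ρ-pair : Fin 6 → Fin 6 → Vec (Role 6) 7
    ρ-pair i j = point (outside² i j) ∷ map rich (edge-outside i j)

    -- For a non-edge (i, j, k) the vertex v takes the place of class `i`, next to y, z in `j`, `k`
    -- and the complementary classes; an edge v y z then rules out every embedding in G²₆. In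
    -- `ρ-dense` v is merely covered with the complementary vertices, in `ρ-single` its link is
    -- nearly that of class `i`.
    ρ-dense ρ-single : Fin 6 → Fin 6 → Fin 6 → Vec (Role 6) 6
    ρ-dense i j k = point none ∷ point (six j) ∷ rich k ∷ map rich (rest i j k)
    ρ-single i j k = point (six i) ∷ point (six j) ∷ point (six k) ∷ map rich (rest i j k)

    Q-all Q-cover Q-inside : List (Fin 7 × Fin 7)
    Q-all = List.map (λ r → 0F , suc r) (List.allFin 6)
    Q-cover = (0F , 1F) ∷ List.map (λ r → 0F , suc (suc r)) (List.allFin 5)
    Q-inside = (0F , 1F) ∷ []

    Q-dense : List (Fin 6 × Fin 6)
    Q-dense = List.map (λ r → 0F , suc (suc (suc r))) (List.allFin 3)

    Forbidden₇ : List (Triple 7) → List (Fin 7 × Fin 7) → Set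
    Forbidden₇ E Q = AllJoined E Q × Spread E

    forbidden₇? : ∀ E Q → Dec (Forbidden₇ E Q)
    forbidden₇? E Q = allJoined? E Q ×-dec spread? E

    Forbidden₆ : List (Triple 6) → List (Fin 6 × Fin 6) → Set
    Forbidden₆ E Q = AllJoined E Q × Spread E × every E (λ _ → false) ≡ true

    forbidden₆? : ∀ E Q → Dec (Forbidden₆ E Q)
    forbidden₆? E Q = allJoined? E Q ×-dec spread? E ×-dec (every E (λ _ → false) Bool.≟ true)

    -- This and the following facts depend on at most three classes and are decided by evaluation.
    check-all : Forbidden₇ (known ρ-all nowhere) Q-all
    check-all = toWitness {a? = forbidden₇? (known ρ-all nowhere) Q-all} _

    check-cover : ∀ i → Forbidden₇ (known (ρ-cover i) nowhere) Q-cover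
    check-cover = toWitness {a? = all? λ i → forbidden₇? (known (ρ-cover i) nowhere) Q-cover} _

    check-inside : ∀ i → Forbidden₇ (known (ρ-inside i) nowhere) Q-inside
    check-inside = toWitness {a? = all? λ i → forbidden₇? (known (ρ-inside i) nowhere) Q-inside} _

    check-pair : ∀ i j → i ≢ j → Forbidden₇ (known (ρ-pair i j) nowhere) []
    check-pair = toWitness {a? = all? λ i → all? λ j → ¬? (i Fin.≟ j) →-dec forbidden₇? (known (ρ-pair i j) nowhere) []} _

    -- The last conjunct ensures that the complementary vertices come from classes in which many
    -- vertices are covered together with v.
    check-dense : ∀ i j k → bad i j k ≡ true → Forbidden₆ (known (ρ-dense i j k) initial) Q-dense × (∀ r → lookup (rest i j k) r ≢ i)
    check-dense = toWitness {a? = all? λ i → all? λ j → all? λ k → (bad i j k Bool.≟ true) →-dec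
      (forbidden₆? (known (ρ-dense i j k) initial) Q-dense ×-dec all? λ r → ¬? (lookup (rest i j k) r Fin.≟ i))} _

    check-single : ∀ i j k → bad i j k ≡ true → Forbidden₆ (known (ρ-single i j k) initial) []
    check-single = toWitness {a? = all? λ i → all? λ j → all? λ k → (bad i j k Bool.≟ true) →-dec forbidden₆? (known (ρ-single i j k) initial) []} _

-- Vertex extension for colourings by G²₆.

module SixExtension where

  open Integration
  open Configurations
  open Selection
  open Extension
  open SixVolume
  open SixConfigurations
  open import Data.Nat
  open import Data.Nat.Properties
  open import Data.Nat.Tactic.RingSolver using (solve-∀)
  open import Data.Bool using (Bool; true; false; _∧_; not)
  import Data.Bool.Properties as Bool
  open import Data.Fin using (Fin; zero; suc; punchIn)
  open import Data.Fin.Patterns using (0F; 1F; 2F; 3F; 4F; 5F)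
  open import Data.Fin.Properties using (any?; punchInᵢ≢i)
  import Data.Fin as Fin
  open import Data.Vec using (Vec; []; _∷_; lookup; map; allFin)
  open import Data.Vec.Properties using (lookup-map; lookup∘tabulate)
  open import Data.List using (List; []; _∷_)
  import Data.List as List
  open import Data.List.Relation.Unary.All using (All; []; _∷_)
  import Data.List.Relation.Unary.All as All
  import Data.List.Relation.Unary.All.Properties as All
  open import Data.Product using (∃; _×_; _,_; proj₁; proj₂)
  open import Data.Empty using (⊥; ⊥-elim)
  open import Relation.Nullary using (¬_; Dec; yes; no; does; contradiction; ¬?; _×-dec_)
  open import Relation.Binary.PropositionalEquality hiding (J)

  open Patterns

  module SixExtension {n : ℕ} {G : MFreeRelation n} (S : Situation G Six) (scale : Scale (Situation.J S)) where
    open InSituation S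
    open Scale scale
    open Forbidden G using (CoveredOn)

    ω : Fin 6 → Fin n → ℕ
    ω = fibre w c

    private
      h : ℕ
      h = 36 * (N₀ * N₀)

      h>0 : 0 < h
      h>0 = *-mono-≤ {1} {36} (s≤s z≤n) (*-mono-≤ (>-nonZero⁻¹ N₀) (>-nonZero⁻¹ N₀))

      128≤J : 128 ≤ J
      128≤J = ≤-trans (*-monoʳ-≤ 128 h>0) (≤-trans q-large q≤J)

      x : Fin 6 → ℕ
      x i = sum (ω i)

      total-mass : m ≡ x 0F + x 1F + (x 3F + x 4F) + (x 2F + x 5F)
      total-mass = trans (mass-fibres c w) (sum₆ x)

      near : ∀ i → J * m ≤ 6 * (J * x i) + 12 * m
      near i = subst₂ (λ k y → J * k ≤ 6 * (J * y) + 12 * k) (sym total-mass) (at i)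
        (NearSixth.near-sixth J (x 0F) (x 1F) (x 2F) (x 3F) (x 4F) (x 5F) (≤-trans (m≤m+n 24 104) 128≤J) (subst (0 <_) total-mass m>0)
          (subst₂ (λ k V → 4 * (J * J) * (k * k * k) ≤ 9 * (J * J) * V + k * k * k) total-mass (trans (vol-fibres Six c w) (vol-six x)) vol-high) i)
        where
        at : ∀ i → lookup (x 0F ∷ x 1F ∷ x 2F ∷ x 3F ∷ x 4F ∷ x 5F ∷ []) i ≡ x i
        at 0F = refl
        at 1F = refl
        at 2F = refl
        at 3F = refl
        at 4F = refl
        at 5F = refl

      m≤ω : ∀ i → m ≤ N₀ * x i
      m≤ω i = ≤-trans (*-cancelˡ-≤ J (certify 0 (+-mono-≤ (*-monoʳ-≤ 2 (near i)) (*-monoʳ-≤ m (≤-trans (m≤m+n 24 104) 128≤J))) (id₁ J m (x i))))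
        (*-monoˡ-≤ (x i) N₀≥12)
        where
        id₁ : ∀ J m x → J * m + (2 * (6 * (J * x) + 12 * m) + m * J) + 0 ≡ J * (12 * x) + (2 * (J * m) + m * 24)
        id₁ = solve-∀

    module S₀ = Slots S N₀ N₀-small
    module S₁ = Slots S N₁ J-large

    rich-ω : ∀ i → S₀.Fits (rich i) (ω i)
    rich-ω i = S₀.fits-rich i (fibre≤ w c i) (class i) (m≤ω i)

    cov : Fin n → Bool
    cov y = does (any? λ z → e v y z Bool.≟ true)

    cov-covered : ∀ y → cov y ≡ true → Covered v y
    cov-covered y p with any? (λ z → e v y z Bool.≟ true)
    ... | yes q = q

    μ : Fin 6 → Fin n → ℕ
    μ l = ω l ↾ cov

    -- Many vertices of class `l` are covered together with `v`. The number of classes that fail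
    -- this decides: zero and two or more are impossible, and if exactly one class fails, it becomes
    -- the colour of `v`.
    Big : Fin 6 → Set
    Big l = m ≤ q * sum (μ l)

    private
      rich-μ : ∀ l → Big l → S₁.Fits (rich l) (μ l)
      rich-μ l big = S₁.fits-rich l (λ y → ≤-trans (↾≤ (ω l) cov y) (fibre≤ w c l y)) (λ y y∈ → class l y (proj₂ (↾-support (ω l) cov y y∈)))
        (≤-trans big (*-monoˡ-≤ (sum (μ l)) (≤-trans (m≤n*m q 2) N₁-large)))

      μ-covered : ∀ l y → 0 < μ l y → Covered v y
      μ-covered l y y∈ = cov-covered y (proj₁ (↾-support (ω l) cov y y∈))

      fits-map₀ : ∀ {k} (ls : Vec (Fin 6) k) r → S₀.Fits (lookup (map rich ls) r) (lookup (map ω ls) r)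
      fits-map₀ ls r = subst₂ S₀.Fits (sym (lookup-map r rich ls)) (sym (lookup-map r ω ls)) (rich-ω (lookup ls r))

      fits-map₁ : ∀ {k} (ls : Vec (Fin 6) k) → (∀ r → Big (lookup ls r)) → ∀ r → S₁.Fits (lookup (map rich ls) r) (lookup (map μ ls) r)
      fits-map₁ ls big r = subst₂ S₁.Fits (sym (lookup-map r rich ls)) (sym (lookup-map r μ ls)) (rich-μ (lookup ls r) (big r))

      map-covered : ∀ {k} (ls : Vec (Fin 6) k) r y → 0 < lookup (map μ ls) r y → Covered v y
      map-covered ls r y y∈ = μ-covered (lookup ls r) y (subst (λ ν → 0 < ν y) (lookup-map r μ ls) y∈)

    not-all-big : ¬ (∀ l → Big l)
    not-all-big big = S₁.refute₇ ρ-all (δ v ∷ map μ (allFin 6)) fits nowhere (λ _ ()) Q-all covered (proj₁ check-all) (proj₂ check-all)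
      where
      fits : ∀ i → S₁.Fits (lookup ρ-all i) (lookup (δ v ∷ map μ (allFin 6)) i)
      fits 0F = S₁.fits-bare v
      fits (suc r) = fits-map₁ (allFin 6) (λ r → big (lookup (allFin 6) r)) r
      covered : ∀ xs → (∀ i → 0 < lookup (δ v ∷ map μ (allFin 6)) i (lookup xs i)) → CoveredOn xs Q-all
      covered (x₀ ∷ xs) xs∈ = All.map⁺ {f = λ r → 0F , suc r} (All.universal (λ r → subst (λ y → Covered y (lookup xs r)) (δ-support v x₀ (xs∈ 0F))
        (map-covered (allFin 6) r (lookup xs r) (xs∈ (suc r)))) (List.allFin 6))

    no-inside : ∀ {y z} j → U y ≡ true → c y ≡ j → U z ≡ true → c z ≡ j → Covered y z → ⊥
    no-inside {y} {z} j y∈ cy z∈ cz yz = S₀.refute₇ (ρ-inside j) μs fits nowhere (λ _ ()) Q-inside covered (proj₁ (check-inside j)) (proj₂ (check-inside j))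
      where
      μs : Vec (Fin n → ℕ) 7
      μs = δ y ∷ δ z ∷ map ω (others j)
      fits : ∀ i → S₀.Fits (lookup (ρ-inside j) i) (lookup μs i)
      fits 0F = S₀.fits-point {y} y∈ cy
      fits 1F = S₀.fits-point {z} z∈ cz
      fits (suc (suc r)) = fits-map₀ (others j) r
      covered : ∀ xs → (∀ i → 0 < lookup μs i (lookup xs i)) → CoveredOn xs Q-inside
      covered (x₀ ∷ x₁ ∷ xs) xs∈ = subst₂ Covered (δ-support y x₀ (xs∈ 0F)) (δ-support z x₁ (xs∈ 1F)) yz ∷ []

    degree-at : Fin 6 → ℕ
    degree-at l = ∫ (ω l) λ y → ∫ w λ z → ⟦ e v y z ⟧

    private
      degree-at≤ : ∀ l → degree-at l ≤ sum (μ l) * m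
      degree-at≤ l = begin
        degree-at l                      ≤⟨ ∫-mono (ω l) (λ y _ → pointwise y) ⟩
        ∫ (ω l) (λ y → ⟦ cov y ⟧ * m)    ≡⟨ sym (∫-↾ (ω l) cov (λ _ → m)) ⟩
        ∫ (μ l) (λ _ → m)                ≡⟨ ∫-const (μ l) m ⟩
        sum (μ l) * m                    ∎
        where
        open ≤-Reasoning
        pointwise : ∀ y → ∫ w (λ z → ⟦ e v y z ⟧) ≤ ⟦ cov y ⟧ * m
        pointwise y with any? (λ z → e v y z Bool.≟ true)
        ... | yes _ = ≤-trans (∫≤ w 1 λ z _ → ⟦⟧≤1 (e v y z)) (≤-reflexive (trans (*-identityʳ m) (sym (+-identityʳ m))))
        ... | no ¬p = ≤-reflexive (∫-zero w λ z _ → cong ⟦_⟧ (Bool.¬-not λ p → ¬p (z , p)))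

      small-degree : ∀ l → ¬ Big l → q * degree-at l ≤ m * m
      small-degree l ¬big = ≤-trans (*-monoʳ-≤ q (degree-at≤ l)) (≤-trans (≤-reflexive (sym (*-assoc q (sum (μ l)) m))) (*-monoˡ-≤ m (<⇒≤ (≰⇒> ¬big))))

    -- If two classes are hardly covered together with `v`, its link lives on the other four, of
    -- mass W close to 2m/3. As W² is close to 4m²/9, just the degree that `v` must have, nearly all
    -- pairs outside `i` and `j` belong to the link, including pairs within a class; this is
    -- `ρ-pair`.
    module TwoSmall (i j : Fin 6) (i≢j : i ≢ j) (¬i : ¬ Big i) (¬j : ¬ Big j) where
      private
        W : ℕ
        W = ∫ w λ y → ⟦ outside i j (c y) ⟧

        link≡ : linkSize (outside² i j) ≡ W * W
        link≡ = trans (∫-cong w λ y → trans (∫-cong w λ z → ∧-* (outside i j (c y)) (outside i j (c z))) (∫-* w ⟦ outside i j (c y) ⟧ _))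
          (trans (∫-cong w λ y → *-comm ⟦ outside i j (c y) ⟧ W) (∫-* w W _))
          where
          ∧-* : ∀ a b → ⟦ a ∧ b ⟧ ≡ ⟦ a ⟧ * ⟦ b ⟧
          ∧-* true b = sym (+-identityʳ _)
          ∧-* false b = refl

        W+≤ : W + x i + x j ≤ m
        W+≤ = begin
          W + x i + x j ≡⟨ cong₂ _+_ (cong (W +_) (mass-↾ w _)) (mass-↾ w _) ⟩
          W + ∫ w (λ y → δ (c y) i) + ∫ w (λ y → δ (c y) j) ≡⟨ sym (trans (∫-+ w _ _) (cong (_+ _) (∫-+ w _ _))) ⟩
          ∫ w (λ y → ⟦ outside i j (c y) ⟧ + δ (c y) i + δ (c y) j) ≤⟨ ∫-mono w (λ y _ → pointwise (c y)) ⟩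
          ∫ w (λ _ → 1) ≡⟨ ∫-1 w ⟩
          m ∎
          where
          open ≤-Reasoning
          pointwise : ∀ k → ⟦ outside i j k ⟧ + δ k i + δ k j ≤ 1
          pointwise k with i Fin.≟ k | j Fin.≟ k | k Fin.≟ i | k Fin.≟ j
          ... | yes refl | yes p | _ | _ = contradiction (sym p) i≢j
          ... | _ | _ | yes refl | yes p = contradiction p i≢j
          ... | yes refl | _ | no p | _ = contradiction refl p
          ... | no p | _ | yes q | _ = contradiction (sym q) p
          ... | _ | yes refl | _ | no p = contradiction refl p
          ... | _ | no p | _ | yes q = contradiction (sym q) p
          ... | yes _ | no _ | yes _ | no _ = ≤-refl
          ... | no _ | yes _ | no _ | yes _ = ≤-refl
          ... | no _ | no _ | no _ | no _ = ≤-refl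

        3JW≤ : 3 * (J * W) ≤ (2 * J + 12) * m
        3JW≤ = *-cancelˡ-≤ 2 (certify 0 (+-mono-≤ (*-monoʳ-≤ (6 * J) W+≤) (+-mono-≤ (near i) (near j))) (id₁ J m W (x i) (x j)))
          where
          id₁ : ∀ J m W a b → 2 * (3 * (J * W)) + (6 * J * m + (6 * (J * a) + 12 * m + (6 * (J * b) + 12 * m))) + 0 ≡
            2 * ((2 * J + 12) * m) + (6 * J * (W + a + b) + (J * m + J * m))
          id₁ = solve-∀

        stray≤ : stray v (outside² i j) ≤ degree-at i + degree-at j + (degree-at i + degree-at j)
        stray≤ = begin
          stray v (outside² i j) ≤⟨ ∫-mono w (λ y _ → ∫-mono w λ z _ → pointwise (c y) (c z) (e v y z)) ⟩
          ∫ w (λ y → ∫ w λ z → (δ (c y) i * ⟦ e v y z ⟧ + δ (c y) j * ⟦ e v y z ⟧) + (δ (c z) i * ⟦ e v y z ⟧ + δ (c z) j * ⟦ e v y z ⟧))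
            ≡⟨ trans (∫-cong w λ y → trans (∫-+ w _ _) (cong₂ _+_ (∫-+ w _ _) (∫-+ w _ _))) (trans (∫-+ w _ _) (cong₂ _+_ (∫-+ w _ _) (∫-+ w _ _))) ⟩
          (left i + left j) + (right i + right j) ≡⟨ cong₂ _+_ (cong₂ _+_ (left≡ i) (left≡ j)) (cong₂ _+_ (trans (right≡ i) (left≡ i)) (trans (right≡ j) (left≡ j))) ⟩
          degree-at i + degree-at j + (degree-at i + degree-at j) ∎
          where
          open ≤-Reasoning
          left right : Fin 6 → ℕ
          left l = ∫ w λ y → ∫ w λ z → δ (c y) l * ⟦ e v y z ⟧
          right l = ∫ w λ y → ∫ w λ z → δ (c z) l * ⟦ e v y z ⟧
          left≡ : ∀ l → left l ≡ degree-at l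
          left≡ l = trans (∫-cong w λ y → ∫-* w (δ (c y) l) _) (sym (∫-↾ w (λ y → does (c y Fin.≟ l)) _))
          right≡ : ∀ l → right l ≡ left l
          right≡ l = trans (∫-swap w w _) (∫-cong w λ z → ∫-cong w λ y → cong (λ b → δ (c z) l * ⟦ b ⟧) (swap₂₃ v y z))
          pointwise : ∀ k l b → ⟦ not (outside² i j k l) ∧ b ⟧ ≤ (δ k i * ⟦ b ⟧ + δ k j * ⟦ b ⟧) + (δ l i * ⟦ b ⟧ + δ l j * ⟦ b ⟧)
          pointwise k l false = ≤-trans (≤-reflexive (cong ⟦_⟧ (Bool.∧-zeroʳ (not (outside² i j k l))))) z≤n
          pointwise k l true with i Fin.≟ k | j Fin.≟ k | i Fin.≟ l | j Fin.≟ l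
          ... | yes refl | _ | _ | _ rewrite δ-self i = s≤s z≤n
          ... | no _ | yes refl | _ | _ rewrite δ-self j = ≤-trans (m≤n+m 1 (δ j i * 1)) (m≤m+n _ _)
          ... | no _ | no _ | yes refl | _ rewrite δ-self i = ≤-trans (s≤s z≤n) (m≤n+m (1 + δ i j * 1) (δ k i * 1 + δ k j * 1))
          ... | no _ | no _ | no _ | yes refl rewrite δ-self j = ≤-trans (m≤n+m 1 (δ j i * 1)) (m≤n+m (δ j i * 1 + 1) (δ k i * 1 + δ k j * 1))
          ... | no _ | no _ | no _ | no _ = z≤n

        qstray : q * stray v (outside² i j) ≤ 4 * (m * m)
        qstray = ≤-trans (*-monoʳ-≤ q stray≤) (certify 0 (+-mono-≤ (*-monoʳ-≤ 2 (small-degree i ¬i)) (*-monoʳ-≤ 2 (small-degree j ¬j)))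
          (id₁ q (degree-at i) (degree-at j) (m * m)))
          where
          id₁ : ∀ q a b M → q * (a + b + (a + b)) + (2 * M + 2 * M) + 0 ≡ 4 * M + (2 * (q * a) + 2 * (q * b))
          id₁ = solve-∀

        near-v : h * gap v (outside² i j) ≤ m * m
        -- In (2 `J` + 12)² = 4 `J`² + 48 `J` + 144 the first term is matched by the degree of `v`.
        -- The rest, with 1 added for the tolerance of that degree, is 48 `J` + 145 and is absorbed
        -- by 128 `h` ≤ `J`.
        near-v = *-cancelˡ-≤ (1152 * (J * J)) {{m*n≢0 1152 (J * J) {{_}} {{m*n≢0 J J}}}} (certify (923 * (J * J * (m * m)))
          (+-mono-≤ (≤-reflexive (cong (128 * h * (9 * (J * J)) *_) (trans (gap-deg v (outside² i j)) (cong (_+ stray v (outside² i j)) link≡))))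
            (+-mono-≤ (*-monoʳ-≤ (128 * h) high-v)
            (+-mono-≤ (*-monoʳ-≤ (128 * h) (*-mono-≤ 3JW≤ 3JW≤))
            (+-mono-≤ (*-monoʳ-≤ (9 * (J * J)) (≤-trans (*-monoˡ-≤ (stray v (outside² i j)) q-large) qstray))
            (+-mono-≤ (*-monoˡ-≤ ((48 * J + 145) * (m * m)) (≤-trans q-large q≤J))
              (*-monoʳ-≤ (145 * (J * (m * m))) J>0))))))
          (id₁ J m h W (gap v (outside² i j)) (deg e w v) (stray v (outside² i j))))
          where
          id₁ : ∀ J m h W g d t →
            1152 * (J * J) * (h * g) + (128 * h * (9 * (J * J)) * (W * W + t) + (128 * h * (9 * (J * J) * d + m * m) + (128 * h * ((2 * J + 12) * m * ((2 * J + 12) * m)) +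
              (9 * (J * J) * (4 * (m * m)) + (J * ((48 * J + 145) * (m * m)) + 145 * (J * (m * m)) * J))))) + 923 * (J * J * (m * m)) ≡
            1152 * (J * J) * (m * m) + (128 * h * (9 * (J * J)) * (g + d) + (128 * h * (4 * (J * J) * (m * m)) + (128 * h * (3 * (J * W) * (3 * (J * W))) +
              (9 * (J * J) * (128 * h * t) + (128 * h * ((48 * J + 145) * (m * m)) + 145 * (J * (m * m)) * 1)))))
          id₁ = solve-∀

      absurd : ⊥
      absurd = S₀.refute₇ (ρ-pair i j) μs fits nowhere (λ _ ()) [] (λ _ _ → []) (proj₁ (check-pair i j i≢j)) (proj₂ (check-pair i j i≢j))
        where
        μs : Vec (Fin n → ℕ) 7
        μs = δ v ∷ map ω (edge-outside i j)
        fits : ∀ r → S₀.Fits (lookup (ρ-pair i j) r) (lookup μs r)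
        fits 0F = S₀.fits-near {v} {outside² i j} near-v
        fits (suc r) = fits-map₀ (edge-outside i j) r

    module OneSmall (i : Fin 6) (others-big : ∀ l → l ≢ i → Big l) where
      no-cover : ∀ {y} → U y ≡ true → c y ≡ i → Covered v y → ⊥
      no-cover {y} y∈ cy vy = S₁.refute₇ (ρ-cover i) μs fits nowhere (λ _ ()) Q-cover covered (proj₁ (check-cover i)) (proj₂ (check-cover i))
        where
        μs : Vec (Fin n → ℕ) 7
        μs = δ v ∷ δ y ∷ map μ (others i)
        fits : ∀ r → S₁.Fits (lookup (ρ-cover i) r) (lookup μs r)
        fits 0F = S₁.fits-bare v
        fits 1F = S₁.fits-point {y} y∈ cy
        fits (suc (suc r)) = fits-map₁ (others i) (λ r → subst Big (sym (lookup∘tabulate (punchIn i) r)) (others-big (punchIn i r) (punchInᵢ≢i i r))) r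
        covered : ∀ xs → (∀ r → 0 < lookup μs r (lookup xs r)) → CoveredOn xs Q-cover
        covered (x₀ ∷ x₁ ∷ xs) xs∈ = subst₂ Covered (δ-support v x₀ (xs∈ 0F)) (δ-support y x₁ (xs∈ 1F)) vy ∷
          All.map⁺ {f = λ r → 0F , suc (suc r)} (All.universal (λ r → subst (λ y → Covered y (lookup xs r)) (δ-support v x₀ (xs∈ 0F))
            (map-covered (others i) r (lookup xs r) (xs∈ (suc (suc r))))) (List.allFin 5))

      module _ (j k : Fin 6) (ijk : bad i j k ≡ true) where
        private
          f : Fin n → ℕ
          f y = ∫ (ω k) λ z → ⟦ e v y z ⟧

          no-pivot : ∀ y → 0 < ω j y → m ≤ q * f y → ⊥
          no-pivot y y∈ large = S₁.refute₆ (ρ-dense i j k) μs fits initial sure Q-dense covered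
              (proj₁ (proj₁ chk)) (proj₁ (proj₂ (proj₁ chk))) (proj₂ (proj₂ (proj₁ chk)))
            where
            chk = check-dense i j k ijk
            ν : Fin n → ℕ
            ν = ω k ↾ e v y
            μs : Vec (Fin n → ℕ) 6
            μs = δ v ∷ δ y ∷ ν ∷ map μ (rest i j k)
            fits : ∀ r → S₁.Fits (lookup (ρ-dense i j k) r) (lookup μs r)
            fits 0F = S₁.fits-bare v
            fits 1F = S₁.fits-point {y} (w⊆U y (<-≤-trans y∈ (fibre≤ w c j y))) (class j y y∈)
            fits 2F = S₁.fits-rich k (λ z → ≤-trans (↾≤ (ω k) (e v y) z) (fibre≤ w c k z)) (λ z z∈ → class k z (proj₂ (↾-support (ω k) (e v y) z z∈)))
              (≤-trans large (≤-trans (*-monoʳ-≤ q (≤-reflexive (sym (mass-↾ (ω k) (e v y))))) (*-monoˡ-≤ (sum ν) (≤-trans (m≤n*m q 2) N₁-large))))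
            fits (suc (suc (suc r))) = fits-map₁ (rest i j k) (λ r → others-big (lookup (rest i j k) r) (proj₂ chk r)) r
            sure : ∀ t → initial t ≡ true → S₁.SureAt μs t
            sure (first (first zero)) _ x′ y′ z′ px py pz = subst₂ (λ a b → e a b z′ ≡ true) (δ-support v x′ px) (δ-support y y′ py)
              (proj₁ (↾-support (ω k) (e v y) z′ pz))
            covered : ∀ xs → (∀ r → 0 < lookup μs r (lookup xs r)) → CoveredOn xs Q-dense
            covered (x₀ ∷ x₁ ∷ x₂ ∷ xs) xs∈ = All.map⁺ {f = λ r → 0F , suc (suc (suc r))} (All.universal (λ r → subst (λ y → Covered y (lookup xs r)) (δ-support v x₀ (xs∈ 0F))
              (map-covered (rest i j k) r (lookup xs r) (xs∈ (suc (suc (suc r)))))) (List.allFin 3))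

        -- Otherwise, by averaging, some y of class `j` lies in many such pairs. A random z among
        -- its partners, with three complementary vertices covered together with `v`, realises
        -- `ρ-dense`.
        bad-sparse : q * ∫ (ω j) f ≤ m * m
        bad-sparse with q * ∫ (ω j) f ≤? m * m
        ... | yes p = p
        ... | no ¬p = let (y , y∈ , large) = pivot in ⊥-elim (no-pivot y y∈ large)
          where
          open ≤-Reasoning
          pivot : ∃ λ y → 0 < ω j y × m ≤ q * f y
          pivot = ∫-≤⇒∃≤ (ω j) {λ _ → m} {λ y → q * f y} (proj₁ (proj₁ (rich-ω j))) (begin
            ∫ (ω j) (λ _ → m)        ≡⟨ ∫-const (ω j) m ⟩
            x j * m                  ≤⟨ *-monoˡ-≤ m (mass-fibre≤ w c j) ⟩
            m * m                    ≤⟨ <⇒≤ (≰⇒> ¬p) ⟩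
            q * ∫ (ω j) f            ≡⟨ sym (∫-* (ω j) q f) ⟩
            ∫ (ω j) (λ y → q * f y)  ∎)

      private
        -- A class repeated among the three is excluded by `no-cover` or by `no-inside`, so a wrong
        -- pair comes from a non-edge with three different classes.
        classify : ∀ y z → U y ≡ true → U z ≡ true → e v y z ≡ true → six i (c y) (c z) ≡ false → bad i (c y) (c z) ≡ true
        classify y z y∈ z∈ vyz ¬six with i Fin.≟ c y | c y Fin.≟ c z | i Fin.≟ c z
        ... | yes p | _ | _ = ⊥-elim (no-cover y∈ (sym p) (z , vyz))
        ... | no _ | yes p | _ = ⊥-elim (no-inside (c z) y∈ p z∈ refl (v , trans (trans (swap₂₃ y z v) (swap₁₂ y v z)) vyz))
        ... | no _ | no _ | yes p = ⊥-elim (no-cover z∈ (sym p) (y , trans (swap₂₃ v z y) vyz))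
        ... | no _ | no _ | no _ = cong not ¬six

        term : Fin 6 → Fin 6 → ℕ
        term j k = ∫ (ω j) λ y → ∫ (ω k) λ z → ⟦ not (six i (c y) (c z)) ∧ e v y z ⟧

        in-U : ∀ j y → 0 < ω j y → U y ≡ true
        in-U j y y∈ = w⊆U y (<-≤-trans y∈ (fibre≤ w c j y))

        term≤ : ∀ j k → q * term j k ≤ m * m
        term≤ j k with bad i j k in ijk
        ... | true = ≤-trans (*-monoʳ-≤ q (∫-mono (ω j) λ y _ → ∫-mono (ω k) λ z _ → drop (not (six i (c y) (c z))) (e v y z))) (bad-sparse j k ijk)
          where
          drop : ∀ a b → ⟦ a ∧ b ⟧ ≤ ⟦ b ⟧
          drop true b = ≤-refl
          drop false b = z≤n
        ... | false = ≤-trans (≤-reflexive (trans (cong (q *_) (∫-zero (ω j) λ y y∈ → ∫-zero (ω k) λ z z∈ → none-here y y∈ z z∈)) (*-zeroʳ q))) z≤n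
          where
          none-here : ∀ y → 0 < ω j y → ∀ z → 0 < ω k z → ⟦ not (six i (c y) (c z)) ∧ e v y z ⟧ ≡ 0
          none-here y y∈ z z∈ with six i (c y) (c z) in s | e v y z in vyz
          ... | true | _ = refl
          ... | false | false = refl
          ... | false | true = contradiction (trans (sym ijk) (trans (cong₂ (bad i) (sym (class j y y∈)) (sym (class k z z∈)))
            (classify y z (in-U j y y∈) (in-U k z z∈) vyz s))) λ ()

        stray≡ : stray v (six i) ≡ sum (λ j → sum (term j))
        stray≡ = trans (∫-classes w c _) (sum-cong-≗ λ j → trans (∫-cong (ω j) λ y → ∫-classes w c _) (∫-sum (ω j) _))

        -- Each of the 36 ordered pairs of classes contributes at most m²/`q`. Since 72 `h` ≤ 128
        -- `h` ≤ `q`, the stray mass stays below m²/(2 `h`), as `gap-split` requires.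
        stray≤ : q * stray v (six i) ≤ 36 * (m * m)
        stray≤ = begin
          q * stray v (six i)                        ≡⟨ cong (q *_) stray≡ ⟩
          q * sum (λ j → sum (term j))               ≡⟨ trans (*-distribˡ-sum q _) (sum-cong-≗ λ j → *-distribˡ-sum q (term j)) ⟩
          sum (λ j → sum (λ k → q * term j k))       ≤⟨ sum≤ _ (6 * (m * m)) (λ j → sum≤ _ (m * m) (term≤ j)) ⟩
          6 * (6 * (m * m))                          ≡⟨ sym (*-assoc 6 6 (m * m)) ⟩
          36 * (m * m)                               ∎
          where open ≤-Reasoning

        near-v : S₀.Near v (six i)
        near-v = gap-split {J} {2 * h} {h} {m * m} {gap v (six i)} {stray v (six i)}
          (≤-trans (*-monoˡ-≤ h {2} {128} (m≤m+n 2 126)) (≤-trans q-large q≤J)) ≤-refl (gap-bound v i high-v (inhabitant i))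
          (*-cancelˡ-≤ 36 (≤-trans (≤-trans (≤-reflexive (id₁ h (stray v (six i)))) (*-monoˡ-≤ (stray v (six i)) (*-monoˡ-≤ h {72} {128} (m≤m+n 72 56))))
            (≤-trans (*-monoˡ-≤ (stray v (six i)) q-large) stray≤)))
          where
          id₁ : ∀ h t → 36 * (2 * h * t) ≡ 72 * h * t
          id₁ = solve-∀
          inhabitant : ∀ i → ∃ λ y → c y ≡ i
          inhabitant i = let (y , y∈ , _) = ∫-<⇒∃< (ω i) {λ _ → 0} {λ _ → 1} (subst₂ _<_ (sym (trans (∫-const (ω i) 0) (*-zeroʳ (x i)))) (sym (∫-1 (ω i))) (proj₁ (proj₁ (rich-ω i))))
            in y , class i y y∈

        -- Now that the link of `v` is almost that of class `i`, a single wrong edge suffices: with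
        -- random vertices of the three complementary classes it realises `ρ-single`.
        no-bad-pair : ∀ {y z} → U y ≡ true → U z ≡ true → e v y z ≡ true → bad i (c y) (c z) ≡ true → ⊥
        no-bad-pair {y} {z} y∈ z∈ vyz ijk = S₀.refute₆ (ρ-single i (c y) (c z)) μs fits initial sure [] (λ _ _ → [])
            (proj₁ chk) (proj₁ (proj₂ chk)) (proj₂ (proj₂ chk))
          where
          chk = check-single i (c y) (c z) ijk
          μs : Vec (Fin n → ℕ) 6
          μs = δ v ∷ δ y ∷ δ z ∷ map ω (rest i (c y) (c z))
          fits : ∀ r → S₀.Fits (lookup (ρ-single i (c y) (c z)) r) (lookup μs r)
          fits 0F = S₀.fits-near {v} {six i} near-v
          fits 1F = S₀.fits-point {y} y∈ refl
          fits 2F = S₀.fits-point {z} z∈ refl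
          fits (suc (suc (suc r))) = fits-map₀ (rest i (c y) (c z)) r
          sure : ∀ t → initial t ≡ true → S₀.SureAt μs t
          sure (first (first zero)) _ x′ y′ z′ px py pz =
            trans (cong₂ (λ a b → e a b z′) (sym (δ-support v x′ px)) (sym (δ-support y y′ py))) (trans (cong (e v y) (sym (δ-support z z′ pz))) vyz)

      extend-here : Extends
      extend-here = extend i ok
        where
        ok : ∀ y z → U y ≡ true → U z ≡ true → e v y z ≡ true → six i (c y) (c z) ≡ true
        ok y z y∈ z∈ vyz with six i (c y) (c z) in s
        ... | true = refl
        ... | false = ⊥-elim (no-bad-pair y∈ z∈ vyz (classify y z y∈ z∈ vyz s))

    big? : ∀ l → Dec (Big l)
    big? l = m ≤? q * sum (μ l)

    extend-six : Extends
    extend-six with any? (λ i → ¬? (big? i))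
    ... | no ¬small = ⊥-elim (not-all-big λ l → decide l)
      where
      decide : ∀ l → Big l
      decide l with big? l
      ... | yes b = b
      ... | no ¬b = ⊥-elim (¬small (l , ¬b))
    ... | yes (i , ¬i) with any? (λ j → ¬? (i Fin.≟ j) ×-dec ¬? (big? j))
    ... | yes (j , i≢j , ¬j) = ⊥-elim (TwoSmall.absurd i j i≢j ¬i ¬j)
    ... | no ¬small = OneSmall.extend-here i decide
      where
      decide : ∀ l → l ≢ i → Big l
      decide l l≢i with big? l
      ... | yes b = b
      ... | no ¬b = ⊥-elim (¬small (l , (λ i≡l → l≢i (sym i≡l)) , ¬b))

-- Pairwise covered vertex sets are coloured.

module Cliques where

  open Configurations
  open Extension
  open import Data.Nat using (ℕ; zero; suc; _≤_; _<_; z≤n; s≤s)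
  open import Data.Nat.Properties using (<⇒≱; ≤-trans; n≤1+n; m≤m+n)
  open import Data.Bool using (Bool; true; false)
  import Data.Bool.Properties as Bool
  open import Data.Fin using (Fin; zero; suc; inject≤)
  open import Data.Fin.Patterns using (0F; 1F; 2F; 3F; 4F; 5F)
  open import Data.Fin.Properties using (all?; any?; injective⇒≤; suc-injective; inject≤-injective)
  import Data.Fin as Fin
  open import Data.Vec using (Vec; []; _∷_; lookup)
  open import Data.List using (List; []; _∷_)
  import Data.List as List
  open import Data.List.Relation.Unary.Any using (Any)
  import Data.List.Relation.Unary.Any as Any
  open import Data.Product using (Σ; ∃; _×_; _,_; proj₁; proj₂)
  open import Data.Sum using (_⊎_; inj₁; inj₂; [_,_]′)
  open import Data.Empty using (⊥; ⊥-elim)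
  open import Function using (_∘_; id)
  open import Function.Definitions using (Injective)
  open import Relation.Nullary using (¬_; Dec; yes; no; contradiction; ¬?; _×-dec_; _⊎-dec_; _→-dec_)
  open import Relation.Nullary.Decidable using (toWitness)
  open import Relation.Binary.PropositionalEquality

  private variable
    n k s : ℕ

  pair-or-counterexample : {P : Pair k → Set} → (∀ p → Dec (P p)) → (∀ p → P p) ⊎ ∃ λ p → ¬ P p
  pair-or-counterexample {zero} P? = inj₁ λ ()
  pair-or-counterexample {suc k} P? with any? (λ r → ¬? (P? (first r)))
  ... | yes (r , ¬p) = inj₂ (first r , ¬p)
  ... | no h with pair-or-counterexample (P? ∘ later)
  ... | inj₂ (p , ¬p) = inj₂ (later p , ¬p)
  ... | inj₁ h′ = inj₁ λ { (first r) → [ id , (λ ¬p → ⊥-elim (h (r , ¬p))) ]′ (decide (P? (first r))) ; (later p) → h′ p }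
    where
    decide : ∀ {A : Set} → Dec A → A ⊎ ¬ A
    decide (yes a) = inj₁ a
    decide (no ¬a) = inj₂ ¬a

  triple-or-counterexample : {P : Triple k → Set} → (∀ t → Dec (P t)) → (∀ t → P t) ⊎ ∃ λ t → ¬ P t
  triple-or-counterexample {zero} P? = inj₁ λ ()
  triple-or-counterexample {suc k} P? with pair-or-counterexample (P? ∘ first) | triple-or-counterexample (P? ∘ later)
  ... | inj₂ (p , ¬p) | _ = inj₂ (first p , ¬p)
  ... | inj₁ _ | inj₂ (t , ¬p) = inj₂ (later t , ¬p)
  ... | inj₁ h | inj₁ h′ = inj₁ λ { (first p) → h p ; (later t) → h′ t }

  allTriples? : {P : Triple k → Set} → (∀ t → Dec (P t)) → Dec (∀ t → P t)
  allTriples? P? with triple-or-counterexample P?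
  ... | inj₁ h = yes h
  ... | inj₂ (t , ¬p) = no λ h → ¬p (h t)

  pairs-suffice : (R R′ : Fin k → Fin k → Bool) → (∀ i → R i i ≡ false) → (∀ i j → R i j ≡ R j i) → (∀ i j → R′ i j ≡ R′ j i) →
    (∀ p → R (fst² p) (snd² p) ≡ true → R′ (fst² p) (snd² p) ≡ true) → ∀ i j → R i j ≡ true → R′ i j ≡ true
  pairs-suffice R R′ irr s s′ h zero zero r = contradiction (trans (sym r) (irr zero)) λ ()
  pairs-suffice R R′ irr s s′ h zero (suc j) r = h (first j) r
  pairs-suffice R R′ irr s s′ h (suc i) zero r = trans (s′ (suc i) zero) (h (first i) (trans (s zero (suc i)) r))
  pairs-suffice R R′ irr s s′ h (suc i) (suc j) r = pairs-suffice (λ a b → R (suc a) (suc b)) (λ a b → R′ (suc a) (suc b))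
    (irr ∘ suc) (λ a b → s (suc a) (suc b)) (λ a b → s′ (suc a) (suc b)) (h ∘ later) i j r

  -- A triple with a repeated point is not in `R`, and any other triple is sorted by the symmetries;
  -- so finite checks may run over increasing triples.
  triples-suffice : (R R′ : Fin k → Fin k → Fin k → Bool) → (∀ i j → R i i j ≡ false) →
    (∀ i j l → R i j l ≡ R j i l) → (∀ i j l → R i j l ≡ R i l j) → (∀ i j l → R′ i j l ≡ R′ j i l) → (∀ i j l → R′ i j l ≡ R′ i l j) →
    (∀ t → R (fst³ t) (snd³ t) (thd³ t) ≡ true → R′ (fst³ t) (snd³ t) (thd³ t) ≡ true) → ∀ i j l → R i j l ≡ true → R′ i j l ≡ true
  triples-suffice {k = suc k} R R′ irr a b a′ b′ h = go
    where
    irr₂₃ : ∀ i j → R i j j ≡ false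
    irr₂₃ i j = trans (a i j j) (trans (b j i j) (irr j i))
    from-zero : ∀ j l → R zero (suc j) (suc l) ≡ true → R′ zero (suc j) (suc l) ≡ true
    from-zero = pairs-suffice (λ j l → R zero (suc j) (suc l)) (λ j l → R′ zero (suc j) (suc l)) (λ j → irr₂₃ zero (suc j))
      (λ j l → b zero (suc j) (suc l)) (λ j l → b′ zero (suc j) (suc l)) (h ∘ first)
    absurd : ∀ {x} {A : Set} → x ≡ false → x ≡ true → A
    absurd p q = contradiction (trans (sym q) p) λ ()
    go : ∀ i j l → R i j l ≡ true → R′ i j l ≡ true
    go zero zero l r = absurd (irr zero l) r
    go zero (suc j) zero r = absurd (trans (b zero (suc j) zero) (irr zero (suc j))) r
    go zero (suc j) (suc l) r = from-zero j l r
    go (suc i) zero zero r = absurd (irr₂₃ (suc i) zero) r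
    go (suc i) zero (suc l) r = trans (a′ (suc i) zero (suc l)) (from-zero i l (trans (a zero (suc i) (suc l)) r))
    go (suc i) (suc j) zero r = trans (trans (b′ (suc i) (suc j) zero) (a′ (suc i) zero (suc j)))
      (from-zero i j (trans (trans (a zero (suc i) (suc j)) (b (suc i) zero (suc j))) r))
    go (suc i) (suc j) (suc l) r = triples-suffice (λ x y z → R (suc x) (suc y) (suc z)) (λ x y z → R′ (suc x) (suc y) (suc z))
      (λ x y → irr (suc x) (suc y)) (λ x y z → a _ _ _) (λ x y z → b _ _ _) (λ x y z → a′ _ _ _) (λ x y z → b′ _ _ _) (h ∘ later) i j l r

  record Enumeration (U : Fin n → Bool) : Set where
    field
      size : ℕ
      elem : Fin size → Fin n
      elem-injective : Injective _≡_ _≡_ elem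
      elem-in : ∀ i → U (elem i) ≡ true
      index : ∀ x → U x ≡ true → ∃ λ i → elem i ≡ x

  enumerate : (U : Fin n → Bool) → Enumeration U
  enumerate {zero} U = record { size = 0 ; elem = λ () ; elem-injective = λ { {()} } ; elem-in = λ () ; index = λ () }
  enumerate {suc n} U with U zero in eq | enumerate (U ∘ suc)
  ... | false | E = record
    { size = size ; elem = suc ∘ elem ; elem-injective = elem-injective ∘ suc-injective ; elem-in = elem-in
    ; index = λ { zero p → contradiction (trans (sym p) eq) λ () ; (suc x) p → let (i , q) = index x p in i , cong suc q } }
    where open Enumeration E
  ... | true | E = record
    { size = suc size
    ; elem = λ { zero → zero ; (suc i) → suc (elem i) }
    ; elem-injective = λ { {zero} {zero} _ → refl ; {suc i} {suc j} p → cong suc (elem-injective (suc-injective p)) }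
    ; elem-in = λ { zero → eq ; (suc i) → elem-in i }
    ; index = λ { zero _ → zero , refl ; (suc x) p → let (i , q) = index x p in suc i , cong suc q } }
    where open Enumeration E

  fresh : (S : Fin s → Fin k) → s < k → ∃ λ y → ∀ i → S i ≢ y
  fresh S s<k with any? (λ y → all? λ i → ¬? (S i Fin.≟ y))
  ... | yes p = p
  ... | no none = contradiction (injective⇒≤ {f = λ y → proj₁ (preimage y)} injective) (<⇒≱ s<k)
    where
    preimage : ∀ y → ∃ λ i → S i ≡ y
    preimage y with any? (λ i → S i Fin.≟ y)
    ... | yes p = p
    ... | no q = contradiction (y , λ i eq → q (i , eq)) none
    injective : Injective _≡_ _≡_ (λ y → proj₁ (preimage y))
    injective {y} {z} eq = trans (sym (proj₂ (preimage y))) (trans (cong S eq) (proj₂ (preimage z)))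

  -- Repetitions in ys are replaced by new points, so that the length is kept.
  spread-out : (ys : Vec (Fin k) s) → s ≤ k → Σ (Vec (Fin k) s) λ S → Injective _≡_ _≡_ (lookup S) × (∀ i → ∃ λ j → lookup S j ≡ lookup ys i)
  spread-out [] _ = [] , (λ { {()} }) , λ ()
  spread-out {k} (y ∷ ys) s<k with spread-out ys (≤-trans (n≤1+n _) s<k)
  ... | S , inj , cov with any? (λ j → lookup S j Fin.≟ y)
  ... | yes (j , eq) = let (z , new) = fresh (lookup S) s<k in z ∷ S , extended z new ,
      λ { zero → suc j , eq ; (suc i) → let (j , eq) = cov i in suc j , eq }
    where
    extended : ∀ z → (∀ i → lookup S i ≢ z) → Injective _≡_ _≡_ (lookup (z ∷ S))
    extended z new {zero} {zero} _ = refl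
    extended z new {zero} {suc j} p = contradiction (sym p) (new j)
    extended z new {suc i} {zero} p = contradiction p (new i)
    extended z new {suc i} {suc j} p = cong suc (inj p)
  ... | no new = y ∷ S , extended ,
      λ { zero → zero , refl ; (suc i) → let (j , eq) = cov i in suc j , eq }
    where
    extended : Injective _≡_ _≡_ (lookup (y ∷ S))
    extended {zero} {zero} _ = refl
    extended {zero} {suc j} p = contradiction (j , sym p) new
    extended {suc i} {zero} p = contradiction (i , p) new
    extended {suc i} {suc j} p = cong suc (inj p)

  module FivePoints where
    -- Four classes all of whose triples are edges of G²₆; they serve as distinct colours for any
    -- four or fewer vertices.
    K₄ : Vec (Fin 6) 4
    K₄ = 0F ∷ 2F ∷ 3F ∷ 5F ∷ []

    K₄-edges : ∀ i j l → i ≢ j × j ≢ l × i ≢ l → six (lookup K₄ i) (lookup K₄ j) (lookup K₄ l) ≡ true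
    K₄-edges = toWitness {a? = all? λ i → all? λ j → all? λ l → (¬? (i Fin.≟ j) ×-dec ¬? (j Fin.≟ l) ×-dec ¬? (i Fin.≟ l)) →-dec
      (six (lookup K₄ i) (lookup K₄ j) (lookup K₄ l) Bool.≟ true)} _

    Same : Triple k → Triple k → Set
    Same t u = fst³ t ≡ fst³ u × snd³ t ≡ snd³ u × thd³ t ≡ thd³ u

    same? : (t u : Triple k) → Dec (Same t u)
    same? t u = (fst³ t Fin.≟ fst³ u) ×-dec (snd³ t Fin.≟ snd³ u) ×-dec (thd³ t Fin.≟ thd³ u)

    origin : Triple 5
    origin = first (first zero)

    Good : Triple 5 → Vec (Fin 6) 5 → Set
    Good u v = ∀ t → Same t origin ⊎ Same t u ⊎ six (lookup v (fst³ t)) (lookup v (snd³ t)) (lookup v (thd³ t)) ≡ true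

    candidates : List (Vec (Fin 6) 5)
    candidates = (0F ∷ 1F ∷ 2F ∷ 5F ∷ 3F ∷ []) ∷ (0F ∷ 1F ∷ 2F ∷ 3F ∷ 5F ∷ []) ∷ (0F ∷ 2F ∷ 1F ∷ 5F ∷ 3F ∷ []) ∷ (0F ∷ 2F ∷ 1F ∷ 3F ∷ 5F ∷ []) ∷
      (2F ∷ 0F ∷ 1F ∷ 5F ∷ 3F ∷ []) ∷ (2F ∷ 0F ∷ 1F ∷ 3F ∷ 5F ∷ []) ∷ (2F ∷ 0F ∷ 1F ∷ 3F ∷ 4F ∷ []) ∷ (0F ∷ 2F ∷ 1F ∷ 3F ∷ 4F ∷ []) ∷ (0F ∷ 1F ∷ 2F ∷ 3F ∷ 4F ∷ []) ∷ []

    -- Any five classes of G²₆ miss exactly two triples. These share two classes, or only one if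
    -- class 2 or 5 is left out, so both ways in which two triples of five points can meet occur.
    -- There is one candidate for each of the nine triples other than `origin`.
    five-colouring : ∀ u → ¬ Same u origin → Any (Good u) candidates
    five-colouring = toWitness {a? = allTriples? λ u → ¬? (same? u origin) →-dec Any.any? (λ v → allTriples? λ t →
      same? t origin ⊎-dec same? t u ⊎-dec (six (lookup v (fst³ t)) (lookup v (snd³ t)) (lookup v (thd³ t)) Bool.≟ true)) candidates} _

    -- Renumbers the points so that `t` takes the positions of `origin`. Two points always remain,
    -- so the second clause of `others` is not reached.
    arrange : Triple 5 → Vec (Fin 5) 5
    arrange t = fst³ t ∷ snd³ t ∷ thd³ t ∷ others (List.filter (λ i → ¬? (i Fin.≟ fst³ t) ×-dec ¬? (i Fin.≟ snd³ t) ×-dec ¬? (i Fin.≟ thd³ t)) (List.allFin 5))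
      where
      others : List (Fin 5) → Vec (Fin 5) 2
      others (p ∷ q ∷ _) = p ∷ q ∷ []
      others _ = 0F ∷ 0F ∷ []

    arrange-permutes : ∀ t → (∀ i j → lookup (arrange t) i ≡ lookup (arrange t) j → i ≡ j) × (∀ y → ∃ λ i → lookup (arrange t) i ≡ y)
    arrange-permutes = toWitness {a? = allTriples? λ t → (all? λ i → all? λ j → (lookup (arrange t) i Fin.≟ lookup (arrange t) j) →-dec (i Fin.≟ j)) ×-dec
      (all? λ y → any? λ i → lookup (arrange t) i Fin.≟ y)} _

  Coloured : (Fin n → Fin n → Fin n → Bool) → (Fin n → Bool) → Set
  Coloured e U = ∃ (λ c → Colours e Semi c U) ⊎ ∃ (λ c → Colours e Six c U)

  module Clique {n : ℕ} (G : MFreeRelation n) (U : Fin n → Bool)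
    (clique : ∀ x y → U x ≡ true → U y ≡ true → x ≢ y → MFreeRelation.Covered G x y) where
    open MFreeRelation G
    open FivePoints

    module Core {k : ℕ} (elem : Fin k → Fin n) (elem-injective : Injective _≡_ _≡_ elem) (elem-in : ∀ i → U (elem i) ≡ true)
      (index : ∀ x → U x ≡ true → ∃ λ i → elem i ≡ x) where

      e′ : Fin k → Fin k → Fin k → Bool
      e′ i j l = e (elem i) (elem j) (elem l)

      Edge : Fin k → Fin k → Fin k → Set
      Edge i j l = e′ i j l ≡ true

      covered : PairwiseCovered elem
      covered i j i≢j = clique (elem i) (elem j) (elem-in i) (elem-in j) (i≢j ∘ elem-injective)

      edge-≢₁₂ : ∀ {i j l} → Edge i j l → i ≢ j
      edge-≢₁₂ {i} {j} {l} p refl = contradiction (trans (sym p) (irrefl (elem i) (elem l))) λ ()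

      rot : ∀ {i j l} → Edge i j l → Edge j i l
      rot p = trans (swap₁₂ _ _ _) p

      flip′ : ∀ {i j l} → Edge i j l → Edge i l j
      flip′ p = trans (swap₂₃ _ _ _) p

      edge-≢₁₃ : ∀ {i j l} → Edge i j l → i ≢ l
      edge-≢₁₃ p = edge-≢₁₂ (flip′ p)

      colour : (P : Pattern s) (d : Fin s) (col : Fin k → Fin s) → (∀ i j l → Edge i j l → Pattern.rel P (col i) (col j) (col l) ≡ true) →
        ∃ λ c → Colours e P c U
      colour {s} P d col ok = c , good
        where
        find : ∀ x → Dec (∃ λ i → elem i ≡ x)
        find x = any? λ i → elem i Fin.≟ x
        choose : ∀ {x} → Dec (∃ λ i → elem i ≡ x) → Fin s
        choose (yes (i , _)) = col i
        choose (no _) = d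
        c : Fin n → Fin s
        c x = choose (find x)
        at : ∀ x → U x ≡ true → ∃ λ i → elem i ≡ x × c x ≡ col i
        at x x∈ with find x
        ... | yes (i , eq) = i , eq , refl
        ... | no none = contradiction (index x x∈) none
        good : Colours e P c U
        good x y z x∈ y∈ z∈ p with at x x∈ | at y y∈ | at z z∈
        ... | i , refl , ci | j , refl , cj | l , refl , cl = subst (λ a → Pattern.rel P a (c (elem j)) (c (elem l)) ≡ true) (sym ci)
          (subst₂ (λ a b → Pattern.rel P (col i) a b ≡ true) (sym cj) (sym cl) (ok i j l p))

      -- The common vertex of all edges forms the part A by itself.
      centre-colours : ∃ (Centre elem) → Coloured e U
      centre-colours (d , centre) = inj₁ (colour Semi 0F col ok)
        where
        col : Fin k → Fin 2
        col i with i Fin.≟ d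
        ... | yes _ = 0F
        ... | no _ = 1F
        ok : ∀ i j l → Edge i j l → semi (col i) (col j) (col l) ≡ true
        ok i j l p with i Fin.≟ d | j Fin.≟ d | l Fin.≟ d
        ... | yes refl | yes refl | _ = contradiction refl (edge-≢₁₂ p)
        ... | yes refl | no _ | yes refl = contradiction refl (edge-≢₁₃ p)
        ... | yes refl | no _ | no _ = refl
        ... | no _ | yes refl | yes refl = contradiction refl (edge-≢₁₃ (rot p))
        ... | no _ | yes refl | no _ = refl
        ... | no _ | no _ | yes refl = refl
        ... | no a | no b | no c = ⊥-elim ([ a , [ b , c ]′ ]′ (centre i j l p))

      six-colours : (col : Fin k → Fin 6) → (∀ t → Edge (fst³ t) (snd³ t) (thd³ t) → six (col (fst³ t)) (col (snd³ t)) (col (thd³ t)) ≡ true) → Coloured e U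
      six-colours col ok = inj₂ (colour Six 0F col (triples-suffice e′ (λ i j l → six (col i) (col j) (col l))
        (λ i j → irrefl _ _) (λ i j l → swap₁₂ _ _ _) (λ i j l → swap₂₃ _ _ _)
        (λ i j l → Pattern.sym₁₂ Six (col i) (col j) (col l)) (λ i j l → Pattern.sym₂₃ Six (col i) (col j) (col l)) ok))

      -- A Helly-type argument: edges on at most seven points share a point. If no point lay on all
      -- edges, one edge would generate four edges on six points without a common point.
      module Large (7≤k : 7 ≤ k) (avoid : ∀ d → ∃ λ p → ∃ λ q → ∃ λ r → Edge p q r × p ≢ d × q ≢ d × r ≢ d) where

        _∈_ : Fin k → Vec (Fin k) 7 → Set
        x ∈ ys = ∃ λ i → lookup ys i ≡ x

        opaque
          star : (ys : Vec (Fin k) 7) → ∃ λ d → ∀ {p q r} → p ∈ ys → q ∈ ys → r ∈ ys → Edge p q r → p ≡ d ⊎ q ≡ d ⊎ r ≡ d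
          star ys = let (S , inj , cov) = spread-out ys 7≤k
                        (d , centre) = seven (elem ∘ lookup S) (λ i j i≢j → covered _ _ (i≢j ∘ inj))
                    in lookup S d , λ { (i , refl) (j , refl) (l , refl) p → found S cov centre i j l p }
            where
            found : ∀ (S : Vec (Fin k) 7) → (cov : ∀ i → ∃ λ j → lookup S j ≡ lookup ys i) → ∀ {d} → Centre (elem ∘ lookup S) d → ∀ i j l →
              Edge (lookup ys i) (lookup ys j) (lookup ys l) → lookup ys i ≡ lookup S d ⊎ lookup ys j ≡ lookup S d ⊎ lookup ys l ≡ lookup S d
            found S cov centre i j l p with cov i | cov j | cov l
            ... | i′ , a | j′ , b | l′ , c with centre i′ j′ l′ (trans (cong₂ (λ x y → e′ x y (lookup S l′)) a b) (trans (cong (e′ (lookup ys i) (lookup ys j)) c) p))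
            ... | inj₁ refl = inj₁ (sym a)
            ... | inj₂ (inj₁ refl) = inj₂ (inj₁ (sym b))
            ... | inj₂ (inj₂ refl) = inj₂ (inj₂ (sym c))

        meet : ∀ {a b c p q r} → Edge a b c → Edge p q r → ∃ λ d → (a ≡ d ⊎ b ≡ d ⊎ c ≡ d) × (p ≡ d ⊎ q ≡ d ⊎ r ≡ d)
        meet {a} {b} {c} {p} {q} {r} E F with star (a ∷ b ∷ c ∷ p ∷ q ∷ r ∷ r ∷ [])
        ... | d , h = d , h (0F , refl) (1F , refl) (2F , refl) E , h (3F , refl) (4F , refl) (5F , refl) F

        record Front (Q : Fin k → Set) (p q r d : Fin k) : Set where
          field
            x y : Fin k
            edge : Edge d x y
            Qx : Q x
            Qy : Q y
            complete : ∀ z → p ≡ z ⊎ q ≡ z ⊎ r ≡ z → d ≡ z ⊎ x ≡ z ⊎ y ≡ z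

        front : ∀ {p q r} d (Q : Fin k → Set) → Edge p q r → Q p → Q q → Q r → p ≡ d ⊎ q ≡ d ⊎ r ≡ d → Front Q p q r d
        front {p} {q} {r} d Q E Qp Qq Qr (inj₁ refl) = record { x = q ; y = r ; edge = E ; Qx = Qq ; Qy = Qr ; complete = λ _ h → h }
        front {p} {q} {r} d Q E Qp Qq Qr (inj₂ (inj₁ refl)) = record { x = p ; y = r ; edge = rot E ; Qx = Qp ; Qy = Qr
          ; complete = λ { _ (inj₁ eq) → inj₂ (inj₁ eq) ; _ (inj₂ (inj₁ eq)) → inj₁ eq ; _ (inj₂ (inj₂ eq)) → inj₂ (inj₂ eq) } }
        front {p} {q} {r} d Q E Qp Qq Qr (inj₂ (inj₂ refl)) = record { x = p ; y = q ; edge = rot (flip′ E) ; Qx = Qp ; Qy = Qq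
          ; complete = λ { _ (inj₁ eq) → inj₂ (inj₁ eq) ; _ (inj₂ (inj₁ eq)) → inj₂ (inj₂ eq) ; _ (inj₂ (inj₂ eq)) → inj₁ eq } }

        private
          close : ∀ {a d o x y} s t z → Edge a d o → Edge d x y → x ≢ a → y ≢ a → x ≢ o → y ≢ o →
            a ≡ s ⊎ o ≡ s → x ≡ t ⊎ y ≡ t → d ≢ s → d ≢ t → d ≢ z → Edge s t z → ⊥
          close {a} {d} {o} {x} {y} s t z E F x≢a y≢a x≢o y≢o s∈ t∈ d≢s d≢t d≢z K = conclude (star ys)
            where
            ys : Vec (Fin k) 7
            ys = a ∷ d ∷ o ∷ x ∷ y ∷ z ∷ z ∷ []
            s-in : a ≡ s ⊎ o ≡ s → s ∈ ys
            s-in (inj₁ eq) = 0F , eq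
            s-in (inj₂ eq) = 2F , eq
            t-in : x ≡ t ⊎ y ≡ t → t ∈ ys
            t-in (inj₁ eq) = 3F , eq
            t-in (inj₂ eq) = 4F , eq
            is-d : ∀ u → d ≡ u ⊎ x ≡ u ⊎ y ≡ u → a ≡ u ⊎ d ≡ u ⊎ o ≡ u → d ≡ u
            is-d u (inj₁ eq) _ = eq
            is-d u (inj₂ _) (inj₂ (inj₁ eq)) = eq
            is-d u (inj₂ (inj₁ eq)) (inj₁ eq′) = contradiction (trans eq (sym eq′)) x≢a
            is-d u (inj₂ (inj₂ eq)) (inj₁ eq′) = contradiction (trans eq (sym eq′)) y≢a
            is-d u (inj₂ (inj₁ eq)) (inj₂ (inj₂ eq′)) = contradiction (trans eq (sym eq′)) x≢o
            is-d u (inj₂ (inj₂ eq)) (inj₂ (inj₂ eq′)) = contradiction (trans eq (sym eq′)) y≢o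
            none : ∀ u → d ≡ u → s ≡ u ⊎ t ≡ u ⊎ z ≡ u → ⊥
            none u eq (inj₁ eq′) = d≢s (trans eq (sym eq′))
            none u eq (inj₂ (inj₁ eq′)) = d≢t (trans eq (sym eq′))
            none u eq (inj₂ (inj₂ eq′)) = d≢z (trans eq (sym eq′))
            conclude : (∃ λ u → ∀ {p q r} → p ∈ ys → q ∈ ys → r ∈ ys → Edge p q r → p ≡ u ⊎ q ≡ u ⊎ r ≡ u) → ⊥
            conclude (u , h) = none u (is-d u (h (1F , refl) (3F , refl) (4F , refl) F) (h (0F , refl) (1F , refl) (2F , refl) E)) (h (s-in s∈) (t-in t∈) (5F , refl) K)

        -- The edges a d o and d x y would meet in d only. An edge avoiding d meets them in
        -- different points, hence has at most one further point, and the three edges lie on at most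
        -- six points. Their common point would have to be d.
        far : ∀ {a d o x y} → Edge a d o → Edge d x y → x ≢ a → y ≢ a → x ≢ o → y ≢ o → ⊥
        far {a} {d} {o} {x} {y} E F x≢a y≢a x≢o y≢o with avoid d
        ... | p , q , r , H , p≢d , q≢d , r≢d with meet E H | meet F H
        ... | s , s∈E , s∈H | t , t∈F , t∈H = third (Front.complete K t t∈H)
          where
          K : Front (_≢ d) p q r s
          K = front s (_≢ d) H p≢d q≢d r≢d s∈H
          d≢s : d ≢ s
          d≢s eq = [ (λ eq′ → p≢d (trans eq′ (sym eq))) , [ (λ eq′ → q≢d (trans eq′ (sym eq))) , (λ eq′ → r≢d (trans eq′ (sym eq))) ]′ ]′ s∈H
          d≢t : d ≢ t
          d≢t eq = [ (λ eq′ → p≢d (trans eq′ (sym eq))) , [ (λ eq′ → q≢d (trans eq′ (sym eq))) , (λ eq′ → r≢d (trans eq′ (sym eq))) ]′ ]′ t∈H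
          drop : a ≡ s ⊎ d ≡ s ⊎ o ≡ s → a ≡ s ⊎ o ≡ s
          drop (inj₁ eq) = inj₁ eq
          drop (inj₂ (inj₁ eq)) = contradiction eq d≢s
          drop (inj₂ (inj₂ eq)) = inj₂ eq
          drop′ : d ≡ t ⊎ x ≡ t ⊎ y ≡ t → x ≡ t ⊎ y ≡ t
          drop′ (inj₁ eq) = contradiction eq d≢t
          drop′ (inj₂ eq) = eq
          distinct : a ≡ s ⊎ o ≡ s → x ≡ t ⊎ y ≡ t → s ≢ t
          distinct (inj₁ p) (inj₁ q) eq = x≢a (trans q (sym (trans p eq)))
          distinct (inj₁ p) (inj₂ q) eq = y≢a (trans q (sym (trans p eq)))
          distinct (inj₂ p) (inj₁ q) eq = x≢o (trans q (sym (trans p eq)))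
          distinct (inj₂ p) (inj₂ q) eq = y≢o (trans q (sym (trans p eq)))
          finish : ∀ z → d ≢ z → Edge s t z → ⊥
          finish z d≢z = close s t z E F x≢a y≢a x≢o y≢o (drop s∈E) (drop′ t∈F) d≢s d≢t d≢z
          third : s ≡ t ⊎ Front.x K ≡ t ⊎ Front.y K ≡ t → ⊥
          third (inj₁ eq) = distinct (drop s∈E) (drop′ t∈F) eq
          third (inj₂ (inj₁ eq)) = finish (Front.y K) (λ eq → Front.Qy K (sym eq)) (subst (λ i → Edge s i (Front.y K)) eq (Front.edge K))
          third (inj₂ (inj₂ eq)) = finish (Front.x K) (λ eq → Front.Qx K (sym eq)) (flip′ (subst (λ i → Edge s (Front.x K) i) eq (Front.edge K)))

        near : ∀ {a d o x y} → Edge a d o → Edge d x y → x ≢ a → y ≢ a → ∃ λ z → Edge d o z × z ≢ a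
        near {a} {d} {o} {x} {y} E F x≢a y≢a with x Fin.≟ o | y Fin.≟ o
        ... | yes refl | _ = y , F , y≢a
        ... | no _ | yes refl = x , flip′ F , x≢a
        ... | no x≢o | no y≢o = ⊥-elim (far E F x≢a y≢a x≢o y≢o)

        -- An edge avoiding `a` meets `E` in b or c. By `far` it cannot meet `E` in just that point,
        -- so it contains both.
        opposite : ∀ {a b c} → Edge a b c → ∃ λ z → Edge b c z × z ≢ a
        opposite {a} {b} {c} E with avoid a
        ... | p , q , r , H , p≢a , q≢a , r≢a with meet E H
        ... | s , inj₁ eq , s∈H = ⊥-elim ([ (λ eq′ → p≢a (trans eq′ (sym eq))) , [ (λ eq′ → q≢a (trans eq′ (sym eq))) , (λ eq′ → r≢a (trans eq′ (sym eq))) ]′ ]′ s∈H)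
        ... | s , inj₂ (inj₁ refl) , s∈H = near E (Front.edge K) (Front.Qx K) (Front.Qy K)
          where
          K : Front (_≢ a) p q r b
          K = front b (_≢ a) H p≢a q≢a r≢a s∈H
        ... | s , inj₂ (inj₂ refl) , s∈H = let (z , F , z≢a) = near (flip′ E) (Front.edge K) (Front.Qx K) (Front.Qy K) in z , rot F , z≢a
          where
          K : Front (_≢ a) p q r c
          K = front c (_≢ a) H p≢a q≢a r≢a s∈H

        -- Exchanging each vertex of `E` in turn gives b c x, a c y, a b z: with `E` they lie on six
        -- points, and each point of `E` is missed by one of them.
        no-edge : ∀ {a b c} → Edge a b c → ⊥
        no-edge {a} {b} {c} E with opposite E | opposite (rot E) | opposite (rot (flip′ E))
        ... | x , F , x≢a | y , F′ , y≢b | z , F″ , z≢c with star (a ∷ b ∷ c ∷ x ∷ y ∷ z ∷ z ∷ [])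
        ... | u , h = contra (h (0F , refl) (1F , refl) (2F , refl) E) (h (1F , refl) (2F , refl) (3F , refl) F)
            (h (0F , refl) (2F , refl) (4F , refl) F′) (h (0F , refl) (1F , refl) (5F , refl) F″)
          where
          miss : ∀ {v₁ v₂ v₃ v} → v ≡ u → v₁ ≢ v → v₂ ≢ v → v₃ ≢ v → v₁ ≡ u ⊎ v₂ ≡ u ⊎ v₃ ≡ u → ⊥
          miss refl p q r = [ p , [ q , r ]′ ]′
          contra : a ≡ u ⊎ b ≡ u ⊎ c ≡ u → b ≡ u ⊎ c ≡ u ⊎ x ≡ u → a ≡ u ⊎ c ≡ u ⊎ y ≡ u → a ≡ u ⊎ b ≡ u ⊎ z ≡ u → ⊥
          contra (inj₁ eq) h _ _ = miss eq (λ p → edge-≢₁₂ E (sym p)) (λ p → edge-≢₁₃ E (sym p)) x≢a h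
          contra (inj₂ (inj₁ eq)) _ h _ = miss eq (edge-≢₁₂ E) (λ p → edge-≢₁₃ (rot E) (sym p)) y≢b h
          contra (inj₂ (inj₂ eq)) _ _ h = miss eq (edge-≢₁₃ E) (edge-≢₁₃ (rot E)) z≢c h

      large : 7 ≤ k → Coloured e U
      large 7≤k with any? (λ d → all? λ p → all? λ q → all? λ r → (e′ p q r Bool.≟ true) →-dec ((p Fin.≟ d) ⊎-dec (q Fin.≟ d) ⊎-dec (r Fin.≟ d)))
      ... | yes centre = centre-colours centre
      -- The point avoided is arbitrary; only some edge is wanted.
      ... | no none = let (p , q , r , E , _) = avoid (inject≤ {7} 0F 7≤k) in ⊥-elim (Large.no-edge 7≤k avoid E)
        where
        avoid : ∀ d → ∃ λ p → ∃ λ q → ∃ λ r → Edge p q r × p ≢ d × q ≢ d × r ≢ d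
        avoid d with any? (λ p → any? λ q → any? λ r → (e′ p q r Bool.≟ true) ×-dec ¬? (p Fin.≟ d) ×-dec ¬? (q Fin.≟ d) ×-dec ¬? (r Fin.≟ d))
        ... | yes found = found
        ... | no nope = contradiction (d , λ p q r E → meets p q r E) none
          where
          meets : ∀ p q r → Edge p q r → p ≡ d ⊎ q ≡ d ⊎ r ≡ d
          meets p q r E with p Fin.≟ d | q Fin.≟ d | r Fin.≟ d
          ... | yes eq | _ | _ = inj₁ eq
          ... | no _ | yes eq | _ = inj₂ (inj₁ eq)
          ... | no _ | no _ | yes eq = inj₂ (inj₂ eq)
          ... | no a | no b | no c = contradiction (p , q , r , E , a , b , c) nope

      small : k ≤ 4 → Coloured e U
      small k≤4 = inj₂ (colour Six 0F (λ i → lookup K₄ (inject≤ i k≤4)) λ i j l E →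
        K₄-edges (inject≤ i k≤4) (inject≤ j k≤4) (inject≤ l k≤4) (edge-≢₁₂ E ∘ inj , edge-≢₁₃ (rot E) ∘ inj , edge-≢₁₃ E ∘ inj))
        where
        inj : ∀ {i j} → inject≤ i k≤4 ≡ inject≤ j k≤4 → i ≡ j
        inj = inject≤-injective k≤4 k≤4 _ _

    module FiveCore (elem : Fin 5 → Fin n) (elem-injective : Injective _≡_ _≡_ elem) (elem-in : ∀ i → U (elem i) ≡ true)
      (index : ∀ x → U x ≡ true → ∃ λ i → elem i ≡ x) where
      open Core elem elem-injective elem-in index

      at : Triple 5 → Bool
      at t = e′ (fst³ t) (snd³ t) (thd³ t)

      two-non-edges : at origin ≢ true → ∀ u → ¬ Same u origin → at u ≢ true → Coloured e U
      two-non-edges ¬o u u≢o ¬u = let (v , good) = Any.satisfied (five-colouring u u≢o) in six-colours (lookup v) λ t E → pick v t E (good t)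
        where
        move : ∀ {t u} → Same t u → at t ≡ true → at u ≡ true
        move (p , q , r) E = trans (trans (cong (λ i → e′ i _ _) (sym p)) (trans (cong (λ i → e′ _ i _) (sym q)) (cong (e′ _ _) (sym r)))) E
        pick : ∀ v t → at t ≡ true → Same t origin ⊎ Same t u ⊎ six (lookup v (fst³ t)) (lookup v (snd³ t)) (lookup v (thd³ t)) ≡ true →
          six (lookup v (fst³ t)) (lookup v (snd³ t)) (lookup v (thd³ t)) ≡ true
        pick v t E (inj₁ same) = contradiction (move {t} {origin} same E) ¬o
        pick v t E (inj₂ (inj₁ same)) = contradiction (move {t} {u} same E) ¬u
        pick v t E (inj₂ (inj₂ p)) = p

      with-origin : at origin ≢ true → Coloured e U
      with-origin ¬o with triple-or-counterexample (λ t → ¬? (same? t origin) →-dec (at t Bool.≟ true))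
      ... | inj₁ h = ⊥-elim (five elem elem-injective λ t t≢o → h t λ same → t≢o (is-origin t same))
        where
        is-origin : ∀ t → Same t origin → t ≡ first (first zero)
        is-origin (first (first zero)) _ = refl
      ... | inj₂ (u , ¬h) with same? u origin
      ... | yes same = ⊥-elim (¬h λ u≢o → contradiction same u≢o)
      ... | no u≢o = two-non-edges ¬o u u≢o λ E → ¬h λ _ → E

    module FivePoint (elem : Fin 5 → Fin n) (elem-injective : Injective _≡_ _≡_ elem) (elem-in : ∀ i → U (elem i) ≡ true)
      (index : ∀ x → U x ≡ true → ∃ λ i → elem i ≡ x) where

      coloured : Coloured e U
      coloured with triple-or-counterexample (λ t → e (elem (fst³ t)) (elem (snd³ t)) (elem (thd³ t)) Bool.≟ true)
      ... | inj₁ h = ⊥-elim (five elem elem-injective λ t _ → h t)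
      ... | inj₂ (t , ¬h) = FiveCore.with-origin (elem ∘ lookup (arrange t)) (λ {i} {j} p → proj₁ (arrange-permutes t) i j (elem-injective p)) (elem-in ∘ lookup (arrange t))
          index′ ¬h
        where
        index′ : ∀ x → U x ≡ true → ∃ λ i → elem (lookup (arrange t) i) ≡ x
        index′ x x∈ = let (i , p) = index x x∈ ; (j , q) = proj₂ (arrange-permutes t) i in j , trans (cong elem q) p

    private
      by-size : ∀ k (elem : Fin k → Fin n) → Injective _≡_ _≡_ elem → (∀ i → U (elem i) ≡ true) → (∀ x → U x ≡ true → ∃ λ i → elem i ≡ x) → Coloured e U
      by-size 0 f a b c = Core.small f a b c z≤n
      by-size 1 f a b c = Core.small f a b c (s≤s z≤n)
      by-size 2 f a b c = Core.small f a b c (s≤s (s≤s z≤n))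
      by-size 3 f a b c = Core.small f a b c (s≤s (s≤s (s≤s z≤n)))
      by-size 4 f a b c = Core.small f a b c (s≤s (s≤s (s≤s (s≤s z≤n))))
      by-size 5 f a b c = FivePoint.coloured f a b c
      by-size 6 f a b c with sixth f (Core.covered f a b c)
      ... | inj₁ centre = Core.centre-colours f a b c centre
      ... | inj₂ (σ , _ , ok) = inj₂ (Core.colour f a b c Six 0F σ ok)
      by-size (suc (suc (suc (suc (suc (suc (suc k))))))) f a b c = Core.large f a b c (m≤m+n 7 k)

    clique-coloured : Coloured e U
    clique-coloured = by-size size elem elem-injective elem-in index
      where open Enumeration (enumerate U)

-- Symmetrisation with integer weights, and its reversal.

module Symmetrisation where

  open Integration
  open Configurations
  open Extension
  open SemiExtension
  open SixVolume
  open SixExtension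
  open Cliques
  open import Data.Nat
  open import Data.Nat.Properties
  open import Data.Nat.Tactic.RingSolver using (solve-∀)
  open import Data.Bool using (Bool; true; false; _∧_; _∨_; not)
  import Data.Bool.Properties as Bool
  open import Data.Fin using (Fin; zero; suc)
  open import Data.Fin.Properties using (any?)
  import Data.Fin as Fin
  open import Data.Product using (∃; _×_; _,_; proj₁; proj₂)
  open import Data.Sum using (inj₁; inj₂; [_,_]′)
  open import Function using (_∘_)
  open import Relation.Nullary using (¬_; Dec; yes; no; does; contradiction; ¬?; _×-dec_)
  open import Relation.Binary.Definitions using (tri<; tri≈; tri>)
  open import Relation.Binary.PropositionalEquality hiding (J)

  private variable
    n : ℕ

  ∧-intro : ∀ {a b} → a ≡ true → b ≡ true → a ∧ b ≡ true
  ∧-intro refl refl = refl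

  ∧-elim : ∀ {a b} → a ∧ b ≡ true → a ≡ true × b ≡ true
  ∧-elim {true} {true} _ = refl , refl

  coloured-⊆ : (e : Fin n → Fin n → Fin n → Bool) {U V : Fin n → Bool} → (∀ x → V x ≡ true → U x ≡ true) → Coloured e U → Coloured e V
  coloured-⊆ e V⊆U (inj₁ (c , col)) = inj₁ (c , λ x y z x∈ y∈ z∈ → col x y z (V⊆U x x∈) (V⊆U y y∈) (V⊆U z z∈))
  coloured-⊆ e V⊆U (inj₂ (c , col)) = inj₂ (c , λ x y z x∈ y∈ z∈ → col x y z (V⊆U x x∈) (V⊆U y y∈) (V⊆U z z∈))

  positive : ℕ → Bool
  positive zero = false
  positive (suc _) = true

  supp : (Fin n → ℕ) → Fin n → Bool
  supp w x = positive (w x)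

  supp⁺ : (w : Fin n → ℕ) (x : Fin n) → 0 < w x → supp w x ≡ true
  supp⁺ w x p with w x
  supp⁺ w x (s≤s _) | suc _ = refl

  supp⁻ : (w : Fin n → ℕ) (x : Fin n) → supp w x ≡ true → 0 < w x
  supp⁻ w x p with w x
  ... | suc _ = z<s

  coloured-volume : (e : Fin n → Fin n → Fin n → Bool) (w : Fin n → ℕ) → Coloured e (supp w) → 9 * vol e w ≤ 4 * (sum w * sum w * sum w)
  coloured-volume {n} e w col = [ (λ (c , h) → ≤-trans (*-monoʳ-≤ 9 (below Semi c h)) (semi-bound c w)) , (λ (c , h) → ≤-trans (*-monoʳ-≤ 9 (below Six c h)) (six-bound c w)) ]′ col
    where
    mono : ∀ {a b} → (a ≡ true → b ≡ true) → ⟦ a ⟧ ≤ ⟦ b ⟧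
    mono {false} h = z≤n
    mono {true} h rewrite h refl = ≤-refl
    below : ∀ {s} (P : Pattern s) c → Colours e P c (supp w) → vol e w ≤ vol (blow P c) w
    below P c h = ∫-mono w λ x x∈ → ∫-mono w λ y y∈ → ∫-mono w λ z z∈ → mono (h x y z (supp⁺ w x x∈) (supp⁺ w y y∈) (supp⁺ w z z∈))

  deg-cong : (e : Fin n → Fin n → Fin n → Bool) {w w′ : Fin n → ℕ} → (∀ x → w x ≡ w′ x) → ∀ x → deg e w x ≡ deg e w′ x
  deg-cong e {w} {w′} h x = trans (∫-cong w λ y → ∫-congˡ _ h) (∫-congˡ _ h)

  vol-cong : (e : Fin n → Fin n → Fin n → Bool) {w w′ : Fin n → ℕ} → (∀ x → w x ≡ w′ x) → vol e w ≡ vol e w′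
  vol-cong e {w} {w′} h = trans (∫-cong w λ x → deg-cong e h x) (∫-congˡ _ h)

  deg≤ : (e : Fin n → Fin n → Fin n → Bool) (w : Fin n → ℕ) (x : Fin n) → deg e w x ≤ sum w * sum w
  deg≤ e w x = ∫≤ w (sum w) λ y _ → ≤-trans (∫≤ w 1 λ z _ → ⟦⟧≤1 (e x y z)) (≤-reflexive (*-identityʳ (sum w)))

  vol≤ : (e : Fin n → Fin n → Fin n → Bool) (w : Fin n → ℕ) → vol e w ≤ sum w * (sum w * sum w)
  vol≤ e w = ∫≤ w (sum w * sum w) λ x _ → deg≤ e w x

  leftover : (Fin n → ℕ) → (Fin n → Bool) → ℕ
  leftover w U = sum (w ↾ (not ∘ U))

  -- A pair that is lost has its first or its second vertex outside `U`.
  deg-restrict : (e : Fin n → Fin n → Fin n → Bool) (w : Fin n → ℕ) (U : Fin n → Bool) (x : Fin n) →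
    deg e w x ≤ deg e (w ↾ U) x + 2 * (leftover w U * sum w)
  deg-restrict {n} e w U x = begin
    ∫ w (λ y → ∫ w (f y))                                       ≡⟨ ∫-split w U _ ⟩
    ∫ (w ↾ U) (λ y → ∫ w (f y)) + ∫ V (λ y → ∫ w (f y))         ≤⟨ +-mono-≤ inner (∫≤ V (sum w) λ y _ → small w y) ⟩
    deg e (w ↾ U) x + sum w * r + r * sum w                     ≡⟨ id₁ (deg e (w ↾ U) x) (sum w) r ⟩
    deg e (w ↾ U) x + 2 * (r * sum w)                           ∎
    where
    open ≤-Reasoning
    V = w ↾ (not ∘ U)
    r = leftover w U
    f : Fin n → Fin n → ℕ
    f y z = ⟦ e x y z ⟧
    small : ∀ μ y → ∫ μ (f y) ≤ sum μ
    small μ y = ≤-trans (∫≤ μ 1 λ z _ → ⟦⟧≤1 (e x y z)) (≤-reflexive (*-identityʳ (sum μ)))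
    inner : ∫ (w ↾ U) (λ y → ∫ w (f y)) ≤ deg e (w ↾ U) x + sum w * r
    inner = begin
      ∫ (w ↾ U) (λ y → ∫ w (f y))                                        ≡⟨ ∫-cong (w ↾ U) (λ y → ∫-split w U (f y)) ⟩
      ∫ (w ↾ U) (λ y → ∫ (w ↾ U) (f y) + ∫ V (f y))                      ≡⟨ ∫-+ (w ↾ U) _ _ ⟩
      deg e (w ↾ U) x + ∫ (w ↾ U) (λ y → ∫ V (f y))                      ≤⟨ +-monoʳ-≤ _ (∫≤ (w ↾ U) r λ y _ → small V y) ⟩
      deg e (w ↾ U) x + sum (w ↾ U) * r                                  ≤⟨ +-monoʳ-≤ (deg e (w ↾ U) x) (*-monoˡ-≤ r (sum-mono (↾≤ w U))) ⟩
      deg e (w ↾ U) x + sum w * r                                        ∎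
    id₁ : ∀ d m r → d + m * r + r * m ≡ d + 2 * (r * m)
    id₁ = solve-∀

  squares : (Fin n → ℕ) → ℕ
  squares w = ∫ w w

  -- The weights before and after a move are `u` ⊹ x and `u` ⊹ y over a common part `u`, which keeps
  -- all differences on the side where they are added.
  module Shift {n : ℕ} (G : MFreeRelation n) (u : Fin n → ℕ) where
    open MFreeRelation G

    infixl 6 _⊹_
    _⊹_ : (Fin n → ℕ) → Fin n → Fin n → ℕ
    (u ⊹ x) z = u z + δ x z

    codeg : Fin n → Fin n → ℕ
    codeg a b = ∫ u λ z → ⟦ e a b z ⟧

    ∫-⊹ : ∀ x f → ∫ (u ⊹ x) f ≡ ∫ u f + f x
    ∫-⊹ x f = trans (∫-+ˡ u (δ x) f) (cong (∫ u f +_) (∫-δ x f))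

    mass-⊹ : ∀ x → sum (u ⊹ x) ≡ sum u + 1
    mass-⊹ x = trans (sym (∫-1 (u ⊹ x))) (trans (∫-⊹ x _) (cong (_+ 1) (∫-1 u)))

    irrefl₂₃ : ∀ a x → e a x x ≡ false
    irrefl₂₃ a x = trans (swap₁₂ a x x) (trans (swap₂₃ x a x) (irrefl x a))

    deg-⊹ : ∀ x a → deg e (u ⊹ x) a ≡ deg e u a + 2 * codeg a x
    deg-⊹ x a = begin
      ∫ (u ⊹ x) (λ b → ∫ (u ⊹ x) λ z → ⟦ e a b z ⟧)                   ≡⟨ ∫-⊹ x _ ⟩
      ∫ u (λ b → ∫ (u ⊹ x) λ z → ⟦ e a b z ⟧) + ∫ (u ⊹ x) (λ z → ⟦ e a x z ⟧)
        ≡⟨ cong₂ _+_ (trans (∫-cong u λ b → ∫-⊹ x _) (∫-+ u _ _)) (∫-⊹ x _) ⟩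
      deg e u a + ∫ u (λ b → ⟦ e a b x ⟧) + (codeg a x + ⟦ e a x x ⟧)
        ≡⟨ cong₂ (λ s t → deg e u a + s + (codeg a x + t)) (∫-cong u λ b → cong ⟦_⟧ (swap₂₃ a b x)) (cong ⟦_⟧ (irrefl₂₃ a x)) ⟩
      deg e u a + codeg a x + (codeg a x + 0)                         ≡⟨ id₁ (deg e u a) (codeg a x) ⟩
      deg e u a + 2 * codeg a x                                       ∎
      where
      open ≡-Reasoning
      id₁ : ∀ d t → d + t + (t + 0) ≡ d + 2 * t
      id₁ = solve-∀

    codeg-self : ∀ x → codeg x x ≡ 0
    codeg-self x = ∫-zero u λ z _ → cong ⟦_⟧ (irrefl x z)

    deg-⊹-self : ∀ x → deg e (u ⊹ x) x ≡ deg e u x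
    deg-⊹-self x = trans (deg-⊹ x x) (trans (cong (λ t → deg e u x + 2 * t) (codeg-self x)) (+-identityʳ _))

    vol-⊹ : ∀ x → vol e (u ⊹ x) ≡ vol e u + 3 * deg e u x
    vol-⊹ x = begin
      ∫ (u ⊹ x) (deg e (u ⊹ x))                                       ≡⟨ ∫-⊹ x _ ⟩
      ∫ u (deg e (u ⊹ x)) + deg e (u ⊹ x) x                           ≡⟨ cong₂ _+_ (trans (∫-cong u (deg-⊹ x)) (trans (∫-+ u _ _) (cong (vol e u +_) (∫-* u 2 _)))) (deg-⊹-self x) ⟩
      vol e u + 2 * ∫ u (λ a → codeg a x) + deg e u x                 ≡⟨ cong (λ t → vol e u + 2 * t + deg e u x) (∫-cong u λ a → ∫-cong u λ z → cong ⟦_⟧ (swap₁₂ a x z)) ⟩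
      vol e u + 2 * deg e u x + deg e u x                             ≡⟨ id₁ (vol e u) (deg e u x) ⟩
      vol e u + 3 * deg e u x                                         ∎
      where
      open ≡-Reasoning
      id₁ : ∀ v d → v + 2 * d + d ≡ v + 3 * d
      id₁ = solve-∀

    -- An exact formula: moving a unit from x to y adds 3 (deg y - deg x) - 6 codeg to the volume.
    -- The correction vanishes for uncovered pairs, which is what Zykov symmetrisation rests on.
    vol-shift : ∀ x y → vol e (u ⊹ y) + 3 * deg e (u ⊹ x) x + 6 * codeg y x ≡ vol e (u ⊹ x) + 3 * deg e (u ⊹ x) y
    vol-shift x y = begin
      vol e (u ⊹ y) + 3 * deg e (u ⊹ x) x + 6 * codeg y x              ≡⟨ cong₂ (λ s t → s + 3 * t + 6 * codeg y x) (vol-⊹ y) (deg-⊹-self x) ⟩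
      vol e u + 3 * deg e u y + 3 * deg e u x + 6 * codeg y x          ≡⟨ id₁ (vol e u) (deg e u x) (deg e u y) (codeg y x) ⟩
      vol e u + 3 * deg e u x + 3 * (deg e u y + 2 * codeg y x)        ≡⟨ cong₂ (λ s t → s + 3 * t) (sym (vol-⊹ x)) (sym (deg-⊹ x y)) ⟩
      vol e (u ⊹ x) + 3 * deg e (u ⊹ x) y                              ∎
      where
      open ≡-Reasoning
      id₁ : ∀ v a b c → v + 3 * b + 3 * a + 6 * c ≡ v + 3 * a + 3 * (b + 2 * c)
      id₁ = solve-∀

    squares-⊹ : ∀ x → squares (u ⊹ x) ≡ squares u + 2 * u x + 1
    squares-⊹ x = begin
      ∫ (u ⊹ x) (u ⊹ x)                                ≡⟨ ∫-⊹ x _ ⟩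
      ∫ u (λ z → u z + δ x z) + (u x + δ x x)          ≡⟨ cong₂ _+_ (∫-+ u u (δ x)) (cong (u x +_) (δ-self x)) ⟩
      squares u + ∫ u (δ x) + (u x + 1)                ≡⟨ cong (λ t → squares u + t + (u x + 1)) (trans (∫-comm u (δ x)) (∫-δ x u)) ⟩
      squares u + u x + (u x + 1)                      ≡⟨ id₁ (squares u) (u x) ⟩
      squares u + 2 * u x + 1                          ∎
      where
      open ≡-Reasoning
      id₁ : ∀ s t → s + t + (t + 1) ≡ s + 2 * t + 1
      id₁ = solve-∀

  module Process {n : ℕ} (G : MFreeRelation n) (J : ℕ) (scale : Scale J) where
    open MFreeRelation G

    -- `K` = 2 `J`² grants half of the degree tolerance of a `Situation`; the other half is spent on
    -- restricting the weight to the coloured set. A leftover of m/`R` costs 2 m²/`R` there, whence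
    -- `R` = 36 `J`². `A` = 2 `K` `R` keeps the leftover of a `Dense` weight below m/(2 `R`).
    K R A : ℕ
    K = 2 * (J * J)
    R = 36 * (J * J)
    A = 2 * (K * R)

    J>0 : 0 < J
    J>0 = ≤-trans (Scale.q>0 scale) (Scale.q≤J scale)

    instance
      J≢0 : NonZero J
      J≢0 = >-nonZero J>0
      K≢0 : NonZero K
      K≢0 = m*n≢0 2 (J * J) {{_}} {{m*n≢0 J J}}
      R≢0 : NonZero R
      R≢0 = m*n≢0 36 (J * J) {{_}} {{m*n≢0 J J}}
      A≢0 : NonZero A
      A≢0 = m*n≢0 2 (K * R) {{_}} {{m*n≢0 K R}}

    3K≤A : 3 * K ≤ A
    3K≤A = ≤-trans (*-monoˡ-≤ K {3} {72} (m≤m+n 3 69)) (certify 0 (*-monoʳ-≤ (144 * (J * J)) (*-mono-≤ J>0 J>0)) (id₁ (J * J)))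
      where
      id₁ : ∀ j → 72 * (2 * j) + 144 * j * j + 0 ≡ 2 * (2 * j * (36 * j)) + 144 * j * (1 * 1)
      id₁ = solve-∀

    High : (Fin n → ℕ) → Fin n → Set
    High w x = 4 * K * (sum w * sum w) ≤ 9 * K * deg e w x + sum w * sum w

    -- Vertex extension is applied to the weight restricted to `U`; few vertices are outside, so all
    -- degrees stay high. Vertices of `U` without weight are dropped, since nothing is known about
    -- their degrees.
    readd : (w : Fin n → ℕ) → (∀ x → 0 < w x → High w x) → (U : Fin n → Bool) → R * leftover w U ≤ sum w → 0 < sum w →
      (v : Fin n) → 0 < w v → Coloured e U → Coloured e ((λ x → U x ∧ supp w x) ∪̂ v)
    readd w good U few m>0 v v∈ col = [ (λ (c , h) → inj₁ (SemiExtension.extend-semi (situation Semi semi-bound c h) scale))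
                                      , (λ (c , h) → inj₂ (SixExtension.extend-six (situation Six six-bound c h) scale)) ]′
                                      (coloured-⊆ e {U} {λ x → U x ∧ supp w x} (λ x p → proj₁ (∧-elim p)) col)
      where
      w₁ : Fin n → ℕ
      w₁ = w ↾ U
      m₁ r : ℕ
      m₁ = sum w₁
      r = leftover w U
      split : sum w ≡ m₁ + r
      split = mass-split w U
      positive-mass : ∀ k → sum w ≡ k + r → 0 < k
      positive-mass (suc k) _ = z<s
      positive-mass zero eq = contradiction (≤-trans (*-monoˡ-≤ (sum w) {2} {R} (≤-trans (m≤m+n 2 34) (m≤m*n 36 (J * J) {{m*n≢0 J J}})))
        (subst (λ t → R * t ≤ sum w) (sym eq) few)) (<⇒≱ (certify 0 m>0 (id₁ (sum w))))
        where
        id₁ : ∀ m → suc m + m + 0 ≡ 2 * m + 1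
        id₁ = solve-∀
      high : ∀ x → 0 < w x → 4 * (J * J) * (m₁ * m₁) ≤ 9 * (J * J) * deg e w₁ x + m₁ * m₁
      high x x∈ = certify 0 (+-mono-≤ step (*-monoʳ-≤ (2 * (m₁ * r) + r * r) (*-mono-≤ {1} {4} (s≤s z≤n) (*-mono-≤ J>0 J>0)))) (id₁ (J * J) m₁ r (deg e w₁ x))
        where
        id₁ : ∀ j m r d → 4 * j * (m * m) + (9 * j * d + (m + r) * (m + r) + (2 * (m * r) + r * r) * (4 * j)) + 0 ≡
          9 * j * d + m * m + (4 * j * ((m + r) * (m + r)) + (2 * (m * r) + r * r) * (1 * (1 * 1)))
        id₁ = solve-∀
        step : 4 * (J * J) * ((m₁ + r) * (m₁ + r)) ≤ 9 * (J * J) * deg e w₁ x + (m₁ + r) * (m₁ + r)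
        step = subst (λ m → 4 * (J * J) * (m * m) ≤ 9 * (J * J) * deg e w₁ x + m * m) split
          (*-cancelˡ-≤ 2 (certify 0 (+-mono-≤ (good x x∈) (+-mono-≤ (*-monoʳ-≤ (18 * (J * J)) (deg-restrict e w U x)) (*-monoˡ-≤ (sum w) few)))
            (id₃ (J * J) (sum w) (deg e w x) (deg e w₁ x) r)))
          where
          id₃ : ∀ j m d d₁ r → 2 * (4 * j * (m * m)) + (9 * (2 * j) * d + m * m + (18 * j * (d₁ + 2 * (r * m)) + m * m)) + 0 ≡
            2 * (9 * j * d₁ + m * m) + (4 * (2 * j) * (m * m) + (18 * j * d + 36 * j * r * m))
          id₃ = solve-∀
      situation : ∀ {s} (P : Pattern s) → VolumeBound P → (c : Fin n → Fin s) → Colours e P c (λ x → U x ∧ supp w x) → Situation G P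
      situation P bd c h = record
        { bound = bd ; J = J ; J>0 = J>0 ; U = λ x → U x ∧ supp w x ; w = w₁
        ; w⊆U = λ x x∈ → let (a , b) = ↾-support w U x x∈ in ∧-intro a (supp⁺ w x b)
        ; m>0 = positive-mass m₁ split ; c = c ; coloured = h
        ; high = λ x x∈ → high x (supp⁻ w x (proj₂ (∧-elim x∈)))
        ; v = v ; high-v = high v v∈ }

    -- The correction of at most 6 m in a move has to be small against a gain of order m²/`K`. This
    -- asks for 54 `K` ≤ m, and 54 `K` is 108 `J`².
    module WithMass (m : ℕ) (m-large : 108 * (J * J) ≤ m) where
      private
        54K≤m : 54 * K ≤ m
        54K≤m = ≤-trans (≤-reflexive (sym (*-assoc 54 2 (J * J)))) m-large

        2R≤m : 2 * R ≤ m
        2R≤m = ≤-trans (≤-reflexive (sym (*-assoc 2 36 (J * J)))) (≤-trans (*-monoˡ-≤ (J * J) {72} {108} (m≤m+n 72 36)) m-large)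

      m>0 : 0 < m
      m>0 = ≤-trans (*-mono-≤ {1} {108} (s≤s z≤n) (*-mono-≤ J>0 J>0)) m-large

      instance
        m≢0 : NonZero m
        m≢0 = >-nonZero m>0

      -- Every unit of weight outside `U` is paid for by m²/(9 `K`) of volume missing from the
      -- maximum.
      Result : (Fin n → ℕ) → Set
      Result w = ∃ λ U → Coloured e U × m * m * leftover w U + 9 * K * vol e w ≤ 4 * K * (m * m * m)

      Dense : (Fin n → ℕ) → Set
      Dense w = 4 * A * (m * m * m) ≤ 9 * A * vol e w + m * m * m

      -- A move that does not raise the volume raises the sum of squares, which is at most m².
      Φ : (Fin n → ℕ) → ℕ
      Φ w = vol e w * (m * m + 1) + squares w

      squares≤ : (w : Fin n → ℕ) → sum w ≡ m → squares w ≤ m * m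
      squares≤ w mass = ≤-trans (∫≤ w m λ x _ → ≤-trans (term≤sum w x) (≤-reflexive mass)) (≤-reflexive (cong (_* m) mass))

      Φ-vol : (w w′ : Fin n → ℕ) → sum w ≡ m → vol e w < vol e w′ → Φ w < Φ w′
      Φ-vol w w′ mass lt = certify (squares w′) (+-mono-≤ (*-monoˡ-≤ (m * m + 1) lt) (squares≤ w mass)) (id₁ (vol e w) (vol e w′) (squares w) (squares w′) (m * m))
        where
        id₁ : ∀ V V′ s s′ M → suc (V * (M + 1) + s) + (V′ * (M + 1) + M) + s′ ≡ V′ * (M + 1) + s′ + (suc V * (M + 1) + s)
        id₁ = solve-∀

      dense-mono : (w w′ : Fin n → ℕ) → Dense w → vol e w ≤ vol e w′ → Dense w′
      dense-mono w w′ dense le = ≤-trans dense (+-monoˡ-≤ (m * m * m) (*-monoʳ-≤ (9 * A) le))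

      -- A `Dense` weight misses at most m³/(9 `A`) of volume, which pays for at most m/(2 `R`)
      -- units. The factor 2 is kept in reserve for the single unit by which the leftovers before
      -- and after a move may differ.
      few-left : (w : Fin n → ℕ) (U : Fin n → Bool) → Dense w → m * m * leftover w U + 9 * K * vol e w ≤ 4 * K * (m * m * m) → 2 * (R * leftover w U) ≤ m
      few-left w U dense res = *-cancelˡ-≤ K (*-cancelˡ-≤ (m * m) {{m*n≢0 m m}}
        (certify 0 (+-mono-≤ (*-monoʳ-≤ A res) (*-monoʳ-≤ K dense)) (id₁ K R m (leftover w U) (vol e w))))
        where
        id₁ : ∀ K R m r V → m * m * (K * (2 * (R * r))) + (2 * (K * R) * (4 * K * (m * m * m)) + K * (9 * (2 * (K * R)) * V + m * m * m)) + 0 ≡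
          m * m * (K * m) + (2 * (K * R) * (m * m * r + 9 * K * V) + K * (4 * (2 * (K * R)) * (m * m * m)))
        id₁ = solve-∀

      module Move (w : Fin n → ℕ) (mass : sum w ≡ m) (x y : Fin n) (x∈ : 0 < w x) where
        u : Fin n → ℕ
        u z = w z ∸ δ x z

        open Shift G u public

        w≗ : ∀ z → w z ≡ (u ⊹ x) z
        w≗ z = sym (m∸n+n≡m (δ≤ z))
          where
          δ≤ : ∀ z → δ x z ≤ w z
          δ≤ z with x Fin.≟ z
          ... | yes refl = x∈
          ... | no _ = z≤n

        w′ : Fin n → ℕ
        w′ = u ⊹ y

        mass′ : sum w′ ≡ m
        mass′ = trans (mass-⊹ y) (trans (sym (mass-⊹ x)) (trans (sum-cong-≗ (λ z → sym (w≗ z))) mass))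

        shifted : vol e w′ + 3 * deg e w x + 6 * codeg y x ≡ vol e w + 3 * deg e w y
        shifted = trans (cong (λ t → vol e w′ + 3 * t + 6 * codeg y x) (deg-cong e w≗ x))
          (trans (vol-shift x y) (sym (cong₂ (λ s t → s + 3 * t) (vol-cong e w≗) (deg-cong e w≗ y))))

        codeg≤ : codeg y x ≤ m
        codeg≤ = ≤-trans (∫≤ u 1 λ z _ → ⟦⟧≤1 (e y x z)) (≤-trans (≤-reflexive (*-identityʳ (sum u)))
          (≤-trans (sum-mono (λ z → m∸n≤m (w z) (δ x z))) (≤-reflexive mass)))

        leftover-≤ : (U : Fin n → Bool) → leftover w U ≤ leftover w′ U + 1
        leftover-≤ U = begin
          sum (w ↾ (not ∘ U))                       ≤⟨ sum-mono pointwise ⟩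
          sum (λ z → (w′ ↾ (not ∘ U)) z + δ x z)    ≡⟨ ∑-distrib-+ _ (δ x) ⟩
          leftover w′ U + sum (δ x)                 ≡⟨ cong (leftover w′ U +_) (mass-δ x) ⟩
          leftover w′ U + 1                         ∎
          where
          open ≤-Reasoning
          pointwise : ∀ z → (w ↾ (not ∘ U)) z ≤ (w′ ↾ (not ∘ U)) z + δ x z
          pointwise z with U z
          ... | true = z≤n
          ... | false = ≤-trans (≤-reflexive (trans (+-identityʳ (w z)) (w≗ z))) (+-monoˡ-≤ (δ x z) (≤-trans (m≤m+n (u z) (δ y z)) (≤-reflexive (sym (+-identityʳ _)))))

      module Step (w : Fin n → ℕ) (mass : sum w ≡ m) (dense : Dense w)
        (next : (w′ : Fin n → ℕ) → sum w′ ≡ m → vol e w ≤ vol e w′ → Φ w < Φ w′ → Result w′) where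

        -- A vertex `y` of at least average degree exceeds `x` so much that 27 `K` times the
        -- difference of the degrees is at least 2 m². One m² covers the correction 54 `K` codeg;
        -- the other pays for the moved unit, which is given up as uncoloured.
        module Low (x : Fin n) (x∈ : 0 < w x) (low : 9 * K * deg e w x + m * m ≤ 4 * K * (m * m)) where
          private
            richest : ∃ λ y → 0 < w y × vol e w ≤ m * deg e w y
            richest = ∫-≤⇒∃≤ w {λ _ → vol e w} {λ y → m * deg e w y} (subst (0 <_) (sym mass) m>0)
              (≤-reflexive (trans (∫-const w _) (trans (cong (_* vol e w) mass) (sym (∫-* w m _)))))

          module _ (y : Fin n) (rich-y : vol e w ≤ m * deg e w y) where
            open Move w mass x y x∈

            private
              deg-y : 12 * K * (m * m) ≤ 27 * K * deg e w y + m * m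
              deg-y = *-cancelˡ-≤ A (*-cancelˡ-≤ m (certify 0
                (+-mono-≤ (*-monoʳ-≤ (3 * K) dense) (+-mono-≤ (*-monoʳ-≤ (27 * K * A) rich-y) (*-monoˡ-≤ (m * m * m) 3K≤A)))
                (id₁ K A m (vol e w) (deg e w y))))
                where
                id₁ : ∀ K A m V d → m * (A * (12 * K * (m * m))) + (3 * K * (9 * A * V + m * m * m) + (27 * K * A * (m * d) + A * (m * m * m))) + 0 ≡
                  m * (A * (27 * K * d + m * m)) + (3 * K * (4 * A * (m * m * m)) + (27 * K * A * V + 3 * K * (m * m * m)))
                id₁ = solve-∀

              gain : 9 * K * vol e w + m * m ≤ 9 * K * vol e w′
              gain = certify 0 (+-mono-≤ (≤-reflexive (cong (9 * K *_) (sym shifted))) (+-mono-≤ (*-monoʳ-≤ 3 low)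
                  (+-mono-≤ deg-y (≤-trans (*-monoʳ-≤ (54 * K) codeg≤) (*-monoˡ-≤ m 54K≤m)))))
                (id₁ K (vol e w) (vol e w′) (deg e w x) (deg e w y) (codeg y x) (m * m))
                where
                id₁ : ∀ K V V′ a b c M → 9 * K * V + M + (9 * K * (V′ + 3 * a + 6 * c) + (3 * (4 * K * M) + (27 * K * b + M + M))) + 0 ≡
                  9 * K * V′ + (9 * K * (V + 3 * b) + (3 * (9 * K * a + M) + (12 * K * M + 54 * K * c)))
                id₁ = solve-∀

              vol< : vol e w < vol e w′
              vol< = ≰⇒> λ le → <⇒≱ (<-≤-trans (m<m+n (9 * K * vol e w) (*-mono-≤ m>0 m>0)) gain) (*-monoʳ-≤ (9 * K) le)

            moved : Result w
            moved = transfer (next w′ mass′ (<⇒≤ vol<) (Φ-vol w w′ mass vol<))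
              where
              id₁ : ∀ K m r r′ V V′ → m * m * r + 9 * K * V + (m * m * (r′ + 1) + (9 * K * V′ + 4 * K * (m * m * m))) + 0 ≡
                4 * K * (m * m * m) + (m * m * r + (9 * K * V + m * m + (m * m * r′ + 9 * K * V′)))
              id₁ = solve-∀
              transfer : Result w′ → Result w
              transfer (U , col , res) = U , col , certify 0 (+-mono-≤ (*-monoʳ-≤ (m * m) (leftover-≤ U)) (+-mono-≤ gain res))
                (id₁ K m (leftover w U) (leftover w′ U) (vol e w) (vol e w′))

          result : Result w
          result = let (y , _ , rich-y) = richest in moved y rich-y

        -- Without codegree the volume cannot fall when the unit goes to the vertex of larger
        -- degree. If the degrees are equal the volume may stay, and moving towards the larger
        -- weight raises the sum of squares instead. Since all degrees are high, `v` is afterwards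
        -- put back.
        module Uncovered (good : ∀ x → 0 < w x → High w x) (v u′ : Fin n) (v∈ : 0 < w v) (v≢u : v ≢ u′) (¬cov : ¬ Covered u′ v)
          (deg-le : deg e w v ≤ deg e w u′) (tie : deg e w v ≡ deg e w u′ → w v ≤ w u′) where
          open Move w mass v u′ v∈

          private
            codeg≡0 : codeg u′ v ≡ 0
            codeg≡0 = ∫-zero u λ z _ → cong ⟦_⟧ (Bool.¬-not λ p → ¬cov (z , p))

            shifted′ : vol e w′ + 3 * deg e w v ≡ vol e w + 3 * deg e w u′
            shifted′ = trans (sym (trans (cong (λ t → vol e w′ + 3 * deg e w v + 6 * t) codeg≡0) (+-identityʳ _))) shifted

            vol≤′ : vol e w ≤ vol e w′
            vol≤′ = certify 0 (+-mono-≤ (*-monoʳ-≤ 3 deg-le) (≤-reflexive (sym shifted′))) (id₁ (vol e w) (vol e w′) (deg e w v) (deg e w u′))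
              where
              id₁ : ∀ V V′ a b → V + (3 * b + (V′ + 3 * a)) + 0 ≡ V′ + (3 * a + (V + 3 * b))
              id₁ = solve-∀

            Φ< : Φ w < Φ w′
            Φ< with deg e w v <? deg e w u′
            ... | yes lt = Φ-vol w w′ mass (certify 2 (+-mono-≤ (*-monoʳ-≤ 3 lt) (≤-reflexive (sym shifted′))) (id₁ (vol e w) (vol e w′) (deg e w v) (deg e w u′)))
              where
              id₁ : ∀ V V′ a b → suc V + (3 * b + (V′ + 3 * a)) + 2 ≡ V′ + (3 * suc a + (V + 3 * b))
              id₁ = solve-∀
            ... | no ¬lt = +-mono-≤-< (*-monoˡ-≤ (m * m + 1) vol≤′) (begin-strict
              squares w                    ≡⟨ trans (∫-congˡ w w≗) (∫-cong (u ⊹ v) w≗) ⟩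
              squares (u ⊹ v)              ≡⟨ squares-⊹ v ⟩
              squares u + 2 * u v + 1      <⟨ +-monoˡ-< 1 (+-monoʳ-< (squares u) (*-monoʳ-< 2 uv<uu)) ⟩
              squares u + 2 * u u′ + 1     ≡⟨ sym (squares-⊹ u′) ⟩
              squares w′                   ∎)
              where
              open ≤-Reasoning
              w-v : w v ≡ u v + 1
              w-v = trans (w≗ v) (cong (u v +_) (δ-self v))
              w-u : w u′ ≡ u u′
              w-u = trans (w≗ u′) (trans (cong (u u′ +_) (δ-other λ eq → v≢u (sym eq))) (+-identityʳ _))
              uv<uu : u v < u u′
              uv<uu = subst₂ _≤_ (trans w-v (+-comm (u v) 1)) w-u (tie (≤-antisym deg-le (≮⇒≥ ¬lt)))

          private
            readded : (Fin n → Bool) → Fin n → Bool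
            readded U′ = (λ x → U′ x ∧ supp w x) ∪̂ v

            few : (U′ : Fin n → Bool) → m * m * leftover w′ U′ + 9 * K * vol e w′ ≤ 4 * K * (m * m * m) → R * leftover w U′ ≤ sum w
            few U′ res = subst (R * leftover w U′ ≤_) (sym mass) (*-cancelˡ-≤ 2 (certify 0
              (+-mono-≤ (*-monoʳ-≤ (2 * R) (leftover-≤ U′)) (+-mono-≤ (few-left w′ U′ (dense-mono w w′ dense vol≤′) res) 2R≤m)) (id₁ R (leftover w U′) (leftover w′ U′) m)))
              where
              id₁ : ∀ R r r′ m → 2 * (R * r) + (2 * R * (r′ + 1) + (m + m)) + 0 ≡ 2 * m + (2 * R * r + (2 * (R * r′) + 2 * R))
              id₁ = solve-∀

            -- Going back, `v` is the only vertex to gain weight, and it belongs to the enlarged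
            -- set; so nothing has to be paid.
            fewer : (U′ : Fin n → Bool) → leftover w (readded U′) ≤ leftover w′ U′
            fewer U′ = sum-mono pointwise
              where
              kept : ∀ z → z ≢ v → w z ≤ w′ z
              kept z z≢v = begin
                w z                     ≡⟨ w≗ z ⟩
                u z + δ v z             ≡⟨ cong (u z +_) (δ-other z≢v) ⟩
                u z + 0                 ≡⟨ +-identityʳ (u z) ⟩
                u z                     ≤⟨ m≤m+n (u z) (δ u′ z) ⟩
                w′ z                    ∎
                where open ≤-Reasoning
              shrink : ∀ a b p k k′ → (p ≡ false → k ≤ k′) → (b ≡ positive k) → ⟦ not ((a ∧ b) ∨ p) ⟧ * k ≤ ⟦ not a ⟧ * k′
              shrink a b true k k′ h _ rewrite Bool.∨-zeroʳ (a ∧ b) = z≤n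
              shrink a b false zero k′ h _ = ≤-trans (≤-reflexive (*-zeroʳ ⟦ not ((a ∧ b) ∨ false) ⟧)) z≤n
              shrink true .true false (suc k) k′ h refl = z≤n
              shrink false .true false (suc k) k′ h refl = +-monoˡ-≤ 0 (h refl)
              pointwise : ∀ z → (w ↾ (not ∘ readded U′)) z ≤ (w′ ↾ (not ∘ U′)) z
              pointwise z = shrink (U′ z) (supp w z) (does (z Fin.≟ v)) (w z) (w′ z) (λ p → kept z λ eq → different p eq) refl
                where
                different : does (z Fin.≟ v) ≡ false → z ≢ v
                different p eq with z Fin.≟ v
                ... | no z≢v = z≢v eq

          result : Result w
          result = transfer (next w′ mass′ vol≤′ Φ<)
            where
            transfer : Result w′ → Result w
            transfer (U′ , col , res) = readded U′ , readd w good U′ (few U′ res) (subst (0 <_) (sym mass) m>0) v v∈ col ,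
              ≤-trans (+-mono-≤ (*-monoʳ-≤ (m * m) (fewer U′)) (*-monoʳ-≤ (9 * K) vol≤′)) res

        Low? : Dec (∃ λ x → 0 < w x × 9 * K * deg e w x + m * m ≤ 4 * K * (m * m))
        Low? = any? λ x → (0 <? w x) ×-dec (9 * K * deg e w x + m * m ≤? 4 * K * (m * m))

        covered? : ∀ x y → Dec (Covered x y)
        covered? x y = any? λ z → e x y z Bool.≟ true

        Uncovered? : Dec (∃ λ x → ∃ λ y → 0 < w x × 0 < w y × x ≢ y × ¬ Covered y x)
        Uncovered? = any? λ x → any? λ y → (0 <? w x) ×-dec (0 <? w y) ×-dec ¬? (x Fin.≟ y) ×-dec ¬? (covered? y x)

        orient : (∀ x → 0 < w x → High w x) → ∀ x y → 0 < w x → 0 < w y → x ≢ y → ¬ Covered y x → Result w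
        orient good x y x∈ y∈ x≢y ¬yx with <-cmp (deg e w x) (deg e w y)
        ... | tri< lt ¬eq _ = Uncovered.result good x y x∈ x≢y ¬yx (<⇒≤ lt) (λ eq → contradiction eq ¬eq)
        ... | tri> _ ¬eq gt = Uncovered.result good y x y∈ (λ eq → x≢y (sym eq)) (λ c → ¬yx (covered-sym c)) (<⇒≤ gt) (λ eq → contradiction (sym eq) ¬eq)
        ... | tri≈ _ eq _ with ≤-total (w x) (w y)
        ... | inj₁ le = Uncovered.result good x y x∈ x≢y ¬yx (≤-reflexive eq) (λ _ → le)
        ... | inj₂ le = Uncovered.result good y x y∈ (λ eq → x≢y (sym eq)) (λ c → ¬yx (covered-sym c)) (≤-reflexive (sym eq)) (λ _ → le)

        cliqueResult : (∀ x y → 0 < w x → 0 < w y → x ≢ y → Covered x y) → Result w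
        cliqueResult covers = supp w , col , ≤-trans (≤-reflexive (cong (λ t → m * m * t + 9 * K * vol e w) nothing-left))
            (certify 0 (*-monoʳ-≤ K (subst (λ k → 9 * vol e w ≤ 4 * (k * k * k)) mass (coloured-volume e w col))) (id₁ K m (vol e w)))
          where
          id₁ : ∀ K m V → m * m * 0 + 9 * K * V + K * (4 * (m * m * m)) + 0 ≡ 4 * K * (m * m * m) + K * (9 * V)
          id₁ = solve-∀
          col : Coloured e (supp w)
          col = Clique.clique-coloured G (supp w) λ x y x∈ y∈ → covers x y (supp⁻ w x x∈) (supp⁻ w y y∈)
          nothing-left : leftover w (supp w) ≡ 0
          nothing-left = sum-zero λ z → zero-at (w z)
            where
            zero-at : ∀ k → ⟦ not (positive k) ⟧ * k ≡ 0
            zero-at zero = refl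
            zero-at (suc k) = refl

        decide : Dec (∃ λ x → 0 < w x × 9 * K * deg e w x + m * m ≤ 4 * K * (m * m)) →
          Dec (∃ λ x → ∃ λ y → 0 < w x × 0 < w y × x ≢ y × ¬ Covered y x) → Result w
        decide (yes (x , x∈ , low)) _ = Low.result x x∈ low
        decide (no ¬low) (yes (x , y , x∈ , y∈ , x≢y , ¬yx)) = orient good x y x∈ y∈ x≢y ¬yx
          where
          good : ∀ x → 0 < w x → High w x
          good x x∈ = subst (λ k → 4 * K * (k * k) ≤ 9 * K * deg e w x + k * k) (sym mass) (<⇒≤ (≰⇒> λ low → ¬low (x , x∈ , low)))
        decide (no _) (no ¬unc) = cliqueResult covers
          where
          covers : ∀ x y → 0 < w x → 0 < w y → x ≢ y → Covered x y
          covers x y x∈ y∈ x≢y with covered? x y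
          ... | yes c = c
          ... | no ¬c = contradiction (y , x , y∈ , x∈ , (λ eq → x≢y (sym eq)) , ¬c) ¬unc

        result : Result w
        result = decide Low? Uncovered?

      private
        limit : ℕ
        limit = m * (m * m) * (m * m + 1) + m * m

        Φ≤ : (w : Fin n → ℕ) → sum w ≡ m → Φ w ≤ limit
        Φ≤ w mass = +-mono-≤ (*-monoˡ-≤ (m * m + 1) (subst (λ k → vol e w ≤ k * (k * k)) mass (vol≤ e w))) (squares≤ w mass)

        -- `Φ` grows with every move and never exceeds `limit`, so the remaining distance serves as
        -- fuel for a structural recursion.
        run : ∀ fuel (w : Fin n → ℕ) → sum w ≡ m → limit ≤ fuel + Φ w → Dense w → Result w
        run fuel w mass budget dense = Step.result w mass dense (λ w′ mass′ le lt → next fuel budget w′ mass′ lt (dense-mono w w′ dense le))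
          where
          next : ∀ fuel → limit ≤ fuel + Φ w → (w′ : Fin n → ℕ) → sum w′ ≡ m → Φ w < Φ w′ → Dense w′ → Result w′
          next zero budget w′ mass′ lt _ = contradiction (≤-trans lt (Φ≤ w′ mass′)) (≤⇒≯ budget)
          next (suc fuel) budget w′ mass′ lt dense′ = run fuel w′ mass′ (≤-trans budget (≤-trans (≤-reflexive (sym (+-suc fuel (Φ w)))) (+-monoʳ-≤ fuel lt))) dense′

      symmetrise : (w : Fin n → ℕ) → sum w ≡ m → Dense w → Result w
      symmetrise w mass = run limit w mass (m≤m+n limit (Φ w))

      -- A weight that is not `Dense` satisfies the bound trivially; for any other the inequality in
      -- `Result` contains it.
      volume-bound : (w : Fin n → ℕ) → sum w ≡ m → 9 * vol e w ≤ 4 * (m * m * m)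
      volume-bound w mass = by-density (4 * A * (m * m * m) ≤? 9 * A * vol e w + m * m * m)
        where
        id₁ : ∀ A V M → A * (9 * V) + 4 * A * M + M ≡ A * (4 * M) + (9 * A * V + M)
        id₁ = solve-∀
        id₂ : ∀ K V M x → K * (9 * V) + 4 * K * M + x ≡ K * (4 * M) + (x + 9 * K * V)
        id₂ = solve-∀
        by-density : Dec (Dense w) → 9 * vol e w ≤ 4 * (m * m * m)
        by-density (yes dense) = let (U , _ , res) = symmetrise w mass dense in
          *-cancelˡ-≤ K (certify (m * m * leftover w U) res (id₂ K (vol e w) (m * m * m) (m * m * leftover w U)))
        by-density (no ¬dense) = *-cancelˡ-≤ A (certify (m * m * m) (<⇒≤ (≰⇒> ¬dense)) (id₁ A (vol e w) (m * m * m)))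

      -- High degrees make w `Dense`, so symmetrisation colours all but a small part of it; the rest
      -- consists of vertices of high degree and can be added one by one.
      module Stability (w : Fin n → ℕ) (mass : sum w ≡ m) (high : ∀ x → 0 < w x → 4 * A * (m * m) ≤ 9 * A * deg e w x + m * m) where
        private
          good : ∀ x → 0 < w x → High w x
          good x x∈ = subst (λ k → 4 * K * (k * k) ≤ 9 * K * deg e w x + k * k) (sym mass)
            (*-cancelˡ-≤ A (certify 0 (+-mono-≤ (*-monoʳ-≤ K (high x x∈)) (*-monoˡ-≤ (m * m) (≤-trans (m≤n*m K 3) 3K≤A))) (id₁ A K (m * m) (deg e w x))))
            where
            id₁ : ∀ A K M d → A * (4 * K * M) + (K * (9 * A * d + M) + A * M) + 0 ≡ A * (9 * K * d + M) + (K * (4 * A * M) + K * M)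
            id₁ = solve-∀

          dense : Dense w
          dense = begin
            4 * A * (m * m * m)                          ≡⟨ id₁ (4 * A) m ⟩
            m * (4 * A * (m * m))                        ≡⟨ trans (cong (_* (4 * A * (m * m))) (sym mass)) (sym (∫-const w _)) ⟩
            ∫ w (λ _ → 4 * A * (m * m))                  ≤⟨ ∫-mono w high ⟩
            ∫ w (λ x → 9 * A * deg e w x + m * m)        ≡⟨ trans (∫-+ w _ _) (cong₂ _+_ (∫-* w (9 * A) (deg e w)) (trans (∫-const w (m * m)) (cong (_* (m * m)) mass))) ⟩
            9 * A * vol e w + m * (m * m)                ≡⟨ cong (9 * A * vol e w +_) (sym (*-assoc m m m)) ⟩
            9 * A * vol e w + m * m * m                  ∎
            where
            open ≤-Reasoning
            id₁ : ∀ a m → a * (m * m * m) ≡ m * (a * (m * m))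
            id₁ = solve-∀

          Acceptable : (Fin n → Bool) → Set
          Acceptable U = Coloured e U × R * leftover w U ≤ sum w

          start : ∃ Acceptable
          start = let (U , col , res) = symmetrise w mass dense in
            U , col , ≤-trans (m≤n*m (R * leftover w U) 2) (≤-trans (few-left w U dense res) (≤-reflexive (sym mass)))

          readded : (Fin n → Bool) → Fin n → Fin n → Bool
          readded U v = (λ x → U x ∧ supp w x) ∪̂ v

          keeps : ∀ U v x → 0 < w x → U x ≡ true → readded U v x ≡ true
          keeps U v x x∈ p rewrite p | supp⁺ w x x∈ = refl

          gains : ∀ U v → readded U v v ≡ true
          gains U v with v Fin.≟ v
          ... | yes _ = Bool.∨-zeroʳ (U v ∧ supp w v)
          ... | no v≢v = contradiction refl v≢v

          leftover-mono : (U V : Fin n → Bool) → (∀ x → 0 < w x → U x ≡ true → V x ≡ true) → leftover w V ≤ leftover w U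
          leftover-mono U V U⊆V = sum-mono λ x → pointwise (U x) (V x) (w x) (U⊆V x)
            where
            pointwise : ∀ a b k → (0 < k → a ≡ true → b ≡ true) → ⟦ not b ⟧ * k ≤ ⟦ not a ⟧ * k
            pointwise a b zero h = ≤-reflexive (trans (*-zeroʳ ⟦ not b ⟧) (sym (*-zeroʳ ⟦ not a ⟧)))
            pointwise false false (suc k) h = ≤-refl
            pointwise false true (suc k) h = z≤n
            pointwise true b (suc k) h rewrite h z<s refl = z≤n

          add : ∀ U → Acceptable U → ∀ v → ∃ λ V → Acceptable V × (∀ x → 0 < w x → U x ≡ true → V x ≡ true) × (0 < w v → V v ≡ true)
          add U ok v with 0 <? w v
          ... | no ¬v = U , ok , (λ _ _ p → p) , λ v∈ → contradiction v∈ ¬v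
          ... | yes v∈ = readded U v , (readd w good U (proj₂ ok) (subst (0 <_) (sym mass) m>0) v v∈ (proj₁ ok) ,
              ≤-trans (*-monoʳ-≤ R (leftover-mono U (readded U v) (keeps U v))) (proj₂ ok)) , keeps U v , λ _ → gains U v

          -- Adding a vertex keeps all earlier vertices of positive weight. The leftover never
          -- increases, the condition of `readd` persists, and no error accumulates over the
          -- induction.
          add-all : ∀ {k} (f : Fin k → Fin n) → ∃ λ V → Acceptable V × (∀ i → 0 < w (f i) → V (f i) ≡ true)
          add-all {zero} f = let (U , ok) = start in U , ok , λ ()
          add-all {suc k} f =
            let (U , ok , all) = add-all (f ∘ suc)
                (V , ok′ , keep , new) = add U ok (f zero)
            in V , ok′ , λ { zero → new ; (suc i) i∈ → keep (f (suc i)) i∈ (all i i∈) }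

        coloured : Coloured e (supp w)
        coloured = let (U , ok , all) = add-all (λ x → x) in coloured-⊆ e {U} {supp w} (λ x x∈ → all x (supp⁻ w x x∈)) (proj₁ ok)

-- From M-free graphs to `MFreeRelation`.

module Graphs where

  open import Defs
  open Configurations
  open Cliques using (triples-suffice)
  open import Data.Nat using (ℕ; zero; suc; _+_; _≤_; z≤n; s≤s; _≡ᵇ_)
  open import Data.Nat.Properties using (≤-trans; ≤-reflexive; +-suc; n≤1+n; +-identityʳ; ≡ᵇ⇒≡)
  open import Data.Bool using (Bool; true; false; _∧_; _∨_; not; T)
  import Data.Bool.Properties as Bool
  open import Data.Bool.ListAction using (any)
  open import Data.Fin using (Fin; zero; suc)
  open import Data.Fin.Patterns using (0F)
  open import Data.Fin.Properties using (all?; any?; suc-injective)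
  import Data.Fin as Fin
  open import Data.Fin.Subset using (Subset; _∈_; _∉_; _⊆_; _∩_; _∪_; ⁅_⁆; ∣_∣; ⊤; ⊥; outside)
  open import Data.Fin.Subset.Properties using (x∈⁅x⁆; x∈⁅y⁆⇒x≡y; x∈p∪q⁻; x∈p∪q⁺; x∈p∩q⁻; x∈p∩q⁺; ⊆-antisym; x∈p⇒∣p-x∣<∣p∣; x∈p∧x≢y⇒x∈p-y; ∪-identityˡ; ∪-comm; ∪-assoc; ∪-idem; ∣⁅x⁆∣≡1; ∣⊤∣≡n; ∈⊤; nonempty?; Empty-unique; ∣⊥∣≡0; drop-there)
  open import Data.Vec using (Vec; []; _∷_; lookup; tabulate; here; there)
  open import Data.Vec.Properties using (lookup∘tabulate; []=⇒lookup; lookup⇒[]=)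
  open import Data.List using (List; []; _∷_; length; map)
  import Data.List as List
  open import Data.List.Membership.Propositional using () renaming (_∈_ to _∈ˡ_)
  open import Data.List.Membership.Propositional.Properties using (∈-allFin)
  open import Data.List.Relation.Unary.Any using (here; there)
  open import Data.List.Relation.Unary.All using (All; []; _∷_)
  import Data.List.Relation.Unary.All as All
  import Data.List.Relation.Unary.All.Properties as All
  open import Data.Product using (∃; _×_; _,_; proj₁; proj₂)
  open import Data.Sum using (_⊎_; inj₁; inj₂; [_,_]′)
  open import Data.Empty using (⊥-elim) renaming (⊥ to Absurd)
  open import Function using (_∘_; id)
  open import Function.Definitions using (Injective)
  open import Relation.Nullary using (¬_; Dec; yes; no; contradiction; ¬?; _×-dec_; _⊎-dec_; _→-dec_)
  open import Relation.Nullary.Decidable using (toWitness; dec-true)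
  open import Relation.Binary.PropositionalEquality

  private variable
    n m k s : ℕ

  ∈-triple⁺ : (a b c : Fin n) {x : Fin n} → x ≡ a ⊎ x ≡ b ⊎ x ≡ c → x ∈ triple a b c
  ∈-triple⁺ a b c (inj₁ refl) = x∈p∪q⁺ (inj₁ (x∈⁅x⁆ a))
  ∈-triple⁺ a b c (inj₂ (inj₁ refl)) = x∈p∪q⁺ {p = ⁅ a ⁆} (inj₂ (x∈p∪q⁺ (inj₁ (x∈⁅x⁆ b))))
  ∈-triple⁺ a b c (inj₂ (inj₂ refl)) = x∈p∪q⁺ {p = ⁅ a ⁆} (inj₂ (x∈p∪q⁺ {p = ⁅ b ⁆} (inj₂ (x∈⁅x⁆ c))))

  ∈-triple⁻ : (a b c : Fin n) {x : Fin n} → x ∈ triple a b c → x ≡ a ⊎ x ≡ b ⊎ x ≡ c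
  ∈-triple⁻ a b c x∈ with x∈p∪q⁻ ⁅ a ⁆ (⁅ b ⁆ ∪ ⁅ c ⁆) x∈
  ... | inj₁ p = inj₁ (x∈⁅y⁆⇒x≡y a p)
  ... | inj₂ q with x∈p∪q⁻ ⁅ b ⁆ ⁅ c ⁆ q
  ... | inj₁ p = inj₂ (inj₁ (x∈⁅y⁆⇒x≡y b p))
  ... | inj₂ p = inj₂ (inj₂ (x∈⁅y⁆⇒x≡y c p))

  triple-swap₂₃ : (a b c : Fin n) → triple a b c ≡ triple a c b
  triple-swap₂₃ a b c = cong (⁅ a ⁆ ∪_) (∪-comm ⁅ b ⁆ ⁅ c ⁆)

  triple-swap₁₂ : (a b c : Fin n) → triple a b c ≡ triple b a c
  triple-swap₁₂ a b c = trans (sym (∪-assoc ⁅ a ⁆ ⁅ b ⁆ ⁅ c ⁆)) (trans (cong (_∪ ⁅ c ⁆) (∪-comm ⁅ a ⁆ ⁅ b ⁆)) (∪-assoc ⁅ b ⁆ ⁅ a ⁆ ⁅ c ⁆))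

  card-insert : (x : Fin n) (p : Subset n) → x ∉ p → ∣ ⁅ x ⁆ ∪ p ∣ ≡ suc ∣ p ∣
  card-insert zero (true ∷ p) x∉ = contradiction here x∉
  card-insert zero (false ∷ p) x∉ = cong (suc ∘ ∣_∣) (∪-identityˡ p)
  card-insert (suc x) (true ∷ p) x∉ = cong suc (card-insert x p (x∉ ∘ there))
  card-insert (suc x) (false ∷ p) x∉ = card-insert x p (x∉ ∘ there)

  card-insert≤ : (x : Fin n) (p : Subset n) → ∣ ⁅ x ⁆ ∪ p ∣ ≤ suc ∣ p ∣
  card-insert≤ zero (true ∷ p) = s≤s (≤-trans (≤-reflexive (cong ∣_∣ (∪-identityˡ p))) (n≤1+n _))
  card-insert≤ zero (false ∷ p) = s≤s (≤-reflexive (cong ∣_∣ (∪-identityˡ p)))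
  card-insert≤ (suc x) (true ∷ p) = s≤s (card-insert≤ x p)
  card-insert≤ (suc x) (false ∷ p) = card-insert≤ x p

  card-triple : {a b c : Fin n} → a ≢ b → b ≢ c → a ≢ c → ∣ triple a b c ∣ ≡ 3
  card-triple {a = a} {b} {c} a≢b b≢c a≢c = trans (card-insert a (⁅ b ⁆ ∪ ⁅ c ⁆) a∉) (cong suc (trans (card-insert b ⁅ c ⁆ b∉) (cong suc (∣⁅x⁆∣≡1 c))))
    where
    b∉ : b ∉ ⁅ c ⁆
    b∉ p = b≢c (x∈⁅y⁆⇒x≡y c p)
    a∉ : a ∉ ⁅ b ⁆ ∪ ⁅ c ⁆
    a∉ p = [ a≢b ∘ x∈⁅y⁆⇒x≡y b , a≢c ∘ x∈⁅y⁆⇒x≡y c ]′ (x∈p∪q⁻ ⁅ b ⁆ ⁅ c ⁆ p)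

  1≤card : {x : Fin n} {p : Subset n} → x ∈ p → 1 ≤ ∣ p ∣
  1≤card x∈ = ≤-trans (s≤s z≤n) (x∈p⇒∣p-x∣<∣p∣ x∈)

  2≤card : {x y : Fin n} {p : Subset n} → x ∈ p → y ∈ p → x ≢ y → 2 ≤ ∣ p ∣
  2≤card x∈ y∈ x≢y = ≤-trans (s≤s (1≤card (x∈p∧x≢y⇒x∈p-y x∈ x≢y))) (x∈p⇒∣p-x∣<∣p∣ y∈)

  card≡1⇒∃ : (p : Subset n) → ∣ p ∣ ≡ 1 → ∃ λ x → x ∈ p
  card≡1⇒∃ {n} p eq with nonempty? p
  ... | yes q = q
  ... | no ¬q = contradiction (trans (sym eq) (trans (cong ∣_∣ (Empty-unique ¬q)) (∣⊥∣≡0 n))) λ ()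

  ∧-true : ∀ {a b} → a ∧ b ≡ true → a ≡ true × b ≡ true
  ∧-true {true} {true} _ = refl , refl

  ⊆⇒⊆ᵇ : (p q : Subset n) → p ⊆ q → (p ⊆ᵇ q) ≡ true
  ⊆⇒⊆ᵇ [] [] _ = refl
  ⊆⇒⊆ᵇ (false ∷ p) (b ∷ q) h = ⊆⇒⊆ᵇ p q (drop-there ∘ h ∘ there)
  ⊆⇒⊆ᵇ (true ∷ p) (true ∷ q) h = ⊆⇒⊆ᵇ p q (drop-there ∘ h ∘ there)
  ⊆⇒⊆ᵇ (true ∷ p) (false ∷ q) h with h here
  ... | ()

  ⊆ᵇ⇒⊆ : (p q : Subset n) → (p ⊆ᵇ q) ≡ true → p ⊆ q
  ⊆ᵇ⇒⊆ (true ∷ p) (true ∷ q) h here = here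
  ⊆ᵇ⇒⊆ (a ∷ p) (b ∷ q) h (there x∈) = there (⊆ᵇ⇒⊆ p q (proj₂ (∧-true {not a ∨ b} h)) x∈)

  private
    any⁺ : {A : Set} (f : A → Bool) {x : A} {xs : List A} → x ∈ˡ xs → f x ≡ true → any f xs ≡ true
    any⁺ f (here refl) p rewrite p = refl
    any⁺ f {xs = y ∷ ys} (there x∈) p = trans (cong (f y ∨_) (any⁺ f x∈ p)) (Bool.∨-zeroʳ (f y))

    any⁻ : {A : Set} (f : A → Bool) (xs : List A) → any f xs ≡ true → ∃ λ x → f x ≡ true
    any⁻ f (x ∷ xs) p with f x in eq
    ... | true = x , eq
    ... | false = any⁻ f xs p

  ≡ᵇᶠ⇒≡ : (x y : Fin n) → (x ≡ᵇᶠ y) ≡ true → x ≡ y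
  ≡ᵇᶠ⇒≡ x y p with x Fin.≟ y
  ... | yes q = q

  img⁺ : (φ : Fin m → Fin n) (S : Subset m) {x : Fin m} → x ∈ S → φ x ∈ img φ S
  img⁺ φ S {x} x∈ = lookup⇒[]= (φ x) (img φ S) (trans (lookup∘tabulate _ (φ x)) (any⁺ (λ x′ → lookup S x′ ∧ (φ x′ ≡ᵇᶠ φ x)) (∈-allFin x)
    (cong₂ _∧_ ([]=⇒lookup x∈) (dec-true (φ x Fin.≟ φ x) refl))))

  img⁻ : (φ : Fin m → Fin n) (S : Subset m) {y : Fin n} → y ∈ img φ S → ∃ λ x → x ∈ S × φ x ≡ y
  img⁻ {m} φ S {y} y∈ with any⁻ (λ x → lookup S x ∧ (φ x ≡ᵇᶠ y)) (List.allFin m) (trans (sym (lookup∘tabulate _ y)) ([]=⇒lookup y∈))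
  ... | x , p = let (a , b) = ∧-true {lookup S x} p in x , lookup⇒[]= x S a , ≡ᵇᶠ⇒≡ (φ x) y b

  img-triple : (φ : Fin m → Fin n) (a b c : Fin m) → img φ (triple a b c) ≡ triple (φ a) (φ b) (φ c)
  img-triple φ a b c = ⊆-antisym left right
    where
    left : img φ (triple a b c) ⊆ triple (φ a) (φ b) (φ c)
    left y∈ with img⁻ φ (triple a b c) y∈
    ... | x , x∈ , refl with ∈-triple⁻ a b c x∈
    ... | inj₁ refl = ∈-triple⁺ (φ a) (φ b) (φ c) (inj₁ refl)
    ... | inj₂ (inj₁ refl) = ∈-triple⁺ (φ a) (φ b) (φ c) (inj₂ (inj₁ refl))
    ... | inj₂ (inj₂ refl) = ∈-triple⁺ (φ a) (φ b) (φ c) (inj₂ (inj₂ refl))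
    right : triple (φ a) (φ b) (φ c) ⊆ img φ (triple a b c)
    right y∈ with ∈-triple⁻ (φ a) (φ b) (φ c) y∈
    ... | inj₁ refl = img⁺ φ (triple a b c) (∈-triple⁺ a b c (inj₁ refl))
    ... | inj₂ (inj₁ refl) = img⁺ φ (triple a b c) (∈-triple⁺ a b c (inj₂ (inj₁ refl)))
    ... | inj₂ (inj₂ refl) = img⁺ φ (triple a b c) (∈-triple⁺ a b c (inj₂ (inj₂ refl)))

  edge : 3Graph n → Fin n → Fin n → Fin n → Bool
  edge H a b c = isEdge H (triple a b c)

  module _ (H : 3Graph n) where
    edge-swap₁₂ : ∀ a b c → edge H a b c ≡ edge H b a c
    edge-swap₁₂ a b c = cong (isEdge H) (triple-swap₁₂ a b c)

    edge-swap₂₃ : ∀ a b c → edge H a b c ≡ edge H a c b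
    edge-swap₂₃ a b c = cong (isEdge H) (triple-swap₂₃ a b c)

    edge-irrefl : ∀ a c → edge H a a c ≡ false
    edge-irrefl a c = Bool.¬-not λ p → contradiction (≤-trans (≤-reflexive (sym (trans (sym (cong ∣_∣ merge)) (edge3 H _ p))))
        (≤-trans (card-insert≤ a ⁅ c ⁆) (s≤s (≤-reflexive (∣⁅x⁆∣≡1 c))))) λ { (s≤s (s≤s ())) }
      where
      merge : triple a a c ≡ ⁅ a ⁆ ∪ ⁅ c ⁆
      merge = trans (sym (∪-assoc ⁅ a ⁆ ⁅ a ⁆ ⁅ c ⁆)) (cong (_∪ ⁅ c ⁆) (∪-idem ⁅ a ⁆))

    edge-distinct : ∀ {a b c} → edge H a b c ≡ true → a ≢ b × b ≢ c × a ≢ c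
    edge-distinct {a} {b} {c} p = (λ { refl → no-loop p })
      , (λ { refl → no-loop (trans (edge-swap₂₃ b b a) (trans (edge-swap₁₂ b a b) p)) })
      , λ { refl → no-loop (trans (edge-swap₂₃ a a b) p) }
      where
      no-loop : ∀ {x z} → edge H x x z ≡ true → Absurd
      no-loop {x} {z} q = contradiction (trans (sym q) (edge-irrefl x z)) λ ()

  mk3-edge⁺ : (P : Subset n → Bool) (S : Subset n) → ∣ S ∣ ≡ 3 → P S ≡ true → isEdge (mk3 P) S ≡ true
  mk3-edge⁺ P S eq p rewrite eq = p

  mk3-edge⁻ : (P : Subset n → Bool) (S : Subset n) → isEdge (mk3 P) S ≡ true → P S ≡ true
  mk3-edge⁻ P S p = proj₂ (∧-true p)

  blowup⁺ : (H : 3Graph n) (φ : Fin m → Fin n) (a b c : Fin m) → edge H (φ a) (φ b) (φ c) ≡ true → edge (blowup H φ) a b c ≡ true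
  blowup⁺ H φ a b c p = let (x , y , z) = edge-distinct H p in
    mk3-edge⁺ (λ S → isEdge H (img φ S)) (triple a b c) (card-triple (x ∘ cong φ) (y ∘ cong φ) (z ∘ cong φ)) (trans (cong (isEdge H) (img-triple φ a b c)) p)

  blowup⁻ : (H : 3Graph n) (φ : Fin m → Fin n) (a b c : Fin m) → edge (blowup H φ) a b c ≡ true → edge H (φ a) (φ b) (φ c) ≡ true
  blowup⁻ H φ a b c p = trans (sym (cong (isEdge H) (img-triple φ a b c))) (mk3-edge⁻ (λ S → isEdge H (img φ S)) (triple a b c) p)

  G26≡six : ∀ i j k → edge G26 i j k ≡ six i j k
  G26≡six = toWitness {a? = all? λ i → all? λ j → all? λ k → edge G26 i j k Bool.≟ six i j k} _

  fst²≢snd² : (p : Pair k) → fst² p ≢ snd² p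
  fst²≢snd² (later p) eq = fst²≢snd² p (suc-injective eq)

  pair-of : (i j : Fin k) → i ≢ j → ∃ λ p → (fst² p ≡ i × snd² p ≡ j) ⊎ (fst² p ≡ j × snd² p ≡ i)
  pair-of zero zero i≢j = contradiction refl i≢j
  pair-of zero (suc j) _ = first j , inj₁ (refl , refl)
  pair-of (suc i) zero _ = first i , inj₂ (refl , refl)
  pair-of (suc i) (suc j) i≢j with pair-of i j (i≢j ∘ cong suc)
  ... | p , inj₁ (refl , refl) = later p , inj₁ (refl , refl)
  ... | p , inj₂ (refl , refl) = later p , inj₂ (refl , refl)

  all-pairs : ∀ {Q : Pair k → Set} → All Q (pairs k) → ∀ p → Q p
  all-pairs {suc k} qs (first r) = All.lookup (All.map⁻ (All.++⁻ˡ (map first (List.allFin k)) qs)) (∈-allFin r)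
  all-pairs {suc k} qs (later p) = all-pairs (All.map⁻ (All.++⁻ʳ (map first (List.allFin k)) qs)) p

  -- The vertex set of the forbidden subgraph with core S that is found in H: ws are witnesses for the covered pairs of S.
  record Frame {n k : ℕ} (S : Fin k → Fin n) (ws : List (Fin n)) : Set where
    field
      size : ℕ
      φ : Fin size → Fin n
      φ-injective : Injective _≡_ _≡_ φ
      core : Subset size
      card-core : ∣ core ∣ ≡ k
      pos : Fin k → Fin size
      φ-pos : ∀ i → φ (pos i) ≡ S i
      pos-in : ∀ i → pos i ∈ core
      pos-onto : ∀ x → x ∈ core → ∃ λ i → pos i ≡ x
      size≤ : size ≤ k + length ws
      reaches : All (λ w → ∃ λ x → φ x ≡ w) ws

  frame : (S : Fin k → Fin n) → Injective _≡_ _≡_ S → (ws : List (Fin n)) → Frame S ws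
  frame {k} S inj [] = record
    { size = k ; φ = S ; φ-injective = inj ; core = ⊤ ; card-core = ∣⊤∣≡n k ; pos = id ; φ-pos = λ _ → refl ; pos-in = λ _ → ∈⊤
    ; pos-onto = λ x _ → x , refl ; size≤ = ≤-reflexive (sym (+-identityʳ k)) ; reaches = [] }
  frame {k} S inj (w ∷ ws) = extend (any? λ x → φ x Fin.≟ w)
    where
    open Frame (frame S inj ws)
    extend : Dec (∃ λ x → φ x ≡ w) → Frame S (w ∷ ws)
    extend (yes old) = record
      { size = size ; φ = φ ; φ-injective = φ-injective ; core = core ; card-core = card-core ; pos = pos ; φ-pos = φ-pos ; pos-in = pos-in
      ; pos-onto = pos-onto ; size≤ = ≤-trans size≤ (≤-trans (n≤1+n _) (≤-reflexive (sym (+-suc k (length ws))))) ; reaches = old ∷ reaches }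
    extend (no new) = record
      { size = suc size ; φ = φ′ ; φ-injective = λ {x} {y} → φ′-injective x y ; core = outside ∷ core ; card-core = card-core ; pos = suc ∘ pos ; φ-pos = φ-pos
      ; pos-in = λ i → there (pos-in i) ; pos-onto = λ { (suc x) (there x∈) → let (i , eq) = pos-onto x x∈ in i , cong suc eq }
      ; size≤ = ≤-trans (s≤s size≤) (≤-reflexive (sym (+-suc k (length ws)))) ; reaches = (zero , refl) ∷ All.map (λ (x , eq) → suc x , eq) reaches }
      where
      φ′ : Fin (suc size) → Fin _
      φ′ zero = w
      φ′ (suc x) = φ x
      φ′-injective : ∀ x y → φ′ x ≡ φ′ y → x ≡ y
      φ′-injective zero zero _ = refl
      φ′-injective zero (suc y) eq = contradiction (y , sym eq) new
      φ′-injective (suc x) zero eq = contradiction (x , eq) new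
      φ′-injective (suc x) (suc y) eq = cong suc (φ-injective eq)

  module CoreIn {n k : ℕ} (H : 3Graph n) (S : Fin k → Fin n) (cov : ∀ i j → i ≢ j → ∃ λ z → edge H (S i) (S j) z ≡ true) where
    S-injective : Injective _≡_ _≡_ S
    S-injective {i} {j} eq with i Fin.≟ j
    ... | yes p = p
    ... | no i≢j = contradiction eq (proj₁ (edge-distinct H (proj₂ (cov i j i≢j))))

    witness : Pair k → Fin n
    witness p = proj₁ (cov (fst² p) (snd² p) (fst²≢snd² p))

    open Frame (frame S S-injective (map witness (pairs k))) public

    -- As `φ` is injective, this blowup is the subgraph of `H` induced on the image of `φ`, and no
    -- edges have to be selected.
    F : 3Graph size
    F = blowup H φ

    F⊑H : F ⊑ H
    F⊑H = φ , φ-injective , λ a b c → blowup⁻ H φ a b c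

    edge-cong : ∀ {a b c a′ b′ c′ : Fin n} → a ≡ a′ → b ≡ b′ → c ≡ c′ → edge H a b c ≡ edge H a′ b′ c′
    edge-cong refl refl refl = refl

    core-edge : ∀ a b c → edge H (S a) (S b) (S c) ≡ true → edge F (pos a) (pos b) (pos c) ≡ true
    core-edge a b c p = blowup⁺ H φ (pos a) (pos b) (pos c) (trans (edge-cong (φ-pos a) (φ-pos b) (φ-pos c)) p)

    witnessed : ∀ p → ∃ λ z → edge F (pos (fst² p)) (pos (snd² p)) z ≡ true
    witnessed p = let (x , eq) = all-pairs (All.map⁻ reaches) p in
      x , blowup⁺ H φ (pos (fst² p)) (pos (snd² p)) x (trans (edge-cong (φ-pos (fst² p)) (φ-pos (snd² p)) eq) (proj₂ (cov (fst² p) (snd² p) (fst²≢snd² p))))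

    core-pair : ∀ i j → i ≢ j → ∃ λ z → edge F (pos i) (pos j) z ≡ true
    core-pair i j i≢j = orient (pair-of i j i≢j)
      where
      orient : (∃ λ p → (fst² p ≡ i × snd² p ≡ j) ⊎ (fst² p ≡ j × snd² p ≡ i)) → ∃ λ z → edge F (pos i) (pos j) z ≡ true
      orient (p , inj₁ (refl , refl)) = witnessed p
      orient (p , inj₂ (refl , refl)) = let (x , E) = witnessed p in x , trans (edge-swap₁₂ F (pos (snd² p)) (pos (fst² p)) x) E

    pos-injective : ∀ {i j} → pos i ≡ pos j → i ≡ j
    pos-injective {i} {j} eq = S-injective (trans (sym (φ-pos i)) (trans (cong φ eq) (φ-pos j)))

    isCore : IsCore F k core
    isCore = card-core , λ x y x∈ y∈ x≢y → joined x y (pos-onto x x∈) (pos-onto y y∈) x≢y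
      where
      joined : ∀ x y → (∃ λ i → pos i ≡ x) → (∃ λ j → pos j ≡ y) → x ≢ y → ∃ λ z → IsEdgeT F x y z
      joined x y (i , refl) (j , refl) x≢y = core-pair i j (x≢y ∘ cong pos)

    size-bound : size ≤ k + length (pairs k)
    size-bound = ≤-trans size≤ (≤-reflexive (cong (k +_) (length-map witness (pairs k))))
      where open import Data.List.Properties using (length-map)

    module _ (avoid : ∀ i → ∃ λ a → ∃ λ b → ∃ λ c → edge H (S a) (S b) (S c) ≡ true × a ≢ i × b ≢ i × c ≢ i) (i₀ : Fin k) where
      -- A transversal T has a point t, which lies in the core, and an edge that avoids t contains a
      -- second point of T.
      spread-core : TauInducedGe2 F core
      spread-core T T⊆ hits = let (t , t∈ , _) = hit i₀
                                  (i , eq) = pos-onto t (T⊆ t∈)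
                                  (u , u∈ , u≢) = hit i
                              in 2≤card u∈ t∈ λ u≡t → u≢ (trans u≡t (sym eq))
        where
        hit : ∀ i → ∃ λ t → t ∈ T × t ≢ pos i
        hit i = let (a , b , c , p , a≢ , b≢ , c≢) = avoid i
                    (t , t∈e , t∈T) = hits (triple (pos a) (pos b) (pos c)) (cong₂ _∧_ (core-edge a b c p) (⊆⇒⊆ᵇ (triple (pos a) (pos b) (pos c)) core (λ x∈ → within a b c (∈-triple⁻ (pos a) (pos b) (pos c) x∈))))
                in t , t∈T , different a b c a≢ b≢ c≢ (∈-triple⁻ (pos a) (pos b) (pos c) t∈e)
          where
          within : ∀ a b c {x} → x ≡ pos a ⊎ x ≡ pos b ⊎ x ≡ pos c → x ∈ core
          within a b c (inj₁ refl) = pos-in a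
          within a b c (inj₂ (inj₁ refl)) = pos-in b
          within a b c (inj₂ (inj₂ refl)) = pos-in c
          different : ∀ a b c → a ≢ i → b ≢ i → c ≢ i → ∀ {t} → t ≡ pos a ⊎ t ≡ pos b ⊎ t ≡ pos c → t ≢ pos i
          different a b c a≢ b≢ c≢ (inj₁ refl) eq = a≢ (pos-injective eq)
          different a b c a≢ b≢ c≢ (inj₂ (inj₁ refl)) eq = b≢ (pos-injective eq)
          different a b c a≢ b≢ c≢ (inj₂ (inj₂ refl)) eq = c≢ (pos-injective eq)

    Centred : Fin k → Set
    Centred i = ∀ a b c → edge H (S a) (S b) (S c) ≡ true → a ≡ i ⊎ b ≡ i ⊎ c ≡ i

    centred-or-avoids : ∃ Centred ⊎ (∀ i → ∃ λ a → ∃ λ b → ∃ λ c → edge H (S a) (S b) (S c) ≡ true × a ≢ i × b ≢ i × c ≢ i)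
    centred-or-avoids with any? (λ i → all? λ a → all? λ b → all? λ c → (edge H (S a) (S b) (S c) Bool.≟ true) →-dec ((a Fin.≟ i) ⊎-dec (b Fin.≟ i) ⊎-dec (c Fin.≟ i)))
    ... | yes p = inj₁ p
    ... | no none = inj₂ avoid
      where
      avoid : ∀ i → ∃ λ a → ∃ λ b → ∃ λ c → edge H (S a) (S b) (S c) ≡ true × a ≢ i × b ≢ i × c ≢ i
      avoid i with any? (λ a → any? λ b → any? λ c → (edge H (S a) (S b) (S c) Bool.≟ true) ×-dec ¬? (a Fin.≟ i) ×-dec ¬? (b Fin.≟ i) ×-dec ¬? (c Fin.≟ i))
      ... | yes p = p
      ... | no nope = contradiction (i , meets) none
        where
        meets : Centred i
        meets a b c E with a Fin.≟ i | b Fin.≟ i | c Fin.≟ i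
        ... | yes eq | _ | _ = inj₁ eq
        ... | no _ | yes eq | _ = inj₂ (inj₁ eq)
        ... | no _ | no _ | yes eq = inj₂ (inj₂ eq)
        ... | no x | no y | no z = contradiction (a , b , c , E , x , y , z) nope

    -- Two core vertices both in A would be covered by an edge with two vertices in A, so at most
    -- one is; and every edge inside the core needs one.
    G1-centre : ∀ {N} → Fin k → F ⊑ G1 N → ∃ Centred
    G1-centre {N} i₀ (ψ , _ , ψ-edge) = choose (any? λ i → lookup (G1A N) (at i) Bool.≟ true)
      where
      at : Fin k → Fin N
      at i = ψ (pos i)
      exactly-one : ∀ x y z → edge F x y z ≡ true → ∣ triple (ψ x) (ψ y) (ψ z) ∩ G1A N ∣ ≡ 1
      exactly-one x y z p = ≡ᵇ⇒≡ _ 1 (subst T (sym (mk3-edge⁻ (λ S → ∣ S ∩ G1A N ∣ ≡ᵇ 1) (triple (ψ x) (ψ y) (ψ z)) (ψ-edge x y z p))) _)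
      member : ∀ a b c → edge H (S a) (S b) (S c) ≡ true → ∃ λ i → lookup (G1A N) (at i) ≡ true × (a ≡ i ⊎ b ≡ i ⊎ c ≡ i)
      member a b c p with card≡1⇒∃ (triple (at a) (at b) (at c) ∩ G1A N) (exactly-one (pos a) (pos b) (pos c) (core-edge a b c p))
      ... | x , x∈ with x∈p∩q⁻ (triple (at a) (at b) (at c)) (G1A N) x∈
      ... | x∈t , x∈A with ∈-triple⁻ (at a) (at b) (at c) x∈t
      ... | inj₁ refl = a , []=⇒lookup x∈A , inj₁ refl
      ... | inj₂ (inj₁ refl) = b , []=⇒lookup x∈A , inj₂ (inj₁ refl)
      ... | inj₂ (inj₂ refl) = c , []=⇒lookup x∈A , inj₂ (inj₂ refl)
      unique : ∀ i j → lookup (G1A N) (at i) ≡ true → lookup (G1A N) (at j) ≡ true → i ≡ j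
      unique i j i∈ j∈ with i Fin.≟ j
      ... | yes eq = eq
      ... | no i≢j = let (z , p) = core-pair i j i≢j in contradiction (exactly-one (pos i) (pos j) z p) (two z p)
        where
        two : ∀ z → edge F (pos i) (pos j) z ≡ true → ∣ triple (at i) (at j) (ψ z) ∩ G1A N ∣ ≢ 1
        two z p eq = contradiction (subst (2 ≤_) eq (2≤card {x = at i} {at j} {triple (at i) (at j) (ψ z) ∩ G1A N}
          (x∈p∩q⁺ (∈-triple⁺ (at i) (at j) (ψ z) (inj₁ refl) , lookup⇒[]= (at i) (G1A N) i∈))
          (x∈p∩q⁺ (∈-triple⁺ (at i) (at j) (ψ z) (inj₂ (inj₁ refl)) , lookup⇒[]= (at j) (G1A N) j∈))
          (proj₁ (edge-distinct (G1 N) (ψ-edge (pos i) (pos j) z p))))) λ { (s≤s ()) }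
      choose : Dec (∃ λ i → lookup (G1A N) (at i) ≡ true) → ∃ Centred
      choose (yes (i , i∈)) = i , λ a b c p → let (j , j∈ , h) = member a b c p in subst (λ j → a ≡ j ⊎ b ≡ j ⊎ c ≡ j) (unique j i j∈ i∈) h
      choose (no none) = i₀ , λ a b c p → let (j , j∈ , _) = member a b c p in contradiction (j , j∈) none

    -- Any two core vertices lie in an edge, whose colours are distinct; composing with the blowup
    -- map is therefore injective on the core.
    G26-embedding : ∀ {N} {p : Fin N → Fin 6} → F ⊑ blowup G26 p →
      ∃ λ (σ : Fin k → Fin 6) → Injective _≡_ _≡_ σ × (∀ a b c → edge H (S a) (S b) (S c) ≡ true → six (σ a) (σ b) (σ c) ≡ true)
    G26-embedding {N} {p} (ψ , _ , ψ-edge) = σ , injective , λ a b c E → coloured (pos a) (pos b) (pos c) (core-edge a b c E)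
      where
      σ : Fin k → Fin 6
      σ i = p (ψ (pos i))
      coloured : ∀ x y z → edge F x y z ≡ true → six (p (ψ x)) (p (ψ y)) (p (ψ z)) ≡ true
      coloured x y z E = trans (sym (G26≡six (p (ψ x)) (p (ψ y)) (p (ψ z)))) (blowup⁻ G26 p (ψ x) (ψ y) (ψ z) (ψ-edge x y z E))
      injective : Injective _≡_ _≡_ σ
      injective {i} {j} eq with i Fin.≟ j
      ... | yes q = q
      ... | no i≢j = let (z , E) = core-pair i j i≢j in contradiction eq (six-distinct {σ i} {σ j} {p (ψ z)} (coloured (pos i) (pos j) z E))

  -- Maps into Fin 6 are listed as vectors, so the alternative between an embedding and a member of
  -- M₃ is decided without excluded middle.
  ∃Vec? : {P : Vec (Fin s) k → Set} → (∀ v → Dec (P v)) → Dec (∃ P)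
  ∃Vec? {k = zero} P? with P? []
  ... | yes p = yes ([] , p)
  ... | no ¬p = no λ { ([] , p) → ¬p p }
  ∃Vec? {k = suc k} P? with any? (λ x → ∃Vec? λ v → P? (x ∷ v))
  ... | yes (x , v , p) = yes (x ∷ v , p)
  ... | no ¬p = no λ { (x ∷ v , p) → ¬p (x , v , p) }

  relation : (H : 3Graph n) → MFree H → MFreeRelation n
  relation {n} H (noK5 , noM2 , noM3) = record
    { e = edge H ; swap₁₂ = edge-swap₁₂ H ; swap₂₃ = edge-swap₂₃ H ; irrefl = edge-irrefl H ; seven = seven ; sixth = sixth ; five = five }
    where
    seven : (S : Fin 7 → Fin n) (cov : ∀ i j → i ≢ j → ∃ λ z → edge H (S i) (S j) z ≡ true) → ∃ (CoreIn.Centred H S cov)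
    seven S cov = [ id , (λ avoid → ⊥-elim (noM2 size F (core , (size-bound , isCore) , spread-core avoid 0F) F⊑H)) ]′ centred-or-avoids
      where open CoreIn H S cov

    Embeds : (Fin 6 → Fin n) → (Fin 6 → Fin 6) → Set
    Embeds S σ = Injective _≡_ _≡_ σ × (∀ a b c → edge H (S a) (S b) (S c) ≡ true → six (σ a) (σ b) (σ c) ≡ true)

    sixth : (S : Fin 6 → Fin n) (cov : ∀ i j → i ≢ j → ∃ λ z → edge H (S i) (S j) z ≡ true) → ∃ (CoreIn.Centred H S cov) ⊎ ∃ (Embeds S)
    sixth S cov = [ inj₁ , (λ avoid → inj₂ (search avoid (∃Vec? embeds?))) ]′ centred-or-avoids
      where
      open CoreIn H S cov
      Explicit : Vec (Fin 6) 6 → Set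
      Explicit v = (∀ i j → lookup v i ≡ lookup v j → i ≡ j) × (∀ a b c → edge H (S a) (S b) (S c) ≡ true → six (lookup v a) (lookup v b) (lookup v c) ≡ true)
      embeds? : ∀ v → Dec (Explicit v)
      embeds? v = (all? λ i → all? λ j → (lookup v i Fin.≟ lookup v j) →-dec (i Fin.≟ j)) ×-dec
        (all? λ a → all? λ b → all? λ c → (edge H (S a) (S b) (S c) Bool.≟ true) →-dec (six (lookup v a) (lookup v b) (lookup v c) Bool.≟ true))
      explicit : ∀ σ → Embeds S σ → Explicit (tabulate σ)
      explicit σ (inj , col) = (λ i j eq → inj (trans (sym (lookup∘tabulate σ i)) (trans eq (lookup∘tabulate σ j))))
        , λ a b c E → trans (six-cong (lookup∘tabulate σ a) (lookup∘tabulate σ b) (lookup∘tabulate σ c)) (col a b c E)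
        where
        six-cong : ∀ {a b c a′ b′ c′} → a ≡ a′ → b ≡ b′ → c ≡ c′ → six a b c ≡ six a′ b′ c′
        six-cong refl refl refl = refl
      search : (∀ i → ∃ λ a → ∃ λ b → ∃ λ c → edge H (S a) (S b) (S c) ≡ true × a ≢ i × b ≢ i × c ≢ i) → Dec (∃ Explicit) → ∃ (Embeds S)
      search avoid (yes (v , inj , col)) = lookup v , (λ {i} {j} → inj i j) , col
      search avoid (no none) = ⊥-elim (noM3 size F ((core , size-bound , isCore) , not-G1 , not-G2) F⊑H)
        where
        not-G1 : ∀ N → ¬ (F ⊑ G1 N)
        not-G1 N emb = let (i , centred) = G1-centre 0F emb
                           (a , b , c , E , a≢ , b≢ , c≢) = avoid i
                       in [ a≢ , [ b≢ , c≢ ]′ ]′ (centred a b c E)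
        not-G2 : ∀ N → ¬ InG2 F N
        not-G2 N (p , _ , _ , emb) = let (σ , ok) = G26-embedding {N} {p} emb in none (tabulate σ , explicit σ ok)

    five : (S : Fin 5 → Fin n) → Injective _≡_ _≡_ S → ¬ (∀ t → t ≢ first (first zero) → edge H (S (fst³ t)) (S (snd³ t)) (S (thd³ t)) ≡ true)
    five S inj h = noK5 (S , inj , triples-suffice (edge K5minus) (λ a b c → edge H (S a) (S b) (S c)) (edge-irrefl K5minus)
      (edge-swap₁₂ K5minus) (edge-swap₂₃ K5minus) (λ a b c → edge-swap₁₂ H (S a) (S b) (S c)) (λ a b c → edge-swap₂₃ H (S a) (S b) (S c)) on-triples)
      where
      on-triples : ∀ t → edge K5minus (fst³ t) (snd³ t) (thd³ t) ≡ true → edge H (S (fst³ t)) (S (snd³ t)) (S (thd³ t)) ≡ true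
      on-triples t E = h t λ { refl → contradiction E λ () }

-- Edge and degree counts as iterated sums; colourings as graph notions.

module Counting where

  open import Defs
  open Integration
  open Configurations
  open Extension
  open Graphs
  open import Data.Nat
  open import Data.Nat.Properties
  open import Data.Nat.Tactic.RingSolver using (solve-∀)
  open import Data.Bool using (Bool; true; false; _∧_; not; if_then_else_)
  import Data.Bool.Properties as Bool
  open import Data.Fin using (Fin; zero; suc; _↑ˡ_; _↑ʳ_; splitAt)
  open import Data.Fin.Patterns using (0F; 1F)
  open import Data.Fin.Properties using (↑ˡ-injective; splitAt-↑ˡ; splitAt-↑ʳ)
  import Data.Fin as Fin
  open import Data.Fin.Subset using (Subset; _∈_; _∉_; _⊆_; _∩_; _∪_; _─_; ⁅_⁆; ∣_∣; ⊥)
  open import Data.Fin.Subset.Properties using (∪-identityˡ; ∪-identityʳ; x∈⁅y⁆⇒x≡y; x∈p∪q⁻)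
  open import Data.Vec using (Vec; []; _∷_; lookup; tabulate; here; there)
  open import Data.Vec.Properties using (lookup∘tabulate; []=⇒lookup; lookup⇒[]=)
  open import Data.List using (List; []; _∷_; map; _++_)
  open import Data.Product using (∃; _×_; _,_; proj₁)
  open import Data.Sum using (_⊎_; inj₁; inj₂; [_,_]′)
  open import Function using (_∘_; id)
  open import Relation.Nullary using (yes; no; contradiction)
  open import Relation.Binary.PropositionalEquality

  private variable
    n k : ℕ

  count-++ : {A : Set} (f : A → Bool) (xs ys : List A) → countᵇ f (xs ++ ys) ≡ countᵇ f xs + countᵇ f ys
  count-++ f [] ys = refl
  count-++ f (x ∷ xs) ys with f x
  ... | true = cong suc (count-++ f xs ys)
  ... | false = count-++ f xs ys

  count-map : {A B : Set} (f : B → Bool) (g : A → B) (xs : List A) → countᵇ f (map g xs) ≡ countᵇ (f ∘ g) xs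
  count-map f g [] = refl
  count-map f g (x ∷ xs) with f (g x)
  ... | true = cong suc (count-map f g xs)
  ... | false = count-map f g xs

  subsets : (Subset n → Bool) → ℕ
  subsets {n} f = countᵇ f (allSubsets n)

  subsets-suc : (f : Subset (suc n) → Bool) → subsets f ≡ subsets (f ∘ (true ∷_)) + subsets (f ∘ (false ∷_))
  subsets-suc {n} f = trans (count-++ f (map (true ∷_) (allSubsets n)) _) (cong₂ _+_ (count-map f (true ∷_) (allSubsets n)) (count-map f (false ∷_) (allSubsets n)))

  OfSize : ℕ → (Subset n → Bool) → Set
  OfSize k f = ∀ S → f S ≡ true → ∣ S ∣ ≡ k

  wrong-size : {f : Subset n → Bool} → OfSize k f → ∀ S → ∣ S ∣ ≢ k → f S ≡ false
  wrong-size size S ne = Bool.¬-not λ p → ne (size S p)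

  of-size-true : {f : Subset (suc n) → Bool} → OfSize (suc k) f → OfSize k (f ∘ (true ∷_))
  of-size-true size S p = suc-injective (size (true ∷ S) p)

  of-size-false : {f : Subset (suc n) → Bool} → OfSize k f → OfSize k (f ∘ (false ∷_))
  of-size-false size S p = size (false ∷ S) p

  subsets-none : (f : Subset n → Bool) → (∀ S → f S ≡ false) → subsets f ≡ 0
  subsets-none {n} f h = go (allSubsets n)
    where
    go : ∀ xs → countᵇ f xs ≡ 0
    go [] = refl
    go (x ∷ xs) rewrite h x = go xs

  subsets₀ : (f : Subset n → Bool) → OfSize 0 f → subsets f ≡ ⟦ f ⊥ ⟧
  subsets₀ {zero} f _ with f []
  ... | true = refl
  ... | false = refl
  subsets₀ {suc n} f size = trans (subsets-suc f) (cong₂ _+_ (subsets-none (f ∘ (true ∷_)) λ S → wrong-size {f = f} size (true ∷ S) λ ())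
    (subsets₀ (f ∘ (false ∷_)) (of-size-false {f = f} size)))

  opaque
    unfolding sum

    sum-suc : (f : Fin (suc n) → ℕ) → sum f ≡ f zero + sum (f ∘ suc)
    sum-suc f = refl

  subsets₁ : (f : Subset n → Bool) → OfSize 1 f → sum (λ x → ⟦ f ⁅ x ⁆ ⟧) ≡ subsets f
  subsets₁ {zero} f size = trans (sum-zero λ ()) (sym (cong (λ b → if b then 1 else 0) (wrong-size {f = f} size [] λ ())))
  subsets₁ {suc n} f size = trans (sum-suc _) (trans (cong₂ _+_ (sym (subsets₀ (f ∘ (true ∷_)) (of-size-true {f = f} size)))
    (subsets₁ (f ∘ (false ∷_)) (of-size-false {f = f} size))) (sym (subsets-suc f)))

  ∣⊥∪⊥∣≡0 : ∀ n → ∣ ⊥ {n} ∪ ⊥ ∣ ≡ 0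
  ∣⊥∪⊥∣≡0 zero = refl
  ∣⊥∪⊥∣≡0 (suc n) = ∣⊥∪⊥∣≡0 n

  subsets₂ : (f : Subset n → Bool) → OfSize 2 f → sum (λ x → sum λ y → ⟦ f (⁅ x ⁆ ∪ ⁅ y ⁆) ⟧) ≡ 2 * subsets f
  subsets₂ {zero} f size = trans (sum-zero λ ()) (sym (cong (λ b → 2 * (if b then 1 else 0)) (wrong-size {f = f} size [] λ ())))
  subsets₂ {suc n} f size = begin
    sum (λ x → sum λ y → ⟦ f (⁅ x ⁆ ∪ ⁅ y ⁆) ⟧)
      ≡⟨ trans (sum-suc _) (cong₂ _+_ (sum-suc _) (trans (sum-cong-≗ λ x → sum-suc _) (∑-distrib-+ _ _))) ⟩
    ⟦ f (true ∷ (⊥ ∪ ⊥)) ⟧ + sum (λ y → ⟦ f (true ∷ (⊥ ∪ ⁅ y ⁆)) ⟧) + (sum (λ x → ⟦ f (true ∷ (⁅ x ⁆ ∪ ⊥)) ⟧) + sum (λ x → sum λ y → ⟦ f (false ∷ (⁅ x ⁆ ∪ ⁅ y ⁆)) ⟧))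
      ≡⟨ cong₂ _+_ (cong₂ _+_ (cong ⟦_⟧ (wrong-size {f = f} size (true ∷ (⊥ ∪ ⊥)) λ p → contradiction (trans (sym (∣⊥∪⊥∣≡0 n)) (suc-injective p)) λ ()))
           (sum-cong-≗ λ y → cong (λ S → ⟦ f (true ∷ S) ⟧) (∪-identityˡ ⁅ y ⁆)))
           (cong₂ _+_ (sum-cong-≗ λ x → cong (λ S → ⟦ f (true ∷ S) ⟧) (∪-identityʳ ⁅ x ⁆)) (subsets₂ (f ∘ (false ∷_)) (of-size-false {f = f} size))) ⟩
    0 + sum (λ y → ⟦ f (true ∷ ⁅ y ⁆) ⟧) + (sum (λ x → ⟦ f (true ∷ ⁅ x ⁆) ⟧) + 2 * subsets (f ∘ (false ∷_)))
      ≡⟨ cong (λ t → 0 + t + (t + 2 * subsets (f ∘ (false ∷_)))) (subsets₁ (f ∘ (true ∷_)) (of-size-true {f = f} size)) ⟩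
    0 + subsets (f ∘ (true ∷_)) + (subsets (f ∘ (true ∷_)) + 2 * subsets (f ∘ (false ∷_)))
      ≡⟨ id₁ (subsets (f ∘ (true ∷_))) (subsets (f ∘ (false ∷_))) ⟩
    2 * (subsets (f ∘ (true ∷_)) + subsets (f ∘ (false ∷_)))
      ≡⟨ cong (2 *_) (sym (subsets-suc f)) ⟩
    2 * subsets f ∎
    where
    open ≡-Reasoning
    id₁ : ∀ a b → 0 + a + (a + 2 * b) ≡ 2 * (a + b)
    id₁ = solve-∀

  -- Induction on the ground set by the positions that hold the point `zero`: none gives the sets
  -- avoiding it, exactly one gives `subsets₂` of its link three times, and two or more leave fewer
  -- than three distinct points.
  subsets₃ : (f : Subset n → Bool) → OfSize 3 f → sum (λ x → sum λ y → sum λ z → ⟦ f (triple x y z) ⟧) ≡ 6 * subsets f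
  subsets₃ {zero} f size = trans (sum-zero λ ()) (sym (cong (λ b → 6 * (if b then 1 else 0)) (wrong-size {f = f} size [] λ ())))
  subsets₃ {suc n} f size = begin
    sum (λ x → sum λ y → sum λ z → ⟦ f (triple x y z) ⟧)
      ≡⟨ trans (sum-suc _) (cong₂ _+_ (row zero) (trans (sum-cong-≗ (row ∘ suc)) (trans (∑-distrib-+ _ _) (cong₂ _+_ (∑-distrib-+ _ _) (∑-distrib-+ _ _))))) ⟩
    (g zero zero zero + sum (λ z → g zero zero (suc z))) + (sum (λ y → g zero (suc y) zero) + sum (λ y → sum λ z → g zero (suc y) (suc z))) +
      ((sum (λ x → g (suc x) zero zero) + sum (λ x → sum λ z → g (suc x) zero (suc z))) +
       (sum (λ x → sum λ y → g (suc x) (suc y) zero) + sum (λ x → sum λ y → sum λ z → g (suc x) (suc y) (suc z))))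
      ≡⟨ cong₂ _+_ (cong₂ _+_ (cong₂ _+_ (small zero zero zero (inj₁ refl)) (sum-zero λ z → small zero zero (suc z) (inj₁ refl)))
                     (cong₂ _+_ (sum-zero λ y → small zero (suc y) zero (inj₂ (inj₂ refl))) (sum-cong-≗ λ y → sum-cong-≗ λ z → cong (λ S → ⟦ f (true ∷ S) ⟧) (∪-identityˡ (⁅ y ⁆ ∪ ⁅ z ⁆)))))
           (cong₂ _+_ (cong₂ _+_ (sum-zero λ x → small (suc x) zero zero (inj₂ (inj₁ refl))) (sum-cong-≗ λ x → sum-cong-≗ λ z → cong (λ S → ⟦ f (true ∷ (⁅ x ⁆ ∪ S)) ⟧) (∪-identityˡ ⁅ z ⁆)))
                     (cong₂ _+_ (sum-cong-≗ λ x → sum-cong-≗ λ y → cong (λ S → ⟦ f (true ∷ (⁅ x ⁆ ∪ S)) ⟧) (∪-identityʳ ⁅ y ⁆)) (subsets₃ (f ∘ (false ∷_)) (of-size-false {f = f} size)))) ⟩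
    0 + 0 + (0 + P) + ((0 + P) + (P + 6 * subsets (f ∘ (false ∷_))))
      ≡⟨ cong (λ t → 0 + 0 + (0 + t) + ((0 + t) + (t + 6 * subsets (f ∘ (false ∷_))))) (subsets₂ (f ∘ (true ∷_)) (of-size-true {f = f} size)) ⟩
    _ ≡⟨ id₁ (subsets (f ∘ (true ∷_))) (subsets (f ∘ (false ∷_))) ⟩
    6 * (subsets (f ∘ (true ∷_)) + subsets (f ∘ (false ∷_)))
      ≡⟨ cong (6 *_) (sym (subsets-suc f)) ⟩
    6 * subsets f ∎
    where
    open ≡-Reasoning
    g : Fin (suc n) → Fin (suc n) → Fin (suc n) → ℕ
    g x y z = ⟦ f (triple x y z) ⟧
    P : ℕ
    P = sum λ y → sum λ z → ⟦ f (true ∷ (⁅ y ⁆ ∪ ⁅ z ⁆)) ⟧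
    id₁ : ∀ a b → 0 + 0 + (0 + 2 * a) + ((0 + 2 * a) + (2 * a + 6 * b)) ≡ 6 * (a + b)
    id₁ = solve-∀
    row : ∀ x → sum (λ y → sum λ z → g x y z) ≡ (g x zero zero + sum (λ z → g x zero (suc z))) + (sum (λ y → g x (suc y) zero) + sum (λ y → sum λ z → g x (suc y) (suc z)))
    row x = trans (sum-suc _) (cong₂ _+_ (sum-suc _) (trans (sum-cong-≗ λ y → sum-suc _) (∑-distrib-+ _ _)))
    H : 3Graph (suc n)
    H = record { isEdge = f ; edge3 = size }
    small : ∀ x y z → x ≡ y ⊎ y ≡ z ⊎ x ≡ z → g x y z ≡ 0
    small x y z h = cong ⟦_⟧ (Bool.¬-not λ p → let (a , b , c) = edge-distinct H p in [ a , [ b , c ]′ ]′ h)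

  opaque
    unfolding ∫

    ∫-ones : (f : Fin n → ℕ) → ∫ (λ _ → 1) f ≡ sum f
    ∫-ones f = sum-cong-≗ λ x → +-identityʳ (f x)

    sum-δ : (v : Fin n) (f : Fin n → ℕ) → sum (λ x → δ v x * f x) ≡ f v
    sum-δ v f = ∫-δ v f

  volume-count : (H : 3Graph n) → vol (edge H) (λ _ → 1) ≡ 6 * numEdges H
  volume-count H = trans (trans (∫-ones _) (sum-cong-≗ λ x → trans (∫-ones _) (sum-cong-≗ λ y → ∫-ones _))) (subsets₃ (isEdge H) (edge3 H))

  -- For each of the three positions, `L` ordered edges have `v` in it. Together they are at most
  -- the orderings of the edges containing `v`, six for each.
  link-count : (I : 3Graph n) (v : Fin n) → sum (λ y → sum λ z → ⟦ edge I v y z ⟧) ≤ 2 * degree I v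
  link-count {n} I v = *-cancelˡ-≤ 3 (begin
    3 * L                                            ≡⟨ id₁ L ⟩
    L + L + L                                        ≡⟨ sym (cong₂ _+_ (cong₂ _+_ first-slot second-slot) third-slot) ⟩
    sum (λ x → sum λ y → sum λ z → δ v x * E x y z) + sum (λ x → sum λ y → sum λ z → δ v y * E x y z) + sum (λ x → sum λ y → sum λ z → δ v z * E x y z)
      ≡⟨ sym (trans (sum-cong-≗ λ x → trans (sum-cong-≗ λ y → distrib₃ _ _ _) (distrib₃ _ _ _)) (distrib₃ _ _ _)) ⟩
    sum (λ x → sum λ y → sum λ z → δ v x * E x y z + δ v y * E x y z + δ v z * E x y z)
      ≤⟨ sum-mono (λ x → sum-mono λ y → sum-mono λ z → pointwise x y z) ⟩
    sum (λ x → sum λ y → sum λ z → ⟦ g (triple x y z) ⟧) ≡⟨ subsets₃ g (λ S p → edge3 I S (proj₁ (∧-true p))) ⟩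
    6 * degree I v                                   ≡⟨ *-assoc 3 2 (degree I v) ⟩
    3 * (2 * degree I v)                             ∎)
    where
    open ≤-Reasoning
    E : Fin n → Fin n → Fin n → ℕ
    E x y z = ⟦ edge I x y z ⟧
    L : ℕ
    L = sum λ y → sum λ z → E v y z
    g : Subset n → Bool
    g S = isEdge I S ∧ lookup S v
    id₁ : ∀ a → 3 * a ≡ a + a + a
    id₁ = solve-∀
    distrib₃ : ∀ {n} (f g h : Fin n → ℕ) → sum (λ x → f x + g x + h x) ≡ sum f + sum g + sum h
    distrib₃ f g h = trans (∑-distrib-+ (λ x → f x + g x) h) (cong (_+ sum h) (∑-distrib-+ f g))
    first-slot : sum (λ x → sum λ y → sum λ z → δ v x * E x y z) ≡ L
    first-slot = trans (sum-cong-≗ λ x → trans (sum-cong-≗ λ y → sym (*-distribˡ-sum (δ v x) _)) (sym (*-distribˡ-sum (δ v x) _))) (sum-δ v (λ x → sum λ y → sum λ z → E x y z))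
    second-slot : sum (λ x → sum λ y → sum λ z → δ v y * E x y z) ≡ L
    second-slot = sum-cong-≗ λ x → trans (trans (sum-cong-≗ λ y → sym (*-distribˡ-sum (δ v y) _)) (sum-δ v (λ y → sum λ z → E x y z))) (sum-cong-≗ λ z → cong ⟦_⟧ (edge-swap₁₂ I x v z))
    third-slot : sum (λ x → sum λ y → sum λ z → δ v z * E x y z) ≡ L
    third-slot = sum-cong-≗ λ x → sum-cong-≗ λ y → trans (sum-δ v (E x y)) (cong ⟦_⟧ (trans (edge-swap₂₃ I x y v) (edge-swap₁₂ I x v y)))
    pointwise : ∀ x y z → δ v x * E x y z + δ v y * E x y z + δ v z * E x y z ≤ ⟦ g (triple x y z) ⟧
    pointwise x y z with edge I x y z in eq
    ... | false = ≤-reflexive (cong₂ _+_ (cong₂ _+_ (*-zeroʳ (δ v x)) (*-zeroʳ (δ v y))) (*-zeroʳ (δ v z)))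
    ... | true = one (edge-distinct I eq)
      where
      in-triple : v ≡ x ⊎ v ≡ y ⊎ v ≡ z → lookup (triple x y z) v ≡ true
      in-triple h = []=⇒lookup (∈-triple⁺ x y z h)
      one : x ≢ y × y ≢ z × x ≢ z → δ v x * 1 + δ v y * 1 + δ v z * 1 ≤ ⟦ lookup (triple x y z) v ⟧
      one (x≢y , y≢z , x≢z) with v Fin.≟ x | v Fin.≟ y | v Fin.≟ z
      ... | yes refl | yes p | _ = contradiction p x≢y
      ... | yes refl | no _ | yes p = contradiction p x≢z
      ... | no _ | yes refl | yes p = contradiction p y≢z
      ... | yes p | no _ | no _ rewrite in-triple (inj₁ p) = ≤-refl
      ... | no _ | yes p | no _ rewrite in-triple (inj₂ (inj₁ p)) = ≤-refl
      ... | no _ | no _ | yes p rewrite in-triple (inj₂ (inj₂ p)) = ≤-refl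
      ... | no _ | no _ | no _ = z≤n

  indicator : Subset n → Fin n → ℕ
  indicator W x = ⟦ lookup W x ⟧

  induced-edge⁺ : (H : 3Graph n) (W : Subset n) {x y z : Fin n} → lookup W x ≡ true → lookup W y ≡ true → lookup W z ≡ true → edge H x y z ≡ true →
    edge (induced H W) x y z ≡ true
  induced-edge⁺ H W {x} {y} {z} x∈ y∈ z∈ p = cong₂ _∧_ p (⊆⇒⊆ᵇ (triple x y z) W λ u∈ → within (∈-triple⁻ x y z u∈))
    where
    within : ∀ {u} → u ≡ x ⊎ u ≡ y ⊎ u ≡ z → u ∈ W
    within (inj₁ refl) = lookup⇒[]= x W x∈
    within (inj₂ (inj₁ refl)) = lookup⇒[]= y W y∈
    within (inj₂ (inj₂ refl)) = lookup⇒[]= z W z∈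

  induced-edge⁻ : (H : 3Graph n) (W : Subset n) {x y z : Fin n} → edge (induced H W) x y z ≡ true →
    (lookup W x ≡ true × lookup W y ≡ true × lookup W z ≡ true) × edge H x y z ≡ true
  induced-edge⁻ H W {x} {y} {z} p = let (a , b) = ∧-true p ; inc = ⊆ᵇ⇒⊆ (triple x y z) W b in
    ([]=⇒lookup (inc (∈-triple⁺ x y z (inj₁ refl))) , []=⇒lookup (inc (∈-triple⁺ x y z (inj₂ (inj₁ refl)))) , []=⇒lookup (inc (∈-triple⁺ x y z (inj₂ (inj₂ refl))))) , a

  opaque
    unfolding ∫

    degree-count : (H : 3Graph n) (W : Subset n) (v : Fin n) → lookup W v ≡ true → deg (edge H) (indicator W) v ≤ 2 * degree (induced H W) v
    degree-count H W v v∈ = ≤-trans (sum-mono λ y → ≤-trans (≤-reflexive (*-distribˡ-sum (indicator W y) _)) (sum-mono λ z → pointwise y z)) (link-count (induced H W) v)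
      where
      pointwise : ∀ y z → ⟦ lookup W y ⟧ * (⟦ lookup W z ⟧ * ⟦ edge H v y z ⟧) ≤ ⟦ edge (induced H W) v y z ⟧
      pointwise y z = bounded (lookup W y) (lookup W z) (edge H v y z) λ y∈ z∈ p → induced-edge⁺ H W v∈ y∈ z∈ p
        where
        bounded : ∀ a b d {r} → (a ≡ true → b ≡ true → d ≡ true → r ≡ true) → ⟦ a ⟧ * (⟦ b ⟧ * ⟦ d ⟧) ≤ ⟦ r ⟧
        bounded false b d h = z≤n
        bounded true false d h = z≤n
        bounded true true false h = z≤n
        bounded true true true h rewrite h refl refl refl = ≤-refl

  card-indicator : (W : Subset n) → sum (indicator W) ≡ ∣ W ∣
  card-indicator [] = sum-zero λ ()
  card-indicator (true ∷ W) = trans (sum-suc _) (cong suc (card-indicator W))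
  card-indicator (false ∷ W) = trans (sum-suc _) (card-indicator W)

  card-∩-insert : (x : Fin n) (p q : Subset n) → x ∉ p → ∣ (⁅ x ⁆ ∪ p) ∩ q ∣ ≡ ⟦ lookup q x ⟧ + ∣ p ∩ q ∣
  card-∩-insert zero (true ∷ p) (b ∷ q) x∉ = contradiction here x∉
  card-∩-insert zero (false ∷ p) (true ∷ q) x∉ = cong (λ t → suc ∣ t ∩ q ∣) (∪-identityˡ p)
  card-∩-insert zero (false ∷ p) (false ∷ q) x∉ = cong (λ t → ∣ t ∩ q ∣) (∪-identityˡ p)
  card-∩-insert (suc x) (true ∷ p) (true ∷ q) x∉ = trans (cong suc (card-∩-insert x p q (x∉ ∘ there))) (sym (+-suc ⟦ lookup q x ⟧ ∣ p ∩ q ∣))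
  card-∩-insert (suc x) (true ∷ p) (false ∷ q) x∉ = card-∩-insert x p q (x∉ ∘ there)
  card-∩-insert (suc x) (false ∷ p) (b ∷ q) x∉ = card-∩-insert x p q (x∉ ∘ there)

  card-⊥∩ : (q : Subset n) → ∣ ⊥ ∩ q ∣ ≡ 0
  card-⊥∩ [] = refl
  card-⊥∩ (b ∷ q) = card-⊥∩ q

  card-triple-∩ : {x y z : Fin n} (q : Subset n) → x ≢ y → y ≢ z → x ≢ z → ∣ triple x y z ∩ q ∣ ≡ ⟦ lookup q x ⟧ + (⟦ lookup q y ⟧ + ⟦ lookup q z ⟧)
  card-triple-∩ {x = x} {y} {z} q x≢y y≢z x≢z = trans (card-∩-insert x (⁅ y ⁆ ∪ ⁅ z ⁆) q x∉) (cong (⟦ lookup q x ⟧ +_)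
    (trans (card-∩-insert y ⁅ z ⁆ q y∉) (cong (⟦ lookup q y ⟧ +_) (trans (cong (λ p → ∣ p ∩ q ∣) (sym (∪-identityʳ ⁅ z ⁆)))
      (trans (card-∩-insert z ⊥ q ∉⊥) (trans (cong (⟦ lookup q z ⟧ +_) (card-⊥∩ q)) (+-identityʳ _)))))))
    where
    open import Data.Fin.Subset.Properties using (∉⊥)
    y∉ : y ∉ ⁅ z ⁆
    y∉ p = y≢z (x∈⁅y⁆⇒x≡y z p)
    x∉ : x ∉ ⁅ y ⁆ ∪ ⁅ z ⁆
    x∉ p = [ x≢y ∘ x∈⁅y⁆⇒x≡y y , x≢z ∘ x∈⁅y⁆⇒x≡y z ]′ (x∈p∪q⁻ ⁅ y ⁆ ⁅ z ⁆ p)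

  split-off : (S : Subset n) → ∣ S ∣ ≡ suc k → ∃ λ x → ∃ λ p → S ≡ ⁅ x ⁆ ∪ p × ∣ p ∣ ≡ k
  split-off (true ∷ S) eq = zero , false ∷ S , cong (true ∷_) (sym (∪-identityˡ S)) , suc-injective eq
  split-off (false ∷ S) eq = let (x , p , a , b) = split-off S eq in suc x , false ∷ p , cong (false ∷_) a , b

  as-triple : (S : Subset n) → ∣ S ∣ ≡ 3 → ∃ λ x → ∃ λ y → ∃ λ z → S ≡ triple x y z
  as-triple {n} S eq = let (x , p , a , eq₁) = split-off S eq
                           (y , q , b , eq₂) = split-off p eq₁
                           (z , r , c , eq₃) = split-off q eq₂
                       in x , y , z , trans a (cong (⁅ x ⁆ ∪_) (trans b (cong (⁅ y ⁆ ∪_) (trans c (trans (cong (⁅ z ⁆ ∪_) (empty r eq₃)) (∪-identityʳ ⁅ z ⁆))))))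
    where
    empty : ∀ {n} (r : Subset n) → ∣ r ∣ ≡ 0 → r ≡ ⊥
    empty [] _ = refl
    empty (false ∷ r) eq = cong (false ∷_) (empty r eq)

  lookup-─ : (p q : Subset n) (x : Fin n) → lookup (p ─ q) x ≡ (lookup p x ∧ not (lookup q x))
  lookup-─ (a ∷ p) (true ∷ q) zero = sym (Bool.∧-zeroʳ a)
  lookup-─ (a ∷ p) (false ∷ q) zero = sym (Bool.∧-identityʳ a)
  lookup-─ (a ∷ p) (b ∷ q) (suc x) = lookup-─ p q x

  semibipartite : (H : 3Graph n) (W : Subset n) (c : Fin n → Fin 2) → Colours (edge H) Semi c (lookup W) → SemibipartiteInduced H W
  semibipartite {n} H W c col = A , A⊆W , parts
    where
    isA : Fin 2 → Bool
    isA 0F = true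
    isA 1F = false
    A : Subset n
    A = tabulate λ x → lookup W x ∧ isA (c x)
    at : ∀ x → lookup A x ≡ (lookup W x ∧ isA (c x))
    at x = lookup∘tabulate _ x
    A⊆W : A ⊆ W
    A⊆W {x} x∈ = lookup⇒[]= x W (proj₁ (∧-true (trans (sym (at x)) ([]=⇒lookup x∈))))
    inA : ∀ x → lookup W x ≡ true → lookup A x ≡ isA (c x)
    inA x x∈ = trans (at x) (cong (_∧ isA (c x)) x∈)
    inB : ∀ x → lookup W x ≡ true → lookup (W ─ A) x ≡ not (isA (c x))
    inB x x∈ = trans (lookup-─ W A x) (cong₂ (λ a b → a ∧ not b) x∈ (inA x x∈))
    counts : ∀ i j k → semi i j k ≡ true → ⟦ isA i ⟧ + (⟦ isA j ⟧ + ⟦ isA k ⟧) ≡ 1 × ⟦ not (isA i) ⟧ + (⟦ not (isA j) ⟧ + ⟦ not (isA k) ⟧) ≡ 2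
    counts 0F 1F 1F _ = refl , refl
    counts 1F 0F 1F _ = refl , refl
    counts 1F 1F 0F _ = refl , refl
    counts 0F 0F 0F ()
    counts 0F 0F 1F ()
    counts 0F 1F 0F ()
    counts 1F 0F 0F ()
    counts 1F 1F 1F ()
    sum₃ : ∀ {a b c a′ b′ c′ : Bool} → a ≡ a′ → b ≡ b′ → c ≡ c′ → ⟦ a ⟧ + (⟦ b ⟧ + ⟦ c ⟧) ≡ ⟦ a′ ⟧ + (⟦ b′ ⟧ + ⟦ c′ ⟧)
    sum₃ refl refl refl = refl
    on-triple : ∀ x y z → edge (induced H W) x y z ≡ true → ∣ triple x y z ∩ A ∣ ≡ 1 × ∣ triple x y z ∩ (W ─ A) ∣ ≡ 2
    on-triple x y z p =
      let ((x∈ , y∈ , z∈) , E) = induced-edge⁻ H W {x} {y} {z} p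
          (a , b , d) = edge-distinct H {x} {y} {z} E
          (one , two) = counts (c x) (c y) (c z) (col x y z x∈ y∈ z∈ E)
      in trans (card-triple-∩ A a b d) (trans (sum₃ (inA x x∈) (inA y y∈) (inA z z∈)) one)
       , trans (card-triple-∩ (W ─ A) a b d) (trans (sum₃ (inB x x∈) (inB y y∈) (inB z z∈)) two)
    parts : ∀ S → isEdge (induced H W) S ≡ true → ∣ S ∩ A ∣ ≡ 1 × ∣ S ∩ (W ─ A) ∣ ≡ 2
    parts S p = let (x , y , z , eq) = as-triple S (edge3 (induced H W) S p) in
      subst (λ S → ∣ S ∩ A ∣ ≡ 1 × ∣ S ∩ (W ─ A) ∣ ≡ 2) (sym eq) (on-triple x y z (trans (sym (cong (isEdge (induced H W)) eq)) p))

  -- Six extra vertices, one in each class, make the blowup map surjective.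
  colourable : (H : 3Graph n) (W : Subset n) (c : Fin n → Fin 6) → Colours (edge H) Six c (lookup W) → G26Colorable (induced H W)
  colourable {n} H W c col = n + 6 , p , surjective , (_↑ˡ 6) , (λ {x} {y} → ↑ˡ-injective 6 x y) , edges
    where
    p : Fin (n + 6) → Fin 6
    p x = [ c , id ]′ (splitAt n x)
    p-left : ∀ x → p (x ↑ˡ 6) ≡ c x
    p-left x = cong [ c , id ]′ (splitAt-↑ˡ n x 6)
    surjective : Surj p
    surjective y = n ↑ʳ y , cong [ c , id ]′ (splitAt-↑ʳ n 6 y)
    edges : ∀ x y z → edge (induced H W) x y z ≡ true → edge (blowup G26 p) (x ↑ˡ 6) (y ↑ˡ 6) (z ↑ˡ 6) ≡ true
    edges x y z E = let ((x∈ , y∈ , z∈) , E′) = induced-edge⁻ H W {x} {y} {z} E in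
      blowup⁺ G26 p (x ↑ˡ 6) (y ↑ˡ 6) (z ↑ˡ 6) (trans (three (p-left x) (p-left y) (p-left z)) (trans (G26≡six (c x) (c y) (c z)) (col x y z x∈ y∈ z∈ E′)))
      where
      three : ∀ {a b d a′ b′ d′} → a ≡ a′ → b ≡ b′ → d ≡ d′ → edge G26 a b d ≡ edge G26 a′ b′ d′
      three refl refl refl = refl

-- Removing the vertices of low degree.

module Degrees where

  open import Defs
  open Integration
  open Configurations
  open Extension
  open Cliques using (Coloured)
  open Symmetrisation
  open Graphs
  open Counting
  open import Data.Nat
  open import Data.Nat.Properties
  open import Data.Nat.Tactic.RingSolver using (solve-∀)
  open import Data.Bool using (Bool; true; false; not; T)
  open import Data.Fin using (Fin; zero; suc)
  open import Data.Fin.Subset using (Subset; ∣_∣)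
  open import Data.Vec using (tabulate; lookup)
  open import Data.Vec.Properties using (lookup∘tabulate)
  open import Data.Product using (Σ; _×_; _,_; proj₁)
  open import Data.Empty using (⊥)
  open import Function using (_∘_)
  open import Relation.Nullary using (contradiction)
  open import Relation.Binary.PropositionalEquality hiding (J)

  private variable
    n : ℕ

  opaque
    -- The least values that `Scale` permits: N₀ = 12, q = 128 · 36 · 12², N₁ = 2 q and `J` = 36
    -- N₁². Opaque, so that terms containing `J` are not expanded to huge numerals.
    J : ℕ
    J = 36 * (1327104 * 1327104)

    scale : Scale J
    scale = record { N₀ = 12 ; q = 663552 ; N₁ = 1327104 ; N₀≥12 = ≤-refl ; q-large = ≤-refl ; N₁-large = ≤-refl ; J-large = ≤-refl }

  K R A : ℕ
  K = 2 * (J * J)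
  R = 36 * (J * J)
  A = 2 * (K * R)

  A>0 : 0 < A
  A>0 = *-mono-≤ {1} {2} (s≤s z≤n) (*-mono-≤ (*-mono-≤ {1} {2} (s≤s z≤n) J²>0) (*-mono-≤ {1} {36} (s≤s z≤n) J²>0))
    where
    J²>0 : 0 < J * J
    J²>0 = *-mono-≤ (≤-trans (Scale.q>0 scale) (Scale.q≤J scale)) (≤-trans (Scale.q>0 scale) (Scale.q≤J scale))

  -- Exactly `k` low vertices are taken, so that the mass of the rest is a known polynomial.
  choose : (b : Fin n → Bool) (k : ℕ) → k ≤ sum (λ x → ⟦ b x ⟧) → Σ (Fin n → Bool) λ g → (∀ x → g x ≡ true → b x ≡ true) × sum (λ x → ⟦ g x ⟧) ≡ k
  choose b zero _ = (λ _ → false) , (λ _ ()) , sum-zero λ _ → refl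
  choose {zero} b (suc k) le = contradiction (≤-trans le (≤-reflexive (sum-zero λ ()))) λ ()
  choose {suc n} b (suc k) le with b zero in eq
  ... | true = let (g , g⊆ , mass) = choose (b ∘ suc) k (s≤s⁻¹ (≤-trans le (≤-reflexive (trans (sum-suc _) (cong (λ t → ⟦ t ⟧ + sum (λ x → ⟦ b (suc x) ⟧)) eq))))) in
    (λ { zero → true ; (suc x) → g x }) , (λ { zero _ → eq ; (suc x) → g⊆ x }) , trans (sum-suc _) (cong suc mass)
  ... | false = let (g , g⊆ , mass) = choose (b ∘ suc) (suc k) (≤-trans le (≤-reflexive (trans (sum-suc _) (cong (λ t → ⟦ t ⟧ + sum (λ x → ⟦ b (suc x) ⟧)) eq)))) in
    (λ { zero → false ; (suc x) → g x }) , (λ { zero () ; (suc x) → g⊆ x }) , trans (sum-suc _) mass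

  -- An ordered edge that is lost has a removed vertex in one of its three positions.
  vol-remove : (e : Fin n → Fin n → Fin n → Bool) → (∀ x y z → e x y z ≡ e y x z) → (∀ x y z → e x y z ≡ e x z y) →
    (w : Fin n → ℕ) (g : Fin n → Bool) → vol e w ≤ vol e (w ↾ (not ∘ g)) + 3 * ∫ (w ↾ g) (deg e w)
  vol-remove {n} e s₁₂ s₂₃ w g = begin
    ∫ w (deg e w)                                        ≡⟨ trans (∫-split w g _) (+-comm (∫ G (deg e w)) _) ⟩
    ∫ u (deg e w) + D                                    ≤⟨ +-monoˡ-≤ D (∫-mono u λ a _ → row a) ⟩
    ∫ u (λ a → deg e u a + (X a + Y a)) + D              ≡⟨ cong (_+ D) (trans (∫-+ u _ _) (cong (vol e u +_) (∫-+ u _ _))) ⟩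
    vol e u + (∫ u X + ∫ u Y) + D                        ≤⟨ +-monoˡ-≤ D (+-monoʳ-≤ (vol e u) (+-mono-≤ X≤ Y≤)) ⟩
    vol e u + (D + D) + D                                ≡⟨ id₁ (vol e u) D ⟩
    vol e u + 3 * D                                      ∎
    where
    open ≤-Reasoning
    u G : Fin n → ℕ
    u = w ↾ (not ∘ g)
    G = w ↾ g
    D : ℕ
    D = ∫ G (deg e w)
    X Y : Fin n → ℕ
    X a = ∫ w λ b → ∫ G λ z → ⟦ e a b z ⟧
    Y a = ∫ G λ b → ∫ w λ z → ⟦ e a b z ⟧
    u≤w : ∀ x → u x ≤ w x
    u≤w = ↾≤ w (not ∘ g)
    row : ∀ a → deg e w a ≤ deg e u a + (X a + Y a)
    row a = begin
      ∫ w (λ b → ∫ w (f b))                              ≡⟨ trans (∫-split w g _) (+-comm (Y a) _) ⟩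
      ∫ u (λ b → ∫ w (f b)) + Y a                        ≡⟨ cong (_+ Y a) (∫-cong u λ b → trans (∫-split w g _) (+-comm (∫ G (f b)) _)) ⟩
      ∫ u (λ b → ∫ u (f b) + ∫ G (f b)) + Y a            ≡⟨ cong (_+ Y a) (∫-+ u _ _) ⟩
      deg e u a + ∫ u (λ b → ∫ G (f b)) + Y a            ≤⟨ +-monoˡ-≤ (Y a) (+-monoʳ-≤ (deg e u a) (∫-monoˡ _ u≤w)) ⟩
      deg e u a + X a + Y a                              ≡⟨ +-assoc (deg e u a) (X a) (Y a) ⟩
      deg e u a + (X a + Y a)                            ∎
      where
      f : Fin n → Fin n → ℕ
      f b z = ⟦ e a b z ⟧
    Y≤ : ∫ u Y ≤ D
    Y≤ = begin
      ∫ u Y                                              ≤⟨ ∫-monoˡ Y u≤w ⟩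
      ∫ w Y                                              ≡⟨ ∫-swap w G _ ⟩
      ∫ G (λ b → ∫ w λ a → ∫ w λ z → ⟦ e a b z ⟧)        ≡⟨ ∫-cong G (λ b → ∫-cong w λ a → ∫-cong w λ z → cong ⟦_⟧ (s₁₂ a b z)) ⟩
      D                                                  ∎
    X≤ : ∫ u X ≤ D
    X≤ = begin
      ∫ u X                                              ≤⟨ ∫-monoˡ X u≤w ⟩
      ∫ w X                                              ≡⟨ ∫-cong w (λ a → ∫-swap w G _) ⟩
      ∫ w (λ a → ∫ G λ z → ∫ w λ b → ⟦ e a b z ⟧)        ≡⟨ ∫-cong w (λ a → ∫-cong G λ z → ∫-cong w λ b → cong ⟦_⟧ (s₂₃ a b z)) ⟩
      ∫ w Y                                              ≡⟨ ∫-swap w G _ ⟩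
      ∫ G (λ b → ∫ w λ a → ∫ w λ z → ⟦ e a b z ⟧)        ≡⟨ ∫-cong G (λ b → ∫-cong w λ a → ∫-cong w λ z → cong ⟦_⟧ (s₁₂ a b z)) ⟩
      D                                                  ∎
    id₁ : ∀ v d → v + (d + d) + d ≡ v + 3 * d
    id₁ = solve-∀

  -- Here ε is `p`/`q`, and `s` is √ε n rounded down; `p-below` records ε n² ≤ (`s` + 1)².
  module Removal {n : ℕ} (H : 3Graph n) (free : MFree H) (s p q : ℕ) (s>0 : 0 < s) (q>0 : 0 < q)
    (n-large : 216 * (J * J) ≤ n) (s-small : 360 * A * s ≤ n) (p-below : p * (n * n) ≤ suc s * suc s * q)
    (many-edges : 4 * q * (n * n * n) ≤ 9 * q * (6 * numEdges H) + 54 * p * (n * n * n)) where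

    G : MFreeRelation n
    G = relation H free

    private
      e : Fin n → Fin n → Fin n → Bool
      e = edge H

      ones : Fin n → ℕ
      ones _ = 1

      d : Fin n → ℕ
      d = deg e ones

      J>0 : 0 < J
      J>0 = Process.J>0 G J scale

      n>0 : 0 < n
      n>0 = ≤-trans (*-mono-≤ {1} {216} (s≤s z≤n) (*-mono-≤ J>0 J>0)) n-large

      4s≤n : 4 * s ≤ n
      4s≤n = ≤-trans (*-monoˡ-≤ s (≤-trans (m≤m+n 4 356) (≤-trans (≤-reflexive (sym (*-identityʳ 360))) (*-monoʳ-≤ 360 A>0)))) s-small

      mass-ones : sum ones ≡ n
      mass-ones = go n
        where
        go : ∀ n → sum {n} (λ _ → 1) ≡ n
        go zero = sum-zero λ ()
        go (suc n) = trans (sum-suc _) (cong suc (go n))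

    good : Fin n → Bool
    good x = 4 * (n * n) ≤ᵇ 9 * d x + 54 * (s * n)

    W : Subset n
    W = tabulate good

    private
      good⁻ : ∀ x → good x ≡ true → 4 * (n * n) ≤ 9 * d x + 54 * (s * n)
      good⁻ x p = ≤ᵇ⇒≤ _ _ (subst T (sym p) _)

      bad⁻ : ∀ x → not (good x) ≡ true → 9 * d x + 54 * (s * n) ≤ 4 * (n * n)
      bad⁻ x p = <⇒≤ (≰⇒> λ le → absurd (good x) p (≤⇒≤ᵇ le))
        where
        absurd : ∀ b → not b ≡ true → T b → ⊥
        absurd false _ ()

      r : ℕ
      r = sum λ x → ⟦ not (good x) ⟧

      mass-ones-↾ : ∀ b → sum (ones ↾ b) ≡ sum (λ x → ⟦ b x ⟧)
      mass-ones-↾ b = sum-cong-≗ λ x → *-identityʳ ⟦ b x ⟧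

      half-large : ∀ {m t} → t + m ≡ n → t ≤ 2 * s → n ≤ 2 * m
      half-large {m} {t} eq t≤ = certify 0 (+-mono-≤ (*-monoʳ-≤ 2 t≤) (+-mono-≤ 4s≤n (≤-reflexive (cong (2 *_) (sym eq))))) (id₁ n m t s)
        where
        id₁ : ∀ n m t s → n + (2 * (2 * s) + (n + 2 * (t + m))) + 0 ≡ 2 * m + (2 * t + (4 * s + 2 * n))
        id₁ = solve-∀

      mass-large : ∀ {m t} → t + m ≡ n → t ≤ 2 * s → 108 * (J * J) ≤ m
      mass-large {m} {t} eq t≤ = *-cancelˡ-≤ 2 (≤-trans (≤-reflexive (sym (*-assoc 2 108 (J * J)))) (≤-trans n-large (half-large {m} {t} eq t≤)))

      -- Each of 2 `s` low vertices lies 6 `s` n below the degree 4n²/9. Removing them saves 36 `s`²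
      -- n against the extremal rate, more than the 24 `s`² n by which the volume of `H` may fall
      -- short; the rest then exceeds 4 m³/9.
      module Excess (g : Fin n → Bool) (g⊆ : ∀ x → g x ≡ true → not (good x) ≡ true) (mass-g : sum (λ x → ⟦ g x ⟧) ≡ 2 * s) where
        u : Fin n → ℕ
        u = ones ↾ (not ∘ g)

        m : ℕ
        m = sum u

        split : 2 * s + m ≡ n
        split = trans (cong (_+ m) (sym (trans (mass-ones-↾ g) mass-g))) (trans (sym (mass-split ones g)) mass-ones)

        volume : 9 * vol e u ≤ 4 * (m * m * m)
        volume = Process.WithMass.volume-bound G J scale m (mass-large split ≤-refl) u refl

        D : ℕ
        D = ∫ (ones ↾ g) d

        D≤ : 9 * D + 2 * s * (54 * (s * n)) ≤ 2 * s * (4 * (n * n))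
        D≤ = begin
          9 * D + 2 * s * (54 * (s * n))                        ≡⟨ sym (trans (∫-+ (ones ↾ g) _ _) (cong₂ _+_ (∫-* (ones ↾ g) 9 d) (trans (∫-const (ones ↾ g) _) (cong (_* (54 * (s * n))) mass)))) ⟩
          ∫ (ones ↾ g) (λ x → 9 * d x + 54 * (s * n))           ≤⟨ ∫≤ (ones ↾ g) (4 * (n * n)) (λ x x∈ → bad⁻ x (g⊆ x (proj₁ (↾-support ones g x x∈)))) ⟩
          sum (ones ↾ g) * (4 * (n * n))                        ≡⟨ cong (_* (4 * (n * n))) mass ⟩
          2 * s * (4 * (n * n))                                 ∎
          where
          open ≤-Reasoning
          mass : sum (ones ↾ g) ≡ 2 * s
          mass = trans (mass-ones-↾ g) mass-g

        removal : 6 * numEdges H ≤ vol e u + 3 * D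
        removal = ≤-trans (≤-reflexive (sym (volume-count H))) (vol-remove e (edge-swap₁₂ H) (edge-swap₂₃ H) ones g)

        p≤ : p * (n * n) ≤ 4 * (s * s) * q
        p≤ = ≤-trans p-below (*-monoˡ-≤ q (≤-trans (*-mono-≤ 1+s≤2s 1+s≤2s) (≤-reflexive (id₁ s))))
          where
          1+s≤2s : suc s ≤ 2 * s
          1+s≤2s = certify 0 s>0 (id₂ s)
            where
            id₂ : ∀ s → suc s + s + 0 ≡ 2 * s + 1
            id₂ = solve-∀
          id₁ : ∀ s → 2 * s * (2 * s) ≡ 4 * (s * s)
          id₁ = solve-∀

        vanish : q * (s * (s * n)) ≤ 0
        -- After clearing denominators the contradiction has the surplus 60 q s² n + 32 q s³, of
        -- which one q s² n is retained on the left.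
        vanish = certify (59 * (q * (s * (s * n))) + 32 * (q * (s * s * s)))
          (+-mono-≤ many-edges (+-mono-≤ (*-monoʳ-≤ (9 * q) removal) (+-mono-≤ (*-monoʳ-≤ q volume) (+-mono-≤ (*-monoʳ-≤ (3 * q) D≤) (*-monoʳ-≤ (54 * n) p≤)))))
          (subst (λ n → q * (s * (s * n)) + (9 * q * E + 54 * p * (n * n * n) + (9 * q * (V + 3 * D) + (q * (4 * (m * m * m)) + (3 * q * (2 * s * (4 * (n * n))) + 54 * n * (4 * (s * s) * q))))) +
              (59 * (q * (s * (s * n))) + 32 * (q * (s * s * s))) ≡
            0 + (4 * q * (n * n * n) + (9 * q * E + (q * (9 * V) + (3 * q * (9 * D + 2 * s * (54 * (s * n))) + 54 * n * (p * (n * n)))))))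
            split (id₁ q s m p E V D))
          where
          E = 6 * numEdges H
          V = vol e u
          id₁ : ∀ q s m p E V D → q * (s * (s * (2 * s + m))) + (9 * q * E + 54 * p * ((2 * s + m) * (2 * s + m) * (2 * s + m)) + (9 * q * (V + 3 * D) + (q * (4 * (m * m * m)) +
              (3 * q * (2 * s * (4 * ((2 * s + m) * (2 * s + m)))) + 54 * (2 * s + m) * (4 * (s * s) * q))))) +
              (59 * (q * (s * (s * (2 * s + m)))) + 32 * (q * (s * s * s))) ≡
            0 + (4 * q * ((2 * s + m) * (2 * s + m) * (2 * s + m)) + (9 * q * E + (q * (9 * V) + (3 * q * (9 * D + 2 * s * (54 * (s * (2 * s + m)))) + 54 * (2 * s + m) * (p * ((2 * s + m) * (2 * s + m)))))))
          id₁ = solve-∀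

        absurd : ⊥
        absurd = <⇒≱ (*-mono-≤ q>0 (*-mono-≤ s>0 (*-mono-≤ s>0 n>0))) vanish

      r<2s : r < 2 * s
      r<2s = ≰⇒> λ le → let (g , g⊆ , mass-g) = choose (not ∘ good) (2 * s) le in Excess.absurd g g⊆ mass-g

      W≗ : ∀ x → indicator W x ≡ (ones ↾ good) x
      W≗ x = trans (cong ⟦_⟧ (lookup∘tabulate good x)) (sym (*-identityʳ ⟦ good x ⟧))

      mass-W : r + sum (indicator W) ≡ n
      mass-W = trans (+-comm r _) (trans (cong₂ _+_ (sum-cong-≗ W≗) (sym (mass-ones-↾ (not ∘ good)))) (trans (sym (mass-split ones good)) mass-ones))

      -- The threshold of `good` allows 54 s n, and fewer than 2 s removed vertices cost at most 36
      -- s n more.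
      degree-W : ∀ v → lookup W v ≡ true → 4 * (n * n) ≤ 9 * deg e (indicator W) v + 90 * (s * n)
      degree-W v v∈ = certify 0 (+-mono-≤ (good⁻ v (trans (sym (lookup∘tabulate good v)) v∈)) (+-mono-≤ (*-monoʳ-≤ 9 restricted) (*-monoʳ-≤ (18 * n) (<⇒≤ r<2s))))
        (id₁ n s (d v) (deg e (indicator W) v) r)
        where
        restricted : d v ≤ deg e (indicator W) v + 2 * (r * n)
        restricted = ≤-trans (deg-restrict e ones good v) (≤-reflexive (cong₂ (λ a b → a + 2 * b) (deg-cong e (λ x → sym (W≗ x)) v)
          (cong₂ _*_ (mass-ones-↾ (not ∘ good)) mass-ones)))
        id₁ : ∀ n s d dW r → 4 * (n * n) + (9 * d + 54 * (s * n) + (9 * (dW + 2 * (r * n)) + 18 * n * (2 * s))) + 0 ≡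
          9 * dW + 90 * (s * n) + (4 * (n * n) + (9 * d + 18 * n * r))
        id₁ = solve-∀

    few-removed : n ∸ ∣ W ∣ ≤ 2 * s
    few-removed = ≤-trans (≤-reflexive (trans (cong₂ _∸_ (sym mass-W) (sym (card-indicator W))) (m+n∸n≡m r (sum (indicator W))))) (<⇒≤ r<2s)

    min-degree : ∀ v → lookup W v ≡ true → 2 * (n * n) ≤ 9 * degree (induced H W) v + 45 * (s * n)
    min-degree v v∈ = *-cancelˡ-≤ 2 (certify 0 (+-mono-≤ (degree-W v v∈) (*-monoʳ-≤ 9 (degree-count H W v v∈))) (id₁ n s (deg e (indicator W) v) (degree (induced H W) v)))
      where
      id₁ : ∀ n s dW d → 2 * (2 * (n * n)) + (9 * dW + 90 * (s * n) + 9 * (2 * d)) + 0 ≡ 2 * (9 * d + 45 * (s * n)) + (4 * (n * n) + 9 * dW)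
      id₁ = solve-∀

    coloured : Coloured (edge H) (lookup W)
    coloured = coloured-⊆ e {supp (indicator W)} {lookup W} (λ x p → cong (positive ∘ ⟦_⟧) p)
      (Process.WithMass.Stability.coloured G J scale (sum (indicator W)) (mass-large mass-W (<⇒≤ r<2s)) (indicator W) refl high)
      where
      m : ℕ
      m = sum (indicator W)
      lookup-true : ∀ b → 0 < ⟦ b ⟧ → b ≡ true
      lookup-true true _ = refl
      m≤n : m ≤ n
      m≤n = ≤-trans (m≤n+m m r) (≤-reflexive mass-W)
      n≤2m : n ≤ 2 * m
      n≤2m = half-large mass-W (<⇒≤ r<2s)
      -- By `s-small` the deficit 90 s n is at most n²/(4 `A`), and n ≤ 2 m turns this into m²/`A`.
      high : ∀ x → 0 < indicator W x → 4 * A * (m * m) ≤ 9 * A * deg e (indicator W) x + m * m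
      high x x∈ = *-cancelˡ-≤ 4 (certify 0 (+-mono-≤ (*-monoʳ-≤ (16 * A) (*-mono-≤ m≤n m≤n)) (+-mono-≤ (*-monoʳ-≤ (4 * A) (degree-W x (lookup-true _ x∈)))
          (+-mono-≤ (*-monoˡ-≤ n s-small) (*-mono-≤ n≤2m n≤2m))))
        (id₁ A n m s (deg e (indicator W) x)))
        where
        id₁ : ∀ A n m s d → 4 * (4 * A * (m * m)) + (16 * A * (n * n) + (4 * A * (9 * d + 90 * (s * n)) + (n * n + 2 * m * (2 * m)))) + 0 ≡
          4 * (9 * A * d + m * m) + (16 * A * (m * m) + (4 * A * (4 * (n * n)) + (360 * A * s * n + n * n)))
        id₁ = solve-∀

-- Translation between rational and natural inequalities.

module Rationals where

  open import Defs using (ℚℕ; LtMulSqrt; LeMulSqrt)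
  open Integration using (certify)
  open import Data.Nat as ℕ using (ℕ; suc; z≤n; s≤s; NonZero)
  import Data.Nat.Properties as ℕ
  open import Data.Nat.Tactic.RingSolver using (solve-∀)
  open import Data.Integer as ℤ using (ℤ; +_)
  import Data.Integer.Properties as ℤ
  open import Data.Rational hiding (NonZero)
  open import Data.Rational.Properties
  open import Data.Rational.Unnormalised as ℚᵘ using (ℚᵘ; mkℚᵘ; *≡*; *≤*; *<*)
  import Data.Rational.Unnormalised.Properties as ℚᵘ
  open import Data.Rational.Solver using (module +-*-Solver)
  open import Data.Product using (∃; _×_; _,_)
  open import Data.Sum using (inj₁; inj₂)
  open import Relation.Nullary using (yes; no; contradiction)
  open import Relation.Binary.PropositionalEquality

  open +-*-Solver using (solve; _:+_; _:*_; _:-_; _:=_)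

  private
    ℕᵘ : ℕ → ℚᵘ
    ℕᵘ k = mkℚᵘ (+ k) 0

    toᵘ : ∀ k → toℚᵘ (ℚℕ k) ℚᵘ.≃ ℕᵘ k
    toᵘ k = toℚᵘ-fromℚᵘ (ℕᵘ k)

  ℚℕ-+ : ∀ a b → ℚℕ (a ℕ.+ b) ≡ ℚℕ a + ℚℕ b
  ℚℕ-+ a b = toℚᵘ-injective (ℚᵘ.≃-trans (toᵘ (a ℕ.+ b)) (ℚᵘ.≃-trans (*≡* eq)
    (ℚᵘ.≃-sym (ℚᵘ.≃-trans (toℚᵘ-homo-+ (ℚℕ a) (ℚℕ b)) (ℚᵘ.+-cong (toᵘ a) (toᵘ b))))))
    where
    eq : + (a ℕ.+ b) ℤ.* (+ 1) ≡ (+ a ℤ.* + 1 ℤ.+ + b ℤ.* + 1) ℤ.* + 1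
    eq = cong (ℤ._* + 1) (cong₂ ℤ._+_ (sym (ℤ.*-identityʳ (+ a))) (sym (ℤ.*-identityʳ (+ b))))

  ℚℕ-* : ∀ a b → ℚℕ (a ℕ.* b) ≡ ℚℕ a * ℚℕ b
  ℚℕ-* a b = toℚᵘ-injective (ℚᵘ.≃-trans (toᵘ (a ℕ.* b)) (ℚᵘ.≃-trans (*≡* (cong (ℤ._* + 1) (ℤ.pos-* a b)))
    (ℚᵘ.≃-sym (ℚᵘ.≃-trans (toℚᵘ-homo-* (ℚℕ a) (ℚℕ b)) (ℚᵘ.*-cong (toᵘ a) (toᵘ b))))))

  /-*-cancel : ∀ a b .{{_ : NonZero b}} → (+ a / b) * ℚℕ b ≡ ℚℕ a
  /-*-cancel a (suc b) = toℚᵘ-injective (ℚᵘ.≃-trans (toℚᵘ-homo-* (+ a / suc b) (ℚℕ (suc b)))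
    (ℚᵘ.≃-trans (ℚᵘ.*-cong (toℚᵘ-fromℚᵘ (mkℚᵘ (+ a) b)) (toᵘ (suc b))) (ℚᵘ.≃-trans (*≡* eq) (ℚᵘ.≃-sym (toᵘ a)))))
    where
    eq : (+ a ℤ.* + suc b) ℤ.* + 1 ≡ + a ℤ.* + (suc b ℕ.* 1)
    eq = trans (ℤ.*-assoc (+ a) (+ suc b) (+ 1)) (cong (+ a ℤ.*_) (sym (ℤ.pos-* (suc b) 1)))

  ℚℕ-mono-≤ : ∀ {a b} → a ℕ.≤ b → ℚℕ a ≤ ℚℕ b
  ℚℕ-mono-≤ {a} {b} le = toℚᵘ-cancel-≤ (ℚᵘ.≤-respˡ-≃ (ℚᵘ.≃-sym (toᵘ a)) (ℚᵘ.≤-respʳ-≃ (ℚᵘ.≃-sym (toᵘ b)) (*≤* (ℤ.*-monoʳ-≤-nonNeg (+ 1) (ℤ.+≤+ le)))))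

  ℚℕ-mono-< : ∀ {a b} → a ℕ.< b → ℚℕ a < ℚℕ b
  ℚℕ-mono-< {a} {b} lt = toℚᵘ-cancel-< (ℚᵘ.<-respˡ-≃ (ℚᵘ.≃-sym (toᵘ a)) (ℚᵘ.<-respʳ-≃ (ℚᵘ.≃-sym (toᵘ b)) (*<* (ℤ.*-monoʳ-<-pos (+ 1) (ℤ.+<+ lt)))))

  ℚℕ-cancel-≤ : ∀ {a b} → ℚℕ a ≤ ℚℕ b → a ℕ.≤ b
  ℚℕ-cancel-≤ {a} {b} le with a ℕ.≤? b
  ... | yes p = p
  ... | no ¬p = contradiction (<-≤-trans (ℚℕ-mono-< (ℕ.≰⇒> ¬p)) le) (<-irrefl refl)

  ℚℕ-cancel-< : ∀ {a b} → ℚℕ a < ℚℕ b → a ℕ.< b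
  ℚℕ-cancel-< {a} {b} lt with a ℕ.<? b
  ... | yes p = p
  ... | no ¬p = contradiction (<-≤-trans lt (ℚℕ-mono-≤ (ℕ.≮⇒≥ ¬p))) (<-irrefl refl)

  ℚℕ-nonNeg : ∀ k → NonNegative (ℚℕ k)
  ℚℕ-nonNeg k = nonNegative (ℚℕ-mono-≤ {0} {k} z≤n)

  ℚℕ-pos : ∀ {k} → 0 ℕ.< k → Positive (ℚℕ k)
  ℚℕ-pos lt = positive (ℚℕ-mono-< lt)

  as-fraction : ∀ ε → 0ℚ < ε → ∃ λ p → ∃ λ q → 0 ℕ.< p × 0 ℕ.< q × ε * ℚℕ q ≡ ℚℕ p
  as-fraction ε 0<ε = go ε (positive 0<ε)
    where
    go : ∀ ε → Positive ε → ∃ λ p → ∃ λ q → 0 ℕ.< p × 0 ℕ.< q × ε * ℚℕ q ≡ ℚℕ p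
    go ε@(mkℚ (+ suc k) d _) _ = suc k , suc d , s≤s z≤n , s≤s z≤n , trans (cong (_* ℚℕ (suc d)) (sym (↥p/↧p≡p ε))) (/-*-cancel (suc k) (suc d))

  module _ (ε : ℚ) (p q : ℕ) (q>0 : 0 ℕ.< q) (εq≡p : ε * ℚℕ q ≡ ℚℕ p) where
    private
      instance
        q-pos : Positive (ℚℕ q)
        q-pos = ℚℕ-pos q>0
        q-nonNeg : NonNegative (ℚℕ q)
        q-nonNeg = ℚℕ-nonNeg q

    below-unit-fraction : ∀ D .{{_ : NonZero D}} → ε < + 1 / D → p ℕ.* D ℕ.< q
    below-unit-fraction D lt = ℚℕ-cancel-< (subst₂ _<_ left right (*-monoʳ-<-pos (ℚℕ D * ℚℕ q) {{Dq-pos}} lt))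
      where
      Dq-pos : Positive (ℚℕ D * ℚℕ q)
      Dq-pos = subst Positive (ℚℕ-* D q) (ℚℕ-pos (ℕ.*-mono-≤ (ℕ.>-nonZero⁻¹ D) q>0))
      left : ℚℕ D * ℚℕ q * ε ≡ ℚℕ (p ℕ.* D)
      left = trans (solve 3 (λ e q d → d :* q :* e := e :* q :* d) refl ε (ℚℕ q) (ℚℕ D)) (trans (cong (_* ℚℕ D) εq≡p) (sym (ℚℕ-* p D)))
      right : ℚℕ D * ℚℕ q * (+ 1 / D) ≡ ℚℕ q
      right = trans (solve 3 (λ f q d → d :* q :* f := f :* d :* q) refl (+ 1 / D) (ℚℕ q) (ℚℕ D)) (trans (cong (_* ℚℕ q) (/-*-cancel 1 D)) (*-identityˡ (ℚℕ q)))

    private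
      cube : ∀ n → ℚℕ (n ℕ.* n ℕ.* n) ≡ ℚℕ n * ℚℕ n * ℚℕ n
      cube n = trans (ℚℕ-* (n ℕ.* n) n) (cong (_* ℚℕ n) (ℚℕ-* n n))

    edges-in-ℕ : ∀ n E → (+ 2 / 27) * (ℚℕ n * ℚℕ n * ℚℕ n) - ε * (ℚℕ n * ℚℕ n * ℚℕ n) ≤ ℚℕ E →
      2 ℕ.* q ℕ.* (n ℕ.* n ℕ.* n) ℕ.≤ 27 ℕ.* q ℕ.* E ℕ.+ 27 ℕ.* p ℕ.* (n ℕ.* n ℕ.* n)
    edges-in-ℕ n E le = ℚℕ-cancel-≤ (subst₂ _≤_ left right (+-monoˡ-≤ (ℚℕ 27 * ℚℕ p * N) (*-monoˡ-≤-nonNeg (ℚℕ (27 ℕ.* q)) {{ℚℕ-nonNeg (27 ℕ.* q)}} le)))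
      where
      N = ℚℕ n * ℚℕ n * ℚℕ n
      a = + 2 / 27
      left : ℚℕ (27 ℕ.* q) * (a * N - ε * N) + ℚℕ 27 * ℚℕ p * N ≡ ℚℕ (2 ℕ.* q ℕ.* (n ℕ.* n ℕ.* n))
      left = begin
        ℚℕ (27 ℕ.* q) * (a * N - ε * N) + ℚℕ 27 * ℚℕ p * N              ≡⟨ cong₂ (λ x y → x * (a * N - ε * N) + ℚℕ 27 * y * N) (ℚℕ-* 27 q) (sym εq≡p) ⟩
        ℚℕ 27 * ℚℕ q * (a * N - ε * N) + ℚℕ 27 * (ε * ℚℕ q) * N         ≡⟨ solve 5 (λ t q a e N → t :* q :* (a :* N :- e :* N) :+ t :* (e :* q) :* N := a :* t :* q :* N) refl (ℚℕ 27) (ℚℕ q) a ε N ⟩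
        a * ℚℕ 27 * ℚℕ q * N                                            ≡⟨ cong (λ x → x * ℚℕ q * N) (/-*-cancel 2 27) ⟩
        ℚℕ 2 * ℚℕ q * N                                                 ≡⟨ sym (trans (ℚℕ-* (2 ℕ.* q) (n ℕ.* n ℕ.* n)) (cong₂ _*_ (ℚℕ-* 2 q) (cube n))) ⟩
        ℚℕ (2 ℕ.* q ℕ.* (n ℕ.* n ℕ.* n))                                ∎
        where open ≡-Reasoning
      right : ℚℕ (27 ℕ.* q) * ℚℕ E + ℚℕ 27 * ℚℕ p * N ≡ ℚℕ (27 ℕ.* q ℕ.* E ℕ.+ 27 ℕ.* p ℕ.* (n ℕ.* n ℕ.* n))
      right = sym (trans (ℚℕ-+ (27 ℕ.* q ℕ.* E) _) (cong₂ _+_ (ℚℕ-* (27 ℕ.* q) E) (trans (ℚℕ-* (27 ℕ.* p) (n ℕ.* n ℕ.* n)) (cong₂ _*_ (ℚℕ-* 27 p) (cube n)))))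

    lt-mul-sqrt : ∀ n b → b ℕ.* b ℕ.* q ℕ.< 9 ℕ.* p ℕ.* (n ℕ.* n) → LtMulSqrt (ℚℕ b) (+ 3 / 1) ε (ℚℕ n)
    lt-mul-sqrt n b lt = inj₂ (*-cancelʳ-<-nonNeg (ℚℕ q) (subst₂ _<_ left right (ℚℕ-mono-< lt)))
      where
      left : ℚℕ (b ℕ.* b ℕ.* q) ≡ ℚℕ b * ℚℕ b * ℚℕ q
      left = trans (ℚℕ-* (b ℕ.* b) q) (cong (_* ℚℕ q) (ℚℕ-* b b))
      right : ℚℕ (9 ℕ.* p ℕ.* (n ℕ.* n)) ≡ ℚℕ 3 * ℚℕ 3 * ε * ℚℕ n * ℚℕ n * ℚℕ q
      right = begin
        ℚℕ (9 ℕ.* p ℕ.* (n ℕ.* n))                      ≡⟨ trans (ℚℕ-* (9 ℕ.* p) (n ℕ.* n)) (cong₂ _*_ (trans (ℚℕ-* 9 p) (cong₂ _*_ (ℚℕ-* 3 3) (sym εq≡p))) (ℚℕ-* n n)) ⟩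
        ℚℕ 3 * ℚℕ 3 * (ε * ℚℕ q) * (ℚℕ n * ℚℕ n)        ≡⟨ solve 4 (λ t e q n → t :* t :* (e :* q) :* (n :* n) := t :* t :* e :* n :* n :* q) refl (ℚℕ 3) ε (ℚℕ q) (ℚℕ n) ⟩
        ℚℕ 3 * ℚℕ 3 * ε * ℚℕ n * ℚℕ n * ℚℕ q            ∎
        where open ≡-Reasoning

    -- A vertex of degree at least 2n²/9 falls under the first alternative. Otherwise the deficit is
    -- at most 5 s n, and s² ≤ ε n² gives 25 ε n⁴ for its square, within the 400 ε n⁴ allowed.
    le-mul-sqrt : ∀ n d s → s ℕ.* s ℕ.* q ℕ.≤ p ℕ.* (n ℕ.* n) → 2 ℕ.* (n ℕ.* n) ℕ.≤ 9 ℕ.* d ℕ.+ 45 ℕ.* (s ℕ.* n) →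
      LeMulSqrt ((+ 2 / 9) * (ℚℕ n * ℚℕ n) - ℚℕ d) (+ 20 / 1) ε (ℚℕ n * ℚℕ n)
    le-mul-sqrt n d s s²q≤pn² h with 2 ℕ.* (n ℕ.* n) ℕ.≤? 9 ℕ.* d
    ... | yes le = inj₁ (*-cancelˡ-≤-pos (ℚℕ 9) {{ℚℕ-pos {9} (s≤s z≤n)}} (subst₂ _≤_ (sym nine-x) (sym (*-zeroʳ (ℚℕ 9))) (subst (ℚℕ (2 ℕ.* (n ℕ.* n)) - ℚℕ (9 ℕ.* d) ≤_)
        (+-inverseʳ (ℚℕ (9 ℕ.* d))) (+-monoˡ-≤ (- ℚℕ (9 ℕ.* d)) (ℚℕ-mono-≤ le)))))
      where
      nine-x : ℚℕ 9 * ((+ 2 / 9) * (ℚℕ n * ℚℕ n) - ℚℕ d) ≡ ℚℕ (2 ℕ.* (n ℕ.* n)) - ℚℕ (9 ℕ.* d)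
      nine-x = trans (solve 4 (λ t f n d → t :* (f :* n :- d) := f :* t :* n :- t :* d) refl (ℚℕ 9) (+ 2 / 9) (ℚℕ n * ℚℕ n) (ℚℕ d))
        (cong₂ _-_ (trans (cong (_* (ℚℕ n * ℚℕ n)) (/-*-cancel 2 9)) (sym (trans (ℚℕ-* 2 (n ℕ.* n)) (cong (ℚℕ 2 *_) (ℚℕ-* n n))))) (sym (ℚℕ-* 9 d)))
    ... | no ¬le = inj₂ (*-cancelʳ-≤-pos (ℚℕ (81 ℕ.* q)) {{ℚℕ-pos (ℕ.*-mono-≤ {1} {81} (s≤s z≤n) q>0)}} (subst₂ _≤_ left right (ℚℕ-mono-≤ squares)))
      where
      z : ℕ
      z = 2 ℕ.* (n ℕ.* n) ℕ.∸ 9 ℕ.* d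
      x = (+ 2 / 9) * (ℚℕ n * ℚℕ n) - ℚℕ d
      split : z ℕ.+ 9 ℕ.* d ≡ 2 ℕ.* (n ℕ.* n)
      split = ℕ.m∸n+n≡m (ℕ.<⇒≤ (ℕ.≰⇒> ¬le))
      z≤ : z ℕ.≤ 45 ℕ.* (s ℕ.* n)
      z≤ = ℕ.+-cancelʳ-≤ (9 ℕ.* d) z _ (ℕ.≤-trans (ℕ.≤-reflexive split) (ℕ.≤-trans h (ℕ.≤-reflexive (ℕ.+-comm (9 ℕ.* d) _))))
      nine-x : x * ℚℕ 9 ≡ ℚℕ z
      nine-x = begin
        x * ℚℕ 9                                        ≡⟨ solve 4 (λ t f n d → (f :* n :- d) :* t := f :* t :* n :- t :* d) refl (ℚℕ 9) (+ 2 / 9) (ℚℕ n * ℚℕ n) (ℚℕ d) ⟩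
        (+ 2 / 9) * ℚℕ 9 * (ℚℕ n * ℚℕ n) - ℚℕ 9 * ℚℕ d  ≡⟨ cong₂ _-_ (trans (cong (_* (ℚℕ n * ℚℕ n)) (/-*-cancel 2 9)) (sym (trans (ℚℕ-* 2 (n ℕ.* n)) (cong (ℚℕ 2 *_) (ℚℕ-* n n))))) (sym (ℚℕ-* 9 d)) ⟩
        ℚℕ (2 ℕ.* (n ℕ.* n)) - ℚℕ (9 ℕ.* d)             ≡⟨ cong (_- ℚℕ (9 ℕ.* d)) (trans (sym (cong ℚℕ split)) (ℚℕ-+ z (9 ℕ.* d))) ⟩
        ℚℕ z + ℚℕ (9 ℕ.* d) - ℚℕ (9 ℕ.* d)              ≡⟨ solve 2 (λ a b → a :+ b :- b := a) refl (ℚℕ z) (ℚℕ (9 ℕ.* d)) ⟩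
        ℚℕ z                                            ∎
        where open ≡-Reasoning
      squares : z ℕ.* z ℕ.* q ℕ.≤ 400 ℕ.* p ℕ.* (n ℕ.* n ℕ.* (n ℕ.* n)) ℕ.* 81
      squares = ℕ.≤-trans (ℕ.*-monoˡ-≤ q (ℕ.*-mono-≤ z≤ z≤)) (certify (30375 ℕ.* (p ℕ.* (n ℕ.* n ℕ.* (n ℕ.* n)))) (ℕ.*-monoʳ-≤ (2025 ℕ.* (n ℕ.* n)) s²q≤pn²) (id₁ s n q p))
        where
        id₁ : ∀ s n q p → 45 ℕ.* (s ℕ.* n) ℕ.* (45 ℕ.* (s ℕ.* n)) ℕ.* q ℕ.+ 2025 ℕ.* (n ℕ.* n) ℕ.* (p ℕ.* (n ℕ.* n)) ℕ.+ 30375 ℕ.* (p ℕ.* (n ℕ.* n ℕ.* (n ℕ.* n))) ≡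
          400 ℕ.* p ℕ.* (n ℕ.* n ℕ.* (n ℕ.* n)) ℕ.* 81 ℕ.+ 2025 ℕ.* (n ℕ.* n) ℕ.* (s ℕ.* s ℕ.* q)
        id₁ = solve-∀
      left : ℚℕ (z ℕ.* z ℕ.* q) ≡ x * x * ℚℕ (81 ℕ.* q)
      left = begin
        ℚℕ (z ℕ.* z ℕ.* q)                  ≡⟨ trans (ℚℕ-* (z ℕ.* z) q) (cong (_* ℚℕ q) (trans (ℚℕ-* z z) (sym (cong₂ _*_ nine-x nine-x)))) ⟩
        x * ℚℕ 9 * (x * ℚℕ 9) * ℚℕ q        ≡⟨ solve 3 (λ x t q → x :* t :* (x :* t) :* q := x :* x :* (t :* t :* q)) refl x (ℚℕ 9) (ℚℕ q) ⟩
        x * x * (ℚℕ 9 * ℚℕ 9 * ℚℕ q)        ≡⟨ cong (x * x *_) (sym (trans (ℚℕ-* 81 q) (cong (_* ℚℕ q) (ℚℕ-* 9 9)))) ⟩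
        x * x * ℚℕ (81 ℕ.* q)               ∎
        where open ≡-Reasoning
      right : ℚℕ (400 ℕ.* p ℕ.* (n ℕ.* n ℕ.* (n ℕ.* n)) ℕ.* 81) ≡ ℚℕ 20 * ℚℕ 20 * ε * (ℚℕ n * ℚℕ n) * (ℚℕ n * ℚℕ n) * ℚℕ (81 ℕ.* q)
      right = begin
        ℚℕ (400 ℕ.* p ℕ.* (n ℕ.* n ℕ.* (n ℕ.* n)) ℕ.* 81)
          ≡⟨ trans (ℚℕ-* (400 ℕ.* p ℕ.* (n ℕ.* n ℕ.* (n ℕ.* n))) 81) (cong (_* ℚℕ 81) (trans (ℚℕ-* (400 ℕ.* p) (n ℕ.* n ℕ.* (n ℕ.* n)))
               (cong₂ _*_ (trans (ℚℕ-* 400 p) (cong₂ _*_ (ℚℕ-* 20 20) (sym εq≡p))) (trans (ℚℕ-* (n ℕ.* n) (n ℕ.* n)) (cong₂ _*_ (ℚℕ-* n n) (ℚℕ-* n n)))))) ⟩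
        ℚℕ 20 * ℚℕ 20 * (ε * ℚℕ q) * (ℚℕ n * ℚℕ n * (ℚℕ n * ℚℕ n)) * ℚℕ 81
          ≡⟨ solve 5 (λ t e q y u → t :* t :* (e :* q) :* (y :* y) :* u := t :* t :* e :* y :* y :* (u :* q)) refl (ℚℕ 20) ε (ℚℕ q) (ℚℕ n * ℚℕ n) (ℚℕ 81) ⟩
        ℚℕ 20 * ℚℕ 20 * ε * (ℚℕ n * ℚℕ n) * (ℚℕ n * ℚℕ n) * (ℚℕ 81 * ℚℕ q)
          ≡⟨ cong (ℚℕ 20 * ℚℕ 20 * ε * (ℚℕ n * ℚℕ n) * (ℚℕ n * ℚℕ n) *_) (sym (ℚℕ-* 81 q)) ⟩
        ℚℕ 20 * ℚℕ 20 * ε * (ℚℕ n * ℚℕ n) * (ℚℕ n * ℚℕ n) * ℚℕ (81 ℕ.* q) ∎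
        where open ≡-Reasoning

-- Choice of the constants.

module Assembly where

  open import Defs
  open Integration using (certify)
  open SixVolume using (square-cancel-≤)
  open Counting using (semibipartite; colourable)
  open Degrees using (J; A; A>0; module Removal)
  open Rationals
  open import Data.Nat hiding (_/_)
  open import Data.Nat.Properties
  open import Data.Nat.Tactic.RingSolver using (solve-∀)
  open import Data.Fin.Subset using (Subset; ∣_∣)
  open import Data.Vec.Properties using ([]=⇒lookup)
  open import Data.Product using (Σ; ∃; _×_; _,_)
  open import Data.Sum using (_⊎_; inj₁; inj₂; [_,_]′)
  open import Data.Integer using (+_)
  open import Data.Rational as ℚ using (ℚ; _/_; 0ℚ)
  open import Data.Rational.Properties using (positive⁻¹; normalize-pos)
  open import Relation.Nullary using (yes; no; contradiction)
  open import Relation.Binary.PropositionalEquality hiding (J)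

  -- The search descends from X + 1, whose square times `q` certainly exceeds X.
  square-root : ∀ X q → 0 < q → ∃ λ s → s * s * q ≤ X × X < suc s * suc s * q
  square-root X q q>0 = descend (suc X) (≤-trans (m≤m*n (suc X) (suc X)) (m≤m*n (suc X * suc X) q {{>-nonZero q>0}}))
    where
    descend : ∀ k → X < k * k * q → ∃ λ s → s * s * q ≤ X × X < suc s * suc s * q
    descend (suc k) above with k * k * q ≤? X
    ... | yes below = k , below , above
    ... | no ¬below = descend k (≰⇒> ¬below)

  -- Chosen so that ε < 1/`D` forces 360 `A` s ≤ n for s at most √ε n.
  D : ℕ
  D = 360 * A * (360 * A)

  instance
    D≢0 : NonZero D
    D≢0 = >-nonZero (*-mono-≤ (*-mono-≤ {1} {360} (s≤s z≤n) A>0) (*-mono-≤ {1} {360} (s≤s z≤n) A>0))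

  ε₀ : ℚ
  ε₀ = + 1 / D

  ε₀>0 : 0ℚ ℚ.< ε₀
  ε₀>0 = positive⁻¹ ε₀ {{normalize-pos 1 D}}

  -- The first term leaves at least 108 `J`² vertices after the removal, which costs at most half of
  -- them. The second makes p n² ≥ `q`, so that the rounded root s is not 0.
  threshold : ℕ → ℕ
  threshold q = 216 * (J * J) + q

  Conclusion : ∀ {n} → ℚ → 3Graph n → Set
  Conclusion {n} ε H = Σ (Subset n) λ W →
    LtMulSqrt (ℚℕ (n ∸ ∣ W ∣)) (+ 3 / 1) ε (ℚℕ n) ×
    MinDegInducedGe H W (λ d → LeMulSqrt ((+ 2 / 9) ℚ.* (ℚℕ n ℚ.* ℚℕ n) ℚ.- d) (+ 20 / 1) ε (ℚℕ n ℚ.* ℚℕ n)) ×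
    (SemibipartiteInduced H W ⊎ G26Colorable (induced H W))

  module _ (ε : ℚ) (p q : ℕ) (p>0 : 0 < p) (q>0 : 0 < q) (εq≡p : ε ℚ.* ℚℕ q ≡ ℚℕ p) (pD<q : p * D < q) {n : ℕ} (n≥ : 216 * (J * J) + q ≤ n)
    (H : 3Graph n) (free : MFree H)
    (edges : (+ 2 / 27) ℚ.* (ℚℕ n ℚ.* ℚℕ n ℚ.* ℚℕ n) ℚ.- ε ℚ.* (ℚℕ n ℚ.* ℚℕ n ℚ.* ℚℕ n) ℚ.≤ ℚℕ (numEdges H)) where
    private
      q≤n : q ≤ n
      q≤n = ≤-trans (m≤n+m q _) n≥

      n>0 : 0 < n
      n>0 = ≤-trans q>0 q≤n

      pnn>0 : 0 < p * (n * n)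
      pnn>0 = *-mono-≤ p>0 (*-mono-≤ n>0 n>0)

    module _ (s : ℕ) (below : s * s * q ≤ p * (n * n)) (above : p * (n * n) < suc s * suc s * q) where
      private
        s>0 : 0 < s
        s>0 = positive s above
          where
          positive : ∀ s → p * (n * n) < suc s * suc s * q → 0 < s
          positive (suc s) _ = s≤s z≤n
          positive zero lt = contradiction lt (≤⇒≯ (≤-trans (≤-reflexive (+-identityʳ q)) (≤-trans q≤n (≤-trans (≤-trans (m≤m*n n n {{>-nonZero n>0}}) (m≤n*m (n * n) p {{>-nonZero p>0}})) ≤-refl))))

        s-small : 360 * A * s ≤ n
        s-small = square-cancel-≤ (360 * A * s) n (*-cancelˡ-≤ q {{>-nonZero q>0}} (begin
          q * (360 * A * s * (360 * A * s))    ≡⟨ id₁ q (360 * A) s ⟩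
          D * (s * s * q)                      ≤⟨ *-monoʳ-≤ D below ⟩
          D * (p * (n * n))                    ≡⟨ id₂ D p (n * n) ⟩
          p * D * (n * n)                      ≤⟨ *-monoˡ-≤ (n * n) (<⇒≤ pD<q) ⟩
          q * (n * n)                          ∎))
          where
          open ≤-Reasoning
          id₁ : ∀ q a s → q * (a * s * (a * s)) ≡ a * a * (s * s * q)
          id₁ = solve-∀
          id₂ : ∀ d p m → d * (p * m) ≡ p * d * m
          id₂ = solve-∀

        many : 4 * q * (n * n * n) ≤ 9 * q * (6 * numEdges H) + 54 * p * (n * n * n)
        many = certify 0 (*-monoʳ-≤ 2 (edges-in-ℕ ε p q q>0 εq≡p n (numEdges H) edges)) (id₁ q p (n * n * n) (numEdges H))
          where
          id₁ : ∀ q p N E → 4 * q * N + 2 * (27 * q * E + 27 * p * N) + 0 ≡ 9 * q * (6 * E) + 54 * p * N + 2 * (2 * q * N)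
          id₁ = solve-∀

        open Removal H free s p q s>0 q>0 (≤-trans (m≤m+n (216 * (J * J)) q) n≥) s-small (<⇒≤ above) many

        few : (n ∸ ∣ W ∣) * (n ∸ ∣ W ∣) * q < 9 * p * (n * n)
        few = begin-strict
          (n ∸ ∣ W ∣) * (n ∸ ∣ W ∣) * q        ≤⟨ *-monoˡ-≤ q (*-mono-≤ few-removed few-removed) ⟩
          2 * s * (2 * s) * q                  ≡⟨ id₁ s q ⟩
          4 * (s * s * q)                      ≤⟨ *-monoʳ-≤ 4 below ⟩
          4 * (p * (n * n))                    <⟨ *-monoˡ-< (p * (n * n)) {{>-nonZero pnn>0}} {4} {9} (m≤m+n 5 4) ⟩
          9 * (p * (n * n))                    ≡⟨ sym (*-assoc 9 p (n * n)) ⟩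
          9 * p * (n * n)                      ∎
          where
          open ≤-Reasoning
          id₁ : ∀ s q → 2 * s * (2 * s) * q ≡ 4 * (s * s * q)
          id₁ = solve-∀

      stable-at : Conclusion ε H
      stable-at = W , lt-mul-sqrt ε p q q>0 εq≡p n (n ∸ ∣ W ∣) few
        , (λ v v∈ → le-mul-sqrt ε p q q>0 εq≡p n (degree (induced H W) v) s below (min-degree v ([]=⇒lookup v∈)))
        , [ (λ (c , col) → inj₁ (semibipartite H W c col)) , (λ (c , col) → inj₂ (colourable H W c col)) ]′ coloured

    stable : Conclusion ε H
    stable = let (s , below , above) = square-root (p * (n * n)) q q>0 in stable-at s below above

open import Defs
open import Data.Nat using (ℕ; _∸_) renaming (_≤_ to _≤ℕ_)
open import Data.Fin.Subset using (Subset; ∣_∣)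
open import Data.Product using (Σ; ∃; _×_; _,_)
open import Data.Sum using (_⊎_)
open import Data.Integer using (+_)
open import Data.Rational using (ℚ; _/_; _<_; _≤_; _*_; _-_; 0ℚ)

theorem6p1 :
    ∃ λ (ε₀ : ℚ) → 0ℚ < ε₀ ×
      (∀ (ε : ℚ) → 0ℚ < ε → ε < ε₀ →
        ∃ λ (n₀ : ℕ) → ∀ (n : ℕ) → n₀ ≤ℕ n →
          ∀ (H : 3Graph n) → MFree H →
          (+ 2 / 27) * (ℚℕ n * ℚℕ n * ℚℕ n) - ε * (ℚℕ n * ℚℕ n * ℚℕ n) ≤ ℚℕ (numEdges H) →
          Σ (Subset n) λ W →
            LtMulSqrt (ℚℕ (n ∸ ∣ W ∣)) (+ 3 / 1) ε (ℚℕ n) ×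
            MinDegInducedGe H W (λ d →
              LeMulSqrt ((+ 2 / 9) * (ℚℕ n * ℚℕ n) - d) (+ 20 / 1) ε (ℚℕ n * ℚℕ n)) ×
            (SemibipartiteInduced H W ⊎ G26Colorable (induced H W)))
theorem6p1 = ε₀ , ε₀>0 , λ ε 0<ε ε<ε₀ →
  let (p , q , p>0 , q>0 , εq≡p) = as-fraction ε 0<ε
  in threshold q , λ n n≥ H free edges → stable ε p q p>0 q>0 εq≡p (below-unit-fraction ε p q q>0 εq≡p D ε<ε₀) n≥ H free edges
  where
  open Rationals using (as-fraction; below-unit-fraction)
  open Assembly using (ε₀; ε₀>0; D; D≢0; threshold; stable)
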